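{- Fix $0<\varepsilon<\tfrac12$. For $n\in\mathbb{N}$ let $f_n(X)=X^3-(n-1)X^2-(n+2)X-1$, let $\lambda_0$ be a root of $f_n$, and put $\lambda_1=-\frac{1}{\lambda_0+1}$, $\lambda_2=-\frac{\lambda_0+1}{\lambda_0}$ (these are the other two roots of $f_n$). For $(s,t)\in\mathbb{Z}^2$ define the binary cubic form \[ f_{n,s,t}(x,y)=\bigl(x-\lambda_0^s\lambda_1^t y\bigr)\bigl(x-\lambda_1^s\lambda_2^t y\bigr)\bigl(x-\lambda_2^s\lambda_0^t y\bigr), \] i.e. the norm $N_{\mathbb{K}_n/\mathbb{Q}}(x-\lambda_0^s\lambda_1^t y)$ where $\mathbb{K}_n=\mathbb{Q}(\lambda_0)$. Then there exists an effectively computable constant $n_0=n_0(\varepsilon)$ such that for every integer $n>n_0$ and every $(s,t)\in\mathbb{Z}^2$ with $st\neq 0$ and $\max\{|s|,|t|\}\le n^{1/2-\varepsilon}$, the Thue equation $f_{n,s,t}(x,y)=\pm1$ has no solutions $(x,y)\in\mathbb{Z}^2$ with $|y|\ge 2$.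
   Context: $\mathbb{K}_n=\mathbb{Q}[X]/(f_n)$ is a cyclic cubic field (Shanks' simplest cubic field), and the roots of $f_n$ are permuted cyclically by $\lambda\mapsto -1/(\lambda+1)$. -}

module Defs where

open import Data.Nat as ℕ using (ℕ)
open import Data.Integer as ℤ using (ℤ; +_; -_; _+_; _-_; _*_; ∣_∣)
open import Data.Rational as ℚ using (ℚ; ↥_; ↧ₙ_)

-- The ring ℤ[λ₀] = ℤ[X]/(f_n) ⊂ 𝕂_n = ℚ[X]/(f_n), with
--   f_n(X) = X³ - (n-1)X² - (n+2)X - 1.
-- An element a + b·λ₀ + c·λ₀² is represented by its coordinates in the
-- basis 1, λ₀, λ₀² (a ℚ-basis of 𝕂_n, so equality is coordinatewise).
-- All numbers occurring in the statement lie in ℤ[λ₀], since λ₀ and λ₀+1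
-- are units (f_n(0) = -1, f_n(-1) = 1).
record K : Set where
  constructor ⟨_,_,_⟩
  field
    c₀ c₁ c₂ : ℤ

ι : ℤ → K
ι a = ⟨ a , + 0 , + 0 ⟩

infixl 6 _⊕_ _⊖_

_⊕_ : K → K → K
⟨ a , b , c ⟩ ⊕ ⟨ a' , b' , c' ⟩ = ⟨ a + a' , b + b' , c + c' ⟩

neg : K → K
neg ⟨ a , b , c ⟩ = ⟨ - a , - b , - c ⟩

_⊖_ : K → K → K
x ⊖ y = x ⊕ neg y

-- multiplication in ℤ[X]/(f_n): with p = n-1, q = n+2,
--   λ³ = p λ² + q λ + 1,   λ⁴ = (p² + q) λ² + (p q + 1) λ + p.
mul : ℕ → K → K → K
mul n ⟨ a₀ , a₁ , a₂ ⟩ ⟨ b₀ , b₁ , b₂ ⟩ =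
  ⟨ e₀ + e₃ + p * e₄
  , e₁ + q * e₃ + (p * q + + 1) * e₄
  , e₂ + p * e₃ + (p * p + q) * e₄ ⟩
  where
  p q e₀ e₁ e₂ e₃ e₄ : ℤ
  p = + n - + 1
  q = + n + + 2
  e₀ = a₀ * b₀
  e₁ = a₀ * b₁ + a₁ * b₀
  e₂ = a₀ * b₂ + a₁ * b₁ + a₂ * b₀
  e₃ = a₁ * b₂ + a₂ * b₁
  e₄ = a₂ * b₂

powℕ : ℕ → K → ℕ → K
powℕ n x ℕ.zero    = ι (+ 1)
powℕ n x (ℕ.suc k) = mul n x (powℕ n x k)

powℤ : ℕ → (x xinv : K) → ℤ → K
powℤ n x xinv (+ k)      = powℕ n x k
powℤ n x xinv ℤ.-[1+ k ] = powℕ n xinv (ℕ.suc k)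

λ₀ : K
λ₀ = ⟨ + 0 , + 1 , + 0 ⟩

-- λ₀⁻¹ = λ₀² - (n-1)λ₀ - (n+2)   (since λ₀(λ₀² - (n-1)λ₀ - (n+2)) = 1)
λ₀⁻¹ : ℕ → K
λ₀⁻¹ n = ⟨ - (+ n + + 2) , - (+ n - + 1) , + 1 ⟩

-- (λ₀+1)⁻¹ = -(λ₀² - nλ₀ - 2)   (since f_n(X) = (X+1)(X² - nX - 2) + 1)
λ₀+1⁻¹ : ℕ → K
λ₀+1⁻¹ n = neg ⟨ - + 2 , - + n , + 1 ⟩

λ₁ : ℕ → K
λ₁ n = neg (λ₀+1⁻¹ n)

λ₂ : ℕ → K
λ₂ n = neg (mul n (λ₀ ⊕ ι (+ 1)) (λ₀⁻¹ n))

λ₁⁻¹ : ℕ → K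
λ₁⁻¹ n = neg (λ₀ ⊕ ι (+ 1))

λ₂⁻¹ : ℕ → K
λ₂⁻¹ n = neg (mul n λ₀ (λ₀+1⁻¹ n))

λ₀^ λ₁^ λ₂^ : ℕ → ℤ → K
λ₀^ n = powℤ n λ₀ (λ₀⁻¹ n)
λ₁^ n = powℤ n (λ₁ n) (λ₁⁻¹ n)
λ₂^ n = powℤ n (λ₂ n) (λ₂⁻¹ n)

-- f_{n,s,t}(x,y) = (x - λ₀^s λ₁^t y)(x - λ₁^s λ₂^t y)(x - λ₂^s λ₀^t y),
-- computed in 𝕂_n (its value lies in ℤ, i.e. in ι ℤ).
thueForm : ℕ → (s t x y : ℤ) → K
thueForm n s t x y =
  mul n (mul n (ι x ⊖ mul n (mul n (λ₀^ n s) (λ₁^ n t)) (ι y))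
               (ι x ⊖ mul n (mul n (λ₁^ n s) (λ₂^ n t)) (ι y)))
        (ι x ⊖ mul n (mul n (λ₂^ n s) (λ₀^ n t)) (ι y))

-- |s| ≤ n^(1/2 - ε), for ε = p/q (lowest terms, q > 0) with 0 < ε < 1/2:
-- n^(1/2-ε) = n^((q - 2p)/(2q)), and for nonnegative reals
-- |s| ≤ n^(a/b) ⇔ |s|^b ≤ n^a.
BoundedBy : ℚ → ℕ → ℤ → Set
BoundedBy ε n s = ∣ s ∣ ℕ.^ (2 ℕ.* ↧ₙ ε) ℕ.≤ n ℕ.^ (↧ₙ ε ℕ.∸ 2 ℕ.* ∣ ↥ ε ∣)

{-# OPTIONS --safe #-}
-- No linear forms in logarithms are needed. The proof combines four ingredients.
-- (1) Over ℤ[√−3] a multiple of f_n is a difference of conjugate cubes, so the diagonal Padé approximants of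
-- (1 + 9x)^(1/3) yield good rational approximations to λ₀; by the gap principle, |f_n(p, q)| ≤ κ bounds p and q
-- polynomially in n and κ.
-- (2) Write α = λ₀^s λ₁^t as (aλ₀ + b)/(cλ₀ + d) with integers a, b, c, d. If the norm of β = x − αy is ±1, then
-- β(cλ₀ + d) = p − qλ₀ with f_n(p, q) = ±f_n(d, −c), and (1) bounds the conjugates of β by n^O(|s| + |t|).
-- (3) Let L ≈ n be the largest conjugate of λ₀ and μ = 1 + 1/L. For suitable h and k all conjugates of
-- β λ₀^h λ₁^k are below L/18, so that this unit is a rational integer, that is ±1. Hence the conjugates of β are,
-- up to factors 1 ± L⁻², of the form L^g μ^h, with exponents O(|s| + |t|) = O(√n), like those of α.
-- (4) In Siegel's identity (βᵢ − βⱼ)/(βₖ − βⱼ) = (αᵢ − αⱼ)/(αₖ − αⱼ), with βⱼ the smallest conjugate, comparing the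
-- powers of L forces the powers of μ to differ by an exponent of at least 3, because |y| ≥ 2; this discrepancy
-- 3/L exceeds all the remaining errors.
-- Real conjugates are replaced by values at rational L for which f_n(L) is negative and arbitrarily small.
module Submission where

-- Why cube roots: the discriminant of f_n is a square, so over ℚ(√-3) the form becomes, up to a
-- factor, β̄ Z̄³ - β Z³ with conjugate coefficients, and β̄/β = 1 + 9x with x of order 1/n.
-- Dividing the approximants by k! is essential: it leaves quantities of size c^k N^k and hence a
-- bound polynomial in κ. Nothing weaker would do, since κ is itself of size n^O(|s| + |t|), and the
-- exponents of β must stay linear in |s| + |t| for the powers of μ to stay near 1. Why a gap of 3
-- appears: the three L-exponents of α sum to 0, and each μ-exponent is minus the L-exponent of a
-- neighbouring conjugate; the same cyclic pattern holds for β. If the powers of L in Siegel's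
-- identity balance, the exponents of β exceed those of the differences of α by a common amount r,
-- and |y| ≥ 2 gives r ≥ 1. The cyclic pattern then makes the μ-exponents on the two sides differ by
-- at least 3r. The errors in the differences of α amount to about 2.2/L, and 2.2 < 3.

module Integers where
  import Data.Nat
  open import Data.Integer hiding (suc)
  open import Data.Integer.Properties
  open import Data.List using ([]; _∷_) public
  open import Data.Integer.Tactic.RingSolver using (solve) public
  open import Relation.Binary.PropositionalEquality

  -- An inequality a ≤ b is proved by exhibiting b − a as a nonnegative combination of known
  -- nonnegative quantities (built with ⊞ and ⊠), the identity being left to the ring solver.
  by : ∀ {a b d} → + 0 ≤ d → b ≡ a + d → a ≤ b
  by {a} h e = subst₂ _≤_ (+-identityʳ a) (sym e) (+-monoʳ-≤ a h)

  dif : ∀ {a b} → a ≤ b → + 0 ≤ b - a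
  dif = i≤j⇒0≤j-i

  infixr 6 _⊞_
  infixr 7 _⊠_

  _⊞_ : ∀ {x y} → + 0 ≤ x → + 0 ≤ y → + 0 ≤ x + y
  _⊞_ = +-mono-≤

  _⊠_ : ∀ {x y} → + 0 ≤ x → + 0 ≤ y → + 0 ≤ x * y
  _⊠_ {x} {y} h k = subst (_≤ x * y) (*-zeroʳ x) (*-monoˡ-≤-nonNeg x {{nonNegative h}} k)

  k0 : ∀ n → + 0 ≤ + n
  k0 n = +≤+ Data.Nat.z≤n

  sq0 : ∀ x → + 0 ≤ x * x
  sq0 (+ n) = k0 n ⊠ k0 n
  sq0 -[1+ n ] = +≤+ Data.Nat.z≤n

  -- Equality modulo a hypothesis: the certificate is the multiplier `c`, and what remains is a pure
  -- ring identity.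
  lc1 : ∀ {a b p q} c → p ≡ q → a ≡ b + c * (p - q) → a ≡ b
  lc1 {b = b} {p} c refl e =
    trans e (trans (cong (λ t → b + c * t) (+-inverseʳ p)) (trans (cong (λ t → b + t) (*-zeroʳ c)) (+-identityʳ b)))

  lc2 : ∀ {a b p q r s} c d → p ≡ q → r ≡ s → a ≡ b + c * (p - q) + d * (r - s) → a ≡ b
  lc2 c d h k e = lc1 c h (lc1 d k e)

  abs≤⇒≤ : ∀ {z m} → ∣ z ∣ Data.Nat.≤ m → z ≤ + m
  abs≤⇒≤ {+ n} h = +≤+ h
  abs≤⇒≤ { -[1+ n ] } h = -≤+

  abs≤⇒-≤ : ∀ {z m} → ∣ z ∣ Data.Nat.≤ m → - z ≤ + m
  abs≤⇒-≤ {z} h = abs≤⇒≤ (subst (λ t → t Data.Nat.≤ _) (sym (∣-i∣≡∣i∣ z)) h)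

  ≤⇒abs≤ : ∀ {z m} → z ≤ + m → - z ≤ + m → ∣ z ∣ Data.Nat.≤ m
  ≤⇒abs≤ {+ n} (+≤+ h) _ = h
  ≤⇒abs≤ { -[1+ n ] } _ (+≤+ h) = h

module Naturals where
  open import Data.Nat
  open import Data.Nat.Properties
  open import Data.List using ([]; _∷_)

  open import Data.Nat.Tactic.RingSolver using () renaming (solve to solveℕ) public
  open import Relation.Binary.PropositionalEquality

  ^-distribʳ-* : ∀ k m n → (m * n) ^ k ≡ m ^ k * n ^ k
  ^-distribʳ-* zero m n = refl
  ^-distribʳ-* (suc k) m n = trans (cong (m * n *_) (^-distribʳ-* k m n)) (lem m n (m ^ k) (n ^ k))
    where
    lem : ∀ m n x y → m * n * (x * y) ≡ m * x * (n * y)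
    lem m n x y = solveℕ (m ∷ n ∷ x ∷ y ∷ [])

-- Formal power series with integer coefficients.

module Series where
  open import Data.Nat as ℕ using (ℕ; zero; suc; z≤n; s≤s)
  import Data.Nat.Properties as ℕₚ
  open import Data.Integer hiding (suc)
  open import Data.Integer.Properties
  open import Relation.Binary.PropositionalEquality
  open Integers
  open ≡-Reasoning

  Ser : Set
  Ser = ℕ → ℤ

  infix 4 _≐_
  _≐_ : Ser → Ser → Set
  f ≐ g = ∀ i → f i ≡ g i

  tl sh : Ser → Ser
  tl f i = f (suc i)
  sh f zero = + 0
  sh f (suc i) = f i

  one : Ser
  one zero = + 1
  one (suc _) = + 0

  -- x · d/dx
  θ : Ser → Ser
  θ f i = + i * f i

  sh-cong : ∀ {f g} → f ≐ g → sh f ≐ sh g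
  sh-cong p zero = refl
  sh-cong p (suc i) = p i

  infixl 7 _⊛_
  opaque
    _⊛_ : Ser → Ser → Ser
    (f ⊛ g) zero = f 0 * g 0
    (f ⊛ g) (suc n) = f 0 * g (suc n) + (tl f ⊛ g) n

    ⊛-zero : ∀ f g → (f ⊛ g) 0 ≡ f 0 * g 0
    ⊛-zero f g = refl

    ⊛-suc : ∀ f g n → (f ⊛ g) (suc n) ≡ f 0 * g (suc n) + (tl f ⊛ g) n
    ⊛-suc f g n = refl

    -- The truncated form is needed twice: for the contraction that defines the cube root, and for
    -- Padé approximants, which agree with the series only up to a finite order.
    ⊛-cong-upto : ∀ {f f' g g'} n → (∀ i → i ℕ.≤ n → f i ≡ f' i) → (∀ i → i ℕ.≤ n → g i ≡ g' i) →
                  (f ⊛ g) n ≡ (f' ⊛ g') n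
    ⊛-cong-upto zero p q = cong₂ _*_ (p 0 z≤n) (q 0 z≤n)
    ⊛-cong-upto (suc n) p q =
      cong₂ _+_ (cong₂ _*_ (p 0 z≤n) (q (suc n) ℕₚ.≤-refl))
                (⊛-cong-upto n (λ i h → p (suc i) (s≤s h)) (λ i h → q i (ℕₚ.m≤n⇒m≤1+n h)))

    ⊛-cong : ∀ {f f' g g'} → f ≐ f' → g ≐ g' → f ⊛ g ≐ f' ⊛ g'
    ⊛-cong p q n = ⊛-cong-upto n (λ i _ → p i) (λ i _ → q i)

    ⊛-linˡ : ∀ c d f f' g → (λ i → c * f i + d * f' i) ⊛ g ≐ (λ i → c * (f ⊛ g) i + d * (f' ⊛ g) i)
    ⊛-linˡ c d f f' g zero = lem c d (f 0) (f' 0) (g 0)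
      where
      lem : ∀ c d x y z → (c * x + d * y) * z ≡ c * (x * z) + d * (y * z)
      lem c d x y z = solve (c ∷ d ∷ x ∷ y ∷ z ∷ [])
    ⊛-linˡ c d f f' g (suc n) =
      trans (cong (λ ξ → (c * f 0 + d * f' 0) * g (suc n) + ξ) (⊛-linˡ c d (tl f) (tl f') g n))
            (lem c d (f 0) (f' 0) (g (suc n)) ((tl f ⊛ g) n) ((tl f' ⊛ g) n))
      where
      lem : ∀ c d x y z u v → (c * x + d * y) * z + (c * u + d * v) ≡ c * (x * z + u) + d * (y * z + v)
      lem c d x y z u v = solve (c ∷ d ∷ x ∷ y ∷ z ∷ u ∷ v ∷ [])

    ⊛-tlʳ : ∀ f g n → (f ⊛ g) (suc n) ≡ f (suc n) * g 0 + (f ⊛ tl g) n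
    ⊛-tlʳ f g zero = +-comm (f 0 * g 1) (f 1 * g 0)
    ⊛-tlʳ f g (suc n) =
      trans (cong (λ ξ → f 0 * g (suc (suc n)) + ξ) (⊛-tlʳ (tl f) g n))
            (lem (f 0 * g (suc (suc n))) (f (suc (suc n)) * g 0) ((tl f ⊛ tl g) n))
      where
      lem : ∀ x y z → x + (y + z) ≡ y + (x + z)
      lem x y z = solve (x ∷ y ∷ z ∷ [])

    ⊛-comm : ∀ f g → f ⊛ g ≐ g ⊛ f
    ⊛-comm f g zero = *-comm (f 0) (g 0)
    ⊛-comm f g (suc n) = begin
      f 0 * g (suc n) + (tl f ⊛ g) n  ≡⟨ cong₂ _+_ (*-comm (f 0) (g (suc n))) (⊛-comm (tl f) g n) ⟩
      g (suc n) * f 0 + (g ⊛ tl f) n  ≡⟨ ⊛-tlʳ g f n ⟨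
      (g ⊛ f) (suc n)                 ∎

    ⊛-assoc : ∀ f g h → (f ⊛ g) ⊛ h ≐ f ⊛ (g ⊛ h)
    ⊛-assoc f g h zero = *-assoc (f 0) (g 0) (h 0)
    ⊛-assoc f g h (suc n) = begin
      f 0 * g 0 * h (suc n) + (tl (f ⊛ g) ⊛ h) n
        ≡⟨ cong (λ ξ → f 0 * g 0 * h (suc n) + ξ) (trans (⊛-cong split (λ _ → refl) n)
             (⊛-linˡ (f 0) (+ 1) (tl g) (tl f ⊛ g) h n)) ⟩
      f 0 * g 0 * h (suc n) + (f 0 * (tl g ⊛ h) n + + 1 * ((tl f ⊛ g) ⊛ h) n)
        ≡⟨ cong (λ t → f 0 * g 0 * h (suc n) + (f 0 * (tl g ⊛ h) n + + 1 * t)) (⊛-assoc (tl f) g h n) ⟩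
      f 0 * g 0 * h (suc n) + (f 0 * (tl g ⊛ h) n + + 1 * (tl f ⊛ (g ⊛ h)) n)
        ≡⟨ lem (f 0) (g 0) (h (suc n)) ((tl g ⊛ h) n) ((tl f ⊛ (g ⊛ h)) n) ⟩
      f 0 * (g ⊛ h) (suc n) + (tl f ⊛ (g ⊛ h)) n ∎
      where
      split : tl (f ⊛ g) ≐ (λ i → f 0 * tl g i + + 1 * (tl f ⊛ g) i)
      split i = cong (λ ξ → f 0 * g (suc i) + ξ) (sym (*-identityˡ _))
      lem : ∀ x y z u v → x * y * z + (x * u + + 1 * v) ≡ x * (y * z + u) + v
      lem x y z u v = solve (x ∷ y ∷ z ∷ u ∷ v ∷ [])

    ⊛-interchange : ∀ a b c d → (a ⊛ b) ⊛ (c ⊛ d) ≐ (a ⊛ c) ⊛ (b ⊛ d)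
    ⊛-interchange a b c d i = begin
      ((a ⊛ b) ⊛ (c ⊛ d)) i ≡⟨ ⊛-assoc a b (c ⊛ d) i ⟩
      (a ⊛ (b ⊛ (c ⊛ d))) i ≡⟨ ⊛-cong {a} (λ _ → refl) bcd i ⟩
      (a ⊛ (c ⊛ (b ⊛ d))) i ≡⟨ ⊛-assoc a c (b ⊛ d) i ⟨
      ((a ⊛ c) ⊛ (b ⊛ d)) i ∎
      where
      bcd : b ⊛ (c ⊛ d) ≐ c ⊛ (b ⊛ d)
      bcd j = trans (sym (⊛-assoc b c d j))
                (trans (⊛-cong (⊛-comm b c) (λ _ → refl) j) (⊛-assoc c b d j))

    ⊛-linʳ : ∀ c d g f f' → g ⊛ (λ i → c * f i + d * f' i) ≐ (λ i → c * (g ⊛ f) i + d * (g ⊛ f') i)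
    ⊛-linʳ c d g f f' i =
      trans (⊛-comm g _ i) (trans (⊛-linˡ c d f f' g i)
        (cong₂ (λ u v → c * u + d * v) (⊛-comm f g i) (⊛-comm f' g i)))

    ⊛-shˡ : ∀ f g → sh f ⊛ g ≐ sh (f ⊛ g)
    ⊛-shˡ f g zero = refl
    ⊛-shˡ f g (suc n) = +-identityˡ _

    ⊛-shʳ : ∀ f g → f ⊛ sh g ≐ sh (f ⊛ g)
    ⊛-shʳ f g i = trans (⊛-comm f (sh g) i) (trans (⊛-shˡ g f i) (sh-cong (⊛-comm g f) i))

    zero-⊛ : ∀ f → (λ _ → + 0) ⊛ f ≐ (λ _ → + 0)
    zero-⊛ f zero = refl
    zero-⊛ f (suc n) = trans (+-identityˡ _) (zero-⊛ f n)

    one-⊛ : ∀ f → one ⊛ f ≐ f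
    one-⊛ f zero = *-identityˡ (f 0)
    one-⊛ f (suc n) = trans (cong₂ _+_ (*-identityˡ (f (suc n))) (zero-⊛ f n)) (+-identityʳ _)

    -- The Leibniz rule. With x · d/dx in place of d/dx it involves no shift of indices.
    θ-⊛ : ∀ f g → θ (f ⊛ g) ≐ (λ i → (θ f ⊛ g) i + (f ⊛ θ g) i)
    θ-⊛ f g zero = lem (f 0) (g 0)
      where
      lem : ∀ x y → + 0 * (x * y) ≡ + 0 * x * y + x * (+ 0 * y)
      lem x y = solve (x ∷ y ∷ [])
    θ-⊛ f g (suc n) = begin
      + suc n * (f 0 * g (suc n) + (tl f ⊛ g) n)
        ≡⟨ lem (+ n) (f 0) (g (suc n)) ((tl f ⊛ g) n) ⟩
      f 0 * (+ suc n * g (suc n)) + (θ (tl f ⊛ g) n + (tl f ⊛ g) n)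
        ≡⟨ cong (λ t → f 0 * (+ suc n * g (suc n)) + (t + (tl f ⊛ g) n)) (θ-⊛ (tl f) g n) ⟩
      f 0 * (+ suc n * g (suc n)) + ((θ (tl f) ⊛ g) n + (tl f ⊛ θ g) n + (tl f ⊛ g) n)
        ≡⟨ lem2 (f 0) (f 0 * (+ suc n * g (suc n))) (g (suc n)) ((θ (tl f) ⊛ g) n) ((tl f ⊛ θ g) n) ((tl f ⊛ g) n) ⟩
      (+ 0 * f 0 * g (suc n) + (+ 1 * (θ (tl f) ⊛ g) n + + 1 * (tl f ⊛ g) n)) + (f 0 * (+ suc n * g (suc n)) + (tl f ⊛ θ g) n)
        ≡⟨ cong (λ t → (+ 0 * f 0 * g (suc n) + t) + (f ⊛ θ g) (suc n)) (⊛-linˡ (+ 1) (+ 1) (θ (tl f)) (tl f) g n) ⟨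
      (+ 0 * f 0 * g (suc n) + ((λ i → + 1 * θ (tl f) i + + 1 * tl f i) ⊛ g) n) + (f ⊛ θ g) (suc n)
        ≡⟨ cong (λ t → (+ 0 * f 0 * g (suc n) + t) + (f ⊛ θ g) (suc n)) (⊛-cong shθ (λ _ → refl) n) ⟩
      (θ f ⊛ g) (suc n) + (f ⊛ θ g) (suc n) ∎
      where
      lem : ∀ n a b c → (+ 1 + n) * (a * b + c) ≡ a * ((+ 1 + n) * b) + (n * c + c)
      lem n a b c = solve (n ∷ a ∷ b ∷ c ∷ [])
      lem2 : ∀ x a b c d e → a + (c + d + e) ≡ (+ 0 * x * b + (+ 1 * c + + 1 * e)) + (a + d)
      lem2 x a b c d e = solve (x ∷ a ∷ b ∷ c ∷ d ∷ e ∷ [])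
      lem3 : ∀ n a → + 1 * (n * a) + + 1 * a ≡ (+ 1 + n) * a
      lem3 n a = solve (n ∷ a ∷ [])
      shθ : (λ i → + 1 * θ (tl f) i + + 1 * tl f i) ≐ tl (θ f)
      shθ i = lem3 (+ i) (f (suc i))

-- The cube root of 1 + 9x as an integral power series.

module CubeRoot where
  open import Data.Nat as ℕ using (ℕ; zero; suc; s≤s; s≤s⁻¹)
  import Data.Nat.Properties as ℕₚ
  open import Data.Sum using (inj₁; inj₂)
  open import Data.Integer hiding (suc)
  open import Data.Integer.Properties
  open import Relation.Binary.PropositionalEquality
  open Integers
  open Series
  open ≡-Reasoning

  one+9x : Ser
  one+9x i = one i + + 9 * sh one i

  -- The series F = (1 + 9x)^(1/3) is 1 + 3xu, where u solves u = 1 − 3xu² − 3x²u³.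
  opaque
    Φ : Ser → Ser
    Φ u i = one i + - + 3 * (sh (u ⊛ u) i + sh (sh (u ⊛ (u ⊛ u))) i)

    -- Both nonlinear terms of `Φ` carry a factor x, so a coefficient of the image depends only on
    -- earlier coefficients: `Φ` is a contraction in the x-adic topology.
    Φ-contracts : ∀ u v i → (∀ j → j ℕ.< i → u j ≡ v j) → Φ u i ≡ Φ v i
    Φ-contracts u v zero p = refl
    Φ-contracts u v (suc i) p =
      cong (λ t → + 0 + - + 3 * t) (cong₂ _+_ (sq i λ j h → p j (s≤s h)) (cube i λ j h → p j (s≤s h)))
      where
      sq : ∀ i → (∀ j → j ℕ.≤ i → u j ≡ v j) → (u ⊛ u) i ≡ (v ⊛ v) i
      sq i q = ⊛-cong-upto i q q
      cube : ∀ i → (∀ j → j ℕ.≤ i → u j ≡ v j) → sh (u ⊛ (u ⊛ u)) i ≡ sh (v ⊛ (v ⊛ v)) i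
      cube zero q = refl
      cube (suc i) q = ⊛-cong-upto i q' (λ j h → sq j (λ k h' → q' k (ℕₚ.≤-trans h' h)))
        where
        q' : ∀ j → j ℕ.≤ i → u j ≡ v j
        q' j h = q j (ℕₚ.m≤n⇒m≤1+n h)

    iter : ℕ → Ser
    iter zero _ = + 0
    iter (suc m) = Φ (iter m)

    -- The x-adic limit of the iterates, taken along the diagonal: coefficient i no longer changes
    -- after i + 1 steps.
    u : Ser
    u i = iter (suc i) i

    iter-stable : ∀ m i → i ℕ.< m → iter (suc m) i ≡ iter m i
    iter-stable (suc m) i h =
      Φ-contracts (iter (suc m)) (iter m) i (λ j j<i → iter-stable m j (ℕₚ.≤-trans j<i (s≤s⁻¹ h)))

    iter-u : ∀ m i → i ℕ.< m → iter m i ≡ u i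
    iter-u (suc m) i h with ℕₚ.m≤n⇒m<n∨m≡n (s≤s⁻¹ h)
    ... | inj₁ i<m = trans (iter-stable m i i<m) (iter-u m i i<m)
    ... | inj₂ refl = refl

    u-fixed : u ≐ Φ u
    u-fixed i = Φ-contracts (iter i) u i (λ j h → iter-u i j h)

    g g² g³ : Ser
    g = sh u
    g² = g ⊛ g
    g³ = g ⊛ g²

    g²-sh : g² ≐ sh (sh (u ⊛ u))
    g²-sh i = trans (⊛-shˡ u g i) (sh-cong (⊛-shʳ u u) i)

    g³-sh : g³ ≐ sh (sh (sh (u ⊛ (u ⊛ u))))
    g³-sh i = trans (⊛-cong {g} (λ _ → refl) g²-sh i) (trans (⊛-shˡ u _ i)
      (sh-cong (λ j → trans (⊛-shʳ u _ j) (sh-cong (⊛-shʳ u _) j)) i))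

    -- The fixed-point equation multiplied by x: for g = xu it reads g + 3g² + 3g³ = x, which is (1
    -- + 3g)³ = 1 + 9x up to a factor 9.
    g-eq : ∀ i → g i ≡ sh one i + - + 3 * (g² i + g³ i)
    g-eq zero = sym (cong (λ t → + 0 + - + 3 * t) (cong₂ _+_ (g²-sh 0) (g³-sh 0)))
    g-eq (suc i) = trans (u-fixed i)
      (cong (λ t → one i + - + 3 * t) (cong₂ _+_ (sym (g²-sh (suc i))) (sym (g³-sh (suc i)))))

    F : Ser
    F i = + 1 * one i + + 3 * g i

    F² F³ : Ser
    F² = F ⊛ F
    F³ = F ⊛ F²

    F-⊛ : ∀ f → F ⊛ f ≐ (λ i → + 1 * f i + + 3 * (g ⊛ f) i)
    F-⊛ f i = trans (⊛-linˡ (+ 1) (+ 3) one g f i) (cong (λ t → + 1 * t + + 3 * (g ⊛ f) i) (one-⊛ f i))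

    g-⊛F : g ⊛ F ≐ (λ i → + 1 * g i + + 3 * g² i)
    g-⊛F i = trans (⊛-comm g F i) (F-⊛ g i)

    F-zero : F 0 ≡ + 1
    F-zero = refl

    F³≐ : F ⊛ (F ⊛ F) ≐ one+9x
    F³≐ i = begin
      F³ i                        ≡⟨ F-⊛ F² i ⟩
      + 1 * F² i + + 3 * (g ⊛ F²) i
        ≡⟨ cong₂ (λ a b → + 1 * a + + 3 * b) (F-⊛ F i)
             (trans (⊛-cong {g} (λ _ → refl) (F-⊛ F) i) (⊛-linʳ (+ 1) (+ 3) g F (g ⊛ F) i)) ⟩
      + 1 * (+ 1 * F i + + 3 * (g ⊛ F) i) + + 3 * (+ 1 * (g ⊛ F) i + + 3 * (g ⊛ (g ⊛ F)) i)
        ≡⟨ cong₂ (λ a b → + 1 * (+ 1 * F i + + 3 * a) + + 3 * (+ 1 * a + + 3 * b)) (g-⊛F i)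
             (trans (⊛-cong {g} (λ _ → refl) g-⊛F i) (⊛-linʳ (+ 1) (+ 3) g g g² i)) ⟩
      + 1 * (+ 1 * F i + + 3 * (+ 1 * g i + + 3 * g² i)) + + 3 * (+ 1 * (+ 1 * g i + + 3 * g² i) + + 3 * (+ 1 * g² i + + 3 * g³ i))
        ≡⟨ lem (one i) (g i) (g² i) (g³ i) ⟩
      one i + + 9 * (g i + + 3 * (g² i + g³ i))
        ≡⟨ cong (λ t → one i + + 9 * (t + + 3 * (g² i + g³ i))) (g-eq i) ⟩
      one i + + 9 * ((sh one i + - + 3 * (g² i + g³ i)) + + 3 * (g² i + g³ i))
        ≡⟨ lem2 (one i) (sh one i) (g² i + g³ i) ⟩
      one i + + 9 * sh one i ∎
      where
      lem : ∀ o a b c → + 1 * (+ 1 * (+ 1 * o + + 3 * a) + + 3 * (+ 1 * a + + 3 * b)) + + 3 * (+ 1 * (+ 1 * a + + 3 * b) + + 3 * (+ 1 * b + + 3 * c))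
            ≡ o + + 9 * (a + + 3 * (b + c))
      lem o a b c = solve (o ∷ a ∷ b ∷ c ∷ [])
      lem2 : ∀ o s t → o + + 9 * ((s + - + 3 * t) + + 3 * t) ≡ o + + 9 * s
      lem2 o s t = solve (o ∷ s ∷ t ∷ [])

    one+9x-⊛ : ∀ f → one+9x ⊛ f ≐ (λ i → f i + + 9 * sh f i)
    one+9x-⊛ f i = begin
      (one+9x ⊛ f) i  ≡⟨ ⊛-cong {one+9x} (λ j → cong (_+ + 9 * sh one j) (sym (*-identityˡ (one j)))) (λ _ → refl) i ⟩
      ((λ j → + 1 * one j + + 9 * sh one j) ⊛ f) i ≡⟨ ⊛-linˡ (+ 1) (+ 9) one (sh one) f i ⟩
      + 1 * (one ⊛ f) i + + 9 * (sh one ⊛ f) i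
        ≡⟨ cong₂ (λ a b → a + + 9 * b) (trans (*-identityˡ _) (one-⊛ f i)) (trans (⊛-shˡ one f i) (sh-cong (one-⊛ f) i)) ⟩
      f i + + 9 * sh f i ∎

    -- (1 + 9x) F′ = 3 F, from differentiating F³ = 1 + 9x and multiplying by F.
    F-ode : ∀ i → + suc i * F (suc i) + + 9 * (+ i * F i) ≡ + 3 * F i
    F-ode i = *-cancelˡ-≡ (+ 3) _ _ (begin
      + 3 * (+ suc i * F (suc i) + + 9 * (+ i * F i))
        ≡⟨ cong (+ 3 *_) (trans (⊛-cong {F³} {one+9x} {θ F} F³≐ (λ _ → refl) (suc i)) (one+9x-⊛ (θ F) (suc i))) ⟨
      + 3 * (F³ ⊛ θ F) (suc i)                ≡⟨ cong (+ 3 *_) (⊛-assoc F F² (θ F) (suc i)) ⟩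
      + 3 * (F ⊛ (F² ⊛ θ F)) (suc i)          ≡⟨ lem0 _ ⟨
      + 3 * (F ⊛ (F² ⊛ θ F)) (suc i) + + 0 * (F ⊛ (F² ⊛ θ F)) (suc i)
        ≡⟨ ⊛-linʳ (+ 3) (+ 0) F (F² ⊛ θ F) (F² ⊛ θ F) (suc i) ⟨
      (F ⊛ (λ j → + 3 * (F² ⊛ θ F) j + + 0 * (F² ⊛ θ F) j)) (suc i)
        ≡⟨ ⊛-cong {F} (λ _ → refl) (λ j → trans (lem0 _) (sym (θF³ j))) (suc i) ⟩
      (F ⊛ θ F³) (suc i)                      ≡⟨ ⊛-cong {F} (λ _ → refl) θone+9x (suc i) ⟩
      (F ⊛ (λ j → + 9 * sh one j + + 0 * sh one j)) (suc i)
        ≡⟨ trans (⊛-linʳ (+ 9) (+ 0) F (sh one) (sh one) (suc i)) (lem0' _) ⟩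
      + 9 * (F ⊛ sh one) (suc i)
        ≡⟨ cong (+ 9 *_) (trans (⊛-shʳ F one (suc i)) (trans (⊛-comm F one i) (one-⊛ F i))) ⟩
      + 9 * F i                               ≡⟨ lem9 (F i) ⟩
      + 3 * (+ 3 * F i)                       ∎)
      where
      lem0 : ∀ x → + 3 * x + + 0 * x ≡ + 3 * x
      lem0 x = solve (x ∷ [])
      lem0' : ∀ x → + 9 * x + + 0 * x ≡ + 9 * x
      lem0' x = solve (x ∷ [])
      lem9 : ∀ x → + 9 * x ≡ + 3 * (+ 3 * x)
      lem9 x = solve (x ∷ [])
      lem3 : ∀ x → x + (+ 1 * x + + 1 * x) ≡ + 3 * x
      lem3 x = solve (x ∷ [])
      θF² : ∀ j → θ F² j ≡ + 1 * (F ⊛ θ F) j + + 1 * (F ⊛ θ F) j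
      θF² j = trans (θ-⊛ F F j) (cong₂ _+_ (trans (⊛-comm (θ F) F j) (sym (*-identityˡ _))) (sym (*-identityˡ _)))
      θF³ : ∀ j → θ F³ j ≡ + 3 * (F² ⊛ θ F) j
      θF³ j = begin
        θ F³ j                               ≡⟨ θ-⊛ F F² j ⟩
        (θ F ⊛ F²) j + (F ⊛ θ F²) j
          ≡⟨ cong₂ _+_ (⊛-comm (θ F) F² j) (trans (⊛-cong {F} (λ _ → refl) θF² j)
               (⊛-linʳ (+ 1) (+ 1) F (F ⊛ θ F) (F ⊛ θ F) j)) ⟩
        (F² ⊛ θ F) j + (+ 1 * (F ⊛ (F ⊛ θ F)) j + + 1 * (F ⊛ (F ⊛ θ F)) j)
          ≡⟨ cong (λ t → (F² ⊛ θ F) j + (+ 1 * t + + 1 * t)) (sym (⊛-assoc F F (θ F) j)) ⟩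
        (F² ⊛ θ F) j + (+ 1 * (F² ⊛ θ F) j + + 1 * (F² ⊛ θ F) j) ≡⟨ lem3 _ ⟩
        + 3 * (F² ⊛ θ F) j ∎
      θone+9x : θ F³ ≐ (λ j → + 9 * sh one j + + 0 * sh one j)
      θone+9x zero = refl
      θone+9x (suc zero) = cong (+ 1 *_) (F³≐ 1)
      θone+9x (suc (suc j)) = trans (cong (+ suc (suc j) *_) (F³≐ (suc (suc j)))) (*-zeroʳ (+ suc (suc j)))

-- Diagonal Padé approximants of the cube root.

module Pade where
  open import Data.Nat as ℕ using (ℕ; zero; suc; s≤s; _!)
  import Data.Nat.Properties as ℕₚ
  open import Data.Integer hiding (suc)
  open import Data.Integer.Properties
  open import Data.Product using (∃-syntax; _,_)
  open import Relation.Nullary using (yes; no)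
  open import Relation.Binary.PropositionalEquality
  open Integers
  open Series
  open CubeRoot using (F; F-zero; one+9x; F³≐; F-ode)
  open ≡-Reasoning

  rise : ℤ → ℕ → ℤ
  rise z zero = + 1
  rise z (suc m) = z * rise (z + + 1) m

  rise-snoc : ∀ z m → rise z (suc m) ≡ rise z m * (z + + m)
  rise-snoc z zero = lem z
    where
    lem : ∀ z → z * + 1 ≡ + 1 * (z + + 0)
    lem z = solve (z ∷ [])
  rise-snoc z (suc m) = trans (cong (z *_) (rise-snoc (z + + 1) m)) (lem z (rise (z + + 1) m) (+ m))
    where
    lem : ∀ z r m → z * (r * (z + + 1 + m)) ≡ z * r * (z + (+ 1 + m))
    lem z r m = solve (z ∷ r ∷ m ∷ [])

  rise-vanishes : ∀ j m → j ℕ.< m → rise (- + j) m ≡ + 0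
  rise-vanishes zero (suc m) h = refl
  rise-vanishes (suc j) (suc m) (s≤s h) =
    trans (cong (λ z → - + suc j * rise z m) (lem (+ j)))
          (trans (cong (- + suc j *_) (rise-vanishes j m h)) (*-zeroʳ (- + suc j)))
    where
    lem : ∀ j → - (+ 1 + j) + + 1 ≡ - j
    lem j = solve (j ∷ [])

  -- The quotient is a binomial coefficient, and the induction is Pascal's rule.
  factorial-∣-rise : ∀ k a → ∃[ c ] rise (+ a) k ≡ + (k !) * c
  factorial-∣-rise zero a = + 1 , refl
  factorial-∣-rise (suc k) zero = + 0 , sym (*-zeroʳ (+ (suc k !)))
  factorial-∣-rise (suc k) (suc a) with factorial-∣-rise (suc k) a | factorial-∣-rise k (suc a)
  ... | c , p | d , q = c + d , (begin
    rise (+ suc a) (suc k)       ≡⟨ rise-snoc (+ suc a) k ⟩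
    rise (+ suc a) k * (+ suc a + + k)
      ≡⟨ lem (rise (+ suc a) k) (+ a) (+ k) ⟩
    + a * rise (+ suc a) k + + suc k * rise (+ suc a) k
      ≡⟨ cong₂ (λ s t → + a * s + + suc k * t) (cong (λ t → rise (+ t) k) (ℕₚ.+-comm 1 a)) q ⟩
    rise (+ a) (suc k) + + suc k * (+ (k !) * d)
      ≡⟨ cong₂ _+_ p (sym (*-assoc (+ suc k) (+ (k !)) d)) ⟩
    + (suc k !) * c + + suc k * + (k !) * d
      ≡⟨ cong (λ t → + (suc k !) * c + t * d) (sym (pos-* (suc k) (k !))) ⟩
    + (suc k !) * c + + (suc k !) * d ≡⟨ *-distribˡ-+ (+ (suc k !)) c d ⟨
    + (suc k !) * (c + d) ∎)
    where
    lem : ∀ r a k → r * (+ 1 + a + k) ≡ a * r + (+ 1 + k) * r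
    lem r a k = solve (r ∷ a ∷ k ∷ [])

  -- The power (1 + 9x)^(k + 1/3).
  e : ℕ → Ser
  e zero = F
  e (suc k) i = e k i + + 9 * sh (e k) i

  -- The differential equation (1 + 9x) y′ = (9k + 3) y, coefficient by coefficient.
  e-ode : ∀ k i → + suc i * e k (suc i) + + 9 * (+ i * e k i) ≡ (+ 9 * + k + + 3) * e k i
  e-ode zero i = F-ode i
  e-ode (suc k) zero = lc1 (+ 1) (e-ode k 0) (lem (+ k) (e k 1) (e k 0))
    where
    lem : ∀ k a b → + 1 * (a + + 9 * b) + + 9 * (+ 0 * (b + + 9 * + 0))
          ≡ (+ 9 * (+ 1 + k) + + 3) * (b + + 9 * + 0) + + 1 * (+ 1 * a + + 9 * (+ 0 * b) - (+ 9 * k + + 3) * b)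
    lem k a b = solve (k ∷ a ∷ b ∷ [])
  e-ode (suc k) (suc i) =
    lc2 (+ 1) (+ 9) (e-ode k (suc i)) (e-ode k i) (lem (+ k) (+ i) (e k (suc (suc i))) (e k (suc i)) (e k i))
    where
    lem : ∀ k i a b c → (+ 2 + i) * (a + + 9 * b) + + 9 * ((+ 1 + i) * (b + + 9 * c))
          ≡ (+ 9 * (+ 1 + k) + + 3) * (b + + 9 * c)
            + + 1 * ((+ 2 + i) * a + + 9 * ((+ 1 + i) * b) - (+ 9 * k + + 3) * b)
            + + 9 * ((+ 1 + i) * b + + 9 * (i * c) - (+ 9 * k + + 3) * c)
    lem k i a b c = solve (k ∷ i ∷ a ∷ b ∷ c ∷ [])

  e-step : ∀ k i → + i * e k i ≡ (+ 9 * + k + + 12 - + 9 * + i) * sh (e k) i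
  e-step k zero = sym (*-zeroʳ (+ 9 * + k + + 12 - + 9 * + 0))
  e-step k (suc i) = lc1 (+ 1) (e-ode k i) (lem (+ k) (+ i) (e k (suc i)) (e k i))
    where
    lem : ∀ k i a b → (+ 1 + i) * a ≡ (+ 9 * k + + 12 - + 9 * (+ 1 + i)) * b
            + + 1 * ((+ 1 + i) * a + + 9 * (i * b) - (+ 9 * k + + 3) * b)
    lem k i a b = solve (k ∷ i ∷ a ∷ b ∷ [])

  she-step : ∀ k i → (+ i - + 1) * sh (e k) i ≡ (+ 9 * + k + + 21 - + 9 * + i) * sh (sh (e k)) i
  she-step k zero = sym (*-zeroʳ (+ 9 * + k + + 21 - + 9 * + 0))
  she-step k (suc i) = lc1 (+ 1) (e-step k i) (lem (+ k) (+ i) (e k i) (sh (e k) i))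
    where
    lem : ∀ k i a b → (+ 1 + i - + 1) * a ≡ (+ 9 * k + + 21 - + 9 * (+ 1 + i)) * b
            + + 1 * (i * a - (+ 9 * k + + 12 - + 9 * i) * b)
    lem k i a b = solve (k ∷ i ∷ a ∷ b ∷ [])

  sh-e : ∀ k i → sh (e (suc k)) i ≡ sh (e k) i + + 9 * sh (sh (e k)) i
  sh-e k zero = refl
  sh-e k (suc i) = refl

  -- A Rodrigues formula: up to sign this is x^(2k+1) (d/dx)^k applied to x^(-k-1) (1 + 9x)^(k +
  -- 1/3). Differentiating the monomial x^(i-k-1) k times produces the factor `rise`.
  G : ℕ → Ser
  G k i = e k i * rise (+ k - + i + + 1) k

  sh-G : ∀ k i → sh (G k) i ≡ sh (e k) i * rise (+ k - + i + + 2) k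
  sh-G k zero = refl
  sh-G k (suc i) = cong (λ z → e k i * rise z k) (lem (+ k) (+ i))
    where
    lem : ∀ k i → k - i + + 1 ≡ k - (+ 1 + i) + + 2
    lem k i = solve (k ∷ i ∷ [])

  shsh-G : ∀ k i → sh (sh (G k)) i ≡ sh (sh (e k)) i * rise (+ k - + i + + 3) k
  shsh-G k zero = refl
  shsh-G k (suc i) = trans (sh-G k i) (cong (λ z → sh (e k) i * rise z k) (lem (+ k) (+ i)))
    where
    lem : ∀ k i → k - i + + 2 ≡ k - (+ 1 + i) + + 3
    lem k i = solve (k ∷ i ∷ [])

  -- A contiguity relation of the kind satisfied by Jacobi polynomials. It is stated for arbitrary
  -- series because the numerators, the denominators and the series `G k` all obey it.
  recurrence : ℕ → (f g : Ser) → Ser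
  recurrence k f g i =
    (+ 2 * + k + + 3) * (+ 2 * f i + + 9 * sh f i) + + 9 * (+ 1 - + 9 * ((+ 1 + + k) * (+ 1 + + k))) * sh (sh g) i

  -- The first-order relations e-step and she-step make this an identity in i, k and one
  -- coefficient of e k, up to a common factor.
  G-rec : ∀ k i → G (suc (suc k)) i ≡ recurrence k (G (suc k)) (G k) i
  G-rec k i = begin
    G (2 ℕ.+ k) i
      ≡⟨ cong₂ _*_ (cong (λ t → w + + 9 * v + + 9 * t) (sh-e k i))
           (trans (cong (λ t → rise t (2 ℕ.+ k)) (lem₁ (+ k) z))
             (trans (rise-snoc r (suc k)) (cong (_* (r + + suc k)) (rise-snoc r k)))) ⟩
    (w + + 9 * v + + 9 * (v + + 9 * u)) * (R * (r + + k) * (r + (+ 1 + + k)))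
      ≡⟨ lc2 (R * (z - + 1)) (R * (+ 9 * z - + 9 * + k - + 15)) (e-step k i) (she-step k i) (lem₂ (+ k) z u v w R) ⟩
    (+ 2 * + k + + 3) * (+ 2 * ((w + + 9 * v) * ((+ 1 + + k - z + + 1) * R)) + + 9 * ((v + + 9 * u) * (R * (r + + k))))
      + + 9 * (+ 1 - + 9 * ((+ 1 + + k) * (+ 1 + + k))) * (u * R)
      ≡⟨ cong₂ (λ s t → (+ 2 * + k + + 3) * (+ 2 * s + + 9 * t) + + 9 * (+ 1 - + 9 * ((+ 1 + + k) * (+ 1 + + k))) * (u * R))
           (cong (λ t → (w + + 9 * v) * ((+ 1 + + k - z + + 1) * rise t k)) (lem₃ (+ k) z))
           (sym (trans (sh-G (suc k) i) (cong₂ _*_ (sh-e k i)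
             (trans (cong (λ t → rise t (suc k)) (lem₄ (+ k) z)) (rise-snoc r k))))) ⟩
    (+ 2 * + k + + 3) * (+ 2 * G (suc k) i + + 9 * sh (G (suc k)) i)
      + + 9 * (+ 1 - + 9 * ((+ 1 + + k) * (+ 1 + + k))) * (u * R)
      ≡⟨ cong (λ t → (+ 2 * + k + + 3) * (+ 2 * G (suc k) i + + 9 * sh (G (suc k)) i)
           + + 9 * (+ 1 - + 9 * ((+ 1 + + k) * (+ 1 + + k))) * t) (shsh-G k i) ⟨
    recurrence k (G (suc k)) (G k) i ∎
    where
    z = + i
    w = e k i
    v = sh (e k) i
    u = sh (sh (e k)) i
    r = + k - z + + 3
    R = rise r k
    lem₁ : ∀ k z → + 2 + k - z + + 1 ≡ k - z + + 3
    lem₁ k z = solve (k ∷ z ∷ [])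
    lem₃ : ∀ k z → k - z + + 3 ≡ + 1 + k - z + + 1 + + 1
    lem₃ k z = solve (k ∷ z ∷ [])
    lem₄ : ∀ k z → + 1 + k - z + + 2 ≡ k - z + + 3
    lem₄ k z = solve (k ∷ z ∷ [])
    lem₂ : ∀ k z u v w R →
      (w + + 9 * v + + 9 * (v + + 9 * u)) * (R * (k - z + + 3 + k) * (k - z + + 3 + (+ 1 + k)))
      ≡ (+ 2 * k + + 3) * (+ 2 * ((w + + 9 * v) * ((+ 1 + k - z + + 1) * R)) + + 9 * ((v + + 9 * u) * (R * (k - z + + 3 + k))))
          + + 9 * (+ 1 - + 9 * ((+ 1 + k) * (+ 1 + k))) * (u * R)
        + R * (z - + 1) * (z * w - (+ 9 * k + + 12 - + 9 * z) * v)
        + R * (+ 9 * z - + 9 * k - + 15) * ((z - + 1) * v - (+ 9 * k + + 21 - + 9 * z) * u)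
    lem₂ k z u v w R = solve (k ∷ z ∷ u ∷ v ∷ w ∷ R ∷ [])

  -- h (+ 12) k and h (+ 6) k are k! times the numerator and the denominator of a diagonal
  -- Padé approximant of F.
  h : ℤ → ℕ → Ser
  h c zero = one
  h c (suc zero) i = + 2 * one i + c * sh one i
  h c (suc (suc k)) = recurrence k (h c (suc k)) (h c k)

  -- Multiplication by `F` commutes with the recurrence, so only the two starting values have to be
  -- compared.
  F-⊛-h : ∀ k → F ⊛ h (+ 6) k ≐ G k
  F-⊛-h zero i = trans (⊛-comm F one i) (trans (one-⊛ F i) (sym (*-identityʳ _)))
  F-⊛-h (suc zero) i = begin
    (F ⊛ h (+ 6) 1) i ≡⟨ ⊛-linʳ (+ 2) (+ 6) F one (sh one) i ⟩
    + 2 * (F ⊛ one) i + + 6 * (F ⊛ sh one) i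
      ≡⟨ cong₂ (λ s t → + 2 * s + + 6 * t) (F1 i) (trans (⊛-shʳ F one i) (sh-cong F1 i)) ⟩
    + 2 * F i + + 6 * sh F i ≡⟨ lc1 (+ 1) (e-step 0 i) (lem (+ i) (F i) (sh F i)) ⟩
    G 1 i ∎
    where
    F1 : F ⊛ one ≐ F
    F1 j = trans (⊛-comm F one j) (one-⊛ F j)
    lem : ∀ z w v → + 2 * w + + 6 * v ≡ (w + + 9 * v) * ((+ 1 - z + + 1) * + 1) + + 1 * (z * w - (+ 9 * + 0 + + 12 - + 9 * z) * v)
    lem z w v = solve (z ∷ w ∷ v ∷ [])
  F-⊛-h (suc (suc k)) i = begin
    (F ⊛ recurrence k f₁ f₀) i
      ≡⟨ ⊛-linʳ c d F (λ j → + 2 * f₁ j + + 9 * sh f₁ j) (sh (sh f₀)) i ⟩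
    c * (F ⊛ (λ j → + 2 * f₁ j + + 9 * sh f₁ j)) i + d * (F ⊛ sh (sh f₀)) i
      ≡⟨ cong₂ (λ s t → c * s + d * t)
           (trans (⊛-linʳ (+ 2) (+ 9) F f₁ (sh f₁) i)
             (cong₂ (λ s t → + 2 * s + + 9 * t) (F-⊛-h (suc k) i) (trans (⊛-shʳ F f₁ i) (sh-cong (F-⊛-h (suc k)) i))))
           (trans (⊛-shʳ F (sh f₀) i) (sh-cong (λ j → trans (⊛-shʳ F f₀ j) (sh-cong (F-⊛-h k) j)) i)) ⟩
    recurrence k (G (suc k)) (G k) i ≡⟨ G-rec k i ⟨
    G (suc (suc k)) i ∎
    where
    f₁ = h (+ 6) (suc k)
    f₀ = h (+ 6) k
    c = + 2 * + k + + 3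
    d = + 9 * (+ 1 - + 9 * ((+ 1 + + k) * (+ 1 + + k)))

  private
    recurrence-zero : ∀ k f g i → f i ≡ + 0 → sh f i ≡ + 0 → sh (sh g) i ≡ + 0 → recurrence k f g i ≡ + 0
    recurrence-zero k f g i p q r =
      trans (cong₂ _+_ (cong₂ (λ s t → c * (+ 2 * s + + 9 * t)) p q) (cong (d *_) r))
        (cong₂ _+_ (*-zeroʳ c) (*-zeroʳ d))
      where
      c = + 2 * + k + + 3
      d = + 9 * (+ 1 - + 9 * ((+ 1 + + k) * (+ 1 + + k)))

  h-degree : ∀ c k i → k ℕ.< i → h c k i ≡ + 0
  h-degree c zero (suc i) _ = refl
  h-degree c (suc zero) (suc (suc i)) _ = trans (+-identityˡ _) (*-zeroʳ c)
  h-degree c (suc zero) (suc zero) (s≤s ())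
  h-degree c (suc (suc k)) (suc (suc i)) (s≤s (s≤s p)) =
    recurrence-zero k (h c (suc k)) (h c k) (suc (suc i))
      (h-degree c (suc k) (suc (suc i)) (s≤s (ℕₚ.m≤n⇒m≤1+n p))) (h-degree c (suc k) (suc i) (s≤s p)) (h-degree c k i p)
  h-degree c (suc (suc k)) (suc zero) (s≤s ())

  -- In this range the product `rise` passes through 0. The k missing coefficients are what raises
  -- the order of approximation from k + 1 to 2k + 1.
  G-gap : ∀ k i → k ℕ.< i → i ℕ.≤ k ℕ.+ k → G k i ≡ + 0
  G-gap k i k<i i≤2k = trans (cong (λ z → e k i * rise z k) eq)
    (trans (cong (e k i *_) (rise-vanishes j k j<k)) (*-zeroʳ (e k i)))
    where
    j = i ℕ.∸ suc k
    i≡ : i ≡ suc k ℕ.+ j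
    i≡ = sym (ℕₚ.m+[n∸m]≡n k<i)
    j<k : j ℕ.< k
    j<k = ℕₚ.+-cancelˡ-≤ k (suc j) k (subst (ℕ._≤ k ℕ.+ k) (trans i≡ (sym (ℕₚ.+-suc k j))) i≤2k)
    lem : ∀ k j → k - (+ 1 + k + j) + + 1 ≡ - j
    lem k j = solve (k ∷ j ∷ [])
    eq : + k - + i + + 1 ≡ - + j
    eq = trans (cong (λ t → + k - + t + + 1) i≡) (lem (+ k) (+ j))

  Agree : ℕ → Set
  Agree k = ∀ i → i ℕ.≤ k ℕ.+ k → h (+ 12) k i ≡ G k i

  -- Above degree k + 2 both sides vanish, the polynomial by its degree and `G` by its gap; up to
  -- that degree the recurrence applies to both.
  h≡G-step : ∀ k → Agree (suc k) → Agree k → Agree (suc (suc k))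
  h≡G-step k ih₁ ih₀ i h2 with suc (suc k) ℕ.<? i
  ... | yes q = trans (h-degree (+ 12) (suc (suc k)) i q) (sym (G-gap (suc (suc k)) i q h2))
  ... | no q = begin
    recurrence k (h (+ 12) (suc k)) (h (+ 12) k) i
      ≡⟨ cong₂ _+_ (cong₂ (λ s t → (+ 2 * + k + + 3) * (+ 2 * s + + 9 * t)) (ih₁ i i≤) (shh i i≤))
           (cong (+ 9 * (+ 1 - + 9 * ((+ 1 + + k) * (+ 1 + + k))) *_) (shshh i i≤2+k)) ⟩
    recurrence k (G (suc k)) (G k) i ≡⟨ G-rec k i ⟨
    G (suc (suc k)) i ∎
    where
    i≤2+k : i ℕ.≤ suc (suc k)
    i≤2+k = ℕₚ.≮⇒≥ q
    i≤ : i ℕ.≤ suc k ℕ.+ suc k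
    i≤ = ℕₚ.≤-trans i≤2+k (s≤s (ℕₚ.m≤n+m (suc k) k))
    shh : ∀ i → i ℕ.≤ suc k ℕ.+ suc k → sh (h (+ 12) (suc k)) i ≡ sh (G (suc k)) i
    shh zero _ = refl
    shh (suc i) p = ih₁ i (ℕₚ.≤-trans (ℕₚ.n≤1+n i) p)
    shshh : ∀ i → i ℕ.≤ suc (suc k) → sh (sh (h (+ 12) k)) i ≡ sh (sh (G k)) i
    shshh zero _ = refl
    shshh (suc zero) _ = refl
    shshh (suc (suc i)) (s≤s (s≤s p)) = ih₀ i (ℕₚ.≤-trans p (ℕₚ.m≤m+n k k))

  h≡G : ∀ k → Agree k
  h≡G zero zero _ = sym (trans (*-identityʳ (F 0)) F-zero)
  h≡G (suc zero) i h2 = begin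
    + 2 * one i + + 12 * sh one i ≡⟨ lem i h2 ⟩
    + 2 * F i + + 6 * sh F i ≡⟨ cong (λ t → t) (sym (G1 i)) ⟩
    G 1 i ∎
    where
    G1 : ∀ i → G 1 i ≡ + 2 * F i + + 6 * sh F i
    G1 i = sym (lc1 (+ 1) (e-step 0 i) (lem' (+ i) (F i) (sh F i)))
      where
      lem' : ∀ z w v → + 2 * w + + 6 * v ≡ (w + + 9 * v) * ((+ 1 - z + + 1) * + 1) + + 1 * (z * w - (+ 9 * + 0 + + 12 - + 9 * z) * v)
      lem' z w v = solve (z ∷ w ∷ v ∷ [])
    F1 : F 1 ≡ + 3
    F1 = lc2 (+ 1) (+ 3) (F-ode 0) F-zero (lem' (F 1) (F 0))
      where
      lem' : ∀ a b → a ≡ + 3 + + 1 * (+ 1 * a + + 9 * (+ 0 * b) - + 3 * b) + + 3 * (b - + 1)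
      lem' a b = solve (a ∷ b ∷ [])
    F2 : + 2 * F 2 ≡ - + 18
    F2 = lc2 (+ 1) (- + 6) (F-ode 1) F1 (lem' (F 2) (F 1))
      where
      lem' : ∀ a b → + 2 * a ≡ - + 18 + + 1 * (+ 2 * a + + 9 * (+ 1 * b) - + 3 * b) + - + 6 * (b - + 3)
      lem' a b = solve (a ∷ b ∷ [])
    lem : ∀ i → i ℕ.≤ 2 → + 2 * one i + + 12 * sh one i ≡ + 2 * F i + + 6 * sh F i
    lem zero _ = cong (λ t → + 2 * t + + 6 * + 0) (sym F-zero)
    lem (suc zero) _ = cong₂ (λ s t → + 2 * s + + 6 * t) (sym F1) (sym F-zero)
    lem (suc (suc zero)) _ = cong₂ (λ s t → s + + 6 * t) (sym F2) (sym F1)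
    lem (suc (suc (suc i))) (s≤s (s≤s ()))
  h≡G (suc (suc k)) = h≡G-step k (h≡G (suc k)) (h≡G k)

  -- Up to degree k the coefficients are those of `G k`, each of which contains a product of k
  -- consecutive integers. Without this common divisor the approximants would have factorial size.
  factorial-∣-h : ∀ k i → i ℕ.≤ k → ∃[ c ] h (+ 12) k i ≡ + (k !) * c
  factorial-∣-h k i i≤k with factorial-∣-rise k (suc (k ℕ.∸ i))
  ... | c , p = e k i * c , (begin
    h (+ 12) k i                      ≡⟨ h≡G k i (ℕₚ.≤-trans i≤k (ℕₚ.m≤m+n k k)) ⟩
    e k i * rise (+ k - + i + + 1) k  ≡⟨ cong (λ z → e k i * rise z k) eq ⟩
    e k i * rise (+ suc (k ℕ.∸ i)) k  ≡⟨ cong (e k i *_) p ⟩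
    e k i * (+ (k !) * c)             ≡⟨ lem (e k i) (+ (k !)) c ⟩
    + (k !) * (e k i * c) ∎)
    where
    lem : ∀ a b c → a * (b * c) ≡ b * (a * c)
    lem a b c = solve (a ∷ b ∷ c ∷ [])
    lem2 : ∀ i j → i + j - i + + 1 ≡ + 1 + j
    lem2 i j = solve (i ∷ j ∷ [])
    eq : + k - + i + + 1 ≡ + suc (k ℕ.∸ i)
    eq = trans (cong (λ t → + t - + i + + 1) (sym (ℕₚ.m+[n∸m]≡n i≤k))) (lem2 (+ i) (+ (k ℕ.∸ i)))

  -- Θ = h₊³ − (1 + 9x) h₋³ vanishes to order 2k + 1, since h₊ ≡ F h₋ and F³ = 1 + 9x.
  cube : Ser → Ser
  cube f = f ⊛ (f ⊛ f)

  Θ : ℕ → Ser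
  Θ k i = cube (h (+ 12) k) i - (one+9x ⊛ cube (h (+ 6) k)) i

  Θ-order : ∀ k i → i ℕ.≤ k ℕ.+ k → Θ k i ≡ + 0
  Θ-order k i i≤2k = trans (cong (λ t → cube (h (+ 12) k) i - t) (sym eq)) (+-inverseʳ (cube (h (+ 12) k) i))
    where
    H = h (+ 6) k
    up : ∀ j → j ℕ.≤ i → h (+ 12) k j ≡ (F ⊛ H) j
    up j j≤i = trans (h≡G k j (ℕₚ.≤-trans j≤i i≤2k)) (sym (F-⊛-h k j))
    eq : cube (h (+ 12) k) i ≡ (one+9x ⊛ cube H) i
    eq = begin
      cube (h (+ 12) k) i
        ≡⟨ ⊛-cong-upto i up (λ j p → ⊛-cong-upto j (λ l q → up l (ℕₚ.≤-trans q p)) (λ l q → up l (ℕₚ.≤-trans q p))) ⟩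
      cube (F ⊛ H) i
        ≡⟨ ⊛-cong {F ⊛ H} (λ _ → refl) (⊛-interchange F H F H) i ⟩
      ((F ⊛ H) ⊛ ((F ⊛ F) ⊛ (H ⊛ H))) i ≡⟨ ⊛-interchange F H (F ⊛ F) (H ⊛ H) i ⟩
      (cube F ⊛ cube H) i ≡⟨ ⊛-cong {g = cube H} F³≐ (λ _ → refl) i ⟩
      (one+9x ⊛ cube H) i ∎

-- The ring ℤ[√-3] and homogenised evaluation of polynomials in it.

module Eisenstein where
  open import Algebra.Bundles using (CommutativeRing)
  open import Data.Nat as ℕ using (ℕ; zero; suc; z≤n; s≤s)
  import Data.Nat.Properties as ℕₚ
  open import Data.Integer hiding (suc; _⊖_)
  open import Data.Integer.Properties
  open import Data.Maybe using (just; nothing)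
  open import Data.Product using (_,_)
  open import Level using (0ℓ)
  open import Relation.Binary.PropositionalEquality
  import Tactic.RingSolver as Solver
  import Tactic.RingSolver.Core.AlmostCommutativeRing as ACR
  open Integers
  open Series

  -- mk u v is u + v√−3.
  record E : Set where
    no-eta-equality; pattern
    constructor mk
    field re im : ℤ

  infixl 6 _⊕_
  infixl 7 _⊗_

  _⊕_ _⊗_ : E → E → E
  mk a b ⊕ mk c d = mk (a + c) (b + d)
  mk a b ⊗ mk c d = mk (a * c + - + 3 * (b * d)) (a * d + b * c)

  ⊖_ : E → E
  ⊖ mk a b = mk (- a) (- b)

  int : ℤ → E
  int a = mk a (+ 0)

  0E 1E : E
  0E = int (+ 0)
  1E = int (+ 1)

  E-commutativeRing : CommutativeRing 0ℓ 0ℓ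
  E-commutativeRing = record
    { Carrier = E ; _≈_ = _≡_ ; _+_ = _⊕_ ; _*_ = _⊗_ ; -_ = ⊖_ ; 0# = 0E ; 1# = 1E
    ; isCommutativeRing = record
      { isRing = record
        { +-isAbelianGroup = record
          { isGroup = record
            { isMonoid = record
              { isSemigroup = record
                { isMagma = record { isEquivalence = isEquivalence ; ∙-cong = cong₂ _⊕_ }
                ; assoc = λ { (mk a b) (mk c d) (mk e f) → cong₂ mk (+-assoc a c e) (+-assoc b d f) } }
              ; identity = (λ { (mk a b) → cong₂ mk (+-identityˡ a) (+-identityˡ b) })
                         , (λ { (mk a b) → cong₂ mk (+-identityʳ a) (+-identityʳ b) }) }
            ; inverse = (λ { (mk a b) → cong₂ mk (+-inverseˡ a) (+-inverseˡ b) })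
                      , (λ { (mk a b) → cong₂ mk (+-inverseʳ a) (+-inverseʳ b) })
            ; ⁻¹-cong = cong ⊖_ }
          ; comm = λ { (mk a b) (mk c d) → cong₂ mk (+-comm a c) (+-comm b d) } }
        ; *-cong = cong₂ _⊗_
        ; *-assoc = λ { (mk a b) (mk c d) (mk e f) → cong₂ mk (as₁ a b c d e f) (as₂ a b c d e f) }
        ; *-identity = (λ { (mk a b) → cong₂ mk (i₁ a b) (i₂ a b) }) , (λ { (mk a b) → cong₂ mk (i₃ a b) (i₄ a b) })
        ; distrib = (λ { (mk a b) (mk c d) (mk e f) → cong₂ mk (d₁ a b c d e f) (d₂ a b c d e f) })
                  , (λ { (mk a b) (mk c d) (mk e f) → cong₂ mk (d₃ a b c d e f) (d₄ a b c d e f) }) }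
      ; *-comm = λ { (mk a b) (mk c d) → cong₂ mk (c₁ a b c d) (c₂ a b c d) } } }
    where
    as₁ : ∀ a b c d e f → (a * c + - + 3 * (b * d)) * e + - + 3 * ((a * d + b * c) * f)
          ≡ a * (c * e + - + 3 * (d * f)) + - + 3 * (b * (c * f + d * e))
    as₁ a b c d e f = solve (a ∷ b ∷ c ∷ d ∷ e ∷ f ∷ [])
    as₂ : ∀ a b c d e f → (a * c + - + 3 * (b * d)) * f + (a * d + b * c) * e
          ≡ a * (c * f + d * e) + b * (c * e + - + 3 * (d * f))
    as₂ a b c d e f = solve (a ∷ b ∷ c ∷ d ∷ e ∷ f ∷ [])
    i₁ : ∀ a b → + 1 * a + - + 3 * (+ 0 * b) ≡ a
    i₁ a b = solve (a ∷ b ∷ [])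
    i₂ : ∀ a b → + 1 * b + + 0 * a ≡ b
    i₂ a b = solve (a ∷ b ∷ [])
    i₃ : ∀ a b → a * + 1 + - + 3 * (b * + 0) ≡ a
    i₃ a b = solve (a ∷ b ∷ [])
    i₄ : ∀ a b → a * + 0 + b * + 1 ≡ b
    i₄ a b = solve (a ∷ b ∷ [])
    d₁ : ∀ a b c d e f → a * (c + e) + - + 3 * (b * (d + f)) ≡ a * c + - + 3 * (b * d) + (a * e + - + 3 * (b * f))
    d₁ a b c d e f = solve (a ∷ b ∷ c ∷ d ∷ e ∷ f ∷ [])
    d₂ : ∀ a b c d e f → a * (d + f) + b * (c + e) ≡ a * d + b * c + (a * f + b * e)
    d₂ a b c d e f = solve (a ∷ b ∷ c ∷ d ∷ e ∷ f ∷ [])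
    d₃ : ∀ a b c d e f → (c + e) * a + - + 3 * ((d + f) * b) ≡ c * a + - + 3 * (d * b) + (e * a + - + 3 * (f * b))
    d₃ a b c d e f = solve (a ∷ b ∷ c ∷ d ∷ e ∷ f ∷ [])
    d₄ : ∀ a b c d e f → (c + e) * b + (d + f) * a ≡ c * b + d * a + (e * b + f * a)
    d₄ a b c d e f = solve (a ∷ b ∷ c ∷ d ∷ e ∷ f ∷ [])
    c₁ : ∀ a b c d → a * c + - + 3 * (b * d) ≡ c * a + - + 3 * (d * b)
    c₁ a b c d = solve (a ∷ b ∷ c ∷ d ∷ [])
    c₂ : ∀ a b c d → a * d + b * c ≡ c * b + d * a
    c₂ a b c d = solve (a ∷ b ∷ c ∷ d ∷ [])

  E-ring : ACR.AlmostCommutativeRing 0ℓ 0ℓ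
  E-ring = ACR.fromCommutativeRing E-commutativeRing λ { (mk (+ 0) (+ 0)) → just refl ; _ → nothing }

  int-+ : ∀ a b → int (a + b) ≡ int a ⊕ int b
  int-+ a b = refl

  int-* : ∀ a b → int (a * b) ≡ int a ⊗ int b
  int-* a b = cong₂ mk (lem a b) (lem2 a b)
    where
    lem : ∀ a b → a * b ≡ a * b + - + 3 * (+ 0 * + 0)
    lem a b = solve (a ∷ b ∷ [])
    lem2 : ∀ a b → + 0 ≡ a * + 0 + + 0 * b
    lem2 a b = solve (a ∷ b ∷ [])

  infixr 8 _↑_
  _↑_ : E → ℕ → E
  b ↑ zero = 1E
  b ↑ suc m = b ⊗ b ↑ m

  -- The homogenised value Σ_{i ≤ d} f i · δ^i · b^(d − i).
  module Evaluation (δ b : E) where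

    ev : ℕ → Ser → E
    ev zero f = int (f 0)
    ev (suc d) f = int (f 0) ⊗ b ↑ suc d ⊕ δ ⊗ ev d (tl f)

    Degree : ℕ → Ser → Set
    Degree d f = ∀ i → d ℕ.< i → f i ≡ + 0

    ev-cong-upto : ∀ d {f g} → (∀ i → i ℕ.≤ d → f i ≡ g i) → ev d f ≡ ev d g
    ev-cong-upto zero p = cong int (p 0 z≤n)
    ev-cong-upto (suc d) p =
      cong₂ (λ s t → int s ⊗ b ↑ suc d ⊕ δ ⊗ t) (p 0 z≤n) (ev-cong-upto d (λ i q → p (suc i) (s≤s q)))

    ev-lin : ∀ d c c' f g → ev d (λ i → c * f i + c' * g i) ≡ int c ⊗ ev d f ⊕ int c' ⊗ ev d g
    ev-lin zero c c' f g = trans (int-+ (c * f 0) (c' * g 0)) (cong₂ _⊕_ (int-* c (f 0)) (int-* c' (g 0)))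
    ev-lin (suc d) c c' f g =
      trans (cong₂ (λ s t → s ⊗ b ↑ suc d ⊕ δ ⊗ t)
              (trans (int-+ (c * f 0) (c' * g 0)) (cong₂ _⊕_ (int-* c (f 0)) (int-* c' (g 0)))) (ev-lin d c c' (tl f) (tl g)))
            (lem (int c) (int c') (int (f 0)) (int (g 0)) (b ↑ suc d) δ (ev d (tl f)) (ev d (tl g)))
      where
      lem : ∀ c c' f g b δ x y → (c ⊗ f ⊕ c' ⊗ g) ⊗ b ⊕ δ ⊗ (c ⊗ x ⊕ c' ⊗ y) ≡ c ⊗ (f ⊗ b ⊕ δ ⊗ x) ⊕ c' ⊗ (g ⊗ b ⊕ δ ⊗ y)
      lem c c' f g b δ x y = Solver.solve (c ∷ c' ∷ f ∷ g ∷ b ∷ δ ∷ x ∷ y ∷ []) E-ring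

    ev-pad : ∀ d f → Degree d f → ev (suc d) f ≡ b ⊗ ev d f
    ev-pad zero f p = trans (cong (λ t → int (f 0) ⊗ (b ⊗ 1E) ⊕ δ ⊗ int t) (p 1 (s≤s z≤n))) (lem (int (f 0)) b δ)
      where
      lem : ∀ f b δ → f ⊗ (b ⊗ 1E) ⊕ δ ⊗ 0E ≡ b ⊗ f
      lem f b δ = Solver.solve (f ∷ b ∷ δ ∷ []) E-ring
    ev-pad (suc d) f p =
      trans (cong (λ t → int (f 0) ⊗ (b ⊗ b ↑ suc d) ⊕ δ ⊗ t) (ev-pad d (tl f) (λ i q → p (suc i) (s≤s q))))
        (lem (int (f 0)) b (b ↑ suc d) δ (ev d (tl f)))
      where
      lem : ∀ f b c δ x → f ⊗ (b ⊗ c) ⊕ δ ⊗ (b ⊗ x) ≡ b ⊗ (f ⊗ c ⊕ δ ⊗ x)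
      lem f b c δ x = Solver.solve (f ∷ b ∷ c ∷ δ ∷ x ∷ []) E-ring

    ev-pads : ∀ m d f → Degree d f → ev (m ℕ.+ d) f ≡ b ↑ m ⊗ ev d f
    ev-pads zero d f p = sym (lem (ev d f))
      where
      lem : ∀ x → 1E ⊗ x ≡ x
      lem x = Solver.solve (x ∷ []) E-ring
    ev-pads (suc m) d f p =
      trans (ev-pad (m ℕ.+ d) f (λ i q → p i (ℕₚ.≤-trans (s≤s (ℕₚ.m≤n+m d m)) q)))
        (trans (cong (b ⊗_) (ev-pads m d f p)) (lem b (b ↑ m) (ev d f)))
      where
      lem : ∀ b c x → b ⊗ (c ⊗ x) ≡ (b ⊗ c) ⊗ x
      lem b c x = Solver.solve (b ∷ c ∷ x ∷ []) E-ring

    ev-sh : ∀ d f → ev (suc d) (sh f) ≡ δ ⊗ ev d f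
    ev-sh d f = lem (b ↑ suc d) (δ ⊗ ev d f)
      where
      lem : ∀ b x → 0E ⊗ b ⊕ x ≡ x
      lem b x = Solver.solve (b ∷ x ∷ []) E-ring

    private
      ⊛-const : ∀ f g → Degree 0 f → f ⊛ g ≐ (λ i → f 0 * g i)
      ⊛-const f g p zero = ⊛-zero f g
      ⊛-const f g p (suc n) = trans (⊛-suc f g n)
        (trans (cong (λ t → f 0 * g (suc n) + t)
          (trans (⊛-cong {g = g} (λ i → p (suc i) (s≤s z≤n)) (λ _ → refl) n) (zero-⊛ g n))) (+-identityʳ _))

      ⊛-split : ∀ f g → f ⊛ g ≐ (λ i → f 0 * g i + + 1 * sh (tl f ⊛ g) i)
      ⊛-split f g zero = trans (⊛-zero f g) (sym (+-identityʳ _))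
      ⊛-split f g (suc n) = trans (⊛-suc f g n) (cong (λ t → f 0 * g (suc n) + t) (sym (*-identityˡ _)))

    ⊛-degree : ∀ d d' f g → Degree d f → Degree d' g → Degree (d ℕ.+ d') (f ⊛ g)
    ⊛-degree zero d' f g p q i h = trans (⊛-const f g p i) (trans (cong (f 0 *_) (q i h)) (*-zeroʳ (f 0)))
    ⊛-degree (suc d) d' f g p q (suc i) (s≤s h) = trans (⊛-suc f g i)
      (trans (cong₂ (λ s t → f 0 * s + t) (q (suc i) (ℕₚ.≤-trans (s≤s (ℕₚ.m≤n+m d' d)) (ℕₚ.m≤n⇒m≤1+n h)))
        (⊛-degree d d' (tl f) g (λ j r → p (suc j) (s≤s r)) q i h)) (trans (+-identityʳ _) (*-zeroʳ (f 0))))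

    ev-⊛ : ∀ d d' f g → Degree d f → Degree d' g → ev (d ℕ.+ d') (f ⊛ g) ≡ ev d f ⊗ ev d' g
    ev-⊛ zero d' f g p q =
      trans (ev-cong-upto d' (λ i _ → trans (⊛-const f g p i) (sym (+-identityʳ _))))
        (trans (ev-lin d' (f 0) (+ 0) g g) (lem (int (f 0)) (ev d' g)))
      where
      lem : ∀ c x → c ⊗ x ⊕ 0E ⊗ x ≡ c ⊗ x
      lem c x = Solver.solve (c ∷ x ∷ []) E-ring
    ev-⊛ (suc d) d' f g p q =
      trans (ev-cong-upto (suc d ℕ.+ d') (λ i _ → ⊛-split f g i))
        (trans (ev-lin (suc d ℕ.+ d') (f 0) (+ 1) g (sh (tl f ⊛ g)))
          (trans (cong₂ (λ s t → int (f 0) ⊗ s ⊕ 1E ⊗ t) (ev-pads (suc d) d' g q)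
                   (trans (ev-sh (d ℕ.+ d') (tl f ⊛ g))
                     (cong (δ ⊗_) (ev-⊛ d d' (tl f) g (λ j r → p (suc j) (s≤s r)) q))))
            (lem (int (f 0)) (b ↑ suc d) (ev d' g) δ (ev d (tl f)))))
      where
      lem : ∀ c b y δ x → c ⊗ (b ⊗ y) ⊕ 1E ⊗ (δ ⊗ (x ⊗ y)) ≡ (c ⊗ b ⊕ δ ⊗ x) ⊗ y
      lem c b y δ x = Solver.solve (c ∷ b ∷ y ∷ δ ∷ x ∷ []) E-ring

    -- This is how vanishing to high order at x = 0 becomes smallness of a value: m factors of size
    -- b are replaced by factors δ, which do not grow with n.
    ev-drop : ∀ m d f → (∀ i → i ℕ.< m → f i ≡ + 0) → ev (m ℕ.+ d) f ≡ δ ↑ m ⊗ ev d (λ i → f (m ℕ.+ i))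
    ev-drop zero d f p = sym (lem (ev d f))
      where
      lem : ∀ x → 1E ⊗ x ≡ x
      lem x = Solver.solve (x ∷ []) E-ring
    ev-drop (suc m) d f p =
      trans (cong₂ (λ s t → int s ⊗ b ↑ suc (m ℕ.+ d) ⊕ δ ⊗ t) (p 0 (s≤s z≤n)) (ev-drop m d (tl f) (λ i q → p (suc i) (s≤s q))))
        (lem (b ↑ suc (m ℕ.+ d)) δ (δ ↑ m) (ev d (λ i → f (suc m ℕ.+ i))))
      where
      lem : ∀ b δ c x → 0E ⊗ b ⊕ δ ⊗ (c ⊗ x) ≡ (δ ⊗ c) ⊗ x
      lem b δ c x = Solver.solve (b ∷ δ ∷ c ∷ x ∷ []) E-ring

    ev-scale : ∀ d c f → ev d (λ i → c * f i) ≡ int c ⊗ ev d f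
    ev-scale d c f = trans (ev-cong-upto d (λ i _ → sym (+-identityʳ (c * f i))))
      (trans (ev-lin d c (+ 0) f f) (lem (int c) (ev d f)))
      where
      lem : ∀ c x → c ⊗ x ⊕ 0E ⊗ x ≡ c ⊗ x
      lem c x = Solver.solve (c ∷ x ∷ []) E-ring

  -- An ℓ¹-norm in which √-3 has weight 2; it is submultiplicative because 2² ≥ 3.
  ‖_‖ : E → ℕ
  ‖ mk a b ‖ = ∣ a ∣ ℕ.+ 2 ℕ.* ∣ b ∣

  ‖⊕‖ : ∀ x y → ‖ x ⊕ y ‖ ℕ.≤ ‖ x ‖ ℕ.+ ‖ y ‖
  ‖⊕‖ (mk a b) (mk c d) = ℕₚ.≤-trans (ℕₚ.+-mono-≤ (∣i+j∣≤∣i∣+∣j∣ a c) (ℕₚ.*-monoʳ-≤ 2 (∣i+j∣≤∣i∣+∣j∣ b d)))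
    (ℕₚ.≤-reflexive (lem (∣ a ∣) (∣ b ∣) (∣ c ∣) (∣ d ∣)))
    where
    open import Data.Nat.Tactic.RingSolver renaming (solve to solveℕ)
    lem : ∀ a b c d → (a ℕ.+ c) ℕ.+ 2 ℕ.* (b ℕ.+ d) ≡ (a ℕ.+ 2 ℕ.* b) ℕ.+ (c ℕ.+ 2 ℕ.* d)
    lem a b c d = solveℕ (a ∷ b ∷ c ∷ d ∷ [])

  ‖⊗‖ : ∀ x y → ‖ x ⊗ y ‖ ℕ.≤ ‖ x ‖ ℕ.* ‖ y ‖
  ‖⊗‖ (mk a b) (mk c d) = begin
    ∣ a * c + - + 3 * (b * d) ∣ ℕ.+ 2 ℕ.* ∣ a * d + b * c ∣
      ≤⟨ ℕₚ.+-mono-≤ (∣i+j∣≤∣i∣+∣j∣ (a * c) (- + 3 * (b * d))) (ℕₚ.*-monoʳ-≤ 2 (∣i+j∣≤∣i∣+∣j∣ (a * d) (b * c))) ⟩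
    (∣ a * c ∣ ℕ.+ ∣ - + 3 * (b * d) ∣) ℕ.+ 2 ℕ.* (∣ a * d ∣ ℕ.+ ∣ b * c ∣)
      ≡⟨ cong₂ (λ s t → s ℕ.+ 2 ℕ.* t)
           (cong₂ ℕ._+_ (abs-* a c) (trans (abs-* (- + 3) (b * d)) (cong (3 ℕ.*_) (abs-* b d))))
           (cong₂ ℕ._+_ (abs-* a d) (abs-* b c)) ⟩
    (∣ a ∣ ℕ.* ∣ c ∣ ℕ.+ 3 ℕ.* (∣ b ∣ ℕ.* ∣ d ∣)) ℕ.+ 2 ℕ.* (∣ a ∣ ℕ.* ∣ d ∣ ℕ.+ ∣ b ∣ ℕ.* ∣ c ∣)
      ≤⟨ ℕₚ.m≤m+n _ (∣ b ∣ ℕ.* ∣ d ∣) ⟩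
    ((∣ a ∣ ℕ.* ∣ c ∣ ℕ.+ 3 ℕ.* (∣ b ∣ ℕ.* ∣ d ∣)) ℕ.+ 2 ℕ.* (∣ a ∣ ℕ.* ∣ d ∣ ℕ.+ ∣ b ∣ ℕ.* ∣ c ∣)) ℕ.+ ∣ b ∣ ℕ.* ∣ d ∣
      ≡⟨ lem (∣ a ∣) (∣ b ∣) (∣ c ∣) (∣ d ∣) ⟩
    (∣ a ∣ ℕ.+ 2 ℕ.* ∣ b ∣) ℕ.* (∣ c ∣ ℕ.+ 2 ℕ.* ∣ d ∣) ∎
    where
    open import Data.Nat.Tactic.RingSolver renaming (solve to solveℕ)
    open ℕₚ.≤-Reasoning
    lem : ∀ a b c d → ((a ℕ.* c ℕ.+ 3 ℕ.* (b ℕ.* d)) ℕ.+ 2 ℕ.* (a ℕ.* d ℕ.+ b ℕ.* c)) ℕ.+ b ℕ.* d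
          ≡ (a ℕ.+ 2 ℕ.* b) ℕ.* (c ℕ.+ 2 ℕ.* d)
    lem a b c d = solveℕ (a ∷ b ∷ c ∷ d ∷ [])

  ‖int‖ : ∀ a → ‖ int a ‖ ≡ ∣ a ∣
  ‖int‖ a = ℕₚ.+-identityʳ ∣ a ∣

  ‖↑‖ : ∀ x m → ‖ x ↑ m ‖ ℕ.≤ ‖ x ‖ ℕ.^ m
  ‖↑‖ x zero = ℕₚ.≤-refl
  ‖↑‖ x (suc m) = ℕₚ.≤-trans (‖⊗‖ x (x ↑ m)) (ℕₚ.*-monoʳ-≤ ‖ x ‖ (‖↑‖ x m))

  ‖ev‖ : ∀ δ b d f M β → ‖ δ ‖ ℕ.≤ β → ‖ b ‖ ℕ.≤ β → (∀ i → i ℕ.≤ d → ∣ f i ∣ ℕ.≤ M) →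
         ‖ Evaluation.ev δ b d f ‖ ℕ.≤ suc d ℕ.* (M ℕ.* β ℕ.^ d)
  ‖ev‖ δ b zero f M β p q r = ℕₚ.≤-trans (ℕₚ.≤-reflexive (‖int‖ (f 0)))
    (ℕₚ.≤-trans (r 0 z≤n) (ℕₚ.≤-reflexive (sym (trans (ℕₚ.+-identityʳ (M ℕ.* 1)) (ℕₚ.*-identityʳ M)))))
  ‖ev‖ δ b (suc d) f M β p q r = begin
    ‖ int (f 0) ⊗ b ↑ suc d ⊕ δ ⊗ rest ‖ ≤⟨ ‖⊕‖ (int (f 0) ⊗ b ↑ suc d) (δ ⊗ rest) ⟩
    ‖ int (f 0) ⊗ b ↑ suc d ‖ ℕ.+ ‖ δ ⊗ rest ‖
      ≤⟨ ℕₚ.+-mono-≤ (‖⊗‖ (int (f 0)) (b ↑ suc d)) (‖⊗‖ δ rest) ⟩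
    ‖ int (f 0) ‖ ℕ.* ‖ b ↑ suc d ‖ ℕ.+ ‖ δ ‖ ℕ.* ‖ rest ‖
      ≤⟨ ℕₚ.+-mono-≤
           (ℕₚ.*-mono-≤ (ℕₚ.≤-trans (ℕₚ.≤-reflexive (‖int‖ (f 0))) (r 0 z≤n))
             (ℕₚ.≤-trans (‖↑‖ b (suc d)) (ℕₚ.^-monoˡ-≤ (suc d) q)))
           (ℕₚ.*-mono-≤ p (‖ev‖ δ b d (tl f) M β p q (λ i h → r (suc i) (s≤s h)))) ⟩
    M ℕ.* (β ℕ.* β ℕ.^ d) ℕ.+ β ℕ.* (suc d ℕ.* (M ℕ.* β ℕ.^ d)) ≡⟨ lem M β (β ℕ.^ d) (suc d) ⟩
    suc (suc d) ℕ.* (M ℕ.* (β ℕ.* β ℕ.^ d)) ∎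
    where
    open import Data.Nat.Tactic.RingSolver renaming (solve to solveℕ)
    open ℕₚ.≤-Reasoning
    rest = Evaluation.ev δ b d (tl f)
    lem : ∀ M β c d → M ℕ.* (β ℕ.* c) ℕ.+ β ℕ.* (d ℕ.* (M ℕ.* c)) ≡ (1 ℕ.+ d) ℕ.* (M ℕ.* (β ℕ.* c))
    lem M β c d = solveℕ (M ∷ β ∷ c ∷ d ∷ [])

-- Rational approximations obtained by specialising the Padé approximants.

module Approximants where
  open import Data.Nat as ℕ using (ℕ; zero; suc; s≤s; _!)
  open import Data.Integer hiding (suc; _⊖_)
  open import Data.Integer.Properties
  open import Data.Product using (∃-syntax; _×_; _,_; proj₁; proj₂)
  open import Relation.Nullary using (yes; no; contradiction)
  open import Relation.Binary.PropositionalEquality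
  import Tactic.RingSolver as Solver
  open Integers
  open Series
  open CubeRoot using (one+9x)
  open Pade
  open Eisenstein

  -- 8 f_n(p, q) = g N (2p + q) q for N = 2n + 1.
  g : (N a b : ℤ) → ℤ
  g N a b = a * a * a - N * a * a * b - + 9 * a * b * b + N * b * b * b

  -- The Padé recurrence after specialisation and removal of a power of 18. Its coefficients are
  -- positive, the last one being 3(9(k + 1)² - 1), so it runs in ℕ and growth estimates are
  -- immediate.
  conv : (N t₀ t₁ : ℕ) → ℕ → ℕ
  conv N t₀ t₁ zero = t₀
  conv N t₀ t₁ (suc zero) = t₁
  conv N t₀ t₁ (suc (suc k)) =
    (2 ℕ.* k ℕ.+ 3) ℕ.* N ℕ.* conv N t₀ t₁ (suc k) ℕ.+ (27 ℕ.* (k ℕ.* k) ℕ.+ 54 ℕ.* k ℕ.+ 24) ℕ.* conv N t₀ t₁ k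

  A B : ℕ → ℕ → ℕ
  A N = conv N 1 N
  B N = conv N 0 1

  conv-ℤ : ∀ N t₀ t₁ k → + conv N t₀ t₁ (suc (suc k)) ≡
    (+ 2 * + k + + 3) * + N * + conv N t₀ t₁ (suc k) + (+ 27 * (+ k * + k) + + 54 * + k + + 24) * + conv N t₀ t₁ k
  conv-ℤ N t₀ t₁ k = cong₂ _+_
    (trans (pos-* ((2 ℕ.* k ℕ.+ 3) ℕ.* N) _) (cong (_* + conv N t₀ t₁ (suc k))
      (trans (pos-* (2 ℕ.* k ℕ.+ 3) N) (cong (λ t → (t + + 3) * + N) (pos-* 2 k)))))
    (trans (pos-* (27 ℕ.* (k ℕ.* k) ℕ.+ 54 ℕ.* k ℕ.+ 24) _) (cong (_* + conv N t₀ t₁ k)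
      (cong₂ (λ s t → s + t + + 24) (trans (pos-* 27 (k ℕ.* k)) (cong (+ 27 *_) (pos-* k k))) (pos-* 54 k))))

  pow18 : ℕ → ℤ
  pow18 zero = + 1
  pow18 (suc k) = + 18 * pow18 k

  pow18-pos : ∀ k → pow18 k ≡ + (18 ℕ.^ k)
  pow18-pos zero = refl
  pow18-pos (suc k) = trans (cong (+ 18 *_) (pow18-pos k)) (sym (pos-* 18 (18 ℕ.^ k)))

  -- At x = δ/b with b = `b[ N ]` = 9N - 27√-3 one has b + 9δ = 9N + 27√-3. Thus 1 + 9x is the
  -- quotient of two conjugates, and `F` specialises to a cube root of it.
  δ : E
  δ = mk (+ 0) (+ 6)

  b[_] : ℤ → E
  b[ N ] = mk (+ 9 * N) (- + 27)

  private
    scalar : ∀ c u v → int c ⊗ mk u v ≡ mk (c * u) (c * v)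
    scalar c u v = cong₂ mk (solve (c ∷ u ∷ v ∷ [])) (solve (c ∷ u ∷ v ∷ []))

    b-δ : ∀ N c P u v → int c ⊗ (int (+ 2) ⊗ (b[ N ] ⊗ (int P ⊗ mk u v)) ⊕ int (+ 9) ⊗ (δ ⊗ (int P ⊗ mk u v)))
      ≡ mk (c * P * (+ 18 * N * u)) (c * P * (+ 18 * N * v))
    b-δ N c P u v = trans (cong (λ t → int c ⊗ (int (+ 2) ⊗ (b[ N ] ⊗ t) ⊕ int (+ 9) ⊗ (δ ⊗ t))) (scalar P u v))
        (trans (cong (int c ⊗_) (cong₂ mk (re N (P * u) (P * v)) (im N (P * u) (P * v)))) (trans (scalar c _ _) (cong₂ mk (swap c N P u) (swap c N P v))))
      where
      re : ∀ N x y → + 2 * (+ 9 * N * x + - + 3 * (- + 27 * y)) + - + 3 * (+ 0 * (+ 9 * N * y + - + 27 * x))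
        + (+ 9 * (+ 0 * x + - + 3 * (+ 6 * y)) + - + 3 * (+ 0 * (+ 0 * y + + 6 * x))) ≡ + 18 * N * x
      re N x y = solve (N ∷ x ∷ y ∷ [])
      im : ∀ N x y → + 2 * (+ 9 * N * y + - + 27 * x) + + 0 * (+ 9 * N * x + - + 3 * (- + 27 * y))
        + (+ 9 * (+ 0 * y + + 6 * x) + + 0 * (+ 0 * x + - + 3 * (+ 6 * y))) ≡ + 18 * N * y
      im N x y = solve (N ∷ x ∷ y ∷ [])
      swap : ∀ c N P u → c * (+ 18 * N * (P * u)) ≡ c * P * (+ 18 * N * u)
      swap c N P u = solve (c ∷ N ∷ P ∷ u ∷ [])

    δ-δ : ∀ c P u v → int c ⊗ (δ ⊗ (δ ⊗ (int P ⊗ mk u v))) ≡ mk (c * P * (- + 108 * u)) (c * P * (- + 108 * v))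
    δ-δ c P u v = trans (cong (λ t → int c ⊗ (δ ⊗ (δ ⊗ t))) (scalar P u v))
        (trans (cong (int c ⊗_) (cong₂ mk (re (P * u) (P * v)) (im (P * u) (P * v)))) (trans (scalar c _ _) (cong₂ mk (swap c P u) (swap c P v))))
      where
      re : ∀ x y → + 0 * (+ 0 * x + - + 3 * (+ 6 * y)) + - + 3 * (+ 6 * (+ 0 * y + + 6 * x)) ≡ - + 108 * x
      re x y = solve (x ∷ y ∷ [])
      im : ∀ x y → + 0 * (+ 0 * y + + 6 * x) + + 6 * (+ 0 * x + - + 3 * (+ 6 * y)) ≡ - + 108 * y
      im x y = solve (x ∷ y ∷ [])
      swap : ∀ c P u → c * (- + 108 * (P * u)) ≡ c * P * (- + 108 * u)
      swap c P u = solve (c ∷ P ∷ u ∷ [])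

    -- Since 2b + 9δ = 18N and δ² = -108 are rational integers, the recurrence acts separately on
    -- the two coordinates. The sign `σ` serves to treat a value and its conjugate together.
    step : ∀ k N P σ a₁ b₁ a₀ b₀ →
      int (+ 2 * k + + 3) ⊗ (int (+ 2) ⊗ (b[ N ] ⊗ (int (+ 18 * P) ⊗ mk a₁ (σ * b₁))) ⊕ int (+ 9) ⊗ (δ ⊗ (int (+ 18 * P) ⊗ mk a₁ (σ * b₁))))
        ⊕ int (+ 9 * (+ 1 - + 9 * ((+ 1 + k) * (+ 1 + k)))) ⊗ (δ ⊗ (δ ⊗ (int P ⊗ mk a₀ (σ * b₀))))
      ≡ int (+ 18 * (+ 18 * P)) ⊗ mk ((+ 2 * k + + 3) * N * a₁ + (+ 27 * (k * k) + + 54 * k + + 24) * a₀)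
                                     (σ * ((+ 2 * k + + 3) * N * b₁ + (+ 27 * (k * k) + + 54 * k + + 24) * b₀))
    step k N P σ a₁ b₁ a₀ b₀ =
      trans (cong₂ _⊕_ (b-δ N (+ 2 * k + + 3) (+ 18 * P) a₁ (σ * b₁)) (δ-δ (+ 9 * (+ 1 - + 9 * ((+ 1 + k) * (+ 1 + k)))) P a₀ (σ * b₀)))
        (trans (cong₂ mk (re k N P a₁ a₀) (im k N P σ b₁ b₀)) (sym (scalar (+ 18 * (+ 18 * P)) _ _)))
      where
      re : ∀ k N P a₁ a₀ → (+ 2 * k + + 3) * (+ 18 * P) * (+ 18 * N * a₁) + + 9 * (+ 1 - + 9 * ((+ 1 + k) * (+ 1 + k))) * P * (- + 108 * a₀)
        ≡ + 18 * (+ 18 * P) * ((+ 2 * k + + 3) * N * a₁ + (+ 27 * (k * k) + + 54 * k + + 24) * a₀)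
      re k N P a₁ a₀ = solve (k ∷ N ∷ P ∷ a₁ ∷ a₀ ∷ [])
      im : ∀ k N P σ b₁ b₀ → (+ 2 * k + + 3) * (+ 18 * P) * (+ 18 * N * (σ * b₁)) + + 9 * (+ 1 - + 9 * ((+ 1 + k) * (+ 1 + k))) * P * (- + 108 * (σ * b₀))
        ≡ + 18 * (+ 18 * P) * (σ * ((+ 2 * k + + 3) * N * b₁ + (+ 27 * (k * k) + + 54 * k + + 24) * b₀))
      im k N P σ b₁ b₀ = solve (k ∷ N ∷ P ∷ σ ∷ b₁ ∷ b₀ ∷ [])

    E-cube : ∀ a b → mk a b ⊗ (mk a b ⊗ mk a b) ≡ mk (a * a * a - + 9 * a * b * b) (+ 3 * a * a * b - + 3 * b * b * b)
    E-cube a b = cong₂ mk (solve (a ∷ b ∷ [])) (solve (a ∷ b ∷ []))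

    b-difference : ∀ N C D C' D' → 1E ⊗ (b[ N ] ⊗ mk C D) ⊕ int (- + 1) ⊗ ((1E ⊗ (b[ N ] ⊗ 1E) ⊕ δ ⊗ int (+ 9)) ⊗ mk C' D')
      ≡ mk (+ 9 * N * (C - C') + + 81 * (D + D')) (+ 9 * N * (D - D') - + 27 * (C + C'))
    b-difference N C D C' D' = trans (cong (λ t → 1E ⊗ (b[ N ] ⊗ mk C D) ⊕ int (- + 1) ⊗ (t ⊗ mk C' D')) (cong₂ mk (re N) (im N)))
        (cong₂ mk (solve (N ∷ C ∷ D ∷ C' ∷ D' ∷ [])) (solve (N ∷ C ∷ D ∷ C' ∷ D' ∷ [])))
      where
      re : ∀ N → + 1 * (+ 9 * N * + 1 + - + 3 * (- + 27 * + 0)) + - + 3 * (+ 0 * (+ 9 * N * + 0 + - + 27 * + 1)) + (+ 0 * + 9 + - + 3 * (+ 6 * + 0)) ≡ + 9 * N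
      re N = solve (N ∷ [])
      im : ∀ N → + 1 * (+ 9 * N * + 0 + - + 27 * + 1) + + 0 * (+ 9 * N * + 1 + - + 3 * (- + 27 * + 0)) + (+ 0 * + 0 + + 6 * + 9) ≡ + 27
      im N = solve (N ∷ [])

    -- The left side is β Z³ minus its conjugate, where β = `b[ N ]` and Z = a + b√-3. It is
    -- therefore purely imaginary, and the cubic form `g` appears as its imaginary part.
    combine₁ : ∀ N a b →
      1E ⊗ (b[ N ] ⊗ (mk a (+ 1 * b) ⊗ (mk a (+ 1 * b) ⊗ mk a (+ 1 * b))))
        ⊕ int (- + 1) ⊗ ((1E ⊗ (b[ N ] ⊗ 1E) ⊕ δ ⊗ int (+ 9))
          ⊗ (mk a (- + 1 * b) ⊗ (mk a (- + 1 * b) ⊗ mk a (- + 1 * b))))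
      ≡ mk (+ 0) (- + 54 * (a * a * a - N * a * a * b - + 9 * a * b * b + N * b * b * b))
    combine₁ N a b = trans (cong₂ (λ s t → 1E ⊗ (b[ N ] ⊗ s) ⊕ int (- + 1) ⊗ ((1E ⊗ (b[ N ] ⊗ 1E) ⊕ δ ⊗ int (+ 9)) ⊗ t)) (E-cube a (+ 1 * b)) (E-cube a (- + 1 * b)))
      (trans (b-difference N _ _ _ _) (cong₂ mk (re N a b) (im N a b)))
      where
      re : ∀ N a b → + 9 * N * (a * a * a - + 9 * a * (+ 1 * b) * (+ 1 * b) - (a * a * a - + 9 * a * (- + 1 * b) * (- + 1 * b)))
        + + 81 * (+ 3 * a * a * (+ 1 * b) - + 3 * (+ 1 * b) * (+ 1 * b) * (+ 1 * b) + (+ 3 * a * a * (- + 1 * b) - + 3 * (- + 1 * b) * (- + 1 * b) * (- + 1 * b))) ≡ + 0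
      re N a b = solve (N ∷ a ∷ b ∷ [])
      im : ∀ N a b → + 9 * N * (+ 3 * a * a * (+ 1 * b) - + 3 * (+ 1 * b) * (+ 1 * b) * (+ 1 * b) - (+ 3 * a * a * (- + 1 * b) - + 3 * (- + 1 * b) * (- + 1 * b) * (- + 1 * b)))
        - + 27 * (a * a * a - + 9 * a * (+ 1 * b) * (+ 1 * b) + (a * a * a - + 9 * a * (- + 1 * b) * (- + 1 * b)))
        ≡ - + 54 * (a * a * a - N * a * a * b - + 9 * a * b * b + N * b * b * b)
      im N a b = solve (N ∷ a ∷ b ∷ [])

    combine : ∀ N P a b →
      1E ⊗ (b[ N ] ⊗ ((int P ⊗ mk a (+ 1 * b)) ⊗ ((int P ⊗ mk a (+ 1 * b)) ⊗ (int P ⊗ mk a (+ 1 * b)))))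
        ⊕ int (- + 1) ⊗ ((1E ⊗ (b[ N ] ⊗ 1E) ⊕ δ ⊗ int (+ 9))
          ⊗ ((int P ⊗ mk a (- + 1 * b)) ⊗ ((int P ⊗ mk a (- + 1 * b)) ⊗ (int P ⊗ mk a (- + 1 * b)))))
      ≡ mk (+ 0) (- + 54 * ((P * P * P) * g N a b))
    combine N P a b = begin
      _ ≡⟨ lem (int P) (mk a (+ 1 * b)) (mk a (- + 1 * b)) b[ N ] (1E ⊗ (b[ N ] ⊗ 1E) ⊕ δ ⊗ int (+ 9)) (int (- + 1)) ⟩
      _ ≡⟨ cong (λ t → int P ⊗ (int P ⊗ (int P ⊗ t))) (combine₁ N a b) ⟩
      _ ≡⟨ lem₂ P (g N a b) ⟩
      _ ∎
      where
      open ≡-Reasoning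
      lem : ∀ p x y b c m → 1E ⊗ (b ⊗ ((p ⊗ x) ⊗ ((p ⊗ x) ⊗ (p ⊗ x)))) ⊕ m ⊗ (c ⊗ ((p ⊗ y) ⊗ ((p ⊗ y) ⊗ (p ⊗ y))))
            ≡ p ⊗ (p ⊗ (p ⊗ (1E ⊗ (b ⊗ (x ⊗ (x ⊗ x))) ⊕ m ⊗ (c ⊗ (y ⊗ (y ⊗ y))))))
      lem p x y b c m = Solver.solve (p ∷ x ∷ y ∷ b ∷ c ∷ m ∷ []) E-ring
      lem₂ : ∀ P g → int P ⊗ (int P ⊗ (int P ⊗ mk (+ 0) (- + 54 * g))) ≡ mk (+ 0) (- + 54 * ((P * P * P) * g))
      lem₂ P g = cong₂ mk (solve (P ∷ g ∷ [])) (solve (P ∷ g ∷ []))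

    split-E : ∀ p a b x e → int p ⊗ mk a (+ 1 * b) ≡ int x ⊗ e → ∃[ P ] ∃[ Q ] (p * a ≡ x * P × p * b ≡ x * Q)
    split-E p a b x (mk P Q) eq =
      P , Q , trans (sym (re₁ p a b)) (trans (cong E.re eq) (re₂ x P Q))
            , trans (sym (im₁ p a b)) (trans (cong E.im eq) (im₂ x P Q))
      where
      re₁ : ∀ p a b → p * a + - + 3 * (+ 0 * (+ 1 * b)) ≡ p * a
      re₁ p a b = solve (p ∷ a ∷ b ∷ [])
      im₁ : ∀ p a b → p * (+ 1 * b) + + 0 * a ≡ p * b
      im₁ p a b = solve (p ∷ a ∷ b ∷ [])
      re₂ : ∀ p a b → p * a + - + 3 * (+ 0 * b) ≡ p * a
      re₂ p a b = solve (p ∷ a ∷ b ∷ [])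
      im₂ : ∀ p a b → p * b + + 0 * a ≡ p * b
      im₂ p a b = solve (p ∷ a ∷ b ∷ [])

  module _ (N : ℕ) where
    open Evaluation δ b[ + N ]
    open ≡-Reasoning

    ev-h : ∀ c σ → + 2 * + 1 + c * + 0 ≡ + 2 →
           (int (+ 2) ⊗ (b[ + N ] ⊗ 1E) ⊕ δ ⊗ int (+ 2 * + 0 + c * + 1) ≡ int (+ 18 * + 1) ⊗ mk (+ N) (σ * + 1)) →
           ∀ k → ev k (h c k) ≡ int (pow18 k) ⊗ mk (+ A N k) (σ * + B N k)
    ev-h c σ c0 c1 zero = cong₂ mk (lem₁ σ) (lem₂ σ)
      where
      lem₁ : ∀ σ → + 1 ≡ + 1 * + 1 + - + 3 * (+ 0 * (σ * + 0))
      lem₁ σ = solve (σ ∷ [])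
      lem₂ : ∀ σ → + 0 ≡ + 1 * (σ * + 0) + + 0 * + 1
      lem₂ σ = solve (σ ∷ [])
    ev-h c σ c0 c1 (suc zero) = trans (cong (λ t → int t ⊗ (b[ + N ] ⊗ 1E) ⊕ δ ⊗ int (+ 2 * + 0 + c * + 1)) c0) c1
    ev-h c σ c0 c1 (suc (suc k)) = begin
      ev (2 ℕ.+ k) (recurrence k f₁ f₀)
        ≡⟨ ev-lin (2 ℕ.+ k) u v (λ i → + 2 * f₁ i + + 9 * sh f₁ i) (sh (sh f₀)) ⟩
      int u ⊗ ev (2 ℕ.+ k) (λ i → + 2 * f₁ i + + 9 * sh f₁ i) ⊕ int v ⊗ ev (2 ℕ.+ k) (sh (sh f₀))
        ≡⟨ cong₂ (λ s t → int u ⊗ s ⊕ int v ⊗ t)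
             (trans (ev-lin (2 ℕ.+ k) (+ 2) (+ 9) f₁ (sh f₁))
               (cong₂ (λ s t → int (+ 2) ⊗ s ⊕ int (+ 9) ⊗ t) (ev-pad (suc k) f₁ (h-degree c (suc k))) (ev-sh (suc k) f₁)))
             (trans (ev-sh (suc k) (sh f₀)) (cong (δ ⊗_) (ev-sh k f₀))) ⟩
      int u ⊗ (int (+ 2) ⊗ (b[ + N ] ⊗ ev (suc k) f₁) ⊕ int (+ 9) ⊗ (δ ⊗ ev (suc k) f₁)) ⊕ int v ⊗ (δ ⊗ (δ ⊗ ev k f₀))
        ≡⟨ cong₂ (λ s t → int u ⊗ (int (+ 2) ⊗ (b[ + N ] ⊗ s) ⊕ int (+ 9) ⊗ (δ ⊗ s)) ⊕ int v ⊗ (δ ⊗ (δ ⊗ t)))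
             (ev-h c σ c0 c1 (suc k)) (ev-h c σ c0 c1 k) ⟩
      _ ≡⟨ step (+ k) (+ N) (pow18 k) σ (+ A N (suc k)) (+ B N (suc k)) (+ A N k) (+ B N k) ⟩
      _ ≡⟨ cong₂ (λ s t → int (pow18 (2 ℕ.+ k)) ⊗ mk s (σ * t)) (conv-ℤ N 1 N k) (conv-ℤ N 0 1 k) ⟨
      int (pow18 (2 ℕ.+ k)) ⊗ mk (+ A N (2 ℕ.+ k)) (σ * + B N (2 ℕ.+ k)) ∎
      where
      f₁ = h c (suc k)
      f₀ = h c k
      u = + 2 * + k + + 3
      v = + 9 * (+ 1 - + 9 * ((+ 1 + + k) * (+ 1 + + k)))

    ev-h₊ : ∀ k → ev k (h (+ 12) k) ≡ int (pow18 k) ⊗ mk (+ A N k) (+ 1 * + B N k)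
    ev-h₊ = ev-h (+ 12) (+ 1) refl (lem (+ N))
      where
      lem : ∀ N → int (+ 2) ⊗ (b[ N ] ⊗ 1E) ⊕ δ ⊗ int (+ 12) ≡ int (+ 18 * + 1) ⊗ mk N (+ 1 * + 1)
      lem N = cong₂ mk (solve (N ∷ [])) (solve (N ∷ []))

    -- The starting values 12 and 6 lead to 18N + 18√-3 and 18N - 18√-3, so numerator and
    -- denominator take conjugate values for every k.
    ev-h₋ : ∀ k → ev k (h (+ 6) k) ≡ int (pow18 k) ⊗ mk (+ A N k) (- + 1 * + B N k)
    ev-h₋ = ev-h (+ 6) (- + 1) refl (lem (+ N))
      where
      lem : ∀ N → int (+ 2) ⊗ (b[ N ] ⊗ 1E) ⊕ δ ⊗ int (+ 6) ≡ int (+ 18 * + 1) ⊗ mk N (- + 1 * + 1)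
      lem N = cong₂ mk (solve (N ∷ [])) (solve (N ∷ []))

    ev-Θ : ∀ k → ev (suc (k ℕ.+ (k ℕ.+ k))) (Θ k) ≡ mk (+ 0) (- + 54 * ((pow18 k * pow18 k * pow18 k) * g (+ N) (+ A N k) (+ B N k)))
    ev-Θ k = begin
      ev (suc d) (Θ k)
        ≡⟨ ev-cong-upto (suc d) (λ i _ → lem (cube h₊ i) ((one+9x ⊛ cube h₋) i)) ⟩
      ev (suc d) (λ i → + 1 * cube h₊ i + - + 1 * (one+9x ⊛ cube h₋) i)
        ≡⟨ ev-lin (suc d) (+ 1) (- + 1) (cube h₊) (one+9x ⊛ cube h₋) ⟩
      1E ⊗ ev (suc d) (cube h₊) ⊕ int (- + 1) ⊗ ev (suc d) (one+9x ⊛ cube h₋)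
        ≡⟨ cong₂ (λ s t → 1E ⊗ s ⊕ int (- + 1) ⊗ t)
             (trans (ev-pad d (cube h₊) (cube-degree (+ 12))) (cong (b[ + N ] ⊗_) (ev-cube (+ 12))))
             (trans (ev-⊛ 1 d one+9x (cube h₋) one+9x-degree (cube-degree (+ 6))) (cong (ev 1 one+9x ⊗_) (ev-cube (+ 6)))) ⟩
      1E ⊗ (b[ + N ] ⊗ (X ⊗ (X ⊗ X))) ⊕ int (- + 1) ⊗ (ev 1 one+9x ⊗ (Y ⊗ (Y ⊗ Y)))
        ≡⟨ cong₂ (λ X Y → 1E ⊗ (b[ + N ] ⊗ (X ⊗ (X ⊗ X))) ⊕ int (- + 1) ⊗ (ev 1 one+9x ⊗ (Y ⊗ (Y ⊗ Y)))) (ev-h₊ k) (ev-h₋ k) ⟩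
      _ ≡⟨ combine (+ N) (pow18 k) (+ A N k) (+ B N k) ⟩
      mk (+ 0) (- + 54 * ((pow18 k * pow18 k * pow18 k) * g (+ N) (+ A N k) (+ B N k))) ∎
      where
      d = k ℕ.+ (k ℕ.+ k)
      h₊ = h (+ 12) k
      h₋ = h (+ 6) k
      X = ev k h₊
      Y = ev k h₋
      lem : ∀ x y → x - y ≡ + 1 * x + - + 1 * y
      lem x y = solve (x ∷ y ∷ [])
      one+9x-degree : Degree 1 one+9x
      one+9x-degree (suc (suc i)) _ = refl
      one+9x-degree (suc zero) (s≤s ())
      cube-degree : ∀ c → Degree d (cube (h c k))
      cube-degree c = ⊛-degree k (k ℕ.+ k) (h c k) _ (h-degree c k) (⊛-degree k k (h c k) (h c k) (h-degree c k) (h-degree c k))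
      ev-cube : ∀ c → ev d (cube (h c k)) ≡ ev k (h c k) ⊗ (ev k (h c k) ⊗ ev k (h c k))
      ev-cube c = trans (ev-⊛ k (k ℕ.+ k) (h c k) _ (h-degree c k) (⊛-degree k k (h c k) (h c k) (h-degree c k) (h-degree c k)))
        (cong (ev k (h c k) ⊗_) (ev-⊛ k k (h c k) (h c k) (h-degree c k) (h-degree c k)))

    -- Divisibility by k! is known for the coefficients of the numerator polynomial; `A` and `B` are
    -- both read off as coordinates of its single value in ℤ[√-3].
    divide-factorial : ∀ k → ∃[ P ] ∃[ Q ] (pow18 k * + A N k ≡ + (k !) * P × pow18 k * + B N k ≡ + (k !) * Q)
    divide-factorial k = split-E (pow18 k) (+ A N k) (+ B N k) (+ (k !)) (ev k c)
      (trans (sym (ev-h₊ k)) (trans (ev-cong-upto k c-eq) (ev-scale k (+ (k !)) c)))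
      where
      c : Ser
      c i with i ℕ.≤? k
      ... | yes p = proj₁ (factorial-∣-h k i p)
      -- An arbitrary value: `ev k` reads only the coefficients up to k.
      ... | no _ = + 0
      c-eq : ∀ i → i ℕ.≤ k → h (+ 12) k i ≡ + (k !) * c i
      c-eq i q with i ℕ.≤? k
      ... | yes p = proj₂ (factorial-∣-h k i p)
      ... | no ¬p = contradiction q ¬p

-- The size of the form g at the approximants.

module Remainder where
  open import Data.Nat as ℕ using (ℕ; zero; suc; z≤n; s≤s; _!)
  import Data.Nat.Properties as ℕₚ
  open import Data.Integer hiding (suc; _⊖_)
  open import Data.Integer.Properties
  open import Data.Product using (_,_)
  open Naturals
  open Integers
  open import Relation.Binary.PropositionalEquality
  open Series
  open CubeRoot using (one+9x; one+9x-⊛)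
  open Pade
  open Eisenstein
  open Approximants

  ∣sh∣≤ : ∀ f M → (∀ i → ∣ f i ∣ ℕ.≤ M) → ∀ i → ∣ sh f i ∣ ℕ.≤ M
  ∣sh∣≤ f M p zero = z≤n
  ∣sh∣≤ f M p (suc i) = p i

  private
    coefficient-identity : ∀ k → + 9 * (+ 1 - + 9 * ((+ 1 + k) * (+ 1 + k))) ≡ - (+ 9 * (+ 9 * (k * k) + + 18 * k + + 8))
    coefficient-identity k = solve (k ∷ [])

    growth-identity : ∀ k F T → (2 ℕ.* k ℕ.+ 3) ℕ.* (2 ℕ.* ((1 ℕ.+ k) ℕ.* F ℕ.* (27 ℕ.* T)) ℕ.+ 9 ℕ.* ((1 ℕ.+ k) ℕ.* F ℕ.* (27 ℕ.* T)))
        ℕ.+ (9 ℕ.* (9 ℕ.* (k ℕ.* k) ℕ.+ 18 ℕ.* k ℕ.+ 8)) ℕ.* (F ℕ.* T) ℕ.+ (54 ℕ.* (k ℕ.* k) ℕ.+ 540 ℕ.* k ℕ.+ 495) ℕ.* (F ℕ.* T)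
      ≡ (2 ℕ.+ k) ℕ.* ((1 ℕ.+ k) ℕ.* F) ℕ.* (27 ℕ.* (27 ℕ.* T))
    growth-identity k F T = solveℕ (k ∷ F ∷ T ∷ [])

  private
    size : ℕ → ℕ
    size k = (k !) ℕ.* 27 ℕ.^ k

    coefficient : ∀ k → ∣ + 9 * (+ 1 - + 9 * ((+ 1 + + k) * (+ 1 + + k))) ∣ ≡ 9 ℕ.* (9 ℕ.* (k ℕ.* k) ℕ.+ 18 ℕ.* k ℕ.+ 8)
    coefficient k = trans (cong ∣_∣ (coefficient-identity (+ k))) (trans (∣-i∣≡∣i∣ (+ 9 * c))
      (trans (abs-* (+ 9) c) (cong (9 ℕ.*_) (cong ∣_∣ (cong₂ (λ s t → s + t + + 8)
        (trans (cong (+ 9 *_) (sym (pos-* k k))) (sym (pos-* 9 (k ℕ.* k)))) (sym (pos-* 18 k)))))))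
      where
      c = + 9 * (+ k * + k) + + 18 * + k + + 8

    linear : ∀ k → ∣ + 2 * + k + + 3 ∣ ≡ 2 ℕ.* k ℕ.+ 3
    linear k = cong (λ t → ∣ t + + 3 ∣) (sym (pos-* 2 k))

    growth : ∀ k F T → (2 ℕ.* k ℕ.+ 3) ℕ.* (2 ℕ.* (suc k ℕ.* F ℕ.* (27 ℕ.* T)) ℕ.+ 9 ℕ.* (suc k ℕ.* F ℕ.* (27 ℕ.* T)))
        ℕ.+ (9 ℕ.* (9 ℕ.* (k ℕ.* k) ℕ.+ 18 ℕ.* k ℕ.+ 8)) ℕ.* (F ℕ.* T)
      ℕ.≤ suc (suc k) ℕ.* (suc k ℕ.* F) ℕ.* (27 ℕ.* (27 ℕ.* T))
    growth k F T = ℕₚ.≤-trans (ℕₚ.m≤m+n _ ((54 ℕ.* (k ℕ.* k) ℕ.+ 540 ℕ.* k ℕ.+ 495) ℕ.* (F ℕ.* T))) (ℕₚ.≤-reflexive (growth-identity k F T))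

  h-bound-step : ∀ c k → (∀ i → ∣ h c (suc k) i ∣ ℕ.≤ size (suc k)) → (∀ i → ∣ h c k i ∣ ℕ.≤ size k) →
                 ∀ i → ∣ h c (suc (suc k)) i ∣ ℕ.≤ size (suc (suc k))
  h-bound-step c k ih₁ ih₀ i = begin
    ∣ u * (+ 2 * f₁ i + + 9 * sh f₁ i) + v * sh (sh f₀) i ∣
      ≤⟨ ∣i+j∣≤∣i∣+∣j∣ (u * (+ 2 * f₁ i + + 9 * sh f₁ i)) (v * sh (sh f₀) i) ⟩
    ∣ u * (+ 2 * f₁ i + + 9 * sh f₁ i) ∣ ℕ.+ ∣ v * sh (sh f₀) i ∣
      ≡⟨ cong₂ ℕ._+_ (trans (abs-* u (+ 2 * f₁ i + + 9 * sh f₁ i)) (cong (ℕ._* ∣ + 2 * f₁ i + + 9 * sh f₁ i ∣) (linear k)))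
           (trans (abs-* v (sh (sh f₀) i)) (cong (ℕ._* ∣ sh (sh f₀) i ∣) (coefficient k))) ⟩
    (2 ℕ.* k ℕ.+ 3) ℕ.* ∣ + 2 * f₁ i + + 9 * sh f₁ i ∣ ℕ.+ w ℕ.* ∣ sh (sh f₀) i ∣
      ≤⟨ ℕₚ.+-mono-≤ (ℕₚ.*-monoʳ-≤ (2 ℕ.* k ℕ.+ 3) (ℕₚ.≤-trans (∣i+j∣≤∣i∣+∣j∣ (+ 2 * f₁ i) (+ 9 * sh f₁ i))
           (ℕₚ.+-mono-≤ (scaled 2 (f₁ i) (ih₁ i)) (scaled 9 (sh f₁ i) (∣sh∣≤ f₁ _ ih₁ i)))))
           (ℕₚ.*-monoʳ-≤ w (∣sh∣≤ (sh f₀) _ (∣sh∣≤ f₀ _ ih₀) i)) ⟩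
    (2 ℕ.* k ℕ.+ 3) ℕ.* (2 ℕ.* size (suc k) ℕ.+ 9 ℕ.* size (suc k)) ℕ.+ w ℕ.* size k
      ≤⟨ growth k (k !) (27 ℕ.^ k) ⟩
    size (suc (suc k)) ∎
    where
    open ℕₚ.≤-Reasoning
    f₁ = h c (suc k)
    f₀ = h c k
    u = + 2 * + k + + 3
    v = + 9 * (+ 1 - + 9 * ((+ 1 + + k) * (+ 1 + + k)))
    w = 9 ℕ.* (9 ℕ.* (k ℕ.* k) ℕ.+ 18 ℕ.* k ℕ.+ 8)
    scaled : ∀ m z {M} → ∣ z ∣ ℕ.≤ M → ∣ + m * z ∣ ℕ.≤ m ℕ.* M
    scaled m z q = ℕₚ.≤-trans (ℕₚ.≤-reflexive (abs-* (+ m) z)) (ℕₚ.*-monoʳ-≤ m q)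

  -- The recurrence has leading terms 2k · 11 and 81k², and the induction closes because 22 · 27 +
  -- 81 = 675 ≤ 27².
  h-bound : ∀ c → ∣ c ∣ ℕ.≤ 12 → ∀ k i → ∣ h c k i ∣ ℕ.≤ (k !) ℕ.* 27 ℕ.^ k
  h-bound c p zero zero = ℕₚ.≤-refl
  h-bound c p zero (suc i) = z≤n
  h-bound c p (suc zero) zero = ℕₚ.≤-trans (ℕₚ.≤-reflexive (cong (λ t → ∣ + 2 + t ∣) (*-zeroʳ c))) (s≤s (s≤s z≤n))
  h-bound c p (suc zero) (suc zero) = ℕₚ.≤-trans (ℕₚ.≤-reflexive (cong ∣_∣ (trans (+-identityˡ (c * + 1)) (*-identityʳ c))))
    (ℕₚ.≤-trans p (ℕₚ.m≤m+n 12 15))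
  h-bound c p (suc zero) (suc (suc i)) = ℕₚ.≤-trans (ℕₚ.≤-reflexive (cong ∣_∣ (trans (+-identityˡ (c * + 0)) (*-zeroʳ c)))) z≤n
  h-bound c p (suc (suc k)) = h-bound-step c k (h-bound c p (suc k)) (h-bound c p k)

  ⊛-bound : ∀ f g M M' n → (∀ i → i ℕ.≤ n → ∣ f i ∣ ℕ.≤ M) → (∀ i → i ℕ.≤ n → ∣ g i ∣ ℕ.≤ M') →
            ∣ (f ⊛ g) n ∣ ℕ.≤ suc n ℕ.* (M ℕ.* M')
  ⊛-bound f g M M' zero p q = begin
    ∣ (f ⊛ g) 0 ∣            ≡⟨ trans (cong ∣_∣ (⊛-zero f g)) (abs-* (f 0) (g 0)) ⟩
    ∣ f 0 ∣ ℕ.* ∣ g 0 ∣      ≤⟨ ℕₚ.*-mono-≤ (p 0 z≤n) (q 0 z≤n) ⟩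
    M ℕ.* M'                ≡⟨ ℕₚ.*-identityˡ _ ⟨
    1 ℕ.* (M ℕ.* M')        ∎
    where open ℕₚ.≤-Reasoning
  ⊛-bound f g M M' (suc n) p q = begin
    ∣ (f ⊛ g) (suc n) ∣                       ≡⟨ cong ∣_∣ (⊛-suc f g n) ⟩
    ∣ f 0 * g (suc n) + (tl f ⊛ g) n ∣         ≤⟨ ∣i+j∣≤∣i∣+∣j∣ (f 0 * g (suc n)) ((tl f ⊛ g) n) ⟩
    ∣ f 0 * g (suc n) ∣ ℕ.+ ∣ (tl f ⊛ g) n ∣   ≡⟨ cong (ℕ._+ ∣ (tl f ⊛ g) n ∣) (abs-* (f 0) (g (suc n))) ⟩
    ∣ f 0 ∣ ℕ.* ∣ g (suc n) ∣ ℕ.+ ∣ (tl f ⊛ g) n ∣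
      ≤⟨ ℕₚ.+-mono-≤ (ℕₚ.*-mono-≤ (p 0 z≤n) (q (suc n) ℕₚ.≤-refl))
           (⊛-bound (tl f) g M M' n (λ i h → p (suc i) (s≤s h)) (λ i h → q i (ℕₚ.m≤n⇒m≤1+n h))) ⟩
    M ℕ.* M' ℕ.+ suc n ℕ.* (M ℕ.* M') ∎
    where open ℕₚ.≤-Reasoning

  private
    cubeSize : ℕ → ℕ → ℕ
    cubeSize n M = suc n ℕ.* (M ℕ.* (suc n ℕ.* (M ℕ.* M)))

  cube-bound : ∀ f M n → (∀ i → ∣ f i ∣ ℕ.≤ M) → ∀ i → i ℕ.≤ n → ∣ cube f i ∣ ℕ.≤ cubeSize n M
  cube-bound f M n p i i≤n = ℕₚ.≤-trans
    (⊛-bound f (f ⊛ f) M (suc n ℕ.* (M ℕ.* M)) i (λ j _ → p j)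
      (λ j j≤i → ℕₚ.≤-trans (⊛-bound f f M M j (λ l _ → p l) (λ l _ → p l))
        (ℕₚ.*-monoˡ-≤ (M ℕ.* M) (s≤s (ℕₚ.≤-trans j≤i i≤n)))))
    (ℕₚ.*-monoˡ-≤ _ (s≤s i≤n))

  Θ-bound : ∀ k n i → i ℕ.≤ n → ∣ Θ k i ∣ ℕ.≤ 11 ℕ.* cubeSize n ((k !) ℕ.* 27 ℕ.^ k)
  Θ-bound k n i i≤n = begin
    ∣ cube h₊ i - (one+9x ⊛ cube h₋) i ∣          ≤⟨ ∣i-j∣≤∣i∣+∣j∣ (cube h₊ i) ((one+9x ⊛ cube h₋) i) ⟩
    ∣ cube h₊ i ∣ ℕ.+ ∣ (one+9x ⊛ cube h₋) i ∣    ≡⟨ cong (λ t → ∣ cube h₊ i ∣ ℕ.+ ∣ t ∣) (one+9x-⊛ (cube h₋) i) ⟩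
    ∣ cube h₊ i ∣ ℕ.+ ∣ cube h₋ i + + 9 * sh (cube h₋) i ∣
      ≤⟨ ℕₚ.+-mono-≤ (b₊ i i≤n) (ℕₚ.≤-trans (∣i+j∣≤∣i∣+∣j∣ (cube h₋ i) (+ 9 * sh (cube h₋) i)) (ℕₚ.+-mono-≤ (b₋ i i≤n)
           (ℕₚ.≤-trans (ℕₚ.≤-reflexive (abs-* (+ 9) (sh (cube h₋) i))) (ℕₚ.*-monoʳ-≤ 9 (shb i i≤n))))) ⟩
    C ℕ.+ (C ℕ.+ 9 ℕ.* C)                         ≡⟨⟩
    11 ℕ.* C ∎
    where
    open ℕₚ.≤-Reasoning
    M = (k !) ℕ.* 27 ℕ.^ k
    h₊ = h (+ 12) k
    h₋ = h (+ 6) k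
    C = cubeSize n M
    b₊ = cube-bound h₊ M n (h-bound (+ 12) ℕₚ.≤-refl k)
    b₋ = cube-bound h₋ M n (h-bound (+ 6) (ℕₚ.m≤m+n 6 6) k)
    shb : ∀ i → i ℕ.≤ n → ∣ sh (cube h₋) i ∣ ℕ.≤ C
    shb zero _ = z≤n
    shb (suc i) q = b₋ i (ℕₚ.≤-trans (ℕₚ.n≤1+n i) q)

  opaque
    -- One factor for each source of a k-th power: 144 = 12² from the norm 12 of `δ`, taken 2k
    -- times; 2 for the number k + 1 of terms; 16 = 4² for the square of 3k + 2; 27³ for the cube of
    -- the coefficient bound; 63 for the norm of `b[ N ]`, which is at most 63N.
    Γ : ℕ
    Γ = 144 ℕ.* (2 ℕ.* (16 ℕ.* (19683 ℕ.* 63)))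

    Γ^ : ∀ k → Γ ℕ.^ k ≡ 144 ℕ.^ k ℕ.* (2 ℕ.^ k ℕ.* ((4 ℕ.^ k ℕ.* 4 ℕ.^ k) ℕ.* ((27 ℕ.^ k ℕ.* (27 ℕ.^ k ℕ.* 27 ℕ.^ k)) ℕ.* 63 ℕ.^ k)))
    Γ^ k = begin
      (144 ℕ.* (2 ℕ.* (16 ℕ.* (19683 ℕ.* 63)))) ℕ.^ k ≡⟨ ^-distribʳ-* k 144 _ ⟩
      144 ℕ.^ k ℕ.* (2 ℕ.* (16 ℕ.* (19683 ℕ.* 63))) ℕ.^ k ≡⟨ cong (144 ℕ.^ k ℕ.*_) (^-distribʳ-* k 2 _) ⟩
      144 ℕ.^ k ℕ.* (2 ℕ.^ k ℕ.* (16 ℕ.* (19683 ℕ.* 63)) ℕ.^ k)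
        ≡⟨ cong (λ t → 144 ℕ.^ k ℕ.* (2 ℕ.^ k ℕ.* t)) (trans (^-distribʳ-* k 16 _)
             (cong₂ ℕ._*_ (^-distribʳ-* k 4 4) (trans (^-distribʳ-* k 19683 63)
               (cong (ℕ._* 63 ℕ.^ k) (trans (^-distribʳ-* k 27 729) (cong (27 ℕ.^ k ℕ.*_) (^-distribʳ-* k 27 27))))))) ⟩
      _ ∎
      where open ≡-Reasoning

    2≤Γ : 2 ℕ.≤ Γ
    2≤Γ = ℕₚ.m≤m+n 2 (Γ ℕ.∸ 2)

  k+1≤2^k : ∀ k → suc k ℕ.≤ 2 ℕ.^ k
  k+1≤2^k zero = ℕₚ.≤-refl
  k+1≤2^k (suc k) = ℕₚ.≤-trans (s≤s (k+1≤2^k k))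
    (ℕₚ.≤-trans (ℕₚ.+-monoˡ-≤ (2 ℕ.^ k) (ℕₚ.≤-trans (s≤s z≤n) (k+1≤2^k k)))
      (ℕₚ.≤-reflexive (cong (2 ℕ.^ k ℕ.+_) (sym (ℕₚ.+-identityʳ _)))))

  private
    b≤-identity : ∀ N → 9 ℕ.* N ℕ.+ 54 ℕ.* N ≡ 63 ℕ.* N
    b≤-identity N = solveℕ (N ∷ [])

    3k+2≤2·4^k-identity : ∀ k → 2 ℕ.+ ((1 ℕ.+ k) ℕ.+ ((1 ℕ.+ k) ℕ.+ (1 ℕ.+ k))) ≡ 2 ℕ.+ (k ℕ.+ (k ℕ.+ k)) ℕ.+ 3
    3k+2≤2·4^k-identity k = solveℕ (k ∷ [])

    3k+2≤2·4^k-identity₂ : ∀ x → 2 ℕ.* x ℕ.+ 6 ℕ.* x ≡ 2 ℕ.* (4 ℕ.* x)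
    3k+2≤2·4^k-identity₂ x = solveℕ (x ∷ [])

    g-homogeneous-identity : ∀ N f a b → (f * a) * (f * a) * (f * a) - N * (f * a) * (f * a) * (f * b) - + 9 * (f * a) * (f * b) * (f * b) + N * (f * b) * (f * b) * (f * b)
        ≡ f * f * f * (a * a * a - N * a * a * b - + 9 * a * b * b + N * b * b * b)
    g-homogeneous-identity N f a b = solve (N ∷ f ∷ a ∷ b ∷ [])

    collect-identity : ∀ F a t q s x y → 12 ℕ.* a ℕ.* (t ℕ.* (11 ℕ.* ((2 ℕ.* q) ℕ.* ((F ℕ.* s) ℕ.* ((2 ℕ.* q) ℕ.* ((F ℕ.* s) ℕ.* (F ℕ.* s))))) ℕ.* (x ℕ.* y)))
          ≡ 528 ℕ.* ((F ℕ.* (F ℕ.* F)) ℕ.* ((a ℕ.* (t ℕ.* ((q ℕ.* q) ℕ.* ((s ℕ.* (s ℕ.* s)) ℕ.* x)))) ℕ.* y))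
    collect-identity F a t q s x y = solveℕ (F ∷ a ∷ t ∷ q ∷ s ∷ x ∷ y ∷ [])

  private
    3k+2≤2·4^k : ∀ k → suc (suc (k ℕ.+ (k ℕ.+ k))) ℕ.≤ 2 ℕ.* 4 ℕ.^ k
    3k+2≤2·4^k zero = ℕₚ.≤-refl
    3k+2≤2·4^k (suc k) = begin
      suc (suc (suc k ℕ.+ (suc k ℕ.+ suc k)))        ≡⟨ 3k+2≤2·4^k-identity k ⟩
      suc (suc (k ℕ.+ (k ℕ.+ k))) ℕ.+ 3              ≤⟨ ℕₚ.+-mono-≤ (3k+2≤2·4^k k) (ℕₚ.m≤m+n 3 3) ⟩
      2 ℕ.* 4 ℕ.^ k ℕ.+ 6 ℕ.* 1                      ≤⟨ ℕₚ.+-monoʳ-≤ (2 ℕ.* 4 ℕ.^ k) (ℕₚ.*-monoʳ-≤ 6 (ℕₚ.m^n>0 4 k)) ⟩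
      2 ℕ.* 4 ℕ.^ k ℕ.+ 6 ℕ.* 4 ℕ.^ k                ≡⟨ 3k+2≤2·4^k-identity₂ (4 ℕ.^ k) ⟩
      2 ℕ.* (4 ℕ.* 4 ℕ.^ k) ∎
      where
      open ℕₚ.≤-Reasoning

    g-homogeneous : ∀ N f a b → g N (f * a) (f * b) ≡ f * f * f * g N a b
    g-homogeneous N f a b = g-homogeneous-identity N f a b

    -- The value of `Θ k` has nominal degree 3k + 1, but 2k + 1 factors `δ` split off. Only a sum of
    -- degree k remains, so N enters to the power k instead of about 3k.
    raw-bound : ∀ N k → 1 ℕ.≤ N →
      2 ℕ.* (54 ℕ.* ∣ (pow18 k * pow18 k * pow18 k) * g (+ N) (+ A N k) (+ B N k) ∣)
        ℕ.≤ 12 ℕ.^ suc (k ℕ.+ k) ℕ.* (suc k ℕ.* (11 ℕ.* cubeSize (suc (k ℕ.+ (k ℕ.+ k))) ((k !) ℕ.* 27 ℕ.^ k) ℕ.* (63 ℕ.* N) ℕ.^ k))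
    raw-bound N k 1≤N = begin
      2 ℕ.* (54 ℕ.* ∣ Z ∣)                 ≡⟨ cong (2 ℕ.*_) (abs-* (- + 54) Z) ⟨
      ‖ mk (+ 0) (- + 54 * Z) ‖            ≡⟨ cong ‖_‖ (trans (sym (ev-Θ N k)) dropped) ⟩
      ‖ δ ↑ m ⊗ ev k tail ‖                ≤⟨ ‖⊗‖ (δ ↑ m) (ev k tail) ⟩
      ‖ δ ↑ m ‖ ℕ.* ‖ ev k tail ‖
        ≤⟨ ℕₚ.*-mono-≤ (‖↑‖ δ m) (‖ev‖ δ b[ + N ] k tail _ (63 ℕ.* N) δ≤ b≤
             (λ i i≤k → Θ-bound k (suc (k ℕ.+ (k ℕ.+ k))) (m ℕ.+ i) (ℕₚ.≤-trans (ℕₚ.+-monoʳ-≤ m i≤k) (ℕₚ.≤-reflexive (cong suc (ℕₚ.+-assoc k k k)))))) ⟩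
      _ ∎
      where
      open ℕₚ.≤-Reasoning
      open Evaluation δ b[ + N ]
      m = suc (k ℕ.+ k)
      Z = (pow18 k * pow18 k * pow18 k) * g (+ N) (+ A N k) (+ B N k)
      tail : Ser
      tail i = Θ k (m ℕ.+ i)
      dropped : ev (suc (k ℕ.+ (k ℕ.+ k))) (Θ k) ≡ δ ↑ m ⊗ ev k tail
      dropped = trans (cong (λ d → ev (suc d) (Θ k)) (sym (ℕₚ.+-assoc k k k)))
        (ev-drop m k (Θ k) (λ { i (s≤s q) → Θ-order k i q }))
      δ≤ : 12 ℕ.≤ 63 ℕ.* N
      δ≤ = ℕₚ.≤-trans (ℕₚ.m≤m+n 12 51) (ℕₚ.*-monoʳ-≤ 63 1≤N)
      b≤ : ∣ + 9 * + N ∣ ℕ.+ 2 ℕ.* 27 ℕ.≤ 63 ℕ.* N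
      b≤ = ℕₚ.≤-trans (ℕₚ.+-mono-≤ (ℕₚ.≤-reflexive (abs-* (+ 9) (+ N))) (ℕₚ.*-monoʳ-≤ 54 1≤N)) (ℕₚ.≤-reflexive (b≤-identity N))

    collect : ∀ N k → 12 ℕ.^ suc (k ℕ.+ k) ℕ.* (suc k ℕ.* (11 ℕ.* cubeSize (suc (k ℕ.+ (k ℕ.+ k))) ((k !) ℕ.* 27 ℕ.^ k) ℕ.* (63 ℕ.* N) ℕ.^ k))
              ℕ.≤ 528 ℕ.* ((k ! ℕ.* (k ! ℕ.* k !)) ℕ.* (Γ ℕ.^ k ℕ.* N ℕ.^ k))
    collect N k = begin
      12 ℕ.^ suc (k ℕ.+ k) ℕ.* (suc k ℕ.* (11 ℕ.* (suc n ℕ.* (M ℕ.* (suc n ℕ.* (M ℕ.* M)))) ℕ.* (63 ℕ.* N) ℕ.^ k))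
        ≤⟨ ℕₚ.*-monoʳ-≤ (12 ℕ.^ suc (k ℕ.+ k)) (ℕₚ.*-mono-≤ (k+1≤2^k k) (ℕₚ.*-monoˡ-≤ _ (ℕₚ.*-monoʳ-≤ 11
             (ℕₚ.*-mono-≤ (3k+2≤2·4^k k) (ℕₚ.*-monoʳ-≤ M (ℕₚ.*-monoˡ-≤ (M ℕ.* M) (3k+2≤2·4^k k))))))) ⟩
      12 ℕ.^ suc (k ℕ.+ k) ℕ.* (t ℕ.* (11 ℕ.* ((2 ℕ.* q) ℕ.* (M ℕ.* ((2 ℕ.* q) ℕ.* (M ℕ.* M)))) ℕ.* (63 ℕ.* N) ℕ.^ k))
        ≡⟨ cong₂ (λ u v → 12 ℕ.* u ℕ.* (t ℕ.* (11 ℕ.* ((2 ℕ.* q) ℕ.* (M ℕ.* ((2 ℕ.* q) ℕ.* (M ℕ.* M)))) ℕ.* v)))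
             (trans (ℕₚ.^-distribˡ-+-* 12 k k) (sym (^-distribʳ-* k 12 12))) (^-distribʳ-* k 63 N) ⟩
      12 ℕ.* a ℕ.* (t ℕ.* (11 ℕ.* ((2 ℕ.* q) ℕ.* (M ℕ.* ((2 ℕ.* q) ℕ.* (M ℕ.* M)))) ℕ.* (x ℕ.* y)))
        ≡⟨ collect-identity (k !) a t q s x y ⟩
      528 ℕ.* ((k ! ℕ.* (k ! ℕ.* k !)) ℕ.* ((a ℕ.* (t ℕ.* ((q ℕ.* q) ℕ.* ((s ℕ.* (s ℕ.* s)) ℕ.* x)))) ℕ.* y))
        ≡⟨ cong (λ u → 528 ℕ.* ((k ! ℕ.* (k ! ℕ.* k !)) ℕ.* (u ℕ.* y))) {Γ ℕ.^ k} {a ℕ.* (t ℕ.* ((q ℕ.* q) ℕ.* ((s ℕ.* (s ℕ.* s)) ℕ.* x)))} (Γ^ k) ⟨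
      _ ∎
      where
      open ℕₚ.≤-Reasoning
      n = suc (k ℕ.+ (k ℕ.+ k))
      a = 144 ℕ.^ k
      t = 2 ℕ.^ k
      q = 4 ℕ.^ k
      s = 27 ℕ.^ k
      x = 63 ℕ.^ k
      y = N ℕ.^ k
      M = (k !) ℕ.* s

  -- By homogeneity the division contributes k!³, exactly the factorials in the bound for the cubes
  -- of the coefficients. The constants are 528 = 12 · 11 · 2² and 108 = 2 · 54, with 528 ≤ 5 · 108.
  divided-bound : ∀ N k P Q → 1 ℕ.≤ N → pow18 k * + A N k ≡ + (k !) * P → pow18 k * + B N k ≡ + (k !) * Q →
                  ∣ g (+ N) P Q ∣ ℕ.≤ 5 ℕ.* (Γ ℕ.^ k ℕ.* N ℕ.^ k)
  divided-bound N k P Q 1≤N p q = small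
    where
    open ℕₚ.≤-Reasoning
    F = k !
    R = Γ ℕ.^ k ℕ.* N ℕ.^ k
    eq : (pow18 k * pow18 k * pow18 k) * g (+ N) (+ A N k) (+ B N k) ≡ + F * + F * + F * g (+ N) P Q
    eq = trans (sym (g-homogeneous (+ N) (pow18 k) (+ A N k) (+ B N k)))
           (trans (cong₂ (g (+ N)) p q) (g-homogeneous (+ N) (+ F) P Q))
    abs-eq : ∣ + F * + F * + F * g (+ N) P Q ∣ ≡ F ℕ.* (F ℕ.* F) ℕ.* ∣ g (+ N) P Q ∣
    abs-eq = trans (abs-* (+ F * + F * + F) (g (+ N) P Q)) (cong (ℕ._* ∣ g (+ N) P Q ∣)
      (trans (abs-* (+ F * + F) (+ F)) (trans (cong (ℕ._* F) (abs-* (+ F) (+ F))) (ℕₚ.*-assoc F F F))))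
    nz : ℕ.NonZero (F ℕ.* (F ℕ.* F))
    nz = ℕₚ.m*n≢0 F (F ℕ.* F) {{k ℕₚ.!≢0}} {{ℕₚ.m*n≢0 F F {{k ℕₚ.!≢0}} {{k ℕₚ.!≢0}}}}
    lem : ∀ f x → f ℕ.* (108 ℕ.* x) ≡ 2 ℕ.* (54 ℕ.* (f ℕ.* x))
    lem f x = solveℕ (f ∷ x ∷ [])
    lem2 : ∀ f x → 528 ℕ.* (f ℕ.* x) ℕ.+ 12 ℕ.* (f ℕ.* x) ≡ f ℕ.* (108 ℕ.* (5 ℕ.* x))
    lem2 f x = solveℕ (f ∷ x ∷ [])
    small : ∣ g (+ N) P Q ∣ ℕ.≤ 5 ℕ.* R
    small = ℕₚ.*-cancelˡ-≤ 108 (ℕₚ.*-cancelˡ-≤ (F ℕ.* (F ℕ.* F)) {{nz}} (begin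
      F ℕ.* (F ℕ.* F) ℕ.* (108 ℕ.* ∣ g (+ N) P Q ∣)   ≡⟨ lem (F ℕ.* (F ℕ.* F)) (∣ g (+ N) P Q ∣) ⟩
      2 ℕ.* (54 ℕ.* (F ℕ.* (F ℕ.* F) ℕ.* ∣ g (+ N) P Q ∣)) ≡⟨ cong (λ t → 2 ℕ.* (54 ℕ.* t)) (trans (cong ∣_∣ eq) abs-eq) ⟨
      2 ℕ.* (54 ℕ.* ∣ (pow18 k * pow18 k * pow18 k) * g (+ N) (+ A N k) (+ B N k) ∣)
        ≤⟨ ℕₚ.≤-trans (raw-bound N k 1≤N) (collect N k) ⟩
      528 ℕ.* ((F ℕ.* (F ℕ.* F)) ℕ.* R) ≤⟨ ℕₚ.m≤m+n _ (12 ℕ.* ((F ℕ.* (F ℕ.* F)) ℕ.* R)) ⟩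
      528 ℕ.* ((F ℕ.* (F ℕ.* F)) ℕ.* R) ℕ.+ 12 ℕ.* ((F ℕ.* (F ℕ.* F)) ℕ.* R) ≡⟨ lem2 (F ℕ.* (F ℕ.* F)) R ⟩
      F ℕ.* (F ℕ.* F) ℕ.* (108 ℕ.* (5 ℕ.* R)) ∎))

  record Approximant (N k : ℕ) : Set where
    field
      P Q : ℤ
      P-eq : pow18 k * + A N k ≡ + (k !) * P
      Q-eq : pow18 k * + B N k ≡ + (k !) * Q
      small : ∣ g (+ N) P Q ∣ ℕ.≤ 5 ℕ.* (Γ ℕ.^ k ℕ.* N ℕ.^ k)

  approximant : ∀ N k → 1 ℕ.≤ N → Approximant N k
  approximant N k 1≤N =
    let P , Q , p , q = divide-factorial N k in record { P = P ; Q = Q ; P-eq = p ; Q-eq = q ; small = divided-bound N k P Q 1≤N p q }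

-- The approximating fractions and the gap principle.

module ThueBound where
  open import Data.Nat as ℕ using (ℕ; zero; suc; z≤n; s≤s; _!)
  import Data.Nat.Properties as ℕₚ
  open import Data.Integer hiding (suc; _⊖_)
  open import Data.Integer.Properties
  open import Data.Product using (∃-syntax; _×_; _,_)
  open import Relation.Nullary using (contradiction)
  open import Relation.Binary.PropositionalEquality
  open Naturals
  open Integers
  open Approximants using (g; A; B; conv-ℤ; pow18; pow18-pos)
  open Remainder using (Γ; Approximant; approximant)

  -- Both sequences obey the same recurrence with nonnegative coefficients, so the starting values
  -- decide. It supplies the side condition P/Q ≥ N of the gap principle.
  A≥NB : ∀ N k → N ℕ.* B N k ℕ.≤ A N k
  A≥NB N zero = ℕₚ.≤-trans (ℕₚ.≤-reflexive (ℕₚ.*-zeroʳ N)) z≤n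
  A≥NB N (suc zero) = ℕₚ.≤-reflexive (ℕₚ.*-identityʳ N)
  A≥NB N (suc (suc k)) = ℕₚ.≤-trans (ℕₚ.≤-reflexive (lem N u (B N (suc k)) v (B N k)))
    (ℕₚ.+-mono-≤ (ℕₚ.*-monoʳ-≤ u (A≥NB N (suc k))) (ℕₚ.*-monoʳ-≤ v (A≥NB N k)))
    where
    u = (2 ℕ.* k ℕ.+ 3) ℕ.* N
    v = 27 ℕ.* (k ℕ.* k) ℕ.+ 54 ℕ.* k ℕ.+ 24
    lem : ∀ N u x v y → N ℕ.* (u ℕ.* x ℕ.+ v ℕ.* y) ≡ u ℕ.* (N ℕ.* x) ℕ.+ v ℕ.* (N ℕ.* y)
    lem N u x v y = solveℕ (N ∷ u ∷ x ∷ v ∷ y ∷ [])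

  A-upper : ∀ M k → A (3 ℕ.+ M) k ℕ.≤ k ! ℕ.* (3 ℕ.* (3 ℕ.+ M)) ℕ.^ k
  A-upper M zero = ℕₚ.≤-refl
  A-upper M (suc zero) = ℕₚ.≤-trans (ℕₚ.m≤m+n (3 ℕ.+ M) (2 ℕ.* (3 ℕ.+ M))) (ℕₚ.≤-reflexive (lem M))
    where
    lem : ∀ M → 3 ℕ.+ M ℕ.+ 2 ℕ.* (3 ℕ.+ M) ≡ 1 ℕ.* (3 ℕ.* (3 ℕ.+ M) ℕ.* 1)
    lem M = solveℕ (M ∷ [])
  A-upper M (suc (suc k)) = begin
    u ℕ.* N ℕ.* A N (suc k) ℕ.+ v ℕ.* A N k
      ≤⟨ ℕₚ.+-mono-≤ (ℕₚ.*-monoʳ-≤ (u ℕ.* N) (A-upper M (suc k))) (ℕₚ.*-monoʳ-≤ v (A-upper M k)) ⟩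
    u ℕ.* N ℕ.* (suc k ℕ.* (k !) ℕ.* (3 ℕ.* N ℕ.* T)) ℕ.+ v ℕ.* (k ! ℕ.* T)  ≤⟨ ℕₚ.m≤m+n _ slack ⟩
    u ℕ.* N ℕ.* (suc k ℕ.* (k !) ℕ.* (3 ℕ.* N ℕ.* T)) ℕ.+ v ℕ.* (k ! ℕ.* T) ℕ.+ slack ≡⟨ lem k M (k !) T ⟩
    suc (suc k) ℕ.* (suc k ℕ.* (k !)) ℕ.* (3 ℕ.* N ℕ.* (3 ℕ.* N ℕ.* T)) ∎
    where
    open ℕₚ.≤-Reasoning
    N = 3 ℕ.+ M
    T = (3 ℕ.* N) ℕ.^ k
    u = 2 ℕ.* k ℕ.+ 3
    v = 27 ℕ.* (k ℕ.* k) ℕ.+ 54 ℕ.* k ℕ.+ 24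
    slack = (54 ℕ.* k ℕ.+ 57 ℕ.+ (3 ℕ.* (k ℕ.* k) ℕ.+ 12 ℕ.* k ℕ.+ 9) ℕ.* (6 ℕ.* M ℕ.+ M ℕ.* M)) ℕ.* (k ! ℕ.* T)
    lem : ∀ k M F T → (2 ℕ.* k ℕ.+ 3) ℕ.* (3 ℕ.+ M) ℕ.* ((1 ℕ.+ k) ℕ.* F ℕ.* (3 ℕ.* (3 ℕ.+ M) ℕ.* T)) ℕ.+ (27 ℕ.* (k ℕ.* k) ℕ.+ 54 ℕ.* k ℕ.+ 24) ℕ.* (F ℕ.* T)
        ℕ.+ (54 ℕ.* k ℕ.+ 57 ℕ.+ (3 ℕ.* (k ℕ.* k) ℕ.+ 12 ℕ.* k ℕ.+ 9) ℕ.* (6 ℕ.* M ℕ.+ M ℕ.* M)) ℕ.* (F ℕ.* T)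
        ≡ (2 ℕ.+ k) ℕ.* ((1 ℕ.+ k) ℕ.* F) ℕ.* (3 ℕ.* (3 ℕ.+ M) ℕ.* (3 ℕ.* (3 ℕ.+ M) ℕ.* T))
    lem k M F T = solveℕ (k ∷ M ∷ F ∷ T ∷ [])

  B-lower : ∀ N k → k ! ℕ.* N ℕ.^ k ℕ.≤ B N (suc k)
  B-lower N zero = ℕₚ.≤-refl
  B-lower N (suc k) = begin
    suc k ℕ.* k ! ℕ.* (N ℕ.* N ℕ.^ k)      ≡⟨ lem (suc k) (k !) N (N ℕ.^ k) ⟩
    suc k ℕ.* N ℕ.* (k ! ℕ.* N ℕ.^ k)      ≤⟨ ℕₚ.*-mono-≤ (ℕₚ.*-monoˡ-≤ N k+1≤) (B-lower N k) ⟩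
    (2 ℕ.* k ℕ.+ 3) ℕ.* N ℕ.* B N (suc k)  ≤⟨ ℕₚ.m≤m+n _ _ ⟩
    B N (suc (suc k)) ∎
    where
    open ℕₚ.≤-Reasoning
    lem : ∀ s F N T → s ℕ.* F ℕ.* (N ℕ.* T) ≡ s ℕ.* N ℕ.* (F ℕ.* T)
    lem s F N T = solveℕ (s ∷ F ∷ N ∷ T ∷ [])
    lem2 : ∀ k → 1 ℕ.+ k ℕ.+ (k ℕ.+ 2) ≡ 2 ℕ.* k ℕ.+ 3
    lem2 k = solveℕ (k ∷ [])
    k+1≤ : suc k ℕ.≤ 2 ℕ.* k ℕ.+ 3
    k+1≤ = ℕₚ.≤-trans (ℕₚ.m≤m+n (suc k) (k ℕ.+ 2)) (ℕₚ.≤-reflexive (lem2 k))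

  -- The determinant starts at -1, and each step of the recurrence multiplies it by minus the
  -- nonzero coefficient 27k² + 54k + 24.
  determinant : ∀ N k → + A N (suc k) * + B N k - + A N k * + B N (suc k) ≢ + 0
  determinant N zero eq = contradiction (trans (sym (lem (+ N))) eq) λ ()
    where
    lem : ∀ N → N * + 0 - + 1 * + 1 ≡ - + 1
    lem N = solve (N ∷ [])
  determinant N (suc k) eq = determinant N k (*-cancelˡ-≡ v _ (+ 0) {{v≢0}} (trans
      (lem (+ 2 * + k + + 3) (+ N) v (+ A N (suc k)) (+ B N (suc k)) (+ A N k) (+ B N k))
      (trans (cong -_ (trans (sym (cong₂ (λ s t → s * + B N (suc k) - + A N (suc k) * t) (conv-ℤ N 1 N k) (conv-ℤ N 0 1 k))) eq))
        (sym (*-zeroʳ v)))))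
    where
    v = + 27 * (+ k * + k) + + 54 * + k + + 24
    v-pos : v ≡ + (27 ℕ.* (k ℕ.* k) ℕ.+ 54 ℕ.* k ℕ.+ 24)
    v-pos = sym (cong₂ (λ s t → s + t + + 24) (trans (pos-* 27 (k ℕ.* k)) (cong (+ 27 *_) (pos-* k k))) (pos-* 54 k))
    v≢0 : NonZero v
    v≢0 = subst NonZero (sym (trans v-pos (cong +_ (ℕₚ.+-comm _ 24)))) _
    lem : ∀ u N v a₁ b₁ a₀ b₀ → v * (a₁ * b₀ - a₀ * b₁) ≡ - ((u * N * a₁ + v * a₀) * b₁ - a₁ * (u * N * b₁ + v * b₀))
    lem u N v a₁ b₁ a₀ b₀ = solve (u ∷ N ∷ v ∷ a₁ ∷ b₁ ∷ a₀ ∷ b₀ ∷ [])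

  record Fraction (N k : ℕ) : Set where
    field
      P Q : ℕ
      P-eq : 18 ℕ.^ k ℕ.* A N k ≡ k ! ℕ.* P
      Q-eq : 18 ℕ.^ k ℕ.* B N k ≡ k ! ℕ.* Q
      small : ∣ g (+ N) (+ P) (+ Q) ∣ ℕ.≤ 5 ℕ.* (Γ ℕ.^ k ℕ.* N ℕ.^ k)

  private
    unsign : ∀ k a P → pow18 k * + a ≡ + (k !) * P → ∃[ P' ] (P ≡ + P' × 18 ℕ.^ k ℕ.* a ≡ k ! ℕ.* P')
    unsign k a P eq = ∣ P ∣ , sym (0≤i⇒+∣i∣≡i 0≤P) , +-injective (begin
      + (18 ℕ.^ k ℕ.* a)     ≡⟨ trans (pos-* (18 ℕ.^ k) a) (cong (_* + a) (sym (pow18-pos k))) ⟩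
      pow18 k * + a          ≡⟨ eq ⟩
      + (k !) * P            ≡⟨ cong (+ (k !) *_) (sym (0≤i⇒+∣i∣≡i 0≤P)) ⟩
      + (k !) * + ∣ P ∣      ≡⟨ pos-* (k !) ∣ P ∣ ⟨
      + (k ! ℕ.* ∣ P ∣)      ∎)
      where
      open ≡-Reasoning
      0≤P : + 0 ≤ P
      0≤P = *-cancelˡ-≤-pos (+ 0) P (+ (k !)) {{k!-pos}} (subst₂ _≤_ (sym (*-zeroʳ (+ (k !)))) eq
        (subst (λ t → + 0 ≤ t * + a) (sym (pow18-pos k)) (k0 (18 ℕ.^ k) ⊠ k0 a)))
        where
        k!-pos : Positive (+ (k !))
        k!-pos = positive (+<+ (ℕ.>-nonZero⁻¹ (k !) {{k ℕₚ.!≢0}}))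

  fraction : ∀ N k → 1 ℕ.≤ N → Fraction N k
  fraction N k 1≤N =
    let P' , P≡ , p = unsign k (A N k) P P-eq
        Q' , Q≡ , q = unsign k (B N k) Q Q-eq
    in record { P = P' ; Q = Q' ; P-eq = p ; Q-eq = q
              ; small = subst₂ (λ x y → ∣ g (+ N) x y ∣ ℕ.≤ 5 ℕ.* (Γ ℕ.^ k ℕ.* N ℕ.^ k)) P≡ Q≡ small }
    where open Approximant (approximant N k 1≤N)

  private
    P≥NQ-identity : ∀ x y z → x ℕ.* (y ℕ.* z) ≡ y ℕ.* (x ℕ.* z)
    P≥NQ-identity x y z = solveℕ (x ∷ y ∷ z ∷ [])

    P-upper-identity : ∀ N → 18 ℕ.* (3 ℕ.* N) ≡ 54 ℕ.* N
    P-upper-identity N = solveℕ (N ∷ [])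

  module FractionProperties (N k : ℕ) (φ : Fraction N k) where
    open Fraction φ
    open ℕₚ.≤-Reasoning
    private instance
      k!≢0 : ℕ.NonZero (k !)
      k!≢0 = k ℕₚ.!≢0

    P≥NQ : N ℕ.* Q ℕ.≤ P
    P≥NQ = ℕₚ.*-cancelˡ-≤ (k !) (begin
      k ! ℕ.* (N ℕ.* Q)           ≡⟨ P≥NQ-identity (k !) N Q ⟩
      N ℕ.* (k ! ℕ.* Q)           ≡⟨ cong (N ℕ.*_) Q-eq ⟨
      N ℕ.* (18 ℕ.^ k ℕ.* B N k)  ≡⟨ P≥NQ-identity N (18 ℕ.^ k) (B N k) ⟩
      18 ℕ.^ k ℕ.* (N ℕ.* B N k)  ≤⟨ ℕₚ.*-monoʳ-≤ (18 ℕ.^ k) (A≥NB N k) ⟩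
      18 ℕ.^ k ℕ.* A N k          ≡⟨ P-eq ⟩
      k ! ℕ.* P ∎)

    P-upper : 3 ℕ.≤ N → P ℕ.≤ (54 ℕ.* N) ℕ.^ k
    P-upper 3≤N = ℕₚ.*-cancelˡ-≤ (k !) (begin
      k ! ℕ.* P                            ≡⟨ P-eq ⟨
      18 ℕ.^ k ℕ.* A N k                   ≤⟨ ℕₚ.*-monoʳ-≤ (18 ℕ.^ k) bound ⟩
      18 ℕ.^ k ℕ.* (k ! ℕ.* (3 ℕ.* N) ℕ.^ k) ≡⟨ P≥NQ-identity (18 ℕ.^ k) (k !) ((3 ℕ.* N) ℕ.^ k) ⟩
      k ! ℕ.* (18 ℕ.^ k ℕ.* (3 ℕ.* N) ℕ.^ k) ≡⟨ cong (k ! ℕ.*_) (^-distribʳ-* k 18 (3 ℕ.* N)) ⟨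
      k ! ℕ.* (18 ℕ.* (3 ℕ.* N)) ℕ.^ k     ≡⟨ cong (λ t → k ! ℕ.* t ℕ.^ k) (P-upper-identity N) ⟩
      k ! ℕ.* (54 ℕ.* N) ℕ.^ k ∎)
      where
      bound : A N k ℕ.≤ k ! ℕ.* (3 ℕ.* N) ℕ.^ k
      bound = subst (λ n → A n k ℕ.≤ k ! ℕ.* (3 ℕ.* n) ℕ.^ k) (ℕₚ.m+[n∸m]≡n 3≤N) (A-upper (N ℕ.∸ 3) k)

  private
    k≤18^k : ∀ k → suc k ℕ.≤ 18 ℕ.^ suc k
    k≤18^k k = ℕₚ.≤-trans (ℕₚ.n≤1+n _) (go k)
      where
      go : ∀ k → suc (suc k) ℕ.≤ 18 ℕ.^ suc k
      go zero = ℕₚ.m≤m+n 2 16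
      go (suc k) = ℕₚ.≤-trans (s≤s (go k)) (ℕₚ.≤-trans (ℕₚ.+-monoˡ-≤ (18 ℕ.^ suc k) (ℕₚ.≤-trans (s≤s z≤n) (go k)))
        (ℕₚ.+-monoʳ-≤ (18 ℕ.^ suc k) (ℕₚ.m≤m+n (18 ℕ.^ suc k) _)))

  Q-lower : ∀ N k (φ : Fraction N (suc k)) → N ℕ.^ k ℕ.≤ Fraction.Q φ
  Q-lower N k φ = ℕₚ.*-cancelˡ-≤ (suc k !) {{suc k ℕₚ.!≢0}} (begin
    suc k ℕ.* k ! ℕ.* N ℕ.^ k             ≡⟨ ℕₚ.*-assoc (suc k) (k !) (N ℕ.^ k) ⟩
    suc k ℕ.* (k ! ℕ.* N ℕ.^ k)           ≤⟨ ℕₚ.*-mono-≤ (k≤18^k k) (B-lower N k) ⟩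
    18 ℕ.^ suc k ℕ.* B N (suc k)          ≡⟨ Fraction.Q-eq φ ⟩
    suc k ! ℕ.* Fraction.Q φ ∎)
    where open ℕₚ.≤-Reasoning

  fractions-independent : ∀ N k (φ : Fraction N k) (ψ : Fraction N (suc k)) →
    let open Fraction in P φ ℕ.* Q ψ ≢ P ψ ℕ.* Q φ
  fractions-independent N k φ ψ eq = determinant N k (i≡j⇒i-j≡0 (trans (sym (pos-* a₁ b₀))
      (trans (cong +_ (sym cross)) (pos-* a₀ b₁))))
    where
    open ≡-Reasoning
    open Fraction
    a₀ = A N k
    b₀ = B N k
    a₁ = A N (suc k)
    b₁ = B N (suc k)
    t₀ = 18 ℕ.^ k
    t₁ = 18 ℕ.^ suc k
    lem : ∀ s t a b → s ℕ.* t ℕ.* (a ℕ.* b) ≡ (s ℕ.* a) ℕ.* (t ℕ.* b)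
    lem s t a b = solveℕ (s ∷ t ∷ a ∷ b ∷ [])
    lem2 : ∀ s t a b → (s ℕ.* a) ℕ.* (t ℕ.* b) ≡ s ℕ.* t ℕ.* (a ℕ.* b)
    lem2 s t a b = solveℕ (s ∷ t ∷ a ∷ b ∷ [])
    cross : a₀ ℕ.* b₁ ≡ a₁ ℕ.* b₀
    cross = ℕₚ.*-cancelˡ-≡ _ _ (t₀ ℕ.* t₁) {{ℕₚ.m*n≢0 t₀ t₁ {{ℕₚ.m^n≢0 18 k}} {{ℕₚ.m^n≢0 18 (suc k)}}}} (begin
      t₀ ℕ.* t₁ ℕ.* (a₀ ℕ.* b₁)                     ≡⟨ lem t₀ t₁ a₀ b₁ ⟩
      (t₀ ℕ.* a₀) ℕ.* (t₁ ℕ.* b₁)                   ≡⟨ cong₂ ℕ._*_ (P-eq φ) (Q-eq ψ) ⟩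
      (k ! ℕ.* P φ) ℕ.* (suc k ! ℕ.* Q ψ)           ≡⟨ lem2 (k !) (suc k !) (P φ) (Q ψ) ⟩
      k ! ℕ.* suc k ! ℕ.* (P φ ℕ.* Q ψ)             ≡⟨ cong (k ! ℕ.* suc k ! ℕ.*_) (trans eq (ℕₚ.*-comm (P ψ) (Q φ))) ⟩
      k ! ℕ.* suc k ! ℕ.* (Q φ ℕ.* P ψ)             ≡⟨ lem (k !) (suc k !) (Q φ) (P ψ) ⟩
      (k ! ℕ.* Q φ) ℕ.* (suc k ! ℕ.* P ψ)           ≡⟨ cong₂ ℕ._*_ (Q-eq φ) (P-eq ψ) ⟨
      (t₀ ℕ.* b₀) ℕ.* (t₁ ℕ.* a₁)                   ≡⟨ lem2 t₀ t₁ b₀ a₁ ⟩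
      t₀ ℕ.* t₁ ℕ.* (b₀ ℕ.* a₁)                     ≡⟨ cong (t₀ ℕ.* t₁ ℕ.*_) (ℕₚ.*-comm b₀ a₁) ⟩
      t₀ ℕ.* t₁ ℕ.* (a₁ ℕ.* b₀) ∎)

  private
    identity₂ : ∀ n a b P Q → (a * Q - P * b) * ((a * Q) * (a * Q) + (a * Q) * (P * b) + (P * b) * (P * b) - n * (a * Q + P * b) * (Q * b) - + 9 * (Q * b) * (Q * b))
        ≡ (a * a * a - n * a * a * b - + 9 * a * b * b + n * b * b * b) * (Q * Q * Q)
          - (P * P * P - n * P * P * Q - + 9 * P * Q * Q + n * Q * Q * Q) * (b * b * b)
    identity₂ n a b P Q = solve (n ∷ a ∷ b ∷ P ∷ Q ∷ [])

    u≥-identity : ∀ n a b Q → + 4 * (a * Q) ≡ + 3 * n * (Q * b) + Q * (+ 4 * a - + 3 * n * b)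
    u≥-identity n a b Q = solve (n ∷ a ∷ b ∷ Q ∷ [])

    v≥-identity : ∀ n b P Q → P * b ≡ n * (Q * b) + b * (P - n * Q)
    v≥-identity n b P Q = solve (n ∷ b ∷ P ∷ Q ∷ [])

    conclusion-identity : ∀ N Q b → Q ℕ.* Q ℕ.* (N ℕ.* b ℕ.* (N ℕ.* b)) ℕ.+ N ℕ.* (Q ℕ.* b) ℕ.* (N ℕ.* (Q ℕ.* b)) ≡ 2 ℕ.* (N ℕ.* (Q ℕ.* b) ℕ.* (N ℕ.* (Q ℕ.* b)))
    conclusion-identity N Q b = solveℕ (N ∷ Q ∷ b ∷ [])

    conclusion-identity₂ : ∀ K Q R b → 2 ℕ.* (2 ℕ.* (K ℕ.* (Q ℕ.* Q ℕ.* Q) ℕ.+ R ℕ.* (b ℕ.* b ℕ.* b))) ≡ Q ℕ.* Q ℕ.* (4 ℕ.* (K ℕ.* Q)) ℕ.+ (4 ℕ.* (R ℕ.* b)) ℕ.* (b ℕ.* b)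
    conclusion-identity₂ K Q R b = solveℕ (K ∷ Q ∷ R ∷ b ∷ [])

    conclusion-identity₃ : ∀ N Q b → N ℕ.* Q ℕ.* (N ℕ.* Q) ℕ.* (b ℕ.* b) ≡ N ℕ.* (Q ℕ.* b) ℕ.* (N ℕ.* (Q ℕ.* b))
    conclusion-identity₃ N Q b = solveℕ (N ∷ Q ∷ b ∷ [])

  -- The gap principle: a/b and P/Q both approximate the root of g near N, so aQ − Pb ≠ 0 forces Q to be large.
  gap : ∀ N a b P Q K R → 12 ℕ.≤ N → 1 ℕ.≤ Q → 3 ℕ.* N ℕ.* b ℕ.≤ 4 ℕ.* a → N ℕ.* Q ℕ.≤ P →
        ∣ g (+ N) (+ a) (+ b) ∣ ℕ.≤ K → ∣ g (+ N) (+ P) (+ Q) ∣ ℕ.≤ R →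
        a ℕ.* Q ≢ P ℕ.* b → 4 ℕ.* (R ℕ.* b) ℕ.≤ N ℕ.* Q ℕ.* (N ℕ.* Q) →
        N ℕ.* b ℕ.* (N ℕ.* b) ℕ.≤ 4 ℕ.* (K ℕ.* Q)
  gap N a b P Q K R N≥12 Q≥1 a≥ P≥ gab gPQ a/b≢P/Q R≤ = conclusion
    where
    n = + N
    u = + a * + Q
    v = + P * + b
    w = + Q * + b
    form : ℤ
    form = u * u + u * v + v * v - n * (u + v) * w - + 9 * w * w
    -- The right side vanishes when a/b = P/Q, hence is divisible by aQ - Pb; `form` is the
    -- cofactor.
    identity : (u - v) * form ≡ g n (+ a) (+ b) * (+ Q * + Q * + Q) - g n (+ P) (+ Q) * (+ b * + b * + b)
    identity = identity₂ n (+ a) (+ b) (+ P) (+ Q)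
    cast≤ : ∀ {x y} → x ℕ.≤ y → + x ≤ + y
    cast≤ = +≤+
    u≥ : + 3 * n * w ≤ + 4 * u
    u≥ = by (k0 Q ⊠ dif (subst₂ _≤_ (trans (pos-* (3 ℕ.* N) b) (cong (_* + b) (pos-* 3 N))) (pos-* 4 a) (cast≤ a≥))) (u≥-identity n (+ a) (+ b) (+ Q))
    v≥ : n * w ≤ v
    v≥ = by (k0 b ⊠ dif (subst (_≤ + P) (pos-* N Q) (cast≤ P≥))) (v≥-identity n (+ b) (+ P) (+ Q))
    -- At the corner u = 3nw/4, v = nw the cofactor is (9/16)(nw)² - 9w². For n ≥ 12 the last term
    -- is at most (nw)²/16, which leaves half of (nw)².
    form≥ : ∀ {n u v w} → + 12 ≤ n → + 0 ≤ w → + 3 * n * w ≤ + 4 * u → n * w ≤ v →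
            + 8 * ((n * w) * (n * w)) ≤ + 8 * (+ 2 * (u * u + u * v + v * v - n * (u + v) * w - + 9 * w * w))
    form≥ {n} {u} {v} {w} h1 h2 h3 h4 =
      by ((dif h3 ⊠ (dif h3 ⊞ k0 6 ⊠ n0 ⊠ h2)) ⊞ (k0 4 ⊠ (dif h3 ⊞ k0 3 ⊠ n0 ⊠ h2) ⊠ dif h4) ⊞ (k0 16 ⊠ (dif h4 ⊞ n0 ⊠ h2) ⊠ dif h4)
           ⊞ ((dif h1 ⊠ (dif h1 ⊞ k0 24)) ⊠ h2 ⊠ h2))
         (solve (n ∷ u ∷ v ∷ w ∷ []))
      where
      n0 : + 0 ≤ n
      n0 = ≤-trans (k0 12) h1
    w0 : + 0 ≤ w
    w0 = k0 Q ⊠ k0 b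
    form-lower : (n * w) * (n * w) ≤ + 2 * form
    form-lower = *-cancelˡ-≤-pos ((n * w) * (n * w)) (+ 2 * form) (+ 8) (form≥ (cast≤ N≥12) w0 u≥ v≥)
    form0 : + 0 ≤ form
    form0 = *-cancelˡ-≤-pos (+ 0) form (+ 2) (≤-trans (sq0 (n * w)) form-lower)
    upper : ∣ (u - v) * form ∣ ℕ.≤ K ℕ.* (Q ℕ.* Q ℕ.* Q) ℕ.+ R ℕ.* (b ℕ.* b ℕ.* b)
    upper = begin
      ∣ (u - v) * form ∣ ≡⟨ cong ∣_∣ identity ⟩
      ∣ g n (+ a) (+ b) * (+ Q * + Q * + Q) - g n (+ P) (+ Q) * (+ b * + b * + b) ∣
        ≤⟨ ∣i-j∣≤∣i∣+∣j∣ (g n (+ a) (+ b) * (+ Q * + Q * + Q)) (g n (+ P) (+ Q) * (+ b * + b * + b)) ⟩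
      _ ≡⟨ cong₂ ℕ._+_ (abs-cube (g n (+ a) (+ b)) Q) (abs-cube (g n (+ P) (+ Q)) b) ⟩
      _ ≤⟨ ℕₚ.+-mono-≤ (ℕₚ.*-monoˡ-≤ _ gab) (ℕₚ.*-monoˡ-≤ _ gPQ) ⟩
      K ℕ.* (Q ℕ.* Q ℕ.* Q) ℕ.+ R ℕ.* (b ℕ.* b ℕ.* b) ∎
      where
      open ℕₚ.≤-Reasoning
      abs-cube : ∀ x m → ∣ x * (+ m * + m * + m) ∣ ≡ ∣ x ∣ ℕ.* (m ℕ.* m ℕ.* m)
      abs-cube x m = trans (abs-* x (+ m * + m * + m)) (cong (∣ x ∣ ℕ.*_)
        (trans (abs-* (+ m * + m) (+ m)) (cong (ℕ._* m) (abs-* (+ m) (+ m)))))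
    1≤∣u-v∣ : 1 ℕ.≤ ∣ u - v ∣
    1≤∣u-v∣ with ∣ u - v ∣ in eq
    ... | zero = contradiction (+-injective (trans (pos-* a Q) (trans (i-j≡0⇒i≡j u v (∣i∣≡0⇒i≡0 eq)) (sym (pos-* P b))))) a/b≢P/Q
    ... | suc _ = s≤s z≤n
    form≤ : ∣ form ∣ ℕ.≤ K ℕ.* (Q ℕ.* Q ℕ.* Q) ℕ.+ R ℕ.* (b ℕ.* b ℕ.* b)
    form≤ = begin
      ∣ form ∣                 ≡⟨ ℕₚ.*-identityˡ _ ⟨
      1 ℕ.* ∣ form ∣           ≤⟨ ℕₚ.*-monoˡ-≤ ∣ form ∣ 1≤∣u-v∣ ⟩
      ∣ u - v ∣ ℕ.* ∣ form ∣   ≡⟨ abs-* (u - v) form ⟨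
      ∣ (u - v) * form ∣       ≤⟨ upper ⟩
      K ℕ.* (Q ℕ.* Q ℕ.* Q) ℕ.+ R ℕ.* (b ℕ.* b ℕ.* b) ∎
      where open ℕₚ.≤-Reasoning
    nw : (n * w) * (n * w) ≡ + (N ℕ.* (Q ℕ.* b) ℕ.* (N ℕ.* (Q ℕ.* b)))
    nw = sym (trans (pos-* (N ℕ.* (Q ℕ.* b)) _) (cong (λ t → t * t) (trans (pos-* N (Q ℕ.* b)) (cong (n *_) (pos-* Q b)))))
    nat : N ℕ.* (Q ℕ.* b) ℕ.* (N ℕ.* (Q ℕ.* b)) ℕ.≤ 2 ℕ.* (K ℕ.* (Q ℕ.* Q ℕ.* Q) ℕ.+ R ℕ.* (b ℕ.* b ℕ.* b))
    nat = drop‿+≤+ (≤-trans (≤-reflexive (sym nw)) (≤-trans form-lower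
      (≤-trans (≤-reflexive (trans (cong (+ 2 *_) (sym (0≤i⇒+∣i∣≡i form0))) (sym (pos-* 2 ∣ form ∣)))) (+≤+ (ℕₚ.*-monoʳ-≤ 2 form≤)))))
    conclusion : N ℕ.* b ℕ.* (N ℕ.* b) ℕ.≤ 4 ℕ.* (K ℕ.* Q)
    -- The hypothesis on R makes the contribution of g(P, Q) at most X, so adding X on the left and
    -- cancelling it afterwards removes that contribution.
    conclusion = ℕₚ.*-cancelˡ-≤ (Q ℕ.* Q) {{ℕₚ.m*n≢0 Q Q {{ℕ.>-nonZero Q≥1}} {{ℕ.>-nonZero Q≥1}}}} (ℕₚ.+-cancelʳ-≤ X _ _ (begin
      Q ℕ.* Q ℕ.* (N ℕ.* b ℕ.* (N ℕ.* b)) ℕ.+ X     ≡⟨ conclusion-identity N Q b ⟩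
      2 ℕ.* X                                       ≤⟨ ℕₚ.*-monoʳ-≤ 2 nat ⟩
      2 ℕ.* (2 ℕ.* (K ℕ.* (Q ℕ.* Q ℕ.* Q) ℕ.+ R ℕ.* (b ℕ.* b ℕ.* b))) ≡⟨ conclusion-identity₂ K Q R b ⟩
      Q ℕ.* Q ℕ.* (4 ℕ.* (K ℕ.* Q)) ℕ.+ (4 ℕ.* (R ℕ.* b)) ℕ.* (b ℕ.* b) ≤⟨ ℕₚ.+-monoʳ-≤ _ (ℕₚ.*-monoˡ-≤ (b ℕ.* b) R≤) ⟩
      Q ℕ.* Q ℕ.* (4 ℕ.* (K ℕ.* Q)) ℕ.+ N ℕ.* Q ℕ.* (N ℕ.* Q) ℕ.* (b ℕ.* b) ≡⟨ cong (Q ℕ.* Q ℕ.* (4 ℕ.* (K ℕ.* Q)) ℕ.+_) (conclusion-identity₃ N Q b) ⟩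
      Q ℕ.* Q ℕ.* (4 ℕ.* (K ℕ.* Q)) ℕ.+ X ∎))
      where
      open ℕₚ.≤-Reasoning
      X = N ℕ.* (Q ℕ.* b) ℕ.* (N ℕ.* (Q ℕ.* b))

-- A polynomial bound for the solutions of |f_n(p, q)| ≤ κ.

module FormBound where
  open import Data.Nat as ℕ using (ℕ; zero; suc; z≤n; s≤s)
  import Data.Nat.Properties as ℕₚ
  open import Data.Integer hiding (suc; _⊖_)
  open import Data.Integer.Properties
  open import Data.Product using (∃-syntax; _×_; _,_)
  open import Data.Sum using (_⊎_; inj₁; inj₂)
  open import Relation.Nullary using (yes; no; ¬_; contradiction; Dec)
  open import Relation.Binary.PropositionalEquality
  open Naturals
  open Integers
  open Approximants using (g)
  open Remainder using (Γ; 2≤Γ; k+1≤2^k)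
  open ThueBound

  opaque
    -- For N ≥ `N₁` one has 54^(2j) Γ^(3j) ≤ N^j for all j, which is what eliminates the index j of
    -- the approximant; `C₀` collects the factors that survive this elimination.
    N₁ C₀ : ℕ
    N₁ = 54 ℕ.* 54 ℕ.* (Γ ℕ.* (Γ ℕ.* Γ))
    C₀ = 16 ℕ.* 8000 ℕ.* (54 ℕ.* 54 ℕ.* (54 ℕ.* 54))

    N₁-power : ∀ j → N₁ ℕ.^ j ≡ 54 ℕ.^ j ℕ.* 54 ℕ.^ j ℕ.* (Γ ℕ.^ j ℕ.* (Γ ℕ.^ j ℕ.* Γ ℕ.^ j))
    N₁-power j = trans (^-distribʳ-* j (54 ℕ.* 54) (Γ ℕ.* (Γ ℕ.* Γ)))
      (cong₂ ℕ._*_ (^-distribʳ-* j 54 54) (trans (^-distribʳ-* j Γ (Γ ℕ.* Γ)) (cong (Γ ℕ.^ j ℕ.*_) (^-distribʳ-* j Γ Γ))))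

    N₁≥2Γ : 2 ℕ.* Γ ℕ.≤ N₁
    N₁≥2Γ = ℕₚ.*-mono-≤ (ℕₚ.m≤m+n 2 2914) (ℕₚ.≤-trans (ℕₚ.≤-reflexive (sym (ℕₚ.*-identityʳ Γ))) (ℕₚ.*-monoʳ-≤ Γ (ℕₚ.*-mono-≤ 1≤Γ 1≤Γ)))
      where
      1≤Γ : 1 ℕ.≤ Γ
      1≤Γ = ℕₚ.≤-trans (s≤s z≤n) 2≤Γ

    N₁≥12 : 12 ℕ.≤ N₁
    N₁≥12 = ℕₚ.*-mono-≤ {12} {2916} {1} (ℕₚ.m≤m+n 12 2904) (ℕₚ.*-mono-≤ 1≤Γ (ℕₚ.*-mono-≤ 1≤Γ 1≤Γ))
      where
      1≤Γ : 1 ℕ.≤ Γ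
      1≤Γ = ℕₚ.≤-trans (s≤s z≤n) 2≤Γ

    C₀-def : ∀ c d → c ℕ.* (C₀ ℕ.* d) ≡ c ℕ.* (16 ℕ.* 8000 ℕ.* (54 ℕ.* 54 ℕ.* (54 ℕ.* 54)) ℕ.* d)
    C₀-def c d = refl

    C₀≥1 : 1 ℕ.≤ C₀
    C₀≥1 = ℕₚ.m≤m+n 1 (C₀ ℕ.∸ 1)

  crossing : ∀ {T : ℕ → Set} → (∀ j → Dec (T j)) → ¬ T 0 → ∀ m → T m → ∃[ j ] (¬ T j × T (suc j))
  crossing T? ¬T0 zero Tm = contradiction Tm ¬T0
  crossing T? ¬T0 (suc m) Tm with T? m
  ... | yes q = crossing T? ¬T0 m q
  ... | no q = m , q , Tm

  private
    XY≤-l₁ : ∀ X Y Z → Z ℕ.* (Z ℕ.* Z) ℕ.* (X ℕ.* X ℕ.* (Y ℕ.* Y)) ≡ X ℕ.* X ℕ.* (Z ℕ.* (Z ℕ.* Z)) ℕ.* (Y ℕ.* Y)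
    XY≤-l₁ X Y Z = solveℕ (X ∷ Y ∷ Z ∷ [])

    XY≤-l₂ : ∀ u Z b → u ℕ.* (Z ℕ.* b) ℕ.* (u ℕ.* (Z ℕ.* b) ℕ.* (u ℕ.* (Z ℕ.* b))) ≡ Z ℕ.* (Z ℕ.* Z) ℕ.* (u ℕ.* u ℕ.* u ℕ.* (b ℕ.* b ℕ.* b))
    XY≤-l₂ u Z b = solveℕ (u ∷ Z ∷ b ∷ [])

    cancel-exponent-identity : ∀ N b → N ℕ.* N ℕ.* (N ℕ.* N) ℕ.* (b ℕ.* b ℕ.* b) ℕ.* b ≡ (N ℕ.* b ℕ.* (N ℕ.* b)) ℕ.* (N ℕ.* b ℕ.* (N ℕ.* b))
    cancel-exponent-identity N b = solveℕ (N ∷ b ∷ [])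

    cancel-exponent-identity₂ : ∀ c K N X Y → (4 ℕ.* (K ℕ.* (c ℕ.* N ℕ.* (c ℕ.* N ℕ.* (X ℕ.* Y))))) ℕ.* (4 ℕ.* (K ℕ.* (c ℕ.* N ℕ.* (c ℕ.* N ℕ.* (X ℕ.* Y)))))
        ≡ (16 ℕ.* (c ℕ.* c ℕ.* (c ℕ.* c))) ℕ.* (K ℕ.* K) ℕ.* (N ℕ.* N ℕ.* (N ℕ.* N)) ℕ.* (X ℕ.* X ℕ.* (Y ℕ.* Y))
    cancel-exponent-identity₂ c K N X Y = solveℕ (c ∷ K ∷ N ∷ X ∷ Y ∷ [])

    cancel-exponent-identity₃ : ∀ c u v K N b → (u ℕ.* c) ℕ.* (K ℕ.* K) ℕ.* (N ℕ.* N ℕ.* (N ℕ.* N)) ℕ.* (v ℕ.* (b ℕ.* b ℕ.* b))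
        ≡ N ℕ.* N ℕ.* (N ℕ.* N) ℕ.* (b ℕ.* b ℕ.* b) ℕ.* (u ℕ.* v ℕ.* c ℕ.* (K ℕ.* K))
    cancel-exponent-identity₃ c u v K N b = solveℕ (c ∷ u ∷ v ∷ K ∷ N ∷ b ∷ [])

  private
    -- Squaring the gap inequality produces (54N)^(2j) on the right. The choice of j bounds this by
    -- 8000 b³, so b⁴ is compared with a multiple of b³ and j disappears.
    cancel-exponent : ∀ N b K j → 1 ℕ.≤ b → N₁ ℕ.≤ N → N ℕ.^ j ℕ.≤ 20 ℕ.* (Γ ℕ.^ j ℕ.* b) →
      N ℕ.* b ℕ.* (N ℕ.* b) ℕ.≤ 4 ℕ.* (K ℕ.* (54 ℕ.* N) ℕ.^ (2 ℕ.+ j)) → b ℕ.≤ C₀ ℕ.* (K ℕ.* K)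
    cancel-exponent N b K j b≥1 N≥ Y≤ h = ℕₚ.*-cancelˡ-≤ c {{c≢0}} (begin
      c ℕ.* b                                              ≡⟨ cancel-exponent-identity N b ⟩
      (N ℕ.* b ℕ.* (N ℕ.* b)) ℕ.* (N ℕ.* b ℕ.* (N ℕ.* b))   ≤⟨ ℕₚ.*-mono-≤ h' h' ⟩
      (4 ℕ.* (K ℕ.* (54 ℕ.* N ℕ.* (54 ℕ.* N ℕ.* (X ℕ.* Y))))) ℕ.* (4 ℕ.* (K ℕ.* (54 ℕ.* N ℕ.* (54 ℕ.* N ℕ.* (X ℕ.* Y)))))
        ≡⟨ cancel-exponent-identity₂ 54 K N X Y ⟩
      (16 ℕ.* (54 ℕ.* 54 ℕ.* (54 ℕ.* 54))) ℕ.* (K ℕ.* K) ℕ.* (N ℕ.* N ℕ.* (N ℕ.* N)) ℕ.* (X ℕ.* X ℕ.* (Y ℕ.* Y))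
        ≤⟨ ℕₚ.*-monoʳ-≤ ((16 ℕ.* (54 ℕ.* 54 ℕ.* (54 ℕ.* 54))) ℕ.* (K ℕ.* K) ℕ.* (N ℕ.* N ℕ.* (N ℕ.* N))) XY≤ ⟩
      (16 ℕ.* (54 ℕ.* 54 ℕ.* (54 ℕ.* 54))) ℕ.* (K ℕ.* K) ℕ.* (N ℕ.* N ℕ.* (N ℕ.* N)) ℕ.* (8000 ℕ.* (b ℕ.* b ℕ.* b))
        ≡⟨ cancel-exponent-identity₃ (54 ℕ.* 54 ℕ.* (54 ℕ.* 54)) 16 8000 K N b ⟩
      c ℕ.* (16 ℕ.* 8000 ℕ.* (54 ℕ.* 54 ℕ.* (54 ℕ.* 54)) ℕ.* (K ℕ.* K)) ≡⟨ C₀-def c (K ℕ.* K) ⟨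
      c ℕ.* (C₀ ℕ.* (K ℕ.* K)) ∎)
      where
      open ℕₚ.≤-Reasoning
      X = 54 ℕ.^ j
      Y = N ℕ.^ j
      Z = Γ ℕ.^ j
      c = N ℕ.* N ℕ.* (N ℕ.* N) ℕ.* (b ℕ.* b ℕ.* b)
      instance
        N≢0 : ℕ.NonZero N
        N≢0 = ℕ.>-nonZero (ℕₚ.≤-trans (s≤s z≤n) (ℕₚ.≤-trans N₁≥12 N≥))
        b≢0 : ℕ.NonZero b
        b≢0 = ℕ.>-nonZero b≥1
        Γ≢0 : ℕ.NonZero Γ
        Γ≢0 = ℕ.>-nonZero (ℕₚ.≤-trans (s≤s z≤n) 2≤Γ)
      c≢0 : ℕ.NonZero c
      c≢0 = ℕₚ.m*n≢0 _ _ {{ℕₚ.m*n≢0 _ _ {{ℕₚ.m*n≢0 N N}} {{ℕₚ.m*n≢0 N N}}}} {{ℕₚ.m*n≢0 _ _ {{ℕₚ.m*n≢0 b b}}}}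
      Z³≢0 : ℕ.NonZero (Z ℕ.* (Z ℕ.* Z))
      Z³≢0 = ℕₚ.m*n≢0 Z _ {{ℕₚ.m^n≢0 Γ j}} {{ℕₚ.m*n≢0 Z Z {{ℕₚ.m^n≢0 Γ j}} {{ℕₚ.m^n≢0 Γ j}}}}
      XZ≤Y : X ℕ.* X ℕ.* (Z ℕ.* (Z ℕ.* Z)) ℕ.≤ Y
      XZ≤Y = ℕₚ.≤-trans (ℕₚ.≤-reflexive (sym (N₁-power j))) (ℕₚ.^-monoˡ-≤ j N≥)
      XY≤ : X ℕ.* X ℕ.* (Y ℕ.* Y) ℕ.≤ 8000 ℕ.* (b ℕ.* b ℕ.* b)
      XY≤ = ℕₚ.*-cancelˡ-≤ (Z ℕ.* (Z ℕ.* Z)) {{Z³≢0}} (begin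
        Z ℕ.* (Z ℕ.* Z) ℕ.* (X ℕ.* X ℕ.* (Y ℕ.* Y))     ≡⟨ XY≤-l₁ X Y Z ⟩
        X ℕ.* X ℕ.* (Z ℕ.* (Z ℕ.* Z)) ℕ.* (Y ℕ.* Y)     ≤⟨ ℕₚ.*-monoˡ-≤ (Y ℕ.* Y) XZ≤Y ⟩
        Y ℕ.* (Y ℕ.* Y)                                 ≤⟨ ℕₚ.*-mono-≤ Y≤ (ℕₚ.*-mono-≤ Y≤ Y≤) ⟩
        20 ℕ.* (Z ℕ.* b) ℕ.* (20 ℕ.* (Z ℕ.* b) ℕ.* (20 ℕ.* (Z ℕ.* b))) ≡⟨ XY≤-l₂ 20 Z b ⟩
        Z ℕ.* (Z ℕ.* Z) ℕ.* (8000 ℕ.* (b ℕ.* b ℕ.* b)) ∎)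
      h' : N ℕ.* b ℕ.* (N ℕ.* b) ℕ.≤ 4 ℕ.* (K ℕ.* (54 ℕ.* N ℕ.* (54 ℕ.* N ℕ.* (X ℕ.* Y))))
      h' = subst (λ t → N ℕ.* b ℕ.* (N ℕ.* b) ℕ.≤ 4 ℕ.* (K ℕ.* (54 ℕ.* N ℕ.* (54 ℕ.* N ℕ.* t)))) (^-distribʳ-* j 54 N) h

  private
    choose-l₁ : ∀ b x y → b ℕ.* (x ℕ.* y) ≡ x ℕ.* b ℕ.* y
    choose-l₁ b x y = solveℕ (b ∷ x ∷ y ∷ [])

    choose-l₂ : ∀ b x y → b ℕ.* x ℕ.* y ≡ b ℕ.* y ℕ.* x
    choose-l₂ b x y = solveℕ (b ∷ x ∷ y ∷ [])

    T-large-identity : ∀ x b → 20 ℕ.* (x ℕ.* b) ≡ 20 ℕ.* b ℕ.* x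
    T-large-identity x b = solveℕ (x ∷ b ∷ [])

    T-suc-identity : ∀ G x b → 20 ℕ.* (G ℕ.* x ℕ.* b) ≡ G ℕ.* (20 ℕ.* (x ℕ.* b))
    T-suc-identity G x b = solveℕ (G ∷ x ∷ b ∷ [])

    apply-gap-identity : ∀ x y b → 4 ℕ.* (5 ℕ.* (x ℕ.* y) ℕ.* b) ≡ 20 ℕ.* (x ℕ.* b) ℕ.* y
    apply-gap-identity x y b = solveℕ (x ∷ y ∷ b ∷ [])

  -- k is taken minimal with 20 Γ^k b ≤ N^k; of two consecutive fractions at least one differs from a/b.
  near-root-bound : ∀ N a b K → N₁ ℕ.≤ N → 1 ℕ.≤ b → 3 ℕ.* N ℕ.* b ℕ.≤ 4 ℕ.* a →
                    ∣ g (+ N) (+ a) (+ b) ∣ ℕ.≤ K → b ℕ.≤ C₀ ℕ.* (K ℕ.* K)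
  near-root-bound N a b K N≥ b≥1 a≥ gab =
    let j , ¬Tj , Tk = crossing {T} T? ¬T0 (20 ℕ.* b) T-large in conclude j ¬Tj Tk
    where
    open ℕₚ.≤-Reasoning
    T : ℕ → Set
    -- Here 20 = 4 · 5: this is the condition 4Rb ≤ (NQ)² of the gap principle for R = 5 Γ^j N^j,
    -- given NQ ≥ N^j.
    T j = 20 ℕ.* (Γ ℕ.^ j ℕ.* b) ℕ.≤ N ℕ.^ j
    T? : ∀ j → Dec (T j)
    T? j = 20 ℕ.* (Γ ℕ.^ j ℕ.* b) ℕ.≤? N ℕ.^ j
    ¬T0 : ¬ T 0
    ¬T0 h = contradiction (ℕₚ.≤-trans (ℕₚ.*-monoʳ-≤ 20 (ℕₚ.*-monoʳ-≤ 1 b≥1)) h) λ { (s≤s ()) }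
    T-large : T (20 ℕ.* b)
    T-large = begin
      20 ℕ.* (Γ ℕ.^ m ℕ.* b)    ≡⟨ T-large-identity (Γ ℕ.^ m) b ⟩
      20 ℕ.* b ℕ.* Γ ℕ.^ m      ≤⟨ ℕₚ.*-monoˡ-≤ (Γ ℕ.^ m) (ℕₚ.≤-trans (ℕₚ.n≤1+n m) (k+1≤2^k m)) ⟩
      2 ℕ.^ m ℕ.* Γ ℕ.^ m       ≡⟨ ^-distribʳ-* m 2 Γ ⟨
      (2 ℕ.* Γ) ℕ.^ m           ≤⟨ ℕₚ.^-monoˡ-≤ m (ℕₚ.≤-trans N₁≥2Γ N≥) ⟩
      N ℕ.^ m ∎
      where
      m = 20 ℕ.* b
    T-suc : ∀ j → T j → T (suc j)
    T-suc j h = begin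
      20 ℕ.* (Γ ℕ.* Γ ℕ.^ j ℕ.* b)   ≡⟨ T-suc-identity Γ (Γ ℕ.^ j) b ⟩
      Γ ℕ.* (20 ℕ.* (Γ ℕ.^ j ℕ.* b)) ≤⟨ ℕₚ.*-mono-≤ (ℕₚ.≤-trans (ℕₚ.m≤m+n Γ _) (ℕₚ.≤-trans N₁≥2Γ N≥)) h ⟩
      N ℕ.* N ℕ.^ j ∎
    12≤N = ℕₚ.≤-trans N₁≥12 N≥
    1≤N : 1 ℕ.≤ N
    1≤N = ℕₚ.≤-trans (s≤s z≤n) 12≤N
    instance
      N≢0 : ℕ.NonZero N
      N≢0 = ℕ.>-nonZero 1≤N
      b≢0 : ℕ.NonZero b
      b≢0 = ℕ.>-nonZero b≥1
    apply-gap : ∀ j k → T (suc k) → k ℕ.≤ suc j → (φ : Fraction N (suc k)) → a ℕ.* Fraction.Q φ ≢ Fraction.P φ ℕ.* b →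
                N ℕ.* b ℕ.* (N ℕ.* b) ℕ.≤ 4 ℕ.* (K ℕ.* (54 ℕ.* N) ℕ.^ (2 ℕ.+ j))
    apply-gap j k Tk k≤ φ a/b≢ = ℕₚ.≤-trans
      (gap N a b P Q K _ 12≤N Q≥1 a≥ P≥NQ gab small a/b≢ (begin
        4 ℕ.* (5 ℕ.* (Γ ℕ.^ suc k ℕ.* N ℕ.^ suc k) ℕ.* b)   ≡⟨ apply-gap-identity (Γ ℕ.^ suc k) (N ℕ.^ suc k) b ⟩
        20 ℕ.* (Γ ℕ.^ suc k ℕ.* b) ℕ.* N ℕ.^ suc k          ≤⟨ ℕₚ.*-monoˡ-≤ (N ℕ.^ suc k) Tk ⟩
        N ℕ.^ suc k ℕ.* N ℕ.^ suc k                         ≤⟨ ℕₚ.*-mono-≤ NQ≥ NQ≥ ⟩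
        N ℕ.* Q ℕ.* (N ℕ.* Q) ∎))
      (ℕₚ.*-monoʳ-≤ 4 (ℕₚ.*-monoʳ-≤ K (begin
        Q                          ≤⟨ ℕₚ.m≤n*m Q N ⟩
        N ℕ.* Q                    ≤⟨ P≥NQ ⟩
        P                          ≤⟨ P-upper (ℕₚ.≤-trans (ℕₚ.m≤m+n 3 9) 12≤N) ⟩
        (54 ℕ.* N) ℕ.^ suc k       ≤⟨ ℕₚ.^-monoʳ-≤ (54 ℕ.* N) {{ℕₚ.m*n≢0 54 N}} (s≤s k≤) ⟩
        (54 ℕ.* N) ℕ.^ (2 ℕ.+ j)   ∎)))
      where
      open Fraction φ
      open FractionProperties N (suc k) φ
      NQ≥ : N ℕ.^ suc k ℕ.≤ N ℕ.* Q
      NQ≥ = ℕₚ.*-monoʳ-≤ N (Q-lower N k φ)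
      Q≥1 : 1 ℕ.≤ Q
      Q≥1 = ℕₚ.≤-trans (ℕₚ.m^n>0 N k) (Q-lower N k φ)
    conclude : ∀ j → ¬ T j → T (suc j) → b ℕ.≤ C₀ ℕ.* (K ℕ.* K)
    conclude j ¬Tj Tk = cancel-exponent N b K j b≥1 N≥ (ℕₚ.<⇒≤ (ℕₚ.≰⇒> ¬Tj))
      (choose (fraction N (suc j) 1≤N) (fraction N (suc (suc j)) 1≤N))
      where
      open Fraction
      choose : (φ : Fraction N (suc j)) (ψ : Fraction N (suc (suc j))) → N ℕ.* b ℕ.* (N ℕ.* b) ℕ.≤ 4 ℕ.* (K ℕ.* (54 ℕ.* N) ℕ.^ (2 ℕ.+ j))
      choose φ ψ with a ℕ.* Q φ ℕ.≟ P φ ℕ.* b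
      ... | no φ≢ = apply-gap j j Tk (ℕₚ.n≤1+n j) φ φ≢
      ... | yes φ≡ = apply-gap j (suc j) (T-suc (suc j) Tk) ℕₚ.≤-refl ψ λ ψ≡ →
        fractions-independent N (suc j) φ ψ (ℕₚ.*-cancelˡ-≡ _ _ b (begin-equality
          b ℕ.* (P φ ℕ.* Q ψ)      ≡⟨ choose-l₁ b (P φ) (Q ψ) ⟩
          P φ ℕ.* b ℕ.* Q ψ        ≡⟨ cong (ℕ._* Q ψ) φ≡ ⟨
          a ℕ.* Q φ ℕ.* Q ψ        ≡⟨ choose-l₂ a (Q φ) (Q ψ) ⟩
          a ℕ.* Q ψ ℕ.* Q φ        ≡⟨ cong (ℕ._* Q φ) ψ≡ ⟩
          P ψ ℕ.* b ℕ.* Q φ        ≡⟨ choose-l₁ b (P ψ) (Q φ) ⟨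
          b ℕ.* (P ψ ℕ.* Q φ) ∎))

  private
    square-reflects : ∀ {x y} → + 0 ≤ y → x * x ≤ y * y → x ≤ y
    square-reflects {x} {y} 0≤y h with ≤-total x y
    ... | inj₁ x≤y = x≤y
    ... | inj₂ y≤x with x ≟ y
    ...   | yes refl = ≤-refl
    ...   | no x≢y = contradiction (≤-<-trans h y²<x²) (<-irrefl refl)
      where
      y<x : + 1 + y ≤ x
      y<x = i<j⇒suc[i]≤j (≤∧≢⇒< y≤x (λ e → x≢y (sym e)))
      y²<x² : y * y < x * x
      y²<x² = suc[i]≤j⇒i<j step
        where
        step : + 1 + y * y ≤ x * x
        step = by ((dif y<x ⊠ (dif y<x ⊞ k0 2 ⊠ (k0 1 ⊞ 0≤y))) ⊞ k0 2 ⊠ 0≤y) (solve (x ∷ y ∷ []))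

    case-neg : ∀ {N a b} → + 1 ≤ N → + 1 ≤ b → + 3 * b ≤ a →
      a ≤ a * a * a - N * a * a * - b - + 9 * a * - b * - b + N * - b * - b * - b
    case-neg {N} {a} {b} hN hb ha = by
      ((a0 ⊠ dif ha ⊠ (a0 ⊞ k0 3 ⊠ b0)) ⊞ (dif hN ⊠ b0 ⊠ ab ⊠ (a0 ⊞ b0)) ⊞ (dif hb ⊠ ab ⊠ (a0 ⊞ b0)) ⊞ ((dif ha ⊞ dif hb ⊞ dif hb ⊞ k0 1) ⊠ (a0 ⊞ b0)) ⊞ b0)
      (solve (N ∷ a ∷ b ∷ []))
      where
      b0 : + 0 ≤ b
      b0 = ≤-trans (k0 1) hb
      a0 : + 0 ≤ a
      a0 = ≤-trans (k0 3 ⊠ b0) ha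
      ab : + 0 ≤ (a - + 3 * b) + + 2 * b
      ab = dif ha ⊞ k0 2 ⊠ b0

    case-far : ∀ {N a b} → + 0 ≤ N → + 1 ≤ b → + 3 * b ≤ a → + 4 * a ≤ + 3 * N * b →
      + 4 * a ≤ + 4 * - (a * a * a - N * a * a * b - + 9 * a * b * b + N * b * b * b)
    case-far {N} {a} {b} hN hb ha h = by
      ((a0 ⊠ a0 ⊠ dif h) ⊞ (hN ⊠ b0 ⊠ ((dif ha ⊠ (a0 ⊞ k0 3 ⊠ b0)) ⊞ k0 5 ⊠ b0 ⊠ b0)) ⊞ (k0 36 ⊠ a0 ⊠ dif hb ⊠ (b0 ⊞ k0 1)) ⊞ k0 32 ⊠ a0)
      (solve (N ∷ a ∷ b ∷ []))
      where
      b0 : + 0 ≤ b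
      b0 = ≤-trans (k0 1) hb
      a0 : + 0 ≤ a
      a0 = ≤-trans (k0 3 ⊠ b0) ha

    case-beyond : ∀ {N a b} → + 12 ≤ N → + 1 ≤ b → + 2 * N * b ≤ a →
      + 2 * a ≤ + 2 * (a * a * a - N * a * a * b - + 9 * a * b * b + N * b * b * b)
    case-beyond {N} {a} {b} hN hb h = by
      ((a0 ⊠ a0 ⊠ dif h) ⊞ (a0 ⊠ (((dif h ⊞ (k0 2 ⊠ dif hN ⊞ k0 19) ⊠ b0) ⊠ (a0 ⊞ k0 5 ⊠ b0)) ⊞ k0 7 ⊠ dif hb ⊠ (b0 ⊞ k0 1) ⊞ k0 5)) ⊞ k0 2 ⊠ N0 ⊠ b0 ⊠ b0 ⊠ b0)
      (solve (N ∷ a ∷ b ∷ []))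
      where
      b0 : + 0 ≤ b
      b0 = ≤-trans (k0 1) hb
      N0 : + 0 ≤ N
      N0 = ≤-trans (k0 12) hN
      a0 : + 0 ≤ a
      a0 = ≤-trans ((k0 2 ⊠ N0) ⊠ b0) h

  private
    cube≥-identity : ∀ N → + 0 ≡ + 0 * + 0 * + 0 - N * + 0 * + 0 * + 0 - + 9 * + 0 * + 0 * + 0 + N * + 0 * + 0 * + 0
    cube≥-identity N = solve (N ∷ [])

    cube≥-identity₂ : ∀ N {m} → + 0 ≤ m → + 1 + m ≤ (+ 1 + m) * (+ 1 + m) * (+ 1 + m) - N * (+ 1 + m) * (+ 1 + m) * + 0 - + 9 * (+ 1 + m) * + 0 * + 0 + N * + 0 * + 0 * + 0
    cube≥-identity₂ N {m} m0 = by (m0 ⊠ (m0 ⊞ k0 1) ⊠ (m0 ⊞ k0 2)) (solve (N ∷ m ∷ []))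

    cases-identity : ∀ b → (+ 3 * b) * (+ 3 * b) ≡ (+ 3 * - b) * (+ 3 * - b)
    cases-identity b = solve (b ∷ [])

  -- For a ≥ 3|b| the value |g| is at least a unless a/b lies between 3N/4 and 2N, the neighbourhood
  -- of the large root. Only there is the approximation argument required.
  positive-bound : ∀ N a b K → N₁ ℕ.≤ N → 1 ℕ.≤ K → + 0 ≤ a → (+ 3 * b) * (+ 3 * b) ≤ a * a → ∣ g (+ N) a b ∣ ℕ.≤ K →
                   a ≤ + (2 ℕ.* N ℕ.* (C₀ ℕ.* (K ℕ.* K)))
  positive-bound N a b K N≥ K≥1 0≤a h gab = cases b h gab
    where
    12≤N : 12 ℕ.≤ N
    12≤N = ℕₚ.≤-trans N₁≥12 N≥
    K≤ : K ℕ.≤ 2 ℕ.* N ℕ.* (C₀ ℕ.* (K ℕ.* K))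
    K≤ = ℕₚ.≤-trans (ℕₚ.≤-reflexive (sym (trans (ℕₚ.*-identityˡ (1 ℕ.* (K ℕ.* 1))) (trans (ℕₚ.*-identityˡ (K ℕ.* 1)) (ℕₚ.*-identityʳ K)))))
      (ℕₚ.*-mono-≤ {1} (ℕₚ.≤-trans (ℕₚ.≤-trans (s≤s z≤n) 12≤N) (ℕₚ.m≤n*m N 2)) (ℕₚ.*-mono-≤ C₀≥1 (ℕₚ.*-monoʳ-≤ K K≥1)))
    via-K : a ≤ + K → a ≤ + (2 ℕ.* N ℕ.* (C₀ ℕ.* (K ℕ.* K)))
    via-K p = ≤-trans p (+≤+ K≤)
    N1 : + 1 ≤ + N
    N1 = +≤+ (ℕₚ.≤-trans (s≤s z≤n) 12≤N)
    cube≥ : ∀ a → + 0 ≤ a → a ≤ g (+ N) a (+ 0)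
    cube≥ (+ zero) _ = ≤-reflexive (cube≥-identity (+ N))
    cube≥ (+ suc m) _ = cube≥-identity₂ (+ N) (k0 m)
    cases : ∀ b → (+ 3 * b) * (+ 3 * b) ≤ a * a → ∣ g (+ N) a b ∣ ℕ.≤ K → a ≤ + (2 ℕ.* N ℕ.* (C₀ ℕ.* (K ℕ.* K)))
    cases (+ zero) h gab = via-K (≤-trans (cube≥ a 0≤a) (abs≤⇒≤ gab))
    cases -[1+ m ] h gab = via-K (≤-trans (case-neg {+ N} {a} {+ suc m} N1 (+≤+ (s≤s z≤n))
        (square-reflects 0≤a (≤-trans (≤-reflexive (cases-identity (+ suc m))) h))) (abs≤⇒≤ gab))
    cases (+ suc m) h gab with ≤-total (+ 4 * a) (+ 3 * + N * + suc m)
    ... | inj₁ far = via-K (≤-trans (*-cancelˡ-≤-pos a (- g (+ N) a (+ suc m)) (+ 4)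
        (case-far {+ N} {a} {+ suc m} (k0 N) (+≤+ (s≤s z≤n)) (square-reflects 0≤a h) far)) (abs≤⇒-≤ {g (+ N) a (+ suc m)} gab))
    ... | inj₂ near with ≤-total (+ 2 * + N * + suc m) a
    ...   | inj₁ beyond = via-K (≤-trans (*-cancelˡ-≤-pos a (g (+ N) a (+ suc m)) (+ 2)
        (case-beyond {+ N} {a} {+ suc m} (+≤+ 12≤N) (+≤+ (s≤s z≤n)) beyond)) (abs≤⇒≤ gab))
    ...   | inj₂ a≤ = ≤-trans a≤ (≤-trans (≤-reflexive (sym (trans (pos-* (2 ℕ.* N) (suc m)) (cong (_* + suc m) (pos-* 2 N)))))
        (+≤+ (ℕₚ.*-monoʳ-≤ (2 ℕ.* N) (near-root-bound N ∣ a ∣ (suc m) K N≥ (s≤s z≤n)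
          (drop‿+≤+ (subst₂ _≤_ (sym (trans (pos-* (3 ℕ.* N) (suc m)) (cong (_* + suc m) (pos-* 3 N))))
            (trans (cong (+ 4 *_) a≡) (sym (pos-* 4 ∣ a ∣))) near))
          (subst (λ t → ∣ g (+ N) t (+ suc m) ∣ ℕ.≤ K) a≡ gab)))))
      where
      a≡ : a ≡ + ∣ a ∣
      a≡ = sym (0≤i⇒+∣i∣≡i 0≤a)

  f : ℕ → ℤ → ℤ → ℤ
  f n p q = p * p * p - (+ n - + 1) * p * p * q - (+ n + + 2) * p * q * q - q * q * q

  f-g : ∀ n p q → g (+ (2 ℕ.* n ℕ.+ 1)) (+ 2 * p + q) q ≡ + 8 * f n p q
  f-g n p q = trans (cong (λ t → g (t + + 1) (+ 2 * p + q) q) (pos-* 2 n)) (lem (+ n) p q)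
    where
    lem : ∀ n p q → (+ 2 * p + q) * (+ 2 * p + q) * (+ 2 * p + q) - (+ 2 * n + + 1) * (+ 2 * p + q) * (+ 2 * p + q) * q
        - + 9 * (+ 2 * p + q) * q * q + (+ 2 * n + + 1) * q * q * q
        ≡ + 8 * (p * p * p - (n - + 1) * p * p * q - (n + + 2) * p * q * q - q * q * q)
    lem n p q = solve (n ∷ p ∷ q ∷ [])

  private
    cone-bound-identity : ∀ p q → + 2 * - p + - q ≡ + 0 + (+ 0 - (+ 2 * p + q))
    cone-bound-identity p q = solve (p ∷ q ∷ [])

    cone-bound-identity₂ : ∀ p q → (p - q) * (p + + 2 * q) ≡ (- p - - q) * (- p + + 2 * - q)
    cone-bound-identity₂ p q = solve (p ∷ q ∷ [])

    cone-bound-identity₃ : ∀ n p q → - p * - p * - p - (n - + 1) * - p * - p * - q - (n + + 2) * - p * - q * - q - - q * - q * - q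
         ≡ - (p * p * p - (n - + 1) * p * p * q - (n + + 2) * p * q * q - q * q * q)
    cone-bound-identity₃ n p q = solve (n ∷ p ∷ q ∷ [])

    f-rotate-identity : ∀ n p q → - q * - q * - q - (n - + 1) * - q * - q * (p + q) - (n + + 2) * - q * (p + q) * (p + q) - (p + q) * (p + q) * (p + q)
        ≡ - (p * p * p - (n - + 1) * p * p * q - (n + + 2) * p * q * q - q * q * q)
    f-rotate-identity n p q = solve (n ∷ p ∷ q ∷ [])

    trichotomy-identity : ∀ p q → (+ 0 - (p - q)) * (+ 0 - (p + + 2 * q)) ≡ (p - q) * (p + + 2 * q)
    trichotomy-identity p q = solve (p ∷ q ∷ [])

    trichotomy-identity₂ : ∀ p q → (+ 0 - (p + + 2 * q)) * (+ 2 * p + q) ≡ (- q - (p + q)) * (- q + + 2 * (p + q))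
    trichotomy-identity₂ p q = solve (p ∷ q ∷ [])

    trichotomy-identity₃ : ∀ p q → (p - q) * (+ 0 - (+ 2 * p + q)) ≡ (- (p + q) - (- q + (p + q))) * (- (p + q) + + 2 * (- q + (p + q)))
    trichotomy-identity₃ p q = solve (p ∷ q ∷ [])

    trichotomy-identity₄ : ∀ p q → (+ 0 - (p - q)) * (+ 2 * p + q) ≡ (- (p + q) - (- q + (p + q))) * (- (p + q) + + 2 * (- q + (p + q)))
    trichotomy-identity₄ p q = solve (p ∷ q ∷ [])

    trichotomy-identity₅ : ∀ p q → (p + + 2 * q) * (+ 0 - (+ 2 * p + q)) ≡ (- q - (p + q)) * (- q + + 2 * (p + q))
    trichotomy-identity₅ p q = solve (p ∷ q ∷ [])

    ∣q∣≤-identity : ∀ p q → q ≡ p + q - p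
    ∣q∣≤-identity p q = solve (p ∷ q ∷ [])

  private
    M : ℕ → ℕ → ℕ
    M n κ = 2 ℕ.* (2 ℕ.* n ℕ.+ 1) ℕ.* (C₀ ℕ.* (8 ℕ.* κ ℕ.* (8 ℕ.* κ)))

    -- With a = 2p + q and b = q the sign condition says a² ≥ 9b², since a² - 9b² = 4(p - q)(p +
    -- 2q). This keeps a/b away from the two small roots of `g`.
    half-plane : ∀ n p q κ → N₁ ℕ.≤ 2 ℕ.* n ℕ.+ 1 → 1 ℕ.≤ κ → + 0 ≤ + 2 * p + q → + 0 ≤ (p - q) * (p + + 2 * q) →
                 ∣ f n p q ∣ ℕ.≤ κ → ∣ p ∣ ℕ.≤ M n κ × ∣ q ∣ ℕ.≤ M n κ
    half-plane n p q κ N≥ κ≥1 0≤a cone h = ≤⇒abs≤ p≤ -p≤ , ≤⇒abs≤ q≤ -q≤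
      where
      N = 2 ℕ.* n ℕ.+ 1
      a≤M : + 2 * p + q ≤ + M n κ
      a≤M = positive-bound N (+ 2 * p + q) q (8 ℕ.* κ) N≥ (ℕₚ.≤-trans κ≥1 (ℕₚ.m≤n*m κ 8)) 0≤a
        (by (k0 4 ⊠ cone) (solve (p ∷ q ∷ [])))
        (ℕₚ.≤-trans (ℕₚ.≤-reflexive (trans (cong ∣_∣ (f-g n p q)) (abs-* (+ 8) (f n p q)))) (ℕₚ.*-monoʳ-≤ 8 h))
      3q≤a : + 3 * q ≤ + 2 * p + q
      3q≤a = square-reflects 0≤a (by (k0 4 ⊠ cone) (solve (p ∷ q ∷ [])))
      -3q≤a : + 3 * - q ≤ + 2 * p + q
      -3q≤a = square-reflects 0≤a (by (k0 4 ⊠ cone) (solve (p ∷ q ∷ [])))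
      p≤ : p ≤ + M n κ
      p≤ = ≤-trans (*-cancelˡ-≤-pos p (+ 2 * p + q) (+ 6) (by (dif -3q≤a ⊞ k0 2 ⊠ 0≤a) (solve (p ∷ q ∷ [])))) a≤M
      -p≤ : - p ≤ + M n κ
      -p≤ = ≤-trans (*-cancelˡ-≤-pos (- p) (+ 2 * p + q) (+ 6) (by (dif 3q≤a ⊞ k0 8 ⊠ 0≤a) (solve (p ∷ q ∷ [])))) a≤M
      q≤ : q ≤ + M n κ
      q≤ = ≤-trans (*-cancelˡ-≤-pos q (+ 2 * p + q) (+ 3) (by (dif 3q≤a ⊞ k0 2 ⊠ 0≤a) (solve (p ∷ q ∷ [])))) a≤M
      -q≤ : - q ≤ + M n κ
      -q≤ = ≤-trans (*-cancelˡ-≤-pos (- q) (+ 2 * p + q) (+ 3) (by (dif -3q≤a ⊞ k0 2 ⊠ 0≤a) (solve (p ∷ q ∷ [])))) a≤M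

    cone-bound : ∀ n p q κ → N₁ ℕ.≤ 2 ℕ.* n ℕ.+ 1 → 1 ℕ.≤ κ → + 0 ≤ (p - q) * (p + + 2 * q) →
                 ∣ f n p q ∣ ℕ.≤ κ → ∣ p ∣ ℕ.≤ M n κ × ∣ q ∣ ℕ.≤ M n κ
    cone-bound n p q κ N≥ κ≥1 cone h with ≤-total (+ 0) (+ 2 * p + q)
    ... | inj₁ 0≤a = half-plane n p q κ N≥ κ≥1 0≤a cone h
    ... | inj₂ a≤0 =
      let P , Q = half-plane n (- p) (- q) κ N≥ κ≥1 (by (dif a≤0) (cone-bound-identity p q)) (≤-trans cone (≤-reflexive (cone-bound-identity₂ p q)))
                    (ℕₚ.≤-trans (ℕₚ.≤-reflexive (trans (cong ∣_∣ (cone-bound-identity₃ (+ n) p q)) (∣-i∣≡∣i∣ (f n p q)))) h)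
      in subst (ℕ._≤ M n κ) (∣-i∣≡∣i∣ p) P , subst (ℕ._≤ M n κ) (∣-i∣≡∣i∣ q) Q

    -- On p/q this substitution is λ ↦ -1/(λ + 1), the cyclic symmetry of the roots, which can move
    -- any pair towards the large root.
    f-rotate : ∀ n p q → f n (- q) (p + q) ≡ - f n p q
    f-rotate n p q = f-rotate-identity (+ n) p q

    rotated≤ : ∀ n p q {κ} → ∣ f n p q ∣ ℕ.≤ κ → ∣ f n (- q) (p + q) ∣ ℕ.≤ κ
    rotated≤ n p q h = ℕₚ.≤-trans (ℕₚ.≤-reflexive (trans (cong ∣_∣ (f-rotate n p q)) (∣-i∣≡∣i∣ (f n p q)))) h

    -- With X = p − q, Y = p + 2q and Z = X + Y, one of XY, −YZ, −XZ is nonnegative.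
    trichotomy : ∀ p q → + 0 ≤ (p - q) * (p + + 2 * q) ⊎ + 0 ≤ (- q - (p + q)) * (- q + + 2 * (p + q))
                       ⊎ + 0 ≤ (- (p + q) - (- q + (p + q))) * (- (p + q) + + 2 * (- q + (p + q)))
    trichotomy p q with ≤-total (+ 0) (p - q) | ≤-total (+ 0) (p + + 2 * q) | ≤-total (+ 0) (+ 2 * p + q)
    ... | inj₁ x | inj₁ y | _ = inj₁ (x ⊠ y)
    ... | inj₂ x | inj₂ y | _ = inj₁ (subst (+ 0 ≤_) (trichotomy-identity p q) (dif x ⊠ dif y))
    ... | inj₁ x | inj₂ y | inj₁ z = inj₂ (inj₁ (subst (+ 0 ≤_) (trichotomy-identity₂ p q) (dif y ⊠ z)))
    ... | inj₁ x | inj₂ y | inj₂ z = inj₂ (inj₂ (subst (+ 0 ≤_) (trichotomy-identity₃ p q) (x ⊠ dif z)))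
    ... | inj₂ x | inj₁ y | inj₁ z = inj₂ (inj₂ (subst (+ 0 ≤_) (trichotomy-identity₄ p q) (dif x ⊠ z)))
    ... | inj₂ x | inj₁ y | inj₂ z = inj₂ (inj₁ (subst (+ 0 ≤_) (trichotomy-identity₅ p q) (y ⊠ dif z)))

    ∣q∣≤ : ∀ p q {m} → ∣ p ∣ ℕ.≤ m → ∣ p + q ∣ ℕ.≤ m → ∣ q ∣ ℕ.≤ m ℕ.+ m
    ∣q∣≤ p q {m} h k = ℕₚ.≤-trans (ℕₚ.≤-reflexive (cong ∣_∣ (∣q∣≤-identity p q)))
      (ℕₚ.≤-trans (∣i-j∣≤∣i∣+∣j∣ (p + q) p) (ℕₚ.+-mono-≤ k h))

  opaque
    C₁ : ℕ
    C₁ = 256 ℕ.* C₀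

    C₁-def : ∀ x → C₁ ℕ.* x ≡ 256 ℕ.* C₀ ℕ.* x
    C₁-def x = refl

  private
    2M≤-identity : ∀ N c k → 2 ℕ.* N ℕ.* (c ℕ.* (8 ℕ.* k ℕ.* (8 ℕ.* k))) ℕ.+ 2 ℕ.* N ℕ.* (c ℕ.* (8 ℕ.* k ℕ.* (8 ℕ.* k)))
        ≡ 256 ℕ.* c ℕ.* (N ℕ.* (k ℕ.* k))
    2M≤-identity N c k = solveℕ (N ∷ c ∷ k ∷ [])

    weak-identity : ∀ p q → - q + (p + q) ≡ p
    weak-identity p q = solve (p ∷ q ∷ [])

  -- One of the three rotated pairs lies in the cone of `cone-bound`, and undoing the rotation at
  -- most doubles the bound. This doubling together with the factor 8² from 8f = g explains the 256
  -- in `C₁`.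
  form-bound : ∀ n p q κ → N₁ ℕ.≤ 2 ℕ.* n ℕ.+ 1 → 1 ℕ.≤ κ → ∣ f n p q ∣ ℕ.≤ κ →
               let m = C₁ ℕ.* ((2 ℕ.* n ℕ.+ 1) ℕ.* (κ ℕ.* κ)) in ∣ p ∣ ℕ.≤ m × ∣ q ∣ ℕ.≤ m
  form-bound n p q κ N≥ κ≥1 h =
    let p≤ , q≤ = weak in ℕₚ.≤-trans p≤ 2M≤ , ℕₚ.≤-trans q≤ 2M≤
    where
    m = M n κ
    2M≤ : m ℕ.+ m ℕ.≤ C₁ ℕ.* ((2 ℕ.* n ℕ.+ 1) ℕ.* (κ ℕ.* κ))
    2M≤ = ℕₚ.≤-reflexive (trans (2M≤-identity (2 ℕ.* n ℕ.+ 1) C₀ κ) (sym (C₁-def _)))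
    widen : ∀ {x} → x ℕ.≤ m → x ℕ.≤ m ℕ.+ m
    widen x≤ = ℕₚ.≤-trans x≤ (ℕₚ.m≤m+n m m)
    weak : ∣ p ∣ ℕ.≤ m ℕ.+ m × ∣ q ∣ ℕ.≤ m ℕ.+ m
    weak with trichotomy p q
    ... | inj₁ c = let x , y = cone-bound n p q κ N≥ κ≥1 c h in widen x , widen y
    ... | inj₂ (inj₁ c) =
      let x , y = cone-bound n (- q) (p + q) κ N≥ κ≥1 c (rotated≤ n p q h)
          q≤ = subst (ℕ._≤ m) (∣-i∣≡∣i∣ q) x
      in ∣q∣≤ q p q≤ (subst (λ t → ∣ t ∣ ℕ.≤ m) (+-comm p q) y) , widen q≤
    ... | inj₂ (inj₂ c) =
      let x , y = cone-bound n (- (p + q)) (- q + (p + q)) κ N≥ κ≥1 c (rotated≤ n (- q) (p + q) (rotated≤ n p q h))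
          p≤ = subst (λ t → ∣ t ∣ ℕ.≤ m) (weak-identity p q) y
      in widen p≤ , ∣q∣≤ p q p≤ (subst (ℕ._≤ m) (∣-i∣≡∣i∣ (p + q)) x)

  f-homogeneous : ∀ n k p q → f n (k * p) (k * q) ≡ k * k * k * f n p q
  f-homogeneous n k p q = lem (+ n) k p q
    where
    lem : ∀ n k p q → (k * p) * (k * p) * (k * p) - (n - + 1) * (k * p) * (k * p) * (k * q) - (n + + 2) * (k * p) * (k * q) * (k * q) - (k * q) * (k * q) * (k * q)
        ≡ k * k * k * (p * p * p - (n - + 1) * p * p * q - (n + + 2) * p * q * q - q * q * q)
    lem n k p q = solve (n ∷ k ∷ p ∷ q ∷ [])

-- Rational arithmetic and positivity certificates.

module Rationals where
  open import Data.Nat as ℕ using (ℕ; zero; suc)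
  import Data.Nat.Coprimality as C
  open import Data.Integer as ℤ using (ℤ; +_; -[1+_])
  import Data.Integer.Properties as ℤₚ
  open import Data.List using ([]; _∷_)
  open import Data.Sum using (inj₁; inj₂)
  open import Data.Rational
  open import Data.Rational.Properties
  open import Data.Rational.Unnormalised as ℚᵘ using (*≡*; *≤*)
  import Data.Rational.Unnormalised.Properties as ℚᵘₚ
  open import Level using (0ℓ)
  open import Relation.Nullary.Decidable using (dec⇒maybe)
  open import Relation.Binary.PropositionalEquality
  import Tactic.RingSolver.Core.AlmostCommutativeRing as ACR
  import Data.Integer.Tactic.RingSolver as ℤSolver

  ℚring : ACR.AlmostCommutativeRing 0ℓ 0ℓ
  ℚring = ACR.fromCommutativeRing +-*-commutativeRing (λ x → dec⇒maybe (0ℚ ≟ x))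

  -- Literal constants, which reduce to numerals so that ring identities can compute with them; `ι`
  -- and `ν` embed variable integers and stay opaque.
  # : ℕ → ℚ
  # n = mkℚ (+ n) 0 (C.sym (C.1-coprimeTo n))

  opaque
    ι : ℤ → ℚ
    ι z = mkℚ z 0 (C.sym (C.1-coprimeTo ℤ.∣ z ∣))

    ι-# : ∀ n → ι (+ n) ≡ # n
    ι-# n = refl

    ι-+ : ∀ a b → ι (a ℤ.+ b) ≡ ι a + ι b
    ι-+ a b = toℚᵘ-injective (ℚᵘₚ.≃-trans (*≡* (lem a b)) (ℚᵘₚ.≃-sym (toℚᵘ-homo-+ (ι a) (ι b))))
      where
      lem : ∀ a b → (a ℤ.+ b) ℤ.* + 1 ≡ (a ℤ.* + 1 ℤ.+ b ℤ.* + 1) ℤ.* + 1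
      lem a b = ℤSolver.solve (a ∷ b ∷ [])

    ι-* : ∀ a b → ι (a ℤ.* b) ≡ ι a * ι b
    ι-* a b = toℚᵘ-injective (ℚᵘₚ.≃-trans (*≡* refl) (ℚᵘₚ.≃-sym (toℚᵘ-homo-* (ι a) (ι b))))

    ι-neg : ∀ a → ι (ℤ.- a) ≡ - ι a
    ι-neg a = toℚᵘ-injective (ℚᵘₚ.≃-trans (*≡* refl) (ℚᵘₚ.≃-sym (toℚᵘ-homo‿- (ι a))))

    ι-≤ : ∀ {a b} → a ℤ.≤ b → ι a ≤ ι b
    ι-≤ {a} {b} h = *≤* (subst₂ ℤ._≤_ (sym (ℤₚ.*-identityʳ a)) (sym (ℤₚ.*-identityʳ b)) h)

    ι-abs : ∀ a → ∣ ι a ∣ ≡ ι (+ ℤ.∣ a ∣)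
    ι-abs (+ n) = refl
    ι-abs -[1+ n ] = refl

  ι-sub : ∀ a b → ι (a ℤ.- b) ≡ ι a - ι b
  ι-sub a b = trans (ι-+ a (ℤ.- b)) (cong (λ t → ι a + t) (ι-neg b))

  ν : ℕ → ℚ
  ν n = ι (+ n)

  ν≤ : ∀ {m n} → m ℕ.≤ n → ν m ≤ ν n
  ν≤ h = ι-≤ (ℤ.+≤+ h)

  #≤ : ∀ {m n} → m ℕ.≤ n → # m ≤ # n
  #≤ h = subst₂ _≤_ (ι-# _) (ι-# _) (ν≤ h)

  ν-+ : ∀ m n → ν (m ℕ.+ n) ≡ ν m + ν n
  ν-+ m n = ι-+ (+ m) (+ n)

  ν-* : ∀ m n → ν (m ℕ.* n) ≡ ν m * ν n
  ν-* m n = trans (cong ι (ℤₚ.pos-* m n)) (ι-* (+ m) (+ n))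

  by : ∀ {a b d} → 0ℚ ≤ d → b ≡ a + d → a ≤ b
  by {a} h e = subst₂ _≤_ (+-identityʳ a) (sym e) (+-monoʳ-≤ a h)

  by< : ∀ {a b d} → 0ℚ < d → b ≡ a + d → a < b
  by< {a} h e = subst₂ _<_ (+-identityʳ a) (sym e) (+-monoʳ-< a h)

  dif : ∀ {a b} → a ≤ b → 0ℚ ≤ b - a
  dif {a} {b} h = subst (_≤ b - a) (+-inverseʳ a) (+-monoˡ-≤ (- a) h)

  dif< : ∀ {a b} → a < b → 0ℚ < b - a
  dif< {a} {b} h = subst (_< b - a) (+-inverseʳ a) (+-monoˡ-< (- a) h)

  infixr 6 _⊞_ _⊞<_
  infixr 7 _⊠_ _⊠<_

  _⊞_ : ∀ {x y} → 0ℚ ≤ x → 0ℚ ≤ y → 0ℚ ≤ x + y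
  _⊞_ {x} {y} h k = subst (_≤ x + y) (+-identityʳ 0ℚ) (+-mono-≤ h k)

  _⊞<_ : ∀ {x y} → 0ℚ < x → 0ℚ ≤ y → 0ℚ < x + y
  _⊞<_ {x} {y} h k = subst (_< x + y) (+-identityʳ 0ℚ) (+-mono-<-≤ h k)

  _⊠_ : ∀ {x y} → 0ℚ ≤ x → 0ℚ ≤ y → 0ℚ ≤ x * y
  _⊠_ {x} {y} h k = subst (_≤ x * y) (*-zeroʳ x) (*-monoˡ-≤-nonNeg x {{nonNegative h}} k)

  _⊠<_ : ∀ {x y} → 0ℚ < x → 0ℚ < y → 0ℚ < x * y
  _⊠<_ {x} {y} h k = subst (_< x * y) (*-zeroʳ x) (*-monoʳ-<-pos x {{positive h}} k)

  k0 : ∀ n → 0ℚ ≤ # n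
  k0 n = #≤ ℕ.z≤n

  ν0 : ∀ n → 0ℚ ≤ ν n
  ν0 n = subst (_≤ ν n) (ι-# 0) (ν≤ ℕ.z≤n)

  ν0< : ∀ {n} → 1 ℕ.≤ n → 0ℚ < ν n
  ν0< {n} h = <-≤-trans (positive⁻¹ (# 1)) (subst (_≤ ν n) (ι-# 1) (ν≤ h))

  k0< : ∀ n → 0ℚ < # (suc n)
  k0< n = positive⁻¹ (# (suc n))

  cancel≤ : ∀ {a b} c → 0ℚ < c → c * a ≤ c * b → a ≤ b
  cancel≤ c h = *-cancelˡ-≤-pos c {{positive h}}

  lc1 : ∀ {a b p q} c → p ≡ q → a ≡ b + c * (p - q) → a ≡ b
  lc1 {b = b} {p} c refl e =
    trans e (trans (cong (λ t → b + c * t) (+-inverseʳ p)) (trans (cong (λ t → b + t) (*-zeroʳ c)) (+-identityʳ b)))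

  lc2 : ∀ {a b p q r s} c d → p ≡ q → r ≡ s → a ≡ b + c * (p - q) + d * (r - s) → a ≡ b
  lc2 c d h k e = lc1 c h (lc1 d k e)

  lc3 : ∀ {a b p q r s u v} c d f → p ≡ q → r ≡ s → u ≡ v → a ≡ b + c * (p - q) + d * (r - s) + f * (u - v) → a ≡ b
  lc3 c d f h k l e = lc2 c d h k (lc1 f l e)

  abs≤ : ∀ {x m} → x ≤ m → - x ≤ m → ∣ x ∣ ≤ m
  abs≤ {x} h k with ∣p∣≡p∨∣p∣≡-p x
  ... | inj₁ e = ≤-trans (≤-reflexive e) h
  ... | inj₂ e = ≤-trans (≤-reflexive e) k

  *-mono-abs : ∀ {x y m k} → ∣ x ∣ ≤ m → ∣ y ∣ ≤ k → ∣ x * y ∣ ≤ m * k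
  *-mono-abs {x} {y} {m} {k} h l = ≤-trans (≤-reflexive (∣p*q∣≡∣p∣*∣q∣ x y))
    (≤-trans (*-monoʳ-≤-nonNeg ∣ y ∣ {{∣-∣-nonNeg y}} h) (*-monoˡ-≤-nonNeg m {{nonNegative (≤-trans (0≤∣p∣ x) h)}} l))

  +-mono-abs : ∀ {x y m k} → ∣ x ∣ ≤ m → ∣ y ∣ ≤ k → ∣ x + y ∣ ≤ m + k
  +-mono-abs {x} {y} h l = ≤-trans (∣p+q∣≤∣p∣+∣q∣ x y) (+-mono-≤ h l)

  *-mono : ∀ {x y m k} → 0ℚ ≤ x → 0ℚ ≤ k → x ≤ m → y ≤ k → x * y ≤ m * k
  *-mono {x} {y} {m} {k} x0 k0 h l = ≤-trans (*-monoˡ-≤-nonNeg x {{nonNegative x0}} l) (*-monoʳ-≤-nonNeg k {{nonNegative k0}} h)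

  -- In pw x xi k the argument xi stands for the inverse of x.
  pn : ℚ → ℕ → ℚ
  pn x zero = 1ℚ
  pn x (suc k) = x * pn x k

  pw : (x xi : ℚ) → ℤ → ℚ
  pw x xi (+ k) = pn x k
  pw x xi -[1+ k ] = pn xi (suc k)

-- Uniformly bounded functions on a set of points.

module Bounds where
  open import Data.Nat as ℕ using (zero; suc)
  open import Data.Integer as ℤ using (+_; -[1+_])
  open import Data.Product using (∃-syntax; _,_)
  open import Data.Rational
  open import Data.Rational.Properties
  open import Relation.Binary.PropositionalEquality
  open Rationals

  -- Uniformity over all points is essential: these functions occur as coefficients of an error that
  -- has to disappear as the point approaches a root.
  Bounded : {D : Set} → (D → ℚ) → Set
  Bounded h = ∃[ R ] (∀ P → ∣ h P ∣ ≤ R)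

  module _ {D : Set} where
    b-const : ∀ c → Bounded (λ (_ : D) → c)
    b-const c = ∣ c ∣ , λ _ → ≤-refl

    b-+ : ∀ {g h : D → ℚ} → Bounded g → Bounded h → Bounded (λ P → g P + h P)
    b-+ (R , p) (S , q) = R + S , λ P → +-mono-abs (p P) (q P)

    b-* : ∀ {g h : D → ℚ} → Bounded g → Bounded h → Bounded (λ P → g P * h P)
    b-* (R , p) (S , q) = R * S , λ P → *-mono-abs (p P) (q P)

    b-neg : ∀ {h : D → ℚ} → Bounded h → Bounded (λ P → - h P)
    b-neg {h} (R , p) = R , λ P → ≤-trans (≤-reflexive (∣-p∣≡∣p∣ (h P))) (p P)

    b-pn : ∀ {h : D → ℚ} → Bounded h → ∀ k → Bounded (λ P → pn (h P) k)
    b-pn p zero = b-const 1ℚ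
    b-pn p (suc k) = b-* p (b-pn p k)

    b-pw : ∀ {h hi : D → ℚ} → Bounded h → Bounded hi → ∀ k → Bounded (λ P → pw (h P) (hi P) k)
    b-pw p q (+ k) = b-pn p k
    b-pw p q -[1+ k ] = b-pn q (suc k)


  b-∘ : ∀ {D D' : Set} {h : D → ℚ} (g : D' → D) → Bounded h → Bounded (λ P → h (g P))
  b-∘ g (R , p) = R , λ P → p (g P)

-- Evaluation of ℤ[λ₀] at rational points.

module Points where
  open import Data.Nat as ℕ using (ℕ; zero; suc)
  open import Data.Integer as ℤ using (ℤ; +_; -[1+_])
  open import Data.List using ([]; _∷_)
  open import Data.Product using (∃-syntax; _×_; _,_)
  open import Data.Rational hiding (neg)
  open import Data.Rational.Properties
  open import Relation.Binary.PropositionalEquality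
  open import Tactic.RingSolver using (solve)
  open import Defs renaming (ι to ιK)
  open Rationals
  open Bounds

  -- A point comes with the reciprocals of x and x + 1, because λ₀ and λ₀ + 1 are the units whose
  -- negative powers occur. The bound n + 2 serves near all three roots.
  record Pt (n : ℕ) : Set where
    field
      x xi y : ℚ
      x·xi : x * xi ≡ 1ℚ
      x+1·y : (x + 1ℚ) * y ≡ 1ℚ
      x≤ : ∣ x ∣ ≤ ν (n ℕ.+ 2)
      xi≤ : ∣ xi ∣ ≤ ν (n ℕ.+ 2)
      x+1≤ : ∣ x + 1ℚ ∣ ≤ ν (n ℕ.+ 2)
      y≤ : ∣ y ∣ ≤ ν (n ℕ.+ 2)

  module Evaluate (n : ℕ) where
    open Pt

    N : ℚ
    N = ν n

    φ : Pt n → ℚ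
    φ P = x P * x P * x P - (N - 1ℚ) * (x P * x P) - (N + # 2) * x P - 1ℚ

    ev : Pt n → K → ℚ
    ev P ⟨ a , b , c ⟩ = ι a + ι b * x P + ι c * (x P * x P)

    Fun : Set
    Fun = Pt n → ℚ

    b-x : Bounded x
    b-x = ν (n ℕ.+ 2) , x≤

    b-xi : Bounded xi
    b-xi = ν (n ℕ.+ 2) , xi≤

    b-x+1 : Bounded (λ P → x P + 1ℚ)
    b-x+1 = ν (n ℕ.+ 2) , x+1≤

    b-y : Bounded y
    b-y = ν (n ℕ.+ 2) , y≤

    b-φ : Bounded φ
    b-φ = b-+ (b-+ (b-+ (b-* (b-* b-x b-x) b-x) (b-neg (b-* (b-const (N - 1ℚ)) (b-* b-x b-x))))
      (b-neg (b-* (b-const (N + # 2)) b-x))) (b-const (- 1ℚ))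

    infix 4 _≈_
    -- Evaluation at a point that is not a root is not multiplicative on ℤ[X]/(f_n). It is so modulo
    -- bounded multiples of `φ`, the value of f_n, and this relation records values modulo such
    -- multiples.
    data _≈_ (β : K) (r : Fun) : Set where
      mk≈ : ∃[ E ] (Bounded E × (∀ P → ev P β ≡ r P + φ P * E P)) → β ≈ r

    ev-⊕ : ∀ P β γ → ev P (β ⊕ γ) ≡ ev P β + ev P γ
    ev-⊕ P ⟨ a , b , c ⟩ ⟨ a' , b' , c' ⟩ =
      trans (cong₂ _+_ (cong₂ _+_ (ι-+ a a') (cong (_* x P) (ι-+ b b'))) (cong (_* (x P * x P)) (ι-+ c c')))
        (lem (ι a) (ι b) (ι c) (ι a') (ι b') (ι c') (x P))
      where
      lem : ∀ a b c a' b' c' x → a + a' + (b + b') * x + (c + c') * (x * x) ≡ a + b * x + c * (x * x) + (a' + b' * x + c' * (x * x))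
      lem a b c a' b' c' x = solve (a ∷ b ∷ c ∷ a' ∷ b' ∷ c' ∷ x ∷ []) ℚring

    ev-neg : ∀ P β → ev P (neg β) ≡ - ev P β
    ev-neg P ⟨ a , b , c ⟩ =
      trans (cong₂ _+_ (cong₂ _+_ (ι-neg a) (cong (_* x P) (ι-neg b))) (cong (_* (x P * x P)) (ι-neg c)))
        (lem (ι a) (ι b) (ι c) (x P))
      where
      lem : ∀ a b c x → - a + - b * x + - c * (x * x) ≡ - (a + b * x + c * (x * x))
      lem a b c x = solve (a ∷ b ∷ c ∷ x ∷ []) ℚring

    ev-ι : ∀ P a → ev P (ιK a) ≡ ι a
    ev-ι P a = trans (cong (λ z → ι a + z * x P + z * (x P * x P)) (ι-# 0)) (lem (ι a) (x P))
      where
      lem : ∀ a x → a + 0ℚ * x + 0ℚ * (x * x) ≡ a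
      lem a x = solve (a ∷ x ∷ []) ℚring

    private
      ι-p : ι (+ n ℤ.- + 1) ≡ N - 1ℚ
      ι-p = trans (ι-sub (+ n) (+ 1)) (cong (λ t → N - t) (ι-# 1))

      ι-q : ι (+ n ℤ.+ + 2) ≡ N + # 2
      ι-q = trans (ι-+ (+ n) (+ 2)) (cong (λ t → N + t) (ι-# 2))

      e₁ : ∀ a b c d → ι (a ℤ.* b ℤ.+ c ℤ.* d) ≡ ι a * ι b + ι c * ι d
      e₁ a b c d = trans (ι-+ _ _) (cong₂ _+_ (ι-* a b) (ι-* c d))

      e₂ : ∀ a b c d u v → ι (a ℤ.* b ℤ.+ c ℤ.* d ℤ.+ u ℤ.* v) ≡ ι a * ι b + ι c * ι d + ι u * ι v
      e₂ a b c d u v = trans (ι-+ _ _) (cong₂ _+_ (e₁ a b c d) (ι-* u v))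

    -- The quotient, evaluated at the point, when the product of two quadratic representatives is
    -- divided by f_n.
    overflow : K → K → Fun
    overflow ⟨ a₀ , a₁ , a₂ ⟩ ⟨ b₀ , b₁ , b₂ ⟩ P =
      ι a₁ * ι b₂ + ι a₂ * ι b₁ + ι a₂ * ι b₂ * (N - 1ℚ + x P)

    ev-mul : ∀ P β γ → ev P (mul n β γ) ≡ ev P β * ev P γ - φ P * overflow β γ P
    ev-mul P ⟨ a₀ , a₁ , a₂ ⟩ ⟨ b₀ , b₁ , b₂ ⟩ =
      trans (cong₂ _+_ (cong₂ _+_ c₀ (cong (_* x P) c₁)) (cong (_* (x P * x P)) c₂))
        (lem N (x P) (ι a₀) (ι a₁) (ι a₂) (ι b₀) (ι b₁) (ι b₂))
      where
      E₃ = a₁ ℤ.* b₂ ℤ.+ a₂ ℤ.* b₁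
      E₄ = a₂ ℤ.* b₂
      ιE₃ : ι E₃ ≡ ι a₁ * ι b₂ + ι a₂ * ι b₁
      ιE₃ = e₁ a₁ b₂ a₂ b₁
      ιE₄ : ι E₄ ≡ ι a₂ * ι b₂
      ιE₄ = ι-* a₂ b₂
      c₀ : ι (a₀ ℤ.* b₀ ℤ.+ E₃ ℤ.+ (+ n ℤ.- + 1) ℤ.* E₄) ≡ ι a₀ * ι b₀ + (ι a₁ * ι b₂ + ι a₂ * ι b₁) + (N - 1ℚ) * (ι a₂ * ι b₂)
      c₀ = trans (ι-+ _ _) (cong₂ _+_ (trans (ι-+ _ _) (cong₂ _+_ (ι-* a₀ b₀) ιE₃))
        (trans (ι-* _ E₄) (cong₂ _*_ ι-p ιE₄)))
      c₁ : ι (a₀ ℤ.* b₁ ℤ.+ a₁ ℤ.* b₀ ℤ.+ (+ n ℤ.+ + 2) ℤ.* E₃ ℤ.+ ((+ n ℤ.- + 1) ℤ.* (+ n ℤ.+ + 2) ℤ.+ + 1) ℤ.* E₄)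
         ≡ ι a₀ * ι b₁ + ι a₁ * ι b₀ + (N + # 2) * (ι a₁ * ι b₂ + ι a₂ * ι b₁) + ((N - 1ℚ) * (N + # 2) + 1ℚ) * (ι a₂ * ι b₂)
      c₁ = trans (ι-+ _ _) (cong₂ _+_ (trans (ι-+ _ _) (cong₂ _+_ (e₁ a₀ b₁ a₁ b₀) (trans (ι-* _ E₃) (cong₂ _*_ ι-q ιE₃))))
        (trans (ι-* _ E₄) (cong₂ _*_ (trans (ι-+ _ _) (cong₂ _+_ (trans (ι-* _ _) (cong₂ _*_ ι-p ι-q)) (ι-# 1))) ιE₄)))
      c₂ : ι (a₀ ℤ.* b₂ ℤ.+ a₁ ℤ.* b₁ ℤ.+ a₂ ℤ.* b₀ ℤ.+ (+ n ℤ.- + 1) ℤ.* E₃ ℤ.+ ((+ n ℤ.- + 1) ℤ.* (+ n ℤ.- + 1) ℤ.+ (+ n ℤ.+ + 2)) ℤ.* E₄)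
         ≡ ι a₀ * ι b₂ + ι a₁ * ι b₁ + ι a₂ * ι b₀ + (N - 1ℚ) * (ι a₁ * ι b₂ + ι a₂ * ι b₁) + ((N - 1ℚ) * (N - 1ℚ) + (N + # 2)) * (ι a₂ * ι b₂)
      c₂ = trans (ι-+ _ _) (cong₂ _+_ (trans (ι-+ _ _) (cong₂ _+_ (e₂ a₀ b₂ a₁ b₁ a₂ b₀) (trans (ι-* _ E₃) (cong₂ _*_ ι-p ιE₃))))
        (trans (ι-* _ E₄) (cong₂ _*_ (trans (ι-+ _ _) (cong₂ _+_ (trans (ι-* _ _) (cong₂ _*_ ι-p ι-p)) ι-q)) ιE₄)))
      lem : ∀ N x a₀ a₁ a₂ b₀ b₁ b₂ →
        a₀ * b₀ + (a₁ * b₂ + a₂ * b₁) + (N - 1ℚ) * (a₂ * b₂)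
          + (a₀ * b₁ + a₁ * b₀ + (N + # 2) * (a₁ * b₂ + a₂ * b₁) + ((N - 1ℚ) * (N + # 2) + 1ℚ) * (a₂ * b₂)) * x
          + (a₀ * b₂ + a₁ * b₁ + a₂ * b₀ + (N - 1ℚ) * (a₁ * b₂ + a₂ * b₁) + ((N - 1ℚ) * (N - 1ℚ) + (N + # 2)) * (a₂ * b₂)) * (x * x)
        ≡ (a₀ + a₁ * x + a₂ * (x * x)) * (b₀ + b₁ * x + b₂ * (x * x))
          - (x * x * x - (N - 1ℚ) * (x * x) - (N + # 2) * x - 1ℚ) * (a₁ * b₂ + a₂ * b₁ + a₂ * b₂ * (N - 1ℚ + x))
      lem N x a₀ a₁ a₂ b₀ b₁ b₂ = solve (N ∷ x ∷ a₀ ∷ a₁ ∷ a₂ ∷ b₀ ∷ b₁ ∷ b₂ ∷ []) ℚring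

    b-overflow : ∀ β γ → Bounded (overflow β γ)
    b-overflow ⟨ a₀ , a₁ , a₂ ⟩ ⟨ b₀ , b₁ , b₂ ⟩ =
      b-+ (b-const (ι a₁ * ι b₂ + ι a₂ * ι b₁)) (b-* (b-const (ι a₂ * ι b₂)) (b-+ (b-const (N - 1ℚ)) b-x))

    ≈-ι : ∀ a → ιK a ≈ (λ _ → ι a)
    ≈-ι a = mk≈ ((λ _ → 0ℚ) , b-const 0ℚ , λ P → trans (ev-ι P a) (lem (ι a) (φ P)))
      where
      lem : ∀ a f → a ≡ a + f * 0ℚ
      lem a f = solve (a ∷ f ∷ []) ℚring

    ≈-neg : ∀ {β r} → β ≈ r → neg β ≈ (λ P → - r P)
    ≈-neg {β} {r} (mk≈ (E , b , p)) = mk≈ ((λ P → - E P) , b-neg b , λ P → trans (ev-neg P β) (trans (cong -_ (p P)) (lem (r P) (φ P) (E P))))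
      where
      lem : ∀ r f e → - (r + f * e) ≡ - r + f * - e
      lem r f e = solve (r ∷ f ∷ e ∷ []) ℚring

    ≈-⊕ : ∀ {β γ r s} → β ≈ r → γ ≈ s → β ⊕ γ ≈ (λ P → r P + s P)
    ≈-⊕ {β} {γ} {r} {s} (mk≈ (E , b , p)) (mk≈ (E' , b' , p')) = mk≈ ((λ P → E P + E' P) , b-+ b b' ,
      λ P → trans (ev-⊕ P β γ) (trans (cong₂ _+_ (p P) (p' P)) (lem (r P) (s P) (φ P) (E P) (E' P))))
      where
      lem : ∀ r s f e e' → r + f * e + (s + f * e') ≡ r + s + f * (e + e')
      lem r s f e e' = solve (r ∷ s ∷ f ∷ e ∷ e' ∷ []) ℚring

    ≈-mul : ∀ {β γ r s} → Bounded r → Bounded s → β ≈ r → γ ≈ s → mul n β γ ≈ (λ P → r P * s P)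
    ≈-mul {β} {γ} {r} {s} br bs (mk≈ (E , b , p)) (mk≈ (E' , b' , p')) =
      mk≈ ((λ P → r P * E' P + s P * E P + φ P * (E P * E' P) + - overflow β γ P) ,
      b-+ (b-+ (b-+ (b-* br b') (b-* bs b)) (b-* b-φ (b-* b b'))) (b-neg (b-overflow β γ)) ,
      λ P → trans (ev-mul P β γ) (trans (cong₂ (λ u v → u * v - φ P * overflow β γ P) (p P) (p' P))
        (lem (r P) (s P) (φ P) (E P) (E' P) (overflow β γ P))))
      where
      lem : ∀ r s f e e' o → (r + f * e) * (s + f * e') - f * o ≡ r * s + f * (r * e' + s * e + f * (e * e') + - o)
      lem r s f e e' o = solve (r ∷ s ∷ f ∷ e ∷ e' ∷ o ∷ []) ℚring

    ≈-powℕ : ∀ {β r} → Bounded r → β ≈ r → ∀ k → powℕ n β k ≈ (λ P → pn (r P) k)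
    ≈-powℕ b p zero = mk≈ ((λ _ → 0ℚ) , b-const 0ℚ , λ P → trans (ev-ι P (+ 1)) (trans (ι-# 1) (lem (φ P))))
      where
      lem : ∀ f → 1ℚ ≡ 1ℚ + f * 0ℚ
      lem f = solve (f ∷ []) ℚring
    ≈-powℕ b p (suc k) = ≈-mul b (b-pn b k) p (≈-powℕ b p k)

    ≈-powℤ : ∀ {β βi r ri} → Bounded r → Bounded ri → β ≈ r → βi ≈ ri → ∀ k → powℤ n β βi k ≈ (λ P → pw (r P) (ri P) k)
    ≈-powℤ b bi p pi (+ k) = ≈-powℕ b p k
    ≈-powℤ b bi p pi -[1+ k ] = ≈-powℕ bi pi (suc k)

    -- The functions of x that represent λ₀, λ₁, λ₂ and their inverses.
    v₀ v₁ v₂ u₀ u₁ u₂ : Fun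
    v₀ P = x P
    v₁ P = - y P
    v₂ P = - ((x P + 1ℚ) * xi P)
    u₀ P = xi P
    u₁ P = - (x P + 1ℚ)
    u₂ P = - (x P * y P)

    b-v₀ : Bounded v₀
    b-v₀ = b-x
    b-v₁ : Bounded v₁
    b-v₁ = b-neg b-y
    b-v₂ : Bounded v₂
    b-v₂ = b-neg (b-* b-x+1 b-xi)
    b-u₀ : Bounded u₀
    b-u₀ = b-xi
    b-u₁ : Bounded u₁
    b-u₁ = b-neg b-x+1
    b-u₂ : Bounded u₂
    b-u₂ = b-neg (b-* b-x b-y)

    ≈-λ₀ : λ₀ ≈ v₀
    ≈-λ₀ = mk≈ ((λ _ → 0ℚ) , b-const 0ℚ , λ P → trans (cong₂ (λ o i → o + i * x P + o * (x P * x P)) (ι-# 0) (ι-# 1)) (lem (x P) (φ P)))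
      where
      lem : ∀ x f → 0ℚ + 1ℚ * x + 0ℚ * (x * x) ≡ x + f * 0ℚ
      lem x f = solve (x ∷ f ∷ []) ℚring

    -- As f_n(x) + 1 is x times the polynomial representing λ₀⁻¹, that polynomial and the true
    -- reciprocal differ by f_n(x)/x.
    ≈-λ₀⁻¹ : λ₀⁻¹ n ≈ u₀
    ≈-λ₀⁻¹ = mk≈ (xi , b-xi , λ P →
      trans (cong₂ _+_ (cong₂ _+_ (trans (ι-neg _) (cong -_ ι-q)) (cong (_* x P) (trans (ι-neg _) (cong -_ ι-p)))) (cong (_* (x P * x P)) (ι-# 1)))
        (lc1 (- (x P * x P) + (N - 1ℚ) * x P + (N + # 2)) (x·xi P) (lem N (x P) (xi P))))
      where
      lem : ∀ N x xi → - (N + # 2) + - (N - 1ℚ) * x + 1ℚ * (x * x)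
          ≡ xi + (x * x * x - (N - 1ℚ) * (x * x) - (N + # 2) * x - 1ℚ) * xi + (- (x * x) + (N - 1ℚ) * x + (N + # 2)) * (x * xi - 1ℚ)
      lem N x xi = solve (N ∷ x ∷ xi ∷ []) ℚring

    private
      ≈-quadratic : ⟨ ℤ.- + 2 , ℤ.- + n , + 1 ⟩ ≈ v₁
      ≈-quadratic = mk≈ (y , b-y , λ P →
        trans (cong₂ _+_ (cong₂ _+_ (trans (ι-neg _) (cong -_ (ι-# 2))) (cong (_* x P) (ι-neg _))) (cong (_* (x P * x P)) (ι-# 1)))
          (lc1 (- (x P * x P) + N * x P + # 2) (x+1·y P) (lem N (x P) (y P))))
        where
        lem : ∀ N x y → - # 2 + - N * x + 1ℚ * (x * x)
            ≡ - y + (x * x * x - (N - 1ℚ) * (x * x) - (N + # 2) * x - 1ℚ) * y + (- (x * x) + N * x + # 2) * ((x + 1ℚ) * y - 1ℚ)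
        lem N x y = solve (N ∷ x ∷ y ∷ []) ℚring

    ≈-≗ : ∀ {β r s} → β ≈ r → (∀ P → r P ≡ s P) → β ≈ s
    ≈-≗ (mk≈ (E , b , p)) q = mk≈ (E , b , λ P → trans (p P) (cong (λ t → t + φ P * E P) (q P)))

    ≈-λ₁ : λ₁ n ≈ v₁
    ≈-λ₁ = ≈-≗ {r = λ P → - (- v₁ P)} (≈-neg (≈-neg ≈-quadratic)) (λ P → lem (y P))
      where
      lem : ∀ y → - (- (- y)) ≡ - y
      lem y = solve (y ∷ []) ℚring

    ≈-x+1 : λ₀ ⊕ ιK (+ 1) ≈ (λ P → x P + 1ℚ)
    ≈-x+1 = ≈-≗ (≈-⊕ ≈-λ₀ (≈-ι (+ 1))) (λ P → cong (λ t → x P + t) (ι-# 1))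

    ≈-λ₁⁻¹ : λ₁⁻¹ n ≈ u₁
    ≈-λ₁⁻¹ = ≈-neg ≈-x+1

    ≈-λ₂ : λ₂ n ≈ v₂
    ≈-λ₂ = ≈-neg (≈-mul b-x+1 b-xi ≈-x+1 ≈-λ₀⁻¹)

    ≈-λ₂⁻¹ : λ₂⁻¹ n ≈ u₂
    ≈-λ₂⁻¹ = ≈-≗ {r = λ P → - (x P * - v₁ P)} (≈-neg (≈-mul b-x (b-neg b-v₁) ≈-λ₀ (≈-neg ≈-quadratic))) (λ P → lem (x P) (y P))
      where
      lem : ∀ x y → - (x * - (- y)) ≡ - (x * y)
      lem x y = solve (x ∷ y ∷ []) ℚring

    -- the three conjugates of λ₀^s λ₁^t
    a₀ a₁ a₂ : ℤ → ℤ → Fun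
    a₀ s t P = pw (v₀ P) (u₀ P) s * pw (v₁ P) (u₁ P) t
    a₁ s t P = pw (v₁ P) (u₁ P) s * pw (v₂ P) (u₂ P) t
    a₂ s t P = pw (v₂ P) (u₂ P) s * pw (v₀ P) (u₀ P) t

    b-a₀ : ∀ s t → Bounded (a₀ s t)
    b-a₀ s t = b-* (b-pw b-v₀ b-u₀ s) (b-pw b-v₁ b-u₁ t)
    b-a₁ : ∀ s t → Bounded (a₁ s t)
    b-a₁ s t = b-* (b-pw b-v₁ b-u₁ s) (b-pw b-v₂ b-u₂ t)
    b-a₂ : ∀ s t → Bounded (a₂ s t)
    b-a₂ s t = b-* (b-pw b-v₂ b-u₂ s) (b-pw b-v₀ b-u₀ t)

    unit : ℤ → ℤ → K
    unit s t = mul n (λ₀^ n s) (λ₁^ n t)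

    ≈-unit : ∀ s t → unit s t ≈ a₀ s t
    ≈-unit s t = ≈-mul (b-pw b-v₀ b-u₀ s) (b-pw b-v₁ b-u₁ t) (≈-powℤ b-v₀ b-u₀ ≈-λ₀ ≈-λ₀⁻¹ s) (≈-powℤ b-v₁ b-u₁ ≈-λ₁ ≈-λ₁⁻¹ t)

    ≈-unit₁ : ∀ s t → mul n (λ₁^ n s) (λ₂^ n t) ≈ a₁ s t
    ≈-unit₁ s t = ≈-mul (b-pw b-v₁ b-u₁ s) (b-pw b-v₂ b-u₂ t) (≈-powℤ b-v₁ b-u₁ ≈-λ₁ ≈-λ₁⁻¹ s) (≈-powℤ b-v₂ b-u₂ ≈-λ₂ ≈-λ₂⁻¹ t)

    ≈-unit₂ : ∀ s t → mul n (λ₂^ n s) (λ₀^ n t) ≈ a₂ s t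
    ≈-unit₂ s t = ≈-mul (b-pw b-v₂ b-u₂ s) (b-pw b-v₀ b-u₀ t) (≈-powℤ b-v₂ b-u₂ ≈-λ₂ ≈-λ₂⁻¹ s) (≈-powℤ b-v₀ b-u₀ ≈-λ₀ ≈-λ₀⁻¹ t)

    linear : Fun → ℤ → ℤ → Fun
    linear a X Y P = ι X + - (a P * ι Y)

    b-linear : ∀ {a} → Bounded a → ∀ X Y → Bounded (linear a X Y)
    b-linear b X Y = b-+ (b-const (ι X)) (b-neg (b-* b (b-const (ι Y))))

    ≈-linear : ∀ {α a} → Bounded a → α ≈ a → ∀ X Y → ιK X ⊖ mul n α (ιK Y) ≈ linear a X Y
    ≈-linear b p X Y = ≈-⊕ (≈-ι X) (≈-neg (≈-mul b (b-const (ι Y)) p (≈-ι Y)))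

    ≈-mul₃ : ∀ {β γ δ r s u} → Bounded r → Bounded s → Bounded u → β ≈ r → γ ≈ s → δ ≈ u → mul n (mul n β γ) δ ≈ (λ P → r P * s P * u P)
    ≈-mul₃ {r = r} {s} br bs bu p q o = ≈-mul {r = λ P → r P * s P} (b-* br bs) bu (≈-mul br bs p q) o

    ≈-thueForm : ∀ s t X Y → thueForm n s t X Y ≈ (λ P → linear (a₀ s t) X Y P * linear (a₁ s t) X Y P * linear (a₂ s t) X Y P)
    ≈-thueForm s t X Y = ≈-mul₃ {ιK X ⊖ mul n (mul n (λ₀^ n s) (λ₁^ n t)) (ιK Y)} {ιK X ⊖ mul n (mul n (λ₁^ n s) (λ₂^ n t)) (ιK Y)} {ιK X ⊖ mul n (mul n (λ₂^ n s) (λ₀^ n t)) (ιK Y)}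
        {linear (a₀ s t) X Y} {linear (a₁ s t) X Y} {linear (a₂ s t) X Y} (b-linear (b-a₀ s t) X Y) (b-linear (b-a₁ s t) X Y) (b-linear (b-a₂ s t) X Y)
        (≈-linear {mul n (λ₀^ n s) (λ₁^ n t)} {a₀ s t} (b-a₀ s t) (≈-unit s t) X Y)
        (≈-linear {mul n (λ₁^ n s) (λ₂^ n t)} {a₁ s t} (b-a₁ s t) (≈-unit₁ s t) X Y)
        (≈-linear {mul n (λ₂^ n s) (λ₀^ n t)} {a₂ s t} (b-a₂ s t) (≈-unit₂ s t) X Y)

-- Rational points close to the largest root.

module Root where
  open import Data.Nat as ℕ using (ℕ; zero; suc)
  import Data.Nat.Properties as ℕₚ
  open import Data.Integer as ℤ using (+_)
  open import Data.List using ([]; _∷_)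
  open import Data.Product using (∃-syntax; _×_; _,_; proj₁; proj₂)
  open import Data.Rational hiding (neg)
  open import Data.Rational.Properties
  open import Relation.Nullary using (¬_; Dec; yes; no; contradiction)
  open import Relation.Binary.PropositionalEquality
  open import Tactic.RingSolver using (solve)
  open Rationals
  open Points

  inverse : ∀ q → 0ℚ < q → ∃[ r ] (q * r ≡ 1ℚ)
  inverse q h = (1/ q) {{nz}} , *-inverseʳ q {{nz}}
    where
    nz : NonZero q
    nz = >-nonZero h

  inverse-nonneg : ∀ {q r} → 0ℚ < q → q * r ≡ 1ℚ → 0ℚ ≤ r
  inverse-nonneg {q} h e = cancel≤ q h (≤-trans (≤-reflexive (*-zeroʳ q)) (≤-trans (k0 1) (≤-reflexive (sym e))))

  inverse-≤1 : ∀ {q r} → 1ℚ ≤ q → q * r ≡ 1ℚ → r ≤ 1ℚ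
  inverse-≤1 {q} {r} h e = by (dif h ⊠ inverse-nonneg (<-≤-trans (k0< 0) h) e)
    (lc1 (- 1ℚ) e (lem q r))
    where
    lem : ∀ q r → 1ℚ ≡ r + (q - 1ℚ) * r + - 1ℚ * (q * r - 1ℚ)
    lem q r = solve (q ∷ r ∷ []) ℚring

  private
    L+1≤w-identity : ∀ a → a + 1ℚ + 1ℚ ≡ a + # 2
    L+1≤w-identity a = solve (a ∷ []) ℚring

    r≤1-identity : ∀ y → 1ℚ ≡ 1ℚ - y + y
    r≤1-identity y = solve (y ∷ []) ℚring

    q-eq-identity : ∀ L Li → (L + 1ℚ) * Li ≡ 1ℚ + Li + 1ℚ * (L * Li - 1ℚ)
    q-eq-identity L Li = solve (L ∷ Li ∷ []) ℚring

    r-eq-identity : ∀ L y → L * y ≡ 1ℚ - y + 1ℚ * ((L + 1ℚ) * y - 1ℚ)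
    r-eq-identity L y = solve (L ∷ y ∷ []) ℚring

    P₁-l₁ : ∀ L y → - y * - (L + 1ℚ) ≡ (L + 1ℚ) * y
    P₁-l₁ L y = solve (L ∷ y ∷ []) ℚring

    P₁-l₂ : ∀ L Li y → (- y + 1ℚ) * ((L + 1ℚ) * Li) ≡ 1ℚ + 1ℚ * (L * Li - 1ℚ) + - Li * ((L + 1ℚ) * y - 1ℚ)
    P₁-l₂ L Li y = solve (L ∷ Li ∷ y ∷ []) ℚring

    P₂-l₁ : ∀ L Li y → - ((L + 1ℚ) * Li) * - (L * y) ≡ 1ℚ + (L + 1ℚ) * y * (L * Li - 1ℚ) + 1ℚ * ((L + 1ℚ) * y - 1ℚ)
    P₂-l₁ L Li y = solve (L ∷ Li ∷ y ∷ []) ℚring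

    P₂-l₂ : ∀ L Li → (- ((L + 1ℚ) * Li) + 1ℚ) * - L ≡ 1ℚ + (L + 1ℚ) * (L * Li - 1ℚ)
    P₂-l₂ L Li = solve (L ∷ Li ∷ []) ℚring

    P₂-l₃ : ∀ Li → - Li ≡ - (1ℚ + Li) + 1ℚ
    P₂-l₃ Li = solve (Li ∷ []) ℚring

  -- L is an approximation to the root λ₀ of f_n between n and n + 1.
  record Base (n : ℕ) : Set where
    field
      L Li y : ℚ
      L·Li : L * Li ≡ 1ℚ
      L+1·y : (L + 1ℚ) * y ≡ 1ℚ
      n≤L : ν n ≤ L
      L≤n+1 : L ≤ ν n + 1ℚ

    module _ (n≥1 : 1 ℕ.≤ n) where
      1≤L : 1ℚ ≤ L
      1≤L = ≤-trans (subst (_≤ ν n) (ι-# 1) (ν≤ n≥1)) n≤L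
      0<L : 0ℚ < L
      0<L = <-≤-trans (k0< 0) 1≤L
      0<L+1 : 0ℚ < L + 1ℚ
      0<L+1 = 0<L ⊞< k0 1
      0≤Li : 0ℚ ≤ Li
      0≤Li = inverse-nonneg 0<L L·Li
      Li≤1 : Li ≤ 1ℚ
      Li≤1 = inverse-≤1 1≤L L·Li
      0≤y : 0ℚ ≤ y
      0≤y = inverse-nonneg 0<L+1 L+1·y
      y≤1 : y ≤ 1ℚ
      y≤1 = inverse-≤1 (by (<⇒≤ 0<L) (+-comm L 1ℚ)) L+1·y
      q-eq : (L + 1ℚ) * Li ≡ 1ℚ + Li
      q-eq = lc1 1ℚ L·Li (q-eq-identity L Li)
      r-eq : L * y ≡ 1ℚ - y
      r-eq = lc1 1ℚ L+1·y (r-eq-identity L y)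
      private
        w : ℚ
        w = ν (n ℕ.+ 2)
        w≡ : w ≡ ν n + # 2
        w≡ = trans (ν-+ n 2) (cong (λ t → ν n + t) (ι-# 2))
        3≤w : # 3 ≤ w
        3≤w = subst (_≤ w) (ι-# 3) (ν≤ (ℕₚ.+-monoˡ-≤ 2 n≥1))
        bound : ∀ {x m} → # m ≤ # 3 → x ≤ # m → - x ≤ # m → ∣ x ∣ ≤ w
        bound h p q = ≤-trans (abs≤ p q) (≤-trans h 3≤w)
        posw : ∀ {x} → 0ℚ ≤ x → x ≤ w → ∣ x ∣ ≤ w
        posw h p = ≤-trans (≤-reflexive (0≤p⇒∣p∣≡p h)) p
        neg' : ∀ {x} → 0ℚ ≤ x → x ≤ w → ∣ - x ∣ ≤ w
        neg' {x} h p = ≤-trans (≤-reflexive (∣-p∣≡∣p∣ x)) (posw h p)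
        1≤w : 1ℚ ≤ w
        1≤w = ≤-trans (#≤ {1} {3} (ℕ.s≤s ℕ.z≤n)) 3≤w
        2≤w : # 2 ≤ w
        2≤w = ≤-trans (#≤ {2} {3} (ℕ.s≤s (ℕ.s≤s ℕ.z≤n))) 3≤w
        L+1≤w : L + 1ℚ ≤ w
        L+1≤w = ≤-trans (+-monoˡ-≤ 1ℚ L≤n+1) (≤-reflexive (trans (L+1≤w-identity (ν n)) (sym w≡)))
        L≤w : L ≤ w
        L≤w = ≤-trans (by (k0 1) refl) L+1≤w
        0≤L : 0ℚ ≤ L
        0≤L = <⇒≤ 0<L
        0≤L+1 : 0ℚ ≤ L + 1ℚ
        0≤L+1 = <⇒≤ 0<L+1
        q≤2 : (L + 1ℚ) * Li ≤ # 2
        q≤2 = ≤-trans (≤-reflexive q-eq) (+-monoʳ-≤ 1ℚ Li≤1)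
        r≤1 : L * y ≤ 1ℚ
        r≤1 = ≤-trans (≤-reflexive r-eq) (by 0≤y (r≤1-identity y))

      -- L and its images under one and two applications of x ↦ -1/(x + 1), hence points near the
      -- three roots of f_n.
      P₀ P₁ P₂ : Pt n
      P₀ = record { x = L ; xi = Li ; y = y ; x·xi = L·Li ; x+1·y = L+1·y
        ; x≤ = posw 0≤L L≤w ; xi≤ = posw 0≤Li (≤-trans Li≤1 1≤w) ; x+1≤ = posw 0≤L+1 L+1≤w ; y≤ = posw 0≤y (≤-trans y≤1 1≤w) }
      P₁ = record { x = - y ; xi = - (L + 1ℚ) ; y = (L + 1ℚ) * Li
        ; x·xi = trans (P₁-l₁ L y) L+1·y
        ; x+1·y = lc2 1ℚ (- Li) L·Li L+1·y (P₁-l₂ L Li y)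
        ; x≤ = neg' 0≤y (≤-trans y≤1 1≤w)
        ; xi≤ = neg' 0≤L+1 L+1≤w
        ; x+1≤ = subst (λ t → ∣ t ∣ ≤ w) (trans r-eq (+-comm 1ℚ (- y))) (posw (0≤L ⊠ 0≤y) (≤-trans r≤1 1≤w))
        ; y≤ = posw (0≤L+1 ⊠ 0≤Li) (≤-trans q≤2 2≤w) }
      P₂ = record { x = - ((L + 1ℚ) * Li) ; xi = - (L * y) ; y = - L
        ; x·xi = lc2 ((L + 1ℚ) * y) 1ℚ L·Li L+1·y (P₂-l₁ L Li y)
        ; x+1·y = lc1 (L + 1ℚ) L·Li (P₂-l₂ L Li)
        ; x≤ = neg' (0≤L+1 ⊠ 0≤Li) (≤-trans q≤2 2≤w)
        ; xi≤ = neg' (0≤L ⊠ 0≤y) (≤-trans r≤1 1≤w)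
        ; x+1≤ = subst (λ t → ∣ t ∣ ≤ w) (trans (P₂-l₃ Li) (cong (λ t → - t + 1ℚ) (sym q-eq))) (neg' 0≤Li (≤-trans Li≤1 1≤w))
        ; y≤ = neg' 0≤L L≤w }

  poly : ℕ → ℚ → ℚ
  poly n x = x * x * x - (ν n - 1ℚ) * (x * x) - (ν n + # 2) * x - 1ℚ

  private
    crossing : ∀ {T : ℕ → Set} → (∀ j → Dec (T j)) → T 0 → ∀ m → ¬ T m → ∃[ j ] (suc j ℕ.≤ m × T j × ¬ T (suc j))
    crossing T? T0 zero ¬Tm = contradiction T0 ¬Tm
    crossing T? T0 (suc m) ¬Tm with T? m
    ... | yes q = m , ℕₚ.≤-refl , q , ¬Tm
    ... | no q = let j , h , r = crossing T? T0 m q in j , ℕₚ.m≤n⇒m≤1+n h , r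

    -- A mean value estimate: 3(N + 1)² dominates the derivative of f_n on [N, N + 1]. It converts
    -- the spacing of a grid into the size of f_n at the grid points.
    slope : ∀ {a b N} → 1ℚ ≤ N → N ≤ a → a ≤ b → b ≤ N + 1ℚ →
      (b * b * b - (N - 1ℚ) * (b * b) - (N + # 2) * b - 1ℚ) - (a * a * a - (N - 1ℚ) * (a * a) - (N + # 2) * a - 1ℚ)
        ≤ (b - a) * (# 3 * ((N + 1ℚ) * (N + 1ℚ)))
    slope {a} {b} {N} h1 h2 h3 h4 = by
      (dif h3 ⊠ ((dif h4 ⊠ (N1 ⊞ b0 ⊞ N1 ⊞ a0)) ⊞ (dif (≤-trans h3 h4) ⊠ (N1 ⊞ a0)) ⊞ (N1 ⊠ dif h3) ⊞ (dif h1 ⊠ (a0 ⊞ b0)) ⊞ (N0 ⊞ k0 2)))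
      (solve (a ∷ b ∷ N ∷ []) ℚring)
      where
      N0 : 0ℚ ≤ N
      N0 = ≤-trans (k0 1) h1
      N1 : 0ℚ ≤ N + 1ℚ
      N1 = N0 ⊞ k0 1
      a0 : 0ℚ ≤ a
      a0 = ≤-trans N0 h2
      b0 : 0ℚ ≤ b
      b0 = ≤-trans a0 h3

  private
    step-identity : ∀ N j di → N + (1ℚ + j) * di ≡ N + j * di + di
    step-identity N j di = solve (N ∷ j ∷ di ∷ []) ℚring

    drop-identity : ∀ p q → q - p ≡ - p + q
    drop-identity p q = solve (p ∷ q ∷ []) ℚring

    drop-identity₂ : ∀ x di → x + di - x ≡ di
    drop-identity₂ x di = solve (x ∷ di ∷ []) ℚring

    small-identity : ∀ z di c → (1ℚ + c * z) * di ≡ z * (di * c) + di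
    small-identity z di c = solve (z ∷ di ∷ c ∷ []) ℚring

    start-identity : ∀ N di → N ≡ N + 0ℚ * di
    start-identity N di = solve (N ∷ di ∷ []) ℚring

    start-identity₂ : ∀ N → 0ℚ ≡ N * N * N - (N - 1ℚ) * (N * N) - (N + # 2) * N - 1ℚ + (# 2 * N + 1ℚ)
    start-identity₂ N = solve (N ∷ []) ℚring

    end-pos-end : ∀ {N} → 1ℚ ≤ N → 0ℚ < (N + 1ℚ) * (N + 1ℚ) * (N + 1ℚ) - (N - 1ℚ) * ((N + 1ℚ) * (N + 1ℚ)) - (N + # 2) * (N + 1ℚ) - 1ℚ
    end-pos-end {N} h = by< (k0< 0 ⊞< (dif h ⊠ dif h ⊞ k0 3 ⊠ dif h)) (solve (N ∷ []) ℚring)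

  private
    module FromCrossing (n : ℕ) (n≥1 : 1 ℕ.≤ n) (Z d j : ℕ) (di : ℚ) (d·di : ν d * di ≡ 1ℚ) (0≤di : 0ℚ ≤ di)
      (d≡ : ν d ≡ 1ℚ + # 3 * ((ν n + 1ℚ) * (ν n + 1ℚ)) * ν Z) (j<d : suc j ℕ.≤ d)
      (neg-at : poly n (ν n + ν j * di) ≤ 0ℚ) (pos-at : ¬ poly n (ν n + ν (suc j) * di) ≤ 0ℚ) where
      N = ν n
      X X' C : ℚ
      X = N + ν j * di
      X' = N + ν (suc j) * di
      C = # 3 * ((N + 1ℚ) * (N + 1ℚ))
      1≤N : 1ℚ ≤ N
      1≤N = subst (_≤ N) (ι-# 1) (ν≤ n≥1)
      step : X' ≡ X + di
      step = trans (cong (λ t → N + t * di) (trans (ν-+ 1 j) (cong (_+ ν j) (ι-# 1)))) (step-identity N (ν j) di)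
      N≤X : N ≤ X
      N≤X = by (ν0 j ⊠ 0≤di) refl
      X'≤ : X' ≤ N + 1ℚ
      X'≤ = +-monoʳ-≤ N (≤-trans (*-monoʳ-≤-nonNeg di {{nonNegative 0≤di}} (ν≤ j<d)) (≤-reflexive d·di))
      X≤X' : X ≤ X'
      X≤X' = ≤-trans (by 0≤di refl) (≤-reflexive (sym step))
      1≤X : 1ℚ ≤ X
      1≤X = ≤-trans 1≤N N≤X
      0<X : 0ℚ < X
      0<X = <-≤-trans (k0< 0) 1≤X
      0<X+1 : 0ℚ < X + 1ℚ
      0<X+1 = 0<X ⊞< k0 1
      B : Base n
      B = record { L = X ; Li = proj₁ (inverse X 0<X) ; y = proj₁ (inverse (X + 1ℚ) 0<X+1)
        ; L·Li = proj₂ (inverse X 0<X) ; L+1·y = proj₂ (inverse (X + 1ℚ) 0<X+1)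
        ; n≤L = N≤X ; L≤n+1 = ≤-trans X≤X' X'≤ }
      drop : - poly n X ≤ di * C
      drop = ≤-trans (by (<⇒≤ (≰⇒> pos-at)) (drop-identity (poly n X) (poly n X')))
        (≤-trans (slope 1≤N N≤X X≤X' X'≤) (≤-reflexive (cong (_* C) (trans (cong (λ t → t - X) step) (drop-identity₂ X di)))))
      small : ν Z * - poly n X ≤ 1ℚ
      small = begin
        ν Z * - poly n X  ≤⟨ *-monoˡ-≤-nonNeg (ν Z) {{nonNegative (ν0 Z)}} drop ⟩
        ν Z * (di * C)        ≤⟨ by 0≤di (small-identity (ν Z) di C) ⟩
        (1ℚ + C * ν Z) * di   ≡⟨ cong (_* di) (sym d≡) ⟩
        ν d * di              ≡⟨ d·di ⟩
        1ℚ ∎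
        where
        open ≤-Reasoning

    denominator : ∀ n Z → ∃[ d ] (1 ℕ.≤ d × ν d ≡ 1ℚ + # 3 * ((ν n + 1ℚ) * (ν n + 1ℚ)) * ν Z)
    denominator n Z = suc (3 ℕ.* (m ℕ.* m) ℕ.* Z) , ℕ.s≤s ℕ.z≤n ,
      trans (ν-+ 1 (3 ℕ.* (m ℕ.* m) ℕ.* Z)) (cong₂ _+_ (ι-# 1) (trans (ν-* (3 ℕ.* (m ℕ.* m)) Z) (cong (_* ν Z)
        (trans (ν-* 3 (m ℕ.* m)) (cong₂ _*_ (ι-# 3) (trans (ν-* m m) (cong (λ t → t * t) (trans (ν-+ n 1) (cong (λ t → ν n + t) (ι-# 1))))))))))
      where
      m = n ℕ.+ 1

    start : ∀ n di → poly n (ν n + ν 0 * di) ≤ 0ℚ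
    start n di = subst (λ t → poly n t ≤ 0ℚ) (trans (start-identity (ν n) di) (cong (λ t → ν n + t * di) (sym (ι-# 0))))
        (by (k0 2 ⊠ ν0 n ⊞ k0 1) (start-identity₂ (ν n)))

    end : ∀ n → 1 ℕ.≤ n → 0ℚ < poly n (ν n + 1ℚ)
    end n n≥1 = end-pos-end (subst (_≤ ν n) (ι-# 1) (ν≤ n≥1))

  -- Along the grid of step 1/d in [n, n + 1] the sign of f_n changes. At the last point before a
  -- change -f_n is at most C/d with C = 3(n + 1)², and d = 1 + CZ makes this small enough.
  root-point : ∀ n → 1 ℕ.≤ n → ∀ Z → ∃[ B ] (poly n (Base.L {n} B) ≤ 0ℚ × ν Z * - poly n (Base.L {n} B) ≤ 1ℚ)
  root-point n n≥1 Z =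
    let d , d≥1 , d≡ = denominator n Z
        di , d·di = inverse (ν d) (ν0< d≥1)
        j , j<d , p , q = crossing {λ j → poly n (ν n + ν j * di) ≤ 0ℚ} (λ j → poly n (ν n + ν j * di) ≤? 0ℚ) (start n di) d
          (λ h → <-irrefl refl (<-≤-trans (end n n≥1) (subst (λ t → poly n (ν n + t) ≤ 0ℚ) d·di h)))
        open FromCrossing n n≥1 Z d j di d·di (inverse-nonneg (ν0< d≥1) d·di) d≡ j<d p q
    in B , p , small

-- Relations and inequalities that hold near the root.

module Asymptotics where
  open import Data.Empty using (⊥)
  open import Data.Nat as ℕ using (ℕ; zero; suc)
  import Data.Nat.Properties as ℕₚ
  open import Data.Integer as ℤ using (ℤ; +_; -[1+_])
  import Data.Integer.Properties as ℤₚ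
  open import Data.List using ([]; _∷_)
  open import Data.Product using (∃-syntax; _×_; _,_)
  open import Data.Sum using (inj₁; inj₂)
  open import Data.Rational hiding (neg; _≃_)
  open import Data.Rational.Properties hiding (≃-sym)
  import Data.Rational.Unnormalised as ℚᵘ
  open import Relation.Nullary using (¬_; yes; no; contradiction)
  open import Relation.Binary.PropositionalEquality
  open import Tactic.RingSolver using (solve)
  open Rationals
  open Bounds
  open Points
  open Root

  opaque
    unfolding ι
    archimedean : ∀ R → R ≤ ν ℤ.∣ ↥ R ∣
    archimedean (mkℚ (+ m) d c) = toℚᵘ-cancel-≤ (ℚᵘ.*≤* (ℤₚ.*-monoˡ-≤-nonNeg (+ m) (ℤ.+≤+ (ℕ.s≤s ℕ.z≤n))))
    archimedean (mkℚ -[1+ m ] d c) = toℚᵘ-cancel-≤ (ℚᵘ.*≤* ℤ.-≤+)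

  private
    φ₁-identity : ∀ N y → - y * - y * - y - (N - 1ℚ) * (- y * - y) - (N + # 2) * - y - 1ℚ
        ≡ - ((1ℚ - y) * (1ℚ - y) * (1ℚ - y) - (N - 1ℚ) * ((1ℚ - y) * (1ℚ - y)) * y - (N + # 2) * (1ℚ - y) * (y * y) - y * y * y)
    φ₁-identity N y = solve (N ∷ y ∷ []) ℚring

    φ₁-identity₂ : ∀ N L y → - ((L * y) * (L * y) * (L * y) - (N - 1ℚ) * ((L * y) * (L * y)) * y - (N + # 2) * (L * y) * (y * y) - y * y * y)
        ≡ (L * L * L - (N - 1ℚ) * (L * L) - (N + # 2) * L - 1ℚ) * - (y * y * y)
    φ₁-identity₂ N L y = solve (N ∷ L ∷ y ∷ []) ℚring

    φ₂-identity : ∀ N m → - (1ℚ + m) * - (1ℚ + m) * - (1ℚ + m) - (N - 1ℚ) * (- (1ℚ + m) * - (1ℚ + m)) - (N + # 2) * - (1ℚ + m) - 1ℚ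
        ≡ 1ℚ * 1ℚ * 1ℚ - (N - 1ℚ) * (1ℚ * 1ℚ) * m - (N + # 2) * 1ℚ * (m * m) - m * m * m
    φ₂-identity N m = solve (N ∷ m ∷ []) ℚring

    φ₂-identity₂ : ∀ N L m → (L * m) * (L * m) * (L * m) - (N - 1ℚ) * ((L * m) * (L * m)) * m - (N + # 2) * (L * m) * (m * m) - m * m * m
        ≡ (L * L * L - (N - 1ℚ) * (L * L) - (N + # 2) * L - 1ℚ) * (m * m * m)
    φ₂-identity₂ N L m = solve (N ∷ L ∷ m ∷ []) ℚring

    close-identity : ∀ h e → h + e - h ≡ e
    close-identity h e = solve (h ∷ e ∷ []) ℚring

    close-identity₂ : ∀ a b c → a * (b * c) ≡ a * c * b
    close-identity₂ a b c = solve (a ∷ b ∷ c ∷ []) ℚring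

    ≃-≗-identity : ∀ x f → x ≡ x + f * 0ℚ
    ≃-≗-identity x f = solve (x ∷ f ∷ []) ℚring

    ≃-sym-identity : ∀ h f e → h ≡ h + f * e + f * - e
    ≃-sym-identity h f e = solve (h ∷ f ∷ e ∷ []) ℚring

    ≃-trans-identity : ∀ h f e e' → h + f * e' + f * e ≡ h + f * (e + e')
    ≃-trans-identity h f e e' = solve (h ∷ f ∷ e ∷ e' ∷ []) ℚring

    ≃-+-identity : ∀ h h' f e e' → h + f * e + (h' + f * e') ≡ h + h' + f * (e + e')
    ≃-+-identity h h' f e e' = solve (h ∷ h' ∷ f ∷ e ∷ e' ∷ []) ℚring

    ≃-neg-identity : ∀ h f e → - (h + f * e) ≡ - h + f * - e
    ≃-neg-identity h f e = solve (h ∷ f ∷ e ∷ []) ℚring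

    ≃-*-identity : ∀ h h' f e e' → (h + f * e) * (h' + f * e') ≡ h * h' + f * (h * e' + h' * e + f * (e * e'))
    ≃-*-identity h h' f e e' = solve (h ∷ h' ∷ f ∷ e ∷ e' ∷ []) ℚring

  module Near (n : ℕ) (n≥1 : 1 ℕ.≤ n) where
    open Evaluate n using (φ; ev; _≈_; mk≈; Fun; b-φ)

    Fn : Set
    Fn = Base n → ℚ

    p₀ p₁ p₂ : Base n → Pt n
    p₀ B = Base.P₀ B n≥1
    p₁ B = Base.P₁ B n≥1
    p₂ B = Base.P₂ B n≥1

    φ₀ : Fn
    φ₀ B = φ (p₀ B)

    b-φ₀ : Bounded φ₀
    b-φ₀ = b-∘ p₀ b-φ

    infix 4 _≃_
    -- The substitute for equality at the real root: the two sides differ by a bounded multiple of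
    -- f_n(L), which can be made arbitrarily small.
    data _≃_ (g h : Fn) : Set where
      mk≃ : ∃[ E ] (Bounded E × (∀ B → g B ≡ h B + φ₀ B * E B)) → g ≃ h

    ≃-≗ : ∀ {g h} → (∀ B → g B ≡ h B) → g ≃ h
    ≃-≗ {g} {h} p = mk≃ ((λ _ → 0ℚ) , b-const 0ℚ , λ B → trans (p B) (≃-≗-identity (h B) (φ₀ B)))

    ≃-refl : ∀ {g} → g ≃ g
    ≃-refl = ≃-≗ (λ _ → refl)

    ≃-sym : ∀ {g h} → g ≃ h → h ≃ g
    ≃-sym {g} {h} (mk≃ (E , b , p)) = mk≃ ((λ B → - E B) , b-neg b ,
      λ B → trans (≃-sym-identity (h B) (φ₀ B) (E B)) (cong (λ t → t + φ₀ B * - E B) (sym (p B))))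

    ≃-trans : ∀ {f g h} → f ≃ g → g ≃ h → f ≃ h
    ≃-trans {f} {g} {h} (mk≃ (E , b , p)) (mk≃ (E' , b' , p')) = mk≃ ((λ B → E B + E' B) , b-+ b b' ,
      λ B → trans (p B) (trans (cong (λ t → t + φ₀ B * E B) (p' B)) (≃-trans-identity (h B) (φ₀ B) (E B) (E' B))))

    ≃-+ : ∀ {g g' h h'} → g ≃ h → g' ≃ h' → (λ B → g B + g' B) ≃ (λ B → h B + h' B)
    ≃-+ {g} {g'} {h} {h'} (mk≃ (E , b , p)) (mk≃ (E' , b' , p')) = mk≃ ((λ B → E B + E' B) , b-+ b b' ,
      λ B → trans (cong₂ _+_ (p B) (p' B)) (≃-+-identity (h B) (h' B) (φ₀ B) (E B) (E' B)))

    ≃-neg : ∀ {g h} → g ≃ h → (λ B → - g B) ≃ (λ B → - h B)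
    ≃-neg {g} {h} (mk≃ (E , b , p)) = mk≃ ((λ B → - E B) , b-neg b , λ B → trans (cong -_ (p B)) (≃-neg-identity (h B) (φ₀ B) (E B)))

    ≃-* : ∀ {g g' h h'} → Bounded h → Bounded h' → g ≃ h → g' ≃ h' → (λ B → g B * g' B) ≃ (λ B → h B * h' B)
    ≃-* {g} {g'} {h} {h'} bh bh' (mk≃ (E , b , p)) (mk≃ (E' , b' , p')) =
      mk≃ ((λ B → h B * E' B + h' B * E B + φ₀ B * (E B * E' B)) , b-+ (b-+ (b-* bh b') (b-* bh' b)) (b-* b-φ₀ (b-* b b')) ,
        λ B → trans (cong₂ _*_ (p B) (p' B)) (≃-*-identity (h B) (h' B) (φ₀ B) (E B) (E' B)))

    ≃-err : ∀ {g h} E → Bounded E → (∀ B → g B ≡ h B + φ₀ B * E B) → g ≃ h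
    ≃-err E b p = mk≃ (E , b , p)

    private
      -- This is f_n(-1/(x + 1)) = -f_n(x)/(x + 1)³. With its companion it lets the single quantity
      -- `φ₀` control the errors at all three conjugates.
      φ₁ : ∀ B → φ (p₁ B) ≡ φ₀ B * - (Base.y B * Base.y B * Base.y B)
      φ₁ B = trans (φ₁-identity (ν n) y) (trans (cong (λ r → - (r * r * r - (ν n - 1ℚ) * (r * r) * y - (ν n + # 2) * r * (y * y) - y * y * y))
          (sym (r-eq n≥1))) (φ₁-identity₂ (ν n) L y))
        where
        open Base B

      φ₂ : ∀ B → φ (p₂ B) ≡ φ₀ B * (Base.Li B * Base.Li B * Base.Li B)
      φ₂ B = trans (cong (λ t → - t * - t * - t - (ν n - 1ℚ) * (- t * - t) - (ν n + # 2) * - t - 1ℚ) (q-eq n≥1))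
        (trans (φ₂-identity (ν n) Li) (trans (cong (λ r → r * r * r - (ν n - 1ℚ) * (r * r) * Li - (ν n + # 2) * r * (Li * Li) - Li * Li * Li)
          (sym L·Li)) (φ₂-identity₂ (ν n) L Li)))
        where
        open Base B

    b-Li b-y' : Bounded _
    b-Li = b-∘ p₀ (Evaluate.b-xi n)
    b-y' = b-∘ p₀ (Evaluate.b-y n)

    ev₀ : ∀ {β r} → β ≈ r → (λ B → ev (p₀ B) β) ≃ (λ B → r (p₀ B))
    ev₀ (mk≈ (E , b , p)) = ≃-err (λ B → E (p₀ B)) (b-∘ p₀ b) (λ B → p (p₀ B))

    ev₁ : ∀ {β r} → β ≈ r → (λ B → ev (p₁ B) β) ≃ (λ B → r (p₁ B))
    ev₁ {β} {r} (mk≈ (E , b , p)) = ≃-err (λ B → - (Base.y B * Base.y B * Base.y B) * E (p₁ B))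
      (b-* (b-neg (b-* (b-* b-y' b-y') b-y')) (b-∘ p₁ b))
      (λ B → trans (p (p₁ B)) (cong (λ t → r (p₁ B) + t) (trans (cong (_* E (p₁ B)) (φ₁ B)) (*-assoc (φ₀ B) _ (E (p₁ B))))))

    ev₂ : ∀ {β r} → β ≈ r → (λ B → ev (p₂ B) β) ≃ (λ B → r (p₂ B))
    ev₂ {β} {r} (mk≈ (E , b , p)) = ≃-err (λ B → (Base.Li B * Base.Li B * Base.Li B) * E (p₂ B))
      (b-* (b-* (b-* b-Li b-Li) b-Li) (b-∘ p₂ b))
      (λ B → trans (p (p₂ B)) (cong (λ t → r (p₂ B) + t) (trans (cong (_* E (p₂ B)) (φ₂ B)) (*-assoc (φ₀ B) _ (E (p₂ B))))))

    φ₁-small : ∀ (E : Fn) → Bounded E → (λ B → φ (p₁ B) * E B) ≃ (λ _ → 0ℚ)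
    φ₁-small E b = ≃-err (λ B → - (Base.y B * Base.y B * Base.y B) * E B) (b-* (b-neg (b-* (b-* b-y' b-y') b-y')) b)
      (λ B → trans (cong (_* E B) (φ₁ B)) (trans (*-assoc (φ₀ B) _ (E B)) (sym (+-identityˡ _))))

    φ₂-small : ∀ (E : Fn) → Bounded E → (λ B → φ (p₂ B) * E B) ≃ (λ _ → 0ℚ)
    φ₂-small E b = ≃-err (λ B → (Base.Li B * Base.Li B * Base.Li B) * E B) (b-* (b-* (b-* b-Li b-Li) b-Li) b)
      (λ B → trans (cong (_* E B) (φ₂ B)) (trans (*-assoc (φ₀ B) _ (E B)) (sym (+-identityˡ _))))

    φ₀-small : ∀ (E : Fn) → Bounded E → (λ B → φ₀ B * E B) ≃ (λ _ → 0ℚ)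
    φ₀-small E b = ≃-err E b (λ B → sym (+-identityˡ _))

    -- Q holds at all rational points sufficiently close to the root.
    Ev : (Base n → Set) → Set
    Ev Q = ∃[ Z ] (∀ B → φ₀ B ≤ 0ℚ → ν Z * - φ₀ B ≤ 1ℚ → Q B)

    ev-map : ∀ {Q Q' : Base n → Set} → (∀ B → Q B → Q' B) → Ev Q → Ev Q'
    ev-map f (Z , p) = Z , λ B h k → f B (p B h k)

    ev-× : ∀ {Q Q' : Base n → Set} → Ev Q → Ev Q' → Ev (λ B → Q B × Q' B)
    ev-× (Z , p) (Z' , p') = Z ℕ.+ Z' , λ B h k →
      p B h (≤-trans (mono B h (ν≤ (ℕₚ.m≤m+n Z Z'))) k) , p' B h (≤-trans (mono B h (ν≤ (ℕₚ.m≤n+m Z' Z))) k)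
      where
      mono : ∀ B {a b} → φ₀ B ≤ 0ℚ → a ≤ b → a * - φ₀ B ≤ b * - φ₀ B
      mono B h = *-monoʳ-≤-nonNeg (- φ₀ B) {{nonNegative (neg-antimono-≤ h)}}

    ev-all : ∀ {Q : ℕ → Base n → Set} → (∀ k → Ev (Q k)) → ∀ W → Ev (λ B → ∀ k → k ℕ.≤ W → Q k B)
    ev-all {Q} h zero = ev-map (λ { B q zero _ → q }) (h 0)
    ev-all {Q} h (suc W) = ev-map join (ev-× (ev-all h W) (h (suc W)))
      where
      join : ∀ B → (∀ k → k ℕ.≤ W → Q k B) × Q (suc W) B → ∀ k → k ℕ.≤ suc W → Q k B
      join B (p , q) k k≤ with ℕₚ.m≤n⇒m<n∨m≡n k≤
      ... | inj₁ (ℕ.s≤s k≤W) = p k k≤W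
      ... | inj₂ refl = q

    ev-all-ℤ : ∀ {Q : ℤ → Base n → Set} → (∀ k → Ev (Q k)) → ∀ W → Ev (λ B → ∀ k → ℤ.∣ k ∣ ℕ.≤ W → Q k B)
    ev-all-ℤ {Q} h W = ev-map join (ev-× (ev-all (λ k → h (+ k)) W) (ev-all (λ k → h (ℤ.- + k)) W))
      where
      join : ∀ B → (∀ k → k ℕ.≤ W → Q (+ k) B) × (∀ k → k ℕ.≤ W → Q (ℤ.- + k) B) → ∀ k → ℤ.∣ k ∣ ℕ.≤ W → Q k B
      join B (p , q) (+ k) h = p k h
      join B (p , q) -[1+ k ] h = q (suc k) h

    -- Sufficiently close points exist, so `Ev` is never vacuous; contradictions derived at a point
    -- are discharged here.
    ev-⊥ : ¬ Ev (λ _ → ⊥)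
    ev-⊥ (Z , p) = let B , h , k = root-point n n≥1 Z in p B h k

    ≃⇒ev : ∀ {g h} → g ≃ h → ∀ m → Ev (λ B → ν m * ∣ g B - h B ∣ ≤ 1ℚ)
    ≃⇒ev {g} {h} (mk≃ (E , (R , b) , p)) m = m ℕ.* k , close
      where
      k = ℤ.∣ ↥ R ∣
      close : ∀ B → φ₀ B ≤ 0ℚ → ν (m ℕ.* k) * - φ₀ B ≤ 1ℚ → ν m * ∣ g B - h B ∣ ≤ 1ℚ
      close B φ≤0 small = begin
        ν m * ∣ g B - h B ∣            ≡⟨ cong (λ t → ν m * ∣ t ∣) (trans (cong (λ t → t - h B) (p B)) (close-identity (h B) (φ₀ B * E B))) ⟩
        ν m * ∣ φ₀ B * E B ∣           ≡⟨ cong (λ t → ν m * t) (trans (∣p*q∣≡∣p∣*∣q∣ (φ₀ B) (E B)) (cong (_* ∣ E B ∣)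
                                            (trans (sym (∣-p∣≡∣p∣ (φ₀ B))) (0≤p⇒∣p∣≡p 0≤-φ)))) ⟩
        ν m * (- φ₀ B * ∣ E B ∣)       ≤⟨ *-monoˡ-≤-nonNeg (ν m) {{nonNegative (ν0 m)}} (*-monoˡ-≤-nonNeg (- φ₀ B) {{nonNegative 0≤-φ}}
                                            (≤-trans (b B) (archimedean R))) ⟩
        ν m * (- φ₀ B * ν k)           ≡⟨ close-identity₂ (ν m) (- φ₀ B) (ν k) ⟩
        ν m * ν k * - φ₀ B             ≡⟨ cong (_* - φ₀ B) (ν-* m k) ⟨
        ν (m ℕ.* k) * - φ₀ B           ≤⟨ small ⟩
        1ℚ ∎
        where
        open ≤-Reasoning
        0≤-φ : 0ℚ ≤ - φ₀ B
        0≤-φ = neg-antimono-≤ φ≤0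

    -- Integers at distance at most 1/2 are equal. In this way approximate identities between
    -- integer constants become exact.
    ≃-ι : ∀ {a b} → (λ _ → ι a) ≃ (λ _ → ι b) → a ≡ b
    ≃-ι {a} {b} h with a ℤ.≟ b
    ... | yes e = e
    ... | no a≢b = contradiction (ev-map (λ B q → impossible q) (≃⇒ev h 2)) ev-⊥
      where
      open ≤-Reasoning
      1≤ : 1 ℕ.≤ ℤ.∣ a ℤ.- b ∣
      1≤ with ℤ.∣ a ℤ.- b ∣ in eq
      ... | zero = contradiction (ℤₚ.i-j≡0⇒i≡j a b (ℤₚ.∣i∣≡0⇒i≡0 eq)) a≢b
      ... | suc _ = ℕ.s≤s ℕ.z≤n
      impossible : ν 2 * ∣ ι a - ι b ∣ ≤ 1ℚ → ⊥
      impossible q = <-irrefl refl (begin-strict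
        1ℚ                               <⟨ by< (k0< 0) refl ⟩
        # 2 * 1ℚ                         ≤⟨ *-monoˡ-≤-nonNeg (# 2) (subst (_≤ ν ℤ.∣ a ℤ.- b ∣) (ι-# 1) (ν≤ 1≤)) ⟩
        # 2 * ν ℤ.∣ a ℤ.- b ∣            ≡⟨ cong₂ _*_ (sym (ι-# 2)) (trans (sym (ι-abs (a ℤ.- b))) (cong ∣_∣ (ι-sub a b))) ⟩
        ν 2 * ∣ ι a - ι b ∣              ≤⟨ q ⟩
        1ℚ ∎)

-- Conjugates of α and β, and the norm equation.

module Conjugates where
  open import Data.Nat as ℕ using (ℕ)
  open import Data.Integer as ℤ using (ℤ; +_)
  open import Data.List using ([]; _∷_)
  open import Data.Product using (_,_)
  open import Data.Rational hiding (neg; _≃_)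
  open import Data.Rational.Properties hiding (≃-sym)
  open import Relation.Binary.PropositionalEquality
  open import Tactic.RingSolver using (solve)
  open import Defs using (K; thueForm) renaming (ι to ιK)
  open Rationals
  open Bounds
  open Points
  open Root
  open Asymptotics
  open FormBound using (f)

  f-ι : ∀ n p q → ι (f n p q) ≡ ι p * ι p * ι p - (ν n - 1ℚ) * ι p * ι p * ι q - (ν n + # 2) * ι p * ι q * ι q - ι q * ι q * ι q
  f-ι n p q = trans (ι-sub _ _) (cong₂ _-_ (trans (ι-sub _ _) (cong₂ _-_ (trans (ι-sub _ _) (cong₂ _-_ (cube p)
      (trans (ι-* _ q) (cong (_* ι q) (trans (ι-* _ p) (cong (_* ι p) (trans (ι-* _ p) (cong (_* ι p) n-1))))))))
      (trans (ι-* _ q) (cong (_* ι q) (trans (ι-* _ q) (cong (_* ι q) (trans (ι-* _ p) (cong (_* ι p) n+2)))))))) (cube q))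
    where
    cube : ∀ p → ι (p ℤ.* p ℤ.* p) ≡ ι p * ι p * ι p
    cube p = trans (ι-* _ p) (cong (_* ι p) (ι-* p p))
    n-1 : ι (+ n ℤ.- + 1) ≡ ν n - 1ℚ
    n-1 = trans (ι-sub (+ n) (+ 1)) (cong (λ t → ν n - t) (ι-# 1))
    n+2 : ι (+ n ℤ.+ + 2) ≡ ν n + # 2
    n+2 = trans (ι-+ (+ n) (+ 2)) (cong (λ t → ν n + t) (ι-# 2))

  pw-cong : ∀ {x x' xi xi'} → x ≡ x' → xi ≡ xi' → ∀ k → pw x xi k ≡ pw x' xi' k
  pw-cong refl refl k = refl

  private
    ym-identity : ∀ L m y → y * m ≡ m - y + - y * (L * m - 1ℚ) + m * ((L + 1ℚ) * y - 1ℚ)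
    ym-identity L m y = solve (L ∷ m ∷ y ∷ []) ℚring

    φmy-identity : ∀ N L m y → (L * L * L - (N - 1ℚ) * (L * L) - (N + # 2) * L - 1ℚ) * m * y
         ≡ L * m * (L * (L * y)) - (N - 1ℚ) * (L * m) * (L * y) - (N + # 2) * (L * m) * y - y * m
    φmy-identity N L m y = solve (N ∷ L ∷ m ∷ y ∷ []) ℚring

    φmy-identity₂ : ∀ N L m y → 1ℚ * (L * (L * y)) - (N - 1ℚ) * 1ℚ * (L * y) - (N + # 2) * 1ℚ * y - y * m
         ≡ L - N - y - m + (L - N) * (L * y - (1ℚ - y)) + - 1ℚ * (y * m - (m - y))
    φmy-identity₂ N L m y = solve (N ∷ L ∷ m ∷ y ∷ []) ℚring

    norm-form-expand : ∀ p q L m y → (p - q * L) * (p - q * - y) * (p - q * - (1ℚ + m))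
      ≡ p * p * p - (L - y - 1ℚ - m) * (p * p * q) + (y + m - L - # 2) * (p * q * q) - q * q * q
        + (- (p * q * q) - q * q * q * (1ℚ + m)) * (L * y - (1ℚ - y)) + - (p * q * q) * (L * m - 1ℚ) + (p * q * q + q * q * q) * (y * m - (m - y))
    norm-form-expand p q L m y = solve (p ∷ q ∷ L ∷ m ∷ y ∷ []) ℚring

    norm-form-split : ∀ N p q L m y → p * p * p - (L - y - 1ℚ - m) * (p * p * q) + (y + m - L - # 2) * (p * q * q) - q * q * q
      ≡ p * p * p - (N - 1ℚ) * p * p * q - (N + # 2) * p * q * q - q * q * q + - ((L - N - y - m) * (p * p * q + p * q * q))
    norm-form-split N p q L m y = solve (N ∷ p ∷ q ∷ L ∷ m ∷ y ∷ []) ℚring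

    norm-form-assoc : ∀ a b c d → - (a * b * c * d) ≡ a * - (b * c * d)
    norm-form-assoc a b c d = solve (a ∷ b ∷ c ∷ d ∷ []) ℚring

  module Norms (n : ℕ) (n≥1 : 1 ℕ.≤ n) where
    open Near n n≥1
    open Evaluate n using (φ)

    l₀ l₁ l₂ : Fn
    l₀ B = Base.L B
    l₁ B = - Base.y B
    l₂ B = - ((Base.L B + 1ℚ) * Base.Li B)

    b-l₀ : Bounded l₀
    b-l₀ = b-∘ p₀ (Evaluate.b-x n)
    b-l₁ : Bounded l₁
    b-l₁ = b-∘ p₁ (Evaluate.b-x n)
    b-l₂ : Bounded l₂
    b-l₂ = b-∘ p₂ (Evaluate.b-x n)

    -- The three points have exact product 1, while their sum is n - 1 only up to `φ₀` divided by
    -- L(L + 1). That defect is the whole error of the factorisation.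
    norm-form : ∀ p q → (λ B → (ι p - ι q * l₀ B) * (ι p - ι q * l₁ B) * (ι p - ι q * l₂ B)) ≃ (λ _ → ι (f n p q))
    norm-form p q = ≃-err (λ B → - (Base.Li B * Base.y B * (ι p * ι p * ι q + ι p * ι q * ι q)))
      (b-neg (b-* (b-* b-Li b-y') (b-const (ι p * ι p * ι q + ι p * ι q * ι q))))
      (λ B → let open Base B in trans (trans (cong (λ t → (ι p - ι q * L) * (ι p - ι q * - y) * (ι p - ι q * - t)) (q-eq n≥1))
          (lc3 (- (ι p * ι q * ι q) - ι q * ι q * ι q * (1ℚ + Li)) (- (ι p * ι q * ι q)) (ι p * ι q * ι q + ι q * ι q * ι q)
            (r-eq n≥1) L·Li (ym B) (norm-form-expand (ι p) (ι q) L Li y)))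
        (trans (norm-form-split (ν n) (ι p) (ι q) L Li y) (cong₂ (λ s t → s + t) (sym (f-ι n p q))
          (trans (cong (λ t → - (t * (ι p * ι p * ι q + ι p * ι q * ι q))) (sym (φmy B)))
            (norm-form-assoc (φ₀ B) Li y (ι p * ι p * ι q + ι p * ι q * ι q))))))
      where
      ym : ∀ B → Base.y B * Base.Li B ≡ Base.Li B - Base.y B
      ym B = lc2 (- y) Li L·Li L+1·y (ym-identity L Li y)
        where
        open Base B
      φmy : ∀ B → φ₀ B * Base.Li B * Base.y B ≡ Base.L B - ν n - Base.y B - Base.Li B
      φmy B = trans (φmy-identity (ν n) L Li y) (trans (cong (λ r → r * (L * (L * y)) - (ν n - 1ℚ) * r * (L * y) - (ν n + # 2) * r * y - y * Li) L·Li)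
        (lc2 (L - ν n) (- 1ℚ) (r-eq n≥1) (ym B) (φmy-identity₂ (ν n) L Li y)))
        where
        open Base B

  private
    rotate₂-identity : ∀ L → - (- L) ≡ L
    rotate₂-identity L = solve (L ∷ []) ℚring

    rotate₂-identity₂ : ∀ m → - (- (1ℚ + m) + 1ℚ) ≡ m
    rotate₂-identity₂ m = solve (m ∷ []) ℚring

    cut-identity : ∀ N A₀ A₁ A₂ X Y x →
      (X + - ((A₀ + A₁ * x + A₂ * (x * x)) * Y)) * (A₂ * x + - (A₁ + (N - 1ℚ) * A₂))
      ≡ (X * - (A₁ + (N - 1ℚ) * A₂) - Y * (A₂ * A₂ + - (A₁ + (N - 1ℚ) * A₂) * A₀))
        - (Y * (A₂ * (A₀ + (N + # 2) * A₂) + - (A₁ + (N - 1ℚ) * A₂) * A₁) - X * A₂) * x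
        + (x * x * x - (N - 1ℚ) * (x * x) - (N + # 2) * x - 1ℚ) * - (Y * (A₂ * A₂))
    cut-identity N A₀ A₁ A₂ X Y x = solve (N ∷ A₀ ∷ A₁ ∷ A₂ ∷ X ∷ Y ∷ x ∷ []) ℚring

    norm-m-identity : ∀ c d x → c * x + d ≡ d - - c * x
    norm-m-identity c d x = solve (c ∷ d ∷ x ∷ []) ℚring

    norm-equation-identity : ∀ a b c d e f → a * b * (c * d) * (e * f) ≡ a * c * e * (b * d * f)
    norm-equation-identity a b c d e f = solve (a ∷ b ∷ c ∷ d ∷ e ∷ f ∷ []) ℚring

  module Solution (n : ℕ) (n≥1 : 1 ℕ.≤ n) (s t X Y η : ℤ) (thue : thueForm n s t X Y ≡ ιK η) where
    open Near n n≥1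
    open Norms n n≥1 public
    open Evaluate n using (φ; ev; unit; ≈-unit; ≈-thueForm; a₀; a₁; a₂; b-a₀; b-a₁; b-a₂; ev-ι)

    α₀ α₁ α₂ β₀ β₁ β₂ : Fn
    α₀ B = a₀ s t (p₀ B)
    α₁ B = a₁ s t (p₀ B)
    α₂ B = a₂ s t (p₀ B)
    β₀ B = ι X + - (α₀ B * ι Y)
    β₁ B = ι X + - (α₁ B * ι Y)
    β₂ B = ι X + - (α₂ B * ι Y)

    b-α₀ : Bounded α₀
    b-α₀ = b-∘ p₀ (b-a₀ s t)
    b-α₁ : Bounded α₁
    b-α₁ = b-∘ p₀ (b-a₁ s t)
    b-α₂ : Bounded α₂
    b-α₂ = b-∘ p₀ (b-a₂ s t)

    norm-β : (λ B → β₀ B * β₁ B * β₂ B) ≃ (λ _ → ι η)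
    norm-β = ≃-trans (≃-sym (ev₀ (≈-thueForm s t X Y))) (≃-≗ (λ B → trans (cong (ev (p₀ B)) thue) (ev-ι (p₀ B) η)))

    opaque
      α : K
      α = unit s t

      α-def : α ≡ unit s t
      α-def = refl

    A₀ A₁ A₂ : ℤ
    A₀ = K.c₀ α
    A₁ = K.c₁ α
    A₂ = K.c₂ α

    at-l : Fn → Fn
    at-l l B = ι A₀ + ι A₁ * l B + ι A₂ * (l B * l B)

    -- The same function a₀ taken at the other two points gives the other conjugates.
    rotate₁ : ∀ s t B → a₀ s t (p₁ B) ≡ a₁ s t (p₀ B)
    rotate₁ s t B = cong (λ r → pw (- y) (- (L + 1ℚ)) s * r) (pw-cong refl (cong -_ (trans (+-comm (- y) 1ℚ) (sym (r-eq n≥1)))) t)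
      where open Base B

    rotate₂ : ∀ s t B → a₀ s t (p₂ B) ≡ a₂ s t (p₀ B)
    rotate₂ s t B = cong (λ r → pw (- ((L + 1ℚ) * Li)) (- (L * y)) s * r)
        (pw-cong (rotate₂-identity L) (trans (cong (λ r → - (- r + 1ℚ)) (q-eq n≥1)) (rotate₂-identity₂ Li)) t)
      where
      open Base B

    opaque
      unfolding α

      conj₀ : at-l l₀ ≃ α₀
      conj₀ = ev₀ (≈-unit s t)
      conj₁ : at-l l₁ ≃ α₁
      conj₁ = ≃-trans (ev₁ (≈-unit s t)) (≃-≗ (rotate₁ s t))
      conj₂ : at-l l₂ ≃ α₂
      conj₂ = ≃-trans (ev₂ (≈-unit s t)) (≃-≗ (rotate₂ s t))

    -- α (c λ + d) = a λ + b, hence (X − αY)(c λ + d) = p − q λ.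
    a b c d p q : ℤ
    c = A₂
    d = ℤ.- (A₁ ℤ.+ (+ n ℤ.- + 1) ℤ.* A₂)
    a = A₂ ℤ.* (A₀ ℤ.+ (+ n ℤ.+ + 2) ℤ.* A₂) ℤ.+ d ℤ.* A₁
    b = A₂ ℤ.* A₂ ℤ.+ d ℤ.* A₀
    p = X ℤ.* d ℤ.- Y ℤ.* b
    q = Y ℤ.* a ℤ.- X ℤ.* c

    private
      N : ℚ
      N = ν n
      ι-d : ι d ≡ - (ι A₁ + (N - 1ℚ) * ι A₂)
      ι-d = trans (ι-neg _) (cong -_ (trans (ι-+ A₁ _) (cong (λ r → ι A₁ + r) (trans (ι-* _ A₂) (cong (_* ι A₂)
        (trans (ι-sub (+ n) (+ 1)) (cong (λ r → N - r) (ι-# 1))))))))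
      ι-a : ι a ≡ ι A₂ * (ι A₀ + (N + # 2) * ι A₂) + ι d * ι A₁
      ι-a = trans (ι-+ _ _) (cong₂ _+_ (trans (ι-* A₂ _) (cong (λ r → ι A₂ * r) (trans (ι-+ A₀ _) (cong (λ r → ι A₀ + r)
        (trans (ι-* _ A₂) (cong (_* ι A₂) (trans (ι-+ (+ n) (+ 2)) (cong (λ r → N + r) (ι-# 2))))))))) (ι-* d A₁))
      ι-b : ι b ≡ ι A₂ * ι A₂ + ι d * ι A₀
      ι-b = trans (ι-+ _ _) (cong₂ _+_ (ι-* A₂ A₂) (ι-* d A₀))
      ι-p : ι p ≡ ι X * ι d - ι Y * ι b
      ι-p = trans (ι-sub _ _) (cong₂ _-_ (ι-* X d) (ι-* Y b))
      ι-q : ι q ≡ ι Y * ι a - ι X * ι c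
      ι-q = trans (ι-sub _ _) (cong₂ _-_ (ι-* Y a) (ι-* X c))

    -- Because λ³ contributes (n - 1)λ², the choice of `d` cancels the λ²-coordinate of α(cλ + d),
    -- so that β(cλ + d) becomes linear in λ.
    cut : (l r : Fn) → Bounded l → Bounded r → at-l l ≃ r →
          ((λ B → (l B * l B * l B - (ν n - 1ℚ) * (l B * l B) - (ν n + # 2) * l B - 1ℚ) * - (ι Y * (ι A₂ * ι A₂))) ≃ (λ _ → 0ℚ)) →
          (λ B → (ι X + - (r B * ι Y)) * (ι c * l B + ι d)) ≃ (λ B → ι p - ι q * l B)
    cut l r bl br h hφ = ≃-trans
        (≃-* (b-+ (b-const (ι X)) (b-neg (b-* (b-at-l) (b-const (ι Y))))) (b-+ (b-* (b-const (ι c)) bl) (b-const (ι d)))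
          (≃-+ (≃-refl {λ _ → ι X}) (≃-neg (≃-* b-at-l (b-const (ι Y)) (≃-sym h) ≃-refl))) ≃-refl)
        (≃-trans (≃-≗ (λ B → identity (l B))) (≃-trans (≃-+ (≃-refl {λ B → ι p - ι q * l B}) hφ) (≃-≗ (λ B → +-identityʳ (ι p - ι q * l B)))))
      where
      b-at-l : Bounded (at-l l)
      b-at-l = b-+ (b-+ (b-const (ι A₀)) (b-* (b-const (ι A₁)) bl)) (b-* (b-const (ι A₂)) (b-* bl bl))
      ι-pd : ι p ≡ ι X * - (ι A₁ + (N - 1ℚ) * ι A₂) - ι Y * (ι A₂ * ι A₂ + - (ι A₁ + (N - 1ℚ) * ι A₂) * ι A₀)
      ι-pd = trans ι-p (trans (cong (λ r → ι X * ι d - ι Y * r) ι-b)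
        (cong (λ r → ι X * r - ι Y * (ι A₂ * ι A₂ + r * ι A₀)) ι-d))
      ι-qd : ι q ≡ ι Y * (ι A₂ * (ι A₀ + (N + # 2) * ι A₂) + - (ι A₁ + (N - 1ℚ) * ι A₂) * ι A₁) - ι X * ι A₂
      ι-qd = trans ι-q (trans (cong (λ r → ι Y * r - ι X * ι c) ι-a)
        (cong (λ r → ι Y * (ι A₂ * (ι A₀ + (N + # 2) * ι A₂) + r * ι A₁) - ι X * ι c) ι-d))
      identity : ∀ x → (ι X + - ((ι A₀ + ι A₁ * x + ι A₂ * (x * x)) * ι Y)) * (ι c * x + ι d)
        ≡ ι p - ι q * x + (x * x * x - (N - 1ℚ) * (x * x) - (N + # 2) * x - 1ℚ) * - (ι Y * (ι A₂ * ι A₂))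
      identity x = trans (cong (λ r → (ι X + - ((ι A₀ + ι A₁ * x + ι A₂ * (x * x)) * ι Y)) * (ι c * x + r)) ι-d)
        (trans (cut-identity N (ι A₀) (ι A₁) (ι A₂) (ι X) (ι Y) x)
          (cong₂ (λ r r' → r - r' * x + (x * x * x - (N - 1ℚ) * (x * x) - (N + # 2) * x - 1ℚ) * - (ι Y * (ι A₂ * ι A₂))) (sym ι-pd) (sym ι-qd)))

    m₀ m₁ m₂ : Fn
    m₀ B = ι c * l₀ B + ι d
    m₁ B = ι c * l₁ B + ι d
    m₂ B = ι c * l₂ B + ι d

    cut₀ : (λ B → β₀ B * m₀ B) ≃ (λ B → ι p - ι q * l₀ B)
    cut₀ = cut l₀ α₀ b-l₀ b-α₀ conj₀ (φ₀-small _ (b-const _))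
    cut₁ : (λ B → β₁ B * m₁ B) ≃ (λ B → ι p - ι q * l₁ B)
    cut₁ = cut l₁ α₁ b-l₁ b-α₁ conj₁ (φ₁-small _ (b-const _))
    cut₂ : (λ B → β₂ B * m₂ B) ≃ (λ B → ι p - ι q * l₂ B)
    cut₂ = cut l₂ α₂ b-l₂ b-α₂ conj₂ (φ₂-small _ (b-const _))

    norm-m : (λ B → m₀ B * m₁ B * m₂ B) ≃ (λ _ → ι (f n d (ℤ.- c)))
    norm-m = ≃-trans (≃-≗ (λ B → cong₂ _*_ (cong₂ _*_ (flip (l₀ B)) (flip (l₁ B))) (flip (l₂ B)))) (norm-form d (ℤ.- c))
      where
      flip : ∀ x → ι c * x + ι d ≡ ι d - ι (ℤ.- c) * x
      flip x = trans (norm-m-identity (ι c) (ι d) x) (cong (λ r → ι d - r * x) (sym (ι-neg c)))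

    -- The product of the three relations `cut`, in which β contributes only its norm η. A Thue
    -- equation with exponents s, t thus becomes a value of the fixed form f_n.
    norm-equation : f n p q ≡ η ℤ.* f n d (ℤ.- c)
    norm-equation = ≃-ι (≃-trans (≃-sym (norm-form p q)) (≃-trans
        (≃-sym (≃-* (b-* (b-lin b-l₀) (b-lin b-l₁)) (b-lin b-l₂) (≃-* (b-lin b-l₀) (b-lin b-l₁) cut₀ cut₁) cut₂))
        (≃-trans (≃-≗ (λ B → norm-equation-identity (β₀ B) (m₀ B) (β₁ B) (m₁ B) (β₂ B) (m₂ B)))
          (≃-trans (≃-* (b-const (ι η)) (b-const (ι (f n d (ℤ.- c)))) norm-β norm-m) (≃-≗ (λ _ → sym (ι-* η (f n d (ℤ.- c)))))))))
      where
      b-lin : ∀ {l : Fn} → Bounded l → Bounded (λ B → ι p - ι q * l B)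
      b-lin bl = b-+ (b-const (ι p)) (b-neg (b-* (b-const (ι q)) bl))

-- The size of the coordinates of λ₀^s λ₁^t.

module UnitSize where
  open import Data.Nat as ℕ using (ℕ; zero; suc; _+_; _*_; _^_; _≤_)
  open import Data.Nat.Properties
  open import Data.Integer as ℤ using (ℤ; +_; -[1+_]; ∣_∣)
  import Data.Integer.Properties as ℤₚ
  open import Data.Product using (_×_; _,_)
  open import Relation.Binary.PropositionalEquality
  open import Defs
  open Naturals
  open import Data.List using ([]; _∷_)

  abs+ : ∀ {x y X Y} → ∣ x ∣ ≤ X → ∣ y ∣ ≤ Y → ∣ x ℤ.+ y ∣ ≤ X + Y
  abs+ {x} {y} h k = ≤-trans (ℤₚ.∣i+j∣≤∣i∣+∣j∣ x y) (+-mono-≤ h k)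

  abs- : ∀ {x y X Y} → ∣ x ∣ ≤ X → ∣ y ∣ ≤ Y → ∣ x ℤ.- y ∣ ≤ X + Y
  abs- {x} {y} h k = ≤-trans (ℤₚ.∣i-j∣≤∣i∣+∣j∣ x y) (+-mono-≤ h k)

  abs× : ∀ {x y X Y} → ∣ x ∣ ≤ X → ∣ y ∣ ≤ Y → ∣ x ℤ.* y ∣ ≤ X * Y
  abs× {x} {y} h k = ≤-trans (≤-reflexive (ℤₚ.abs-* x y)) (*-mono-≤ h k)

  absneg : ∀ {x X} → ∣ x ∣ ≤ X → ∣ ℤ.- x ∣ ≤ X
  absneg {x} h = ≤-trans (≤-reflexive (ℤₚ.∣-i∣≡∣i∣ x)) h

  -- With m = n − 1 and w = n + 2; the weight w makes this a submultiplicative norm on ℤ[λ₀].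
  module Size (m : ℕ) where
    n w : ℕ
    n = suc m
    w = m + 3

    size : K → ℕ
    size ⟨ a , b , c ⟩ = ∣ a ∣ + ∣ b ∣ * w + ∣ c ∣ * (w * w)

    private
      ∣p∣ : ∣ + n ℤ.- + 1 ∣ ≤ m
      ∣p∣ = ≤-refl

      ∣q∣ : ∣ + n ℤ.+ + 2 ∣ ≤ w
      ∣q∣ = ≤-reflexive (sym (+-suc m 2))

      weights : ∀ m e₀ e₁ e₂ e₃ e₄ → let w = m + 3 in
        e₀ + e₃ + m * e₄ + (e₁ + w * e₃ + (m * w + 1) * e₄) * w + (e₂ + m * e₃ + (m * m + w) * e₄) * (w * w)
        ≤ e₀ + e₁ * w + e₂ * (w * w) + e₃ * (w * w * w) + e₄ * (w * w * w * w)
      weights m e₀ e₁ e₂ e₃ e₄ = ≤-trans (m≤m+n _ (e₃ * (2 * (m * m) + 12 * m + 17) + e₄ * (4 * (m * m * m) + 30 * (m * m) + 70 * m + 51)))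
        (≤-reflexive (lem m e₀ e₁ e₂ e₃ e₄))
        where
        lem : ∀ m e₀ e₁ e₂ e₃ e₄ →
          e₀ + e₃ + m * e₄ + (e₁ + (m + 3) * e₃ + (m * (m + 3) + 1) * e₄) * (m + 3) + (e₂ + m * e₃ + (m * m + (m + 3)) * e₄) * ((m + 3) * (m + 3))
            + (e₃ * (2 * (m * m) + 12 * m + 17) + e₄ * (4 * (m * m * m) + 30 * (m * m) + 70 * m + 51))
          ≡ e₀ + e₁ * (m + 3) + e₂ * ((m + 3) * (m + 3)) + e₃ * ((m + 3) * (m + 3) * (m + 3)) + e₄ * ((m + 3) * (m + 3) * (m + 3) * (m + 3))
        lem m e₀ e₁ e₂ e₃ e₄ = solveℕ (m ∷ e₀ ∷ e₁ ∷ e₂ ∷ e₃ ∷ e₄ ∷ [])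

    size-mul : ∀ β γ → size (mul n β γ) ≤ size β * size γ
    size-mul ⟨ a₀ , a₁ , a₂ ⟩ ⟨ b₀ , b₁ , b₂ ⟩ = begin
      size (mul n ⟨ a₀ , a₁ , a₂ ⟩ ⟨ b₀ , b₁ , b₂ ⟩)
        ≤⟨ +-mono-≤ (+-mono-≤ c₀ (*-monoˡ-≤ w c₁)) (*-monoˡ-≤ (w * w) c₂) ⟩
      _ ≤⟨ weights m (x₀ * y₀) (x₀ * y₁ + x₁ * y₀) (x₀ * y₂ + x₁ * y₁ + x₂ * y₀) (x₁ * y₂ + x₂ * y₁) (x₂ * y₂) ⟩
      _ ≡⟨ lem w x₀ x₁ x₂ y₀ y₁ y₂ ⟩
      size ⟨ a₀ , a₁ , a₂ ⟩ * size ⟨ b₀ , b₁ , b₂ ⟩ ∎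
      where
      open ≤-Reasoning
      x₀ = ∣ a₀ ∣
      x₁ = ∣ a₁ ∣
      x₂ = ∣ a₂ ∣
      y₀ = ∣ b₀ ∣
      y₁ = ∣ b₁ ∣
      y₂ = ∣ b₂ ∣
      pr : ∀ x y → ∣ x ℤ.* y ∣ ≤ ∣ x ∣ * ∣ y ∣
      pr x y = abs× {x} {y} ≤-refl ≤-refl
      h₃ : ∣ a₁ ℤ.* b₂ ℤ.+ a₂ ℤ.* b₁ ∣ ≤ x₁ * y₂ + x₂ * y₁
      h₃ = abs+ {a₁ ℤ.* b₂} (pr a₁ b₂) (pr a₂ b₁)
      h₄ : ∣ a₂ ℤ.* b₂ ∣ ≤ x₂ * y₂
      h₄ = pr a₂ b₂
      E₀ E₁ E₂ E₃ E₄ P Q : ℤ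
      E₀ = a₀ ℤ.* b₀
      E₁ = a₀ ℤ.* b₁ ℤ.+ a₁ ℤ.* b₀
      E₂ = a₀ ℤ.* b₂ ℤ.+ a₁ ℤ.* b₁ ℤ.+ a₂ ℤ.* b₀
      E₃ = a₁ ℤ.* b₂ ℤ.+ a₂ ℤ.* b₁
      E₄ = a₂ ℤ.* b₂
      P = + n ℤ.- + 1
      Q = + n ℤ.+ + 2
      c₀ : ∣ E₀ ℤ.+ E₃ ℤ.+ P ℤ.* E₄ ∣ ≤ x₀ * y₀ + (x₁ * y₂ + x₂ * y₁) + m * (x₂ * y₂)
      c₀ = abs+ {E₀ ℤ.+ E₃} {P ℤ.* E₄} (abs+ {E₀} {E₃} (pr a₀ b₀) h₃) (abs× {P} {E₄} ∣p∣ h₄)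
      c₁ : ∣ E₁ ℤ.+ Q ℤ.* E₃ ℤ.+ (P ℤ.* Q ℤ.+ + 1) ℤ.* E₄ ∣ ≤ x₀ * y₁ + x₁ * y₀ + w * (x₁ * y₂ + x₂ * y₁) + (m * w + 1) * (x₂ * y₂)
      c₁ = abs+ {E₁ ℤ.+ Q ℤ.* E₃} {(P ℤ.* Q ℤ.+ + 1) ℤ.* E₄}
        (abs+ {E₁} {Q ℤ.* E₃} (abs+ {a₀ ℤ.* b₁} (pr a₀ b₁) (pr a₁ b₀)) (abs× {Q} {E₃} ∣q∣ h₃))
        (abs× {P ℤ.* Q ℤ.+ + 1} {E₄} (abs+ {P ℤ.* Q} {+ 1} (abs× {P} {Q} ∣p∣ ∣q∣) ≤-refl) h₄)
      c₂ : ∣ E₂ ℤ.+ P ℤ.* E₃ ℤ.+ (P ℤ.* P ℤ.+ Q) ℤ.* E₄ ∣ ≤ x₀ * y₂ + x₁ * y₁ + x₂ * y₀ + m * (x₁ * y₂ + x₂ * y₁) + (m * m + w) * (x₂ * y₂)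
      c₂ = abs+ {E₂ ℤ.+ P ℤ.* E₃} {(P ℤ.* P ℤ.+ Q) ℤ.* E₄}
        (abs+ {E₂} {P ℤ.* E₃} (abs+ {a₀ ℤ.* b₂ ℤ.+ a₁ ℤ.* b₁} {a₂ ℤ.* b₀} (abs+ {a₀ ℤ.* b₂} (pr a₀ b₂) (pr a₁ b₁)) (pr a₂ b₀)) (abs× {P} {E₃} ∣p∣ h₃))
        (abs× {P ℤ.* P ℤ.+ Q} {E₄} (abs+ {P ℤ.* P} {Q} (abs× {P} {P} ∣p∣ ∣p∣) ∣q∣) h₄)
      lem : ∀ w x₀ x₁ x₂ y₀ y₁ y₂ → x₀ * y₀ + (x₀ * y₁ + x₁ * y₀) * w + (x₀ * y₂ + x₁ * y₁ + x₂ * y₀) * (w * w)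
          + (x₁ * y₂ + x₂ * y₁) * (w * w * w) + x₂ * y₂ * (w * w * w * w)
        ≡ (x₀ + x₁ * w + x₂ * (w * w)) * (y₀ + y₁ * w + y₂ * (w * w))
      lem w x₀ x₁ x₂ y₀ y₁ y₂ = solveℕ (w ∷ x₀ ∷ x₁ ∷ x₂ ∷ y₀ ∷ y₁ ∷ y₂ ∷ [])

    size-powℕ : ∀ β M k → size β ≤ M → size (powℕ n β k) ≤ M ^ k
    size-powℕ β M zero h = ≤-refl
    size-powℕ β M (suc k) h = ≤-trans (size-mul β (powℕ n β k)) (*-mono-≤ h (size-powℕ β M k h))

    size-powℤ : ∀ β βi M k → size β ≤ M → size βi ≤ M → size (powℤ n β βi k) ≤ M ^ ∣ k ∣
    size-powℤ β βi M (+ k) h _ = size-powℕ β M k h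
    size-powℤ β βi M -[1+ k ] _ h = size-powℕ βi M (suc k) h

    private
      w³ : ℕ
      w³ = w * (w * w)

      slack : ∀ {x} y → x + y ≡ w³ → x ≤ w³
      slack y e = ≤-trans (m≤m+n _ y) (≤-reflexive e)

      s₀ : size λ₀ ≤ w³
      s₀ = slack (m * m * m + 9 * (m * m) + 26 * m + 24) (lem m)
        where
        lem : ∀ m → 0 + 1 * (m + 3) + 0 * ((m + 3) * (m + 3)) + (m * m * m + 9 * (m * m) + 26 * m + 24) ≡ (m + 3) * ((m + 3) * (m + 3))
        lem m = solveℕ (m ∷ [])

      s₀⁻¹ : size (λ₀⁻¹ n) ≤ w³
      s₀⁻¹ = ≤-trans (+-mono-≤ (+-mono-≤ (absneg {+ n ℤ.+ + 2} ∣q∣) (*-monoˡ-≤ w (absneg {+ n ℤ.- + 1} ∣p∣))) ≤-refl)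
        (slack (m * m * m + 7 * (m * m) + 17 * m + 15) (lem m))
        where
        lem : ∀ m → m + 3 + m * (m + 3) + 1 * ((m + 3) * (m + 3)) + (m * m * m + 7 * (m * m) + 17 * m + 15) ≡ (m + 3) * ((m + 3) * (m + 3))
        lem m = solveℕ (m ∷ [])

      s₁ : size (λ₁ n) ≤ w³
      s₁ = slack (m * m * m + 7 * (m * m) + 17 * m + 13) (lem m)
        where
        lem : ∀ m → 2 + (1 + m) * (m + 3) + 1 * ((m + 3) * (m + 3)) + (m * m * m + 7 * (m * m) + 17 * m + 13) ≡ (m + 3) * ((m + 3) * (m + 3))
        lem m = solveℕ (m ∷ [])

      s₁⁻¹ : size (λ₁⁻¹ n) ≤ w³
      s₁⁻¹ = slack (m * m * m + 9 * (m * m) + 26 * m + 23) (lem m)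
        where
        lem : ∀ m → 1 + 1 * (m + 3) + 0 * ((m + 3) * (m + 3)) + (m * m * m + 9 * (m * m) + 26 * m + 23) ≡ (m + 3) * ((m + 3) * (m + 3))
        lem m = solveℕ (m ∷ [])

    size-unit : ∀ s t → size (mul n (λ₀^ n s) (λ₁^ n t)) ≤ (w * (w * w)) ^ (∣ s ∣ + ∣ t ∣)
    size-unit s t = ≤-trans (size-mul (λ₀^ n s) (λ₁^ n t)) (≤-trans
      (*-mono-≤ (size-powℤ λ₀ (λ₀⁻¹ n) w³ s s₀ s₀⁻¹) (size-powℤ (λ₁ n) (λ₁⁻¹ n) w³ t s₁ s₁⁻¹))
      (≤-reflexive (sym (^-distribˡ-+-* w³ ∣ s ∣ ∣ t ∣))))

    -- For β = α these two integers are `c` and `d`, the coefficients of the denominator in the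
    -- fractional linear form of α.
    coefficients : ∀ β D → size β ≤ D → ∣ K.c₂ β ∣ ≤ D × ∣ ℤ.- (K.c₁ β ℤ.+ (+ n ℤ.- + 1) ℤ.* K.c₂ β) ∣ ≤ D
    coefficients ⟨ a , b , c ⟩ D h = ≤-trans (≤-trans (m≤m*n ∣ c ∣ (w * w) {{m*n≢0 w w {{w≢0}} {{w≢0}}}}) (m≤n+m _ (∣ a ∣ + ∣ b ∣ * w))) h ,
      ≤-trans (absneg {b ℤ.+ (+ n ℤ.- + 1) ℤ.* c} (abs+ {b} {(+ n ℤ.- + 1) ℤ.* c} ≤-refl (abs× {+ n ℤ.- + 1} {c} ∣p∣ ≤-refl)))
        (≤-trans (+-mono-≤ (≤-trans (m≤m*n ∣ b ∣ w {{w≢0}}) (m≤n+m _ ∣ a ∣)) (≤-trans (≤-reflexive (*-comm m ∣ c ∣)) (*-monoʳ-≤ ∣ c ∣ m≤w²))) h)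
      where
      w≢0 : ℕ.NonZero w
      w≢0 = subst ℕ.NonZero (+-comm 3 m) _
      m≤w² : m ≤ w * w
      m≤w² = ≤-trans (m≤m+n m 3) (m≤m*n w w {{w≢0}})

-- Bounding the conjugates of β by a power of n.

module BetaBound where
  open import Data.Nat as ℕ using (ℕ; zero; suc; z≤n; s≤s)
  import Data.Nat.Properties as ℕₚ
  open import Data.Integer as ℤ using (ℤ; +_; -[1+_])
  import Data.Integer.Properties as ℤₚ
  open import Data.List using ([]; _∷_)
  open import Data.Product using (_×_; _,_; proj₁; proj₂)
  open import Data.Rational hiding (neg; _≃_)
  open import Data.Rational.Properties hiding (≃-sym)
  open import Relation.Nullary using (¬_; yes; no; contradiction)
  open import Relation.Binary.PropositionalEquality
  open import Tactic.RingSolver using (solve)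
  open import Defs using (K; thueForm; λ₀^; λ₁^; mul) renaming (ι to ιK)
  open Naturals
  open Rationals
  open Bounds
  open Points
  open Root
  open Asymptotics
  open Conjugates
  open UnitSize
  open FormBound using (f; f-homogeneous; form-bound; N₁; C₁)

  -- f_n has no rational root: a zero of the form could be scaled, against form-bound.
  f-zero : ∀ n d c → N₁ ℕ.≤ 2 ℕ.* n ℕ.+ 1 → f n d c ≡ + 0 → d ≡ + 0 × c ≡ + 0
  f-zero n d c N≥ f≡0 = vanish d (λ k → proj₁ (scaled k)) , vanish c (λ k → proj₂ (scaled k))
    where
    M = C₁ ℕ.* ((2 ℕ.* n ℕ.+ 1) ℕ.* (1 ℕ.* 1))
    scaled : ∀ k → ℤ.∣ + k ℤ.* d ∣ ℕ.≤ M × ℤ.∣ + k ℤ.* c ∣ ℕ.≤ M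
    scaled k = form-bound n (+ k ℤ.* d) (+ k ℤ.* c) 1 N≥ ℕₚ.≤-refl
      (ℕₚ.≤-trans (ℕₚ.≤-reflexive (cong ℤ.∣_∣ (trans (f-homogeneous n (+ k) d c) (trans (cong (λ t → + k ℤ.* + k ℤ.* + k ℤ.* t) f≡0) (ℤₚ.*-zeroʳ (+ k ℤ.* + k ℤ.* + k)))))) z≤n)
    vanish : ∀ x → (∀ k → ℤ.∣ + k ℤ.* x ∣ ℕ.≤ M) → x ≡ + 0
    vanish x h with x ℤ.≟ + 0
    ... | yes e = e
    ... | no x≢0 = contradiction (ℕₚ.≤-trans (ℕₚ.m≤m*n (suc M) ℤ.∣ x ∣ {{ℕ.≢-nonZero (λ e → x≢0 (ℤₚ.∣i∣≡0⇒i≡0 e))}})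
        (ℕₚ.≤-trans (ℕₚ.≤-reflexive (sym (ℤₚ.abs-* (+ suc M) x))) (h (suc M)))) ℕₚ.1+n≰n

  abs≥1 : ∀ z → z ≢ + 0 → 1 ℕ.≤ ℤ.∣ z ∣
  abs≥1 (+ zero) h = contradiction refl h
  abs≥1 (+ suc _) h = s≤s z≤n
  abs≥1 -[1+ _ ] h = s≤s z≤n

  private
    mon-*-identity : ∀ a b c d → a ℕ.* b ℕ.* (c ℕ.* d) ≡ a ℕ.* c ℕ.* (b ℕ.* d)
    mon-*-identity a b c d = solveℕ (a ∷ b ∷ c ∷ d ∷ [])

    mon-+-identity : ∀ x → x ℕ.+ x ≡ 2 ℕ.* x
    mon-+-identity x = solveℕ (x ∷ [])

    halve-identity : ∀ x → 1ℚ ≡ x + (1ℚ - # 2 * x + x)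
    halve-identity x = solve (x ∷ []) ℚring

    quotient-bound-identity : ∀ a b → a * (# 2 * b) ≡ # 2 * (a * b)
    quotient-bound-identity a b = solve (a ∷ b ∷ []) ℚring

    quotient-bound-identity₂ : ∀ x a b c → x * (a * b * c) ≡ x * a * (b * c)
    quotient-bound-identity₂ x a b c = solve (x ∷ a ∷ b ∷ c ∷ []) ℚring

    near-abs-identity : ∀ g h → g ≡ h + (g - h)
    near-abs-identity g h = solve (g ∷ h ∷ []) ℚring

    near-abs-identity₂ : ∀ g h → h ≡ g + - (g - h)
    near-abs-identity₂ g h = solve (g ∷ h ∷ []) ℚring

  private
    module Mono (w D : ℕ) (w≥2 : 2 ℕ.≤ w) (D≥1 : 1 ℕ.≤ D) where
      -- Every quantity in the estimate is bounded by such a monomial; since w ≥ 2, a sum of two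
      -- equal bounds costs only one more factor w.
      mon : ℕ → ℕ → ℕ
      mon i j = w ℕ.^ i ℕ.* D ℕ.^ j

      instance
        w≢0 : ℕ.NonZero w
        w≢0 = ℕ.>-nonZero (ℕₚ.≤-trans (s≤s z≤n) w≥2)
        D≢0 : ℕ.NonZero D
        D≢0 = ℕ.>-nonZero D≥1

      mon-mono : ∀ {i i' j j'} → i ℕ.≤ i' → j ℕ.≤ j' → mon i j ℕ.≤ mon i' j'
      mon-mono h k = ℕₚ.*-mono-≤ (ℕₚ.^-monoʳ-≤ w h) (ℕₚ.^-monoʳ-≤ D k)

      mon-* : ∀ {x y} i j k l → x ℕ.≤ mon i j → y ℕ.≤ mon k l → x ℕ.* y ℕ.≤ mon (i ℕ.+ k) (j ℕ.+ l)
      mon-* i j k l h h' = ℕₚ.≤-trans (ℕₚ.*-mono-≤ h h') (ℕₚ.≤-reflexive (trans (mon-*-identity (w ℕ.^ i) (D ℕ.^ j) (w ℕ.^ k) (D ℕ.^ l))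
        (sym (cong₂ ℕ._*_ (ℕₚ.^-distribˡ-+-* w i k) (ℕₚ.^-distribˡ-+-* D j l)))))

      mon-+ : ∀ {x y} i j → x ℕ.≤ mon i j → y ℕ.≤ mon i j → x ℕ.+ y ℕ.≤ mon (suc i) j
      mon-+ i j h k = ℕₚ.≤-trans (ℕₚ.+-mono-≤ h k) (ℕₚ.≤-trans (ℕₚ.≤-reflexive (mon-+-identity (mon i j)))
        (ℕₚ.≤-trans (ℕₚ.*-monoˡ-≤ (mon i j) w≥2) (ℕₚ.≤-reflexive (sym (ℕₚ.*-assoc w _ _)))))

      mon-w : w ℕ.≤ mon 1 0
      mon-w = ℕₚ.≤-reflexive (sym (trans (ℕₚ.*-identityʳ (w ℕ.* 1)) (ℕₚ.*-identityʳ w)))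

      mon-1 : ∀ i j → 1 ℕ.≤ mon i j
      mon-1 i j = mon-mono {0} {i} {0} {j} z≤n z≤n

      mon-D : ∀ {x} → x ℕ.≤ D → x ℕ.≤ mon 0 1
      mon-D h = ℕₚ.≤-trans h (ℕₚ.≤-reflexive (sym (trans (ℕₚ.*-identityˡ (D ℕ.* 1)) (ℕₚ.*-identityʳ D))))

    -- A conjugate of cλ + d may be very small. Its norm, however, is a nonzero integer up to a
    -- small error, so the reciprocal of one conjugate is at most twice the product of the other
    -- two.
    quotient-bound : ∀ {x m m' m'' V U} → 0ℚ ≤ V → 0ℚ ≤ U → ∣ x * m ∣ ≤ V → ∣ m' ∣ ≤ U → ∣ m'' ∣ ≤ U → 1ℚ ≤ # 2 * ∣ m * m' * m'' ∣ →
                     ∣ x ∣ ≤ # 2 * (V * (U * U))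
    quotient-bound {x} {m} {m'} {m''} {V} {U} V0 U0 hV h' h'' hn = begin
      ∣ x ∣                               ≡⟨ *-identityʳ ∣ x ∣ ⟨
      ∣ x ∣ * 1ℚ                          ≤⟨ *-monoˡ-≤-nonNeg ∣ x ∣ {{∣-∣-nonNeg x}} hn ⟩
      ∣ x ∣ * (# 2 * ∣ m * m' * m'' ∣)    ≡⟨ quotient-bound-identity ∣ x ∣ ∣ m * m' * m'' ∣ ⟩
      # 2 * (∣ x ∣ * ∣ m * m' * m'' ∣)    ≡⟨ cong (λ r → # 2 * r) (trans (sym (∣p*q∣≡∣p∣*∣q∣ x (m * m' * m''))) (cong ∣_∣ (quotient-bound-identity₂ x m m' m''))) ⟩
      # 2 * ∣ x * m * (m' * m'') ∣        ≤⟨ *-monoˡ-≤-nonNeg (# 2) (*-mono-abs hV (*-mono-abs h' h'')) ⟩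
      # 2 * (V * (U * U)) ∎
      where
      open ≤-Reasoning

    near-abs : ∀ {g h} → ν 2 * ∣ g - h ∣ ≤ 1ℚ → ∣ g ∣ ≤ ∣ h ∣ + 1ℚ × # 2 * ∣ h ∣ ≤ # 2 * ∣ g ∣ + 1ℚ
    near-abs {g} {h} close = up , down
      where
      open ≤-Reasoning
      close' : # 2 * ∣ g - h ∣ ≤ 1ℚ
      close' = subst (λ r → r * ∣ g - h ∣ ≤ 1ℚ) (ι-# 2) close
      halve : ∀ {x} → 0ℚ ≤ x → # 2 * x ≤ 1ℚ → x ≤ 1ℚ
      halve {x} x0 h = by (dif h ⊞ x0) (halve-identity x)
      up : ∣ g ∣ ≤ ∣ h ∣ + 1ℚ
      up = ≤-trans (≤-reflexive (cong ∣_∣ (near-abs-identity g h))) (≤-trans (∣p+q∣≤∣p∣+∣q∣ h (g - h)) (+-monoʳ-≤ ∣ h ∣ (halve (0≤∣p∣ (g - h)) close')))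
      down : # 2 * ∣ h ∣ ≤ # 2 * ∣ g ∣ + 1ℚ
      down = begin
        # 2 * ∣ h ∣                       ≡⟨ cong (λ r → # 2 * ∣ r ∣) (near-abs-identity₂ g h) ⟩
        # 2 * ∣ g + - (g - h) ∣           ≤⟨ *-monoˡ-≤-nonNeg (# 2) (∣p+q∣≤∣p∣+∣q∣ g (- (g - h))) ⟩
        # 2 * (∣ g ∣ + ∣ - (g - h) ∣)     ≡⟨ cong (λ r → # 2 * (∣ g ∣ + r)) (∣-p∣≡∣p∣ (g - h)) ⟩
        # 2 * (∣ g ∣ + ∣ g - h ∣)         ≡⟨ *-distribˡ-+ (# 2) ∣ g ∣ ∣ g - h ∣ ⟩
        # 2 * ∣ g ∣ + # 2 * ∣ g - h ∣     ≤⟨ +-monoʳ-≤ (# 2 * ∣ g ∣) close' ⟩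
        # 2 * ∣ g ∣ + 1ℚ ∎

  private
    M≤-identity : ∀ m → 2 ℕ.* (1 ℕ.+ m) ℕ.+ 1 ℕ.+ 3 ≡ m ℕ.+ 3 ℕ.+ (m ℕ.+ 3)
    M≤-identity m = solveℕ (m ∷ [])

    exponent-identity : ∀ S → 19 ℕ.* S ℕ.+ 3 ℕ.* S ℕ.* 8 ≡ 43 ℕ.* S
    exponent-identity S = solveℕ (S ∷ [])

    m-bound-identity : ∀ c d w → (c + d) * w ≡ c * w + d + d * (w - 1ℚ)
    m-bound-identity c d w = solve (c ∷ d ∷ w ∷ []) ℚring

  module _ (m : ℕ) (N≥ : N₁ ℕ.≤ 2 ℕ.* suc m ℕ.+ 1) (s t X Y η : ℤ) (η-unit : ℤ.∣ η ∣ ≡ 1)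
           (thue : thueForm (suc m) s t X Y ≡ ιK η) where
    private
      n = suc m
      n≥1 : 1 ℕ.≤ n
      n≥1 = s≤s z≤n
    open Near (suc m) (s≤s z≤n)
    open Solution (suc m) (s≤s z≤n) s t X Y η thue

    module Nondegenerate (cd≢0 : ¬ (d ≡ + 0 × c ≡ + 0)) where
      -- `M` is the bound for p and q given by `form-bound`, `U` bounds the conjugates of cλ + d,
      -- and `V` those of p - qλ with 1 added for the approximation error.
      κ M U V : ℕ
      κ = ℤ.∣ f n d (ℤ.- c) ∣
      M = C₁ ℕ.* ((2 ℕ.* n ℕ.+ 1) ℕ.* (κ ℕ.* κ))
      U = (ℤ.∣ c ∣ ℕ.+ ℤ.∣ d ∣) ℕ.* (n ℕ.+ 2)
      V = M ℕ.+ M ℕ.* (n ℕ.+ 2) ℕ.+ 1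

      κ≥1 : 1 ℕ.≤ κ
      κ≥1 = abs≥1 (f n d (ℤ.- c)) λ f0 → let d0 , c0 = f-zero n d (ℤ.- c) N≥ f0
        in cd≢0 (d0 , trans (sym (ℤₚ.neg-involutive c)) (cong ℤ.-_ c0))

      pq≤ : ℤ.∣ p ∣ ℕ.≤ M × ℤ.∣ q ∣ ℕ.≤ M
      pq≤ = form-bound n p q κ N≥ κ≥1 (ℕₚ.≤-reflexive (trans (cong ℤ.∣_∣ norm-equation)
        (trans (ℤₚ.abs-* η (f n d (ℤ.- c))) (trans (cong (ℕ._* κ) η-unit) (ℕₚ.*-identityˡ κ)))))

      private
        w : ℚ
        w = ν (n ℕ.+ 2)
        1≤w : 1ℚ ≤ w
        1≤w = subst (_≤ w) (ι-# 1) (ν≤ (ℕₚ.≤-trans n≥1 (ℕₚ.m≤m+n n 2)))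
        ∣ι∣≤ : ∀ {z k} → ℤ.∣ z ∣ ℕ.≤ k → ∣ ι z ∣ ≤ ν k
        ∣ι∣≤ {z} h = ≤-trans (≤-reflexive (ι-abs z)) (ν≤ h)

        m-bound : ∀ {l} → ∣ l ∣ ≤ w → ∣ ι c * l + ι d ∣ ≤ ν U
        m-bound {l} h = ≤-trans (+-mono-abs {ι c * l} (*-mono-abs {ι c} (∣ι∣≤ {c} ℕₚ.≤-refl) h) (∣ι∣≤ {d} ℕₚ.≤-refl))
          (≤-trans (by (ν0 ℤ.∣ d ∣ ⊠ dif 1≤w) (m-bound-identity (ν ℤ.∣ c ∣) (ν ℤ.∣ d ∣) w)) (≤-reflexive (sym (trans (ν-* _ (n ℕ.+ 2)) (cong (_* w) (ν-+ ℤ.∣ c ∣ ℤ.∣ d ∣))))))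

        lin-bound : ∀ {l} → ∣ l ∣ ≤ w → ∣ ι p - ι q * l ∣ + 1ℚ ≤ ν V
        lin-bound {l} h = ≤-trans (+-monoˡ-≤ 1ℚ (≤-trans (∣p-q∣≤∣p∣+∣q∣ (ι p) (ι q * l))
            (+-mono-≤ (∣ι∣≤ {p} (proj₁ pq≤)) (*-mono-abs {ι q} (∣ι∣≤ {q} (proj₂ pq≤)) h))))
          (≤-reflexive (sym (trans (ν-+ _ 1) (cong₂ _+_ (trans (ν-+ M _) (cong (λ r → ν M + r) (ν-* M (n ℕ.+ 2)))) (ι-# 1)))))

        norm-large : Ev (λ B → 1ℚ ≤ # 2 * ∣ m₀ B * m₁ B * m₂ B ∣)
        norm-large = ev-map (λ B h → large (proj₂ (near-abs {m₀ B * m₁ B * m₂ B} {ι (f n d (ℤ.- c))} h))) (≃⇒ev norm-m 2)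
          where
          1≤κ : 1ℚ ≤ ∣ ι (f n d (ℤ.- c)) ∣
          1≤κ = subst₂ _≤_ (ι-# 1) (sym (ι-abs (f n d (ℤ.- c)))) (ν≤ κ≥1)
          large : ∀ {x} → # 2 * ∣ ι (f n d (ℤ.- c)) ∣ ≤ x + 1ℚ → 1ℚ ≤ x
          large {x} h = arith 1≤κ h
            where
            arith : ∀ {k} → 1ℚ ≤ k → # 2 * k ≤ x + 1ℚ → 1ℚ ≤ x
            arith {k} h1 h2 = by (dif h2 ⊞ k0 2 ⊠ dif h1) (solve (k ∷ x ∷ []) ℚring)

        one-bound : ∀ (β m₀ m₁ m₂ l : Fn) → (λ B → β B * m₀ B) ≃ (λ B → ι p - ι q * l B) → (∀ B → ∣ l B ∣ ≤ w) →
          (∀ B → ∣ m₁ B ∣ ≤ ν U) → (∀ B → ∣ m₂ B ∣ ≤ ν U) → Ev (λ B → 1ℚ ≤ # 2 * ∣ m₀ B * m₁ B * m₂ B ∣) →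
          Ev (λ B → ∣ β B ∣ ≤ ν (2 ℕ.* (V ℕ.* (U ℕ.* U))))
        one-bound β m₀ m₁ m₂ l cut hl h₁ h₂ large = ev-map (λ B (h , h') →
            ≤-trans (quotient-bound (ν0 V) (ν0 U) (≤-trans (proj₁ (near-abs {β B * m₀ B} {ι p - ι q * l B} h)) (lin-bound (hl B))) (h₁ B) (h₂ B) h')
              (≤-reflexive (sym (trans (ν-* 2 _) (cong₂ _*_ (ι-# 2) (trans (ν-* V _) (cong (λ r → ν V * r) (ν-* U U))))))))
          (ev-× (≃⇒ev cut 2) large)

        l≤₀ : ∀ B → ∣ l₀ B ∣ ≤ w
        l≤₀ B = Pt.x≤ (p₀ B)
        l≤₁ : ∀ B → ∣ l₁ B ∣ ≤ w
        l≤₁ B = Pt.x≤ (p₁ B)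
        l≤₂ : ∀ B → ∣ l₂ B ∣ ≤ w
        l≤₂ B = Pt.x≤ (p₂ B)

      rot₁ : ∀ a b c → a * b * c ≡ b * a * c
      rot₁ a b c = solve (a ∷ b ∷ c ∷ []) ℚring
      rot₂ : ∀ a b c → a * b * c ≡ c * a * b
      rot₂ a b c = solve (a ∷ b ∷ c ∷ []) ℚring

      T : ℕ
      T = 2 ℕ.* (V ℕ.* (U ℕ.* U))

      bound₀ : Ev (λ B → ∣ β₀ B ∣ ≤ ν T)
      bound₀ = one-bound β₀ m₀ m₁ m₂ l₀ cut₀ l≤₀ (λ B → m-bound (l≤₁ B)) (λ B → m-bound (l≤₂ B)) norm-large
      bound₁ : Ev (λ B → ∣ β₁ B ∣ ≤ ν T)
      bound₁ = one-bound β₁ m₁ m₀ m₂ l₁ cut₁ l≤₁ (λ B → m-bound (l≤₀ B)) (λ B → m-bound (l≤₂ B))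
        (ev-map (λ B → subst (λ r → 1ℚ ≤ # 2 * ∣ r ∣) (rot₁ (m₀ B) (m₁ B) (m₂ B))) norm-large)
      bound₂ : Ev (λ B → ∣ β₂ B ∣ ≤ ν T)
      bound₂ = one-bound β₂ m₂ m₀ m₁ l₂ cut₂ l≤₂ (λ B → m-bound (l≤₀ B)) (λ B → m-bound (l≤₁ B))
        (ev-map (λ B → subst (λ r → 1ℚ ≤ # 2 * ∣ r ∣) (rot₂ (m₀ B) (m₁ B) (m₂ B))) norm-large)

      module _ (C≤ : C₁ ℕ.≤ m ℕ.+ 3) (S≥1 : 1 ℕ.≤ ℤ.∣ s ∣ ℕ.+ ℤ.∣ t ∣) where
        open Size m using (size-unit; coefficients)
        private
          w' D S : ℕ
          w' = m ℕ.+ 3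
          S = ℤ.∣ s ∣ ℕ.+ ℤ.∣ t ∣
          D = (w' ℕ.* (w' ℕ.* w')) ℕ.^ S
          n+2≡ : n ℕ.+ 2 ≡ w'
          n+2≡ = sym (ℕₚ.+-suc m 2)
          w≥3 : 3 ℕ.≤ w'
          w≥3 = ℕₚ.m≤n+m 3 m
          instance
            w³≢0 : ℕ.NonZero (w' ℕ.* (w' ℕ.* w'))
            w³≢0 = ℕ.>-nonZero (ℕₚ.*-mono-≤ {1} (ℕₚ.≤-trans (s≤s z≤n) w≥3) (ℕₚ.*-mono-≤ {1} (ℕₚ.≤-trans (s≤s z≤n) w≥3) (ℕₚ.≤-trans (s≤s z≤n) w≥3)))
          open Mono w' D (ℕₚ.≤-trans (s≤s (s≤s z≤n)) w≥3) (ℕₚ.m^n>0 (w' ℕ.* (w' ℕ.* w')) S)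
          cd≤ : ℤ.∣ c ∣ ℕ.≤ D × ℤ.∣ d ∣ ℕ.≤ D
          cd≤ = coefficients α D (subst (λ r → Size.size m r ℕ.≤ D) (sym α-def) (size-unit s t))
          c≤ : ℤ.∣ ℤ.- c ∣ ℕ.≤ mon 0 1
          c≤ = mon-D (absneg {c} (proj₁ cd≤))
          d≤ : ℤ.∣ d ∣ ℕ.≤ mon 0 1
          d≤ = mon-D (proj₂ cd≤)
          triple : ∀ x y z → ℤ.∣ x ∣ ℕ.≤ mon 0 1 → ℤ.∣ y ∣ ℕ.≤ mon 0 1 → ℤ.∣ z ∣ ℕ.≤ mon 0 1 → ℤ.∣ x ℤ.* y ℤ.* z ∣ ℕ.≤ mon 0 3
          triple x y z hx hy hz = ℕₚ.≤-trans (abs× {x ℤ.* y} {z} (ℕₚ.≤-trans (abs× {x} {y} hx hy) (mon-* {mon 0 1} {mon 0 1} 0 1 0 1 ℕₚ.≤-refl ℕₚ.≤-refl)) hz) (mon-* {mon 0 2} {mon 0 1} 0 2 0 1 ℕₚ.≤-refl ℕₚ.≤-refl)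
          weighted : ∀ a x y z → ℤ.∣ a ∣ ℕ.≤ mon 1 0 → ℤ.∣ x ∣ ℕ.≤ mon 0 1 → ℤ.∣ y ∣ ℕ.≤ mon 0 1 → ℤ.∣ z ∣ ℕ.≤ mon 0 1 → ℤ.∣ a ℤ.* x ℤ.* y ℤ.* z ∣ ℕ.≤ mon 1 3
          weighted a x y z ha hx hy hz = ℕₚ.≤-trans (abs× {a ℤ.* x ℤ.* y} {z} (ℕₚ.≤-trans (abs× {a ℤ.* x} {y} (ℕₚ.≤-trans (abs× {a} {x} ha hx) (mon-* {mon 1 0} {mon 0 1} 1 0 0 1 ℕₚ.≤-refl ℕₚ.≤-refl)) hy)
            (mon-* {mon 1 1} {mon 0 1} 1 1 0 1 ℕₚ.≤-refl ℕₚ.≤-refl)) hz) (mon-* {mon 1 2} {mon 0 1} 1 2 0 1 ℕₚ.≤-refl ℕₚ.≤-refl)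
          up : ∀ {x} i j → x ℕ.≤ mon i j → x ℕ.≤ mon (suc i) j
          up i j h = ℕₚ.≤-trans h (mon-mono {i} {suc i} {j} {j} (ℕₚ.n≤1+n i) ℕₚ.≤-refl)
          κ≤ : κ ℕ.≤ mon 4 3
          κ≤ = ℕₚ.≤-trans (abs- {d ℤ.* d ℤ.* d ℤ.- P ℤ.- Q} {c' ℤ.* c' ℤ.* c'}
                (ℕₚ.≤-trans (abs- {d ℤ.* d ℤ.* d ℤ.- P} {Q} (ℕₚ.≤-trans (abs- {d ℤ.* d ℤ.* d} {P} (up 0 3 (triple d d d d≤ d≤ d≤))
                    (weighted (+ n ℤ.- + 1) d d c' n-1≤ d≤ d≤ c≤)) (mon-+ {mon 1 3} {mon 1 3} 1 3 ℕₚ.≤-refl ℕₚ.≤-refl))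
                  (up 1 3 (weighted (+ n ℤ.+ + 2) d c' c' n+2≤ d≤ c≤ c≤))) (mon-+ {mon 2 3} {mon 2 3} 2 3 ℕₚ.≤-refl ℕₚ.≤-refl))
                (up 2 3 (up 1 3 (up 0 3 (triple c' c' c' c≤ c≤ c≤))))) (mon-+ {mon 3 3} {mon 3 3} 3 3 ℕₚ.≤-refl ℕₚ.≤-refl)
            where
            c' P Q : ℤ
            c' = ℤ.- c
            P = (+ n ℤ.- + 1) ℤ.* d ℤ.* d ℤ.* c'
            Q = (+ n ℤ.+ + 2) ℤ.* d ℤ.* c' ℤ.* c'
            n-1≤ : ℤ.∣ + n ℤ.- + 1 ∣ ℕ.≤ mon 1 0
            n-1≤ = ℕₚ.≤-trans (ℕₚ.m≤m+n m 3) mon-w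
            n+2≤ : ℤ.∣ + n ℤ.+ + 2 ∣ ℕ.≤ mon 1 0
            n+2≤ = ℕₚ.≤-trans (ℕₚ.≤-reflexive n+2≡) mon-w
          M≤ : M ℕ.≤ mon 11 6
          M≤ = mon-* 1 0 10 6 (ℕₚ.≤-trans C≤ mon-w) (mon-* 2 0 8 6 (ℕₚ.≤-trans two (mon-+ 1 0 mon-w mon-w)) (mon-* 4 3 4 3 κ≤ κ≤))
            where
            two : 2 ℕ.* n ℕ.+ 1 ℕ.≤ w' ℕ.+ w'
            two = ℕₚ.≤-trans (ℕₚ.m≤m+n _ 3) (ℕₚ.≤-reflexive (M≤-identity m))
          n+2≤w : n ℕ.+ 2 ℕ.≤ mon 1 0
          n+2≤w = ℕₚ.≤-trans (ℕₚ.≤-reflexive n+2≡) mon-w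
          V≤ : V ℕ.≤ mon 14 6
          V≤ = mon-+ 13 6 (mon-+ 12 6 (up 11 6 M≤) (mon-* 11 6 1 0 M≤ n+2≤w)) (mon-1 13 6)
          U≤ : U ℕ.≤ mon 2 1
          U≤ = mon-* 1 1 1 0 (mon-+ 0 1 (mon-D (proj₁ cd≤)) (mon-D (proj₂ cd≤))) n+2≤w

        -- Counting factors bounds `T` by w^19 D^8 with D = w^(3S), and S ≥ 1 turns 19 + 24S into at
        -- most 43S.
        T≤ : T ℕ.≤ (m ℕ.+ 3) ℕ.^ (43 ℕ.* (ℤ.∣ s ∣ ℕ.+ ℤ.∣ t ∣))
        T≤ = begin
          T                                     ≤⟨ mon-* 1 0 18 8 (ℕₚ.≤-trans (ℕₚ.≤-trans (s≤s (s≤s z≤n)) w≥3) mon-w) (mon-* 14 6 4 2 V≤ (mon-* 2 1 2 1 U≤ U≤)) ⟩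
          w' ℕ.^ 19 ℕ.* D ℕ.^ 8                 ≡⟨ cong (λ r → w' ℕ.^ 19 ℕ.* r ℕ.^ 8) D≡ ⟩
          w' ℕ.^ 19 ℕ.* (w' ℕ.^ (3 ℕ.* S)) ℕ.^ 8 ≡⟨ cong (w' ℕ.^ 19 ℕ.*_) (ℕₚ.^-*-assoc w' (3 ℕ.* S) 8) ⟩
          w' ℕ.^ 19 ℕ.* w' ℕ.^ (3 ℕ.* S ℕ.* 8)  ≡⟨ ℕₚ.^-distribˡ-+-* w' 19 (3 ℕ.* S ℕ.* 8) ⟨
          w' ℕ.^ (19 ℕ.+ 3 ℕ.* S ℕ.* 8)         ≤⟨ ℕₚ.^-monoʳ-≤ w' exponent ⟩
          w' ℕ.^ (43 ℕ.* S) ∎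
          where
          open ℕₚ.≤-Reasoning
          D≡ : D ≡ w' ℕ.^ (3 ℕ.* S)
          D≡ = trans (cong (ℕ._^ S) (cong (λ r → w' ℕ.* (w' ℕ.* r)) (sym (ℕₚ.*-identityʳ w')))) (ℕₚ.^-*-assoc w' 3 S)
          exponent : 19 ℕ.+ 3 ℕ.* S ℕ.* 8 ℕ.≤ 43 ℕ.* S
          exponent = ℕₚ.≤-trans (ℕₚ.+-monoˡ-≤ (3 ℕ.* S ℕ.* 8) (ℕₚ.*-monoʳ-≤ 19 S≥1)) (ℕₚ.≤-reflexive (exponent-identity S))

-- Absolute values as products of powers of L and μ.

module Powers where
  open import Data.Nat as ℕ using (ℕ; zero; suc)
  import Data.Nat.Properties as ℕₚ
  open import Data.Integer as ℤ using (ℤ; +_; -[1+_])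
  import Data.Integer.Properties as ℤₚ
  open import Data.List using ([]; _∷_)
  open import Data.Product using (_,_)
  open import Data.Rational
  open import Data.Rational.Properties
  open import Relation.Binary.PropositionalEquality
  open import Tactic.RingSolver using (solve)
  open import Data.Integer.Tactic.RingSolver using () renaming (solve to solveℤ)
  open Rationals
  open Root using (Base)

  private
    pw-suc-identity : ∀ x xi p → xi * p ≡ x * (xi * (xi * p)) + - (xi * p) * (x * xi - 1ℚ)
    pw-suc-identity x xi p = solve (x ∷ xi ∷ p ∷ []) ℚring

    pw-pred-identity : ∀ x xi p q → q ≡ xi * p + - q * (x * xi - 1ℚ) + xi * (x * q - p)
    pw-pred-identity x xi p q = solve (x ∷ xi ∷ p ∷ q ∷ []) ℚring

  module _ {x xi : ℚ} (e : x * xi ≡ 1ℚ) where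

    pw-suc : ∀ k → pw x xi (+ 1 ℤ.+ k) ≡ x * pw x xi k
    pw-suc (+ k) = refl
    pw-suc -[1+ zero ] = sym (trans (cong (x *_) (*-identityʳ xi)) e)
    pw-suc -[1+ suc k ] = lc1 (- (xi * pn xi k)) e (pw-suc-identity x xi (pn xi k))

    pw-pred : ∀ k → pw x xi (-[1+ 0 ] ℤ.+ k) ≡ xi * pw x xi k
    pw-pred k = lc2 (- (pw x xi (-[1+ 0 ] ℤ.+ k))) xi e (sym step) (pw-pred-identity x xi (pw x xi k) (pw x xi (-[1+ 0 ] ℤ.+ k)))
      where
      step : pw x xi k ≡ x * pw x xi (-[1+ 0 ] ℤ.+ k)
      step = trans (cong (pw x xi) (sym (trans (sym (ℤₚ.+-assoc (+ 1) -[1+ 0 ] k)) (ℤₚ.+-identityˡ k)))) (pw-suc (-[1+ 0 ] ℤ.+ k))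

    pw-+ : ∀ a b → pw x xi (a ℤ.+ b) ≡ pw x xi a * pw x xi b
    pw-+ (+ zero) b = trans (cong (pw x xi) (ℤₚ.+-identityˡ b)) (sym (*-identityˡ _))
    pw-+ (+ suc a) b = trans (cong (pw x xi) (ℤₚ.+-assoc (+ 1) (+ a) b))
      (trans (pw-suc (+ a ℤ.+ b)) (trans (cong (x *_) (pw-+ (+ a) b)) (sym (*-assoc x _ _))))
    pw-+ -[1+ zero ] b = trans (pw-pred b) (cong (_* pw x xi b) (sym (*-identityʳ xi)))
    pw-+ -[1+ suc a ] b = trans (cong (pw x xi) (ℤₚ.+-assoc -[1+ 0 ] -[1+ a ] b))
      (trans (pw-pred (-[1+ a ] ℤ.+ b)) (trans (cong (xi *_) (pw-+ -[1+ a ] b)) (sym (*-assoc xi _ _))))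

  pn-mul : ∀ x y k → pn (x * y) k ≡ pn x k * pn y k
  pn-mul x y zero = refl
  pn-mul x y (suc k) = trans (cong (x * y *_) (pn-mul x y k)) (lem x y (pn x k) (pn y k))
    where
    lem : ∀ x y p q → x * y * (p * q) ≡ x * p * (y * q)
    lem x y p q = solve (x ∷ y ∷ p ∷ q ∷ []) ℚring

  pw-mul : ∀ x xi y yi k → pw (x * y) (xi * yi) k ≡ pw x xi k * pw y yi k
  pw-mul x xi y yi (+ k) = pn-mul x y k
  pw-mul x xi y yi -[1+ k ] = pn-mul xi yi (suc k)

  pw-neg : ∀ x xi k → pw x xi (ℤ.- k) ≡ pw xi x k
  pw-neg x xi (+ zero) = refl
  pw-neg x xi (+ suc k) = refl
  pw-neg x xi -[1+ k ] = refl

  pn-abs : ∀ x k → ∣ pn x k ∣ ≡ pn ∣ x ∣ k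
  pn-abs x zero = refl
  pn-abs x (suc k) = trans (∣p*q∣≡∣p∣*∣q∣ x (pn x k)) (cong (∣ x ∣ *_) (pn-abs x k))

  pw-abs : ∀ x xi k → ∣ pw x xi k ∣ ≡ pw ∣ x ∣ ∣ xi ∣ k
  pw-abs x xi (+ k) = pn-abs x k
  pw-abs x xi -[1+ k ] = pn-abs xi (suc k)

  pn-pos : ∀ {x} → 0ℚ < x → ∀ k → 0ℚ < pn x k
  pn-pos h zero = k0< 0
  pn-pos h (suc k) = h ⊠< pn-pos h k

  pw-pos : ∀ {x xi} → 0ℚ < x → 0ℚ < xi → ∀ k → 0ℚ < pw x xi k
  pw-pos h k (+ j) = pn-pos h j
  pw-pos h k -[1+ j ] = pn-pos k (suc j)

  pn-≥1 : ∀ {x} → 1ℚ ≤ x → ∀ k → 1ℚ ≤ pn x k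
  pn-≥1 h zero = ≤-refl
  pn-≥1 {x} h (suc k) = *-mono {1ℚ} {1ℚ} {x} {pn x k} (k0 1) (≤-trans (k0 1) (pn-≥1 h k)) h (pn-≥1 h k)

  pn-≤1 : ∀ {x} → 0ℚ ≤ x → x ≤ 1ℚ → ∀ k → pn x k ≤ 1ℚ
  pn-≤1 h h' zero = ≤-refl
  pn-≤1 {x} h h' (suc k) = *-mono {x} {pn x k} {1ℚ} {1ℚ} h (k0 1) h' (pn-≤1 h h' k)

  inverse-pos : ∀ {x xi} → 0ℚ < x → x * xi ≡ 1ℚ → 0ℚ < xi
  inverse-pos {x} {xi} h e = ≰⇒> λ xi≤0 → <-irrefl refl (<-≤-trans (k0< 0)
    (≤-trans (≤-reflexive (sym e)) (≤-trans (*-monoˡ-≤-nonNeg x {{nonNegative (<⇒≤ h)}} xi≤0) (≤-reflexive (*-zeroʳ x)))))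

  private
    weaken-identity : ∀ κ x → # 2 * (1ℚ + κ) * x ≡ # 2 * κ * x + # 2 * x
    weaken-identity κ x = solve (κ ∷ x ∷ []) ℚring

    step-identity : ∀ x κ → 1ℚ + # 2 * (1ℚ + κ) * x ≡ (1ℚ + x) * (1ℚ + # 2 * κ * x) + (x * (1ℚ - # 2 * (1ℚ + κ) * x) + # 2 * (x * x))
    step-identity x κ = solve (x ∷ κ ∷ []) ℚring

    step-identity₂ : ∀ x κ m p → m * p ≡ 1ℚ - (1ℚ + κ) * x + (p * (m - (1ℚ - x)) + (p - (1ℚ - κ * x) + x * (1ℚ - p)))
    step-identity₂ x κ m p = solve (x ∷ κ ∷ m ∷ p ∷ []) ℚring

    from-tiny-identity : ∀ x → 1ℚ ≡ # 2 * x + (# 198 * x + (1ℚ - # 200 * x))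
    from-tiny-identity x = solve (x ∷ []) ℚring

    y-eq-identity : ∀ L Li y → y ≡ Li * (L * y) + - y * (L * Li - 1ℚ)
    y-eq-identity L Li y = solve (L ∷ Li ∷ y ∷ []) ℚring

    L+1-eq-identity : ∀ L Li → L + 1ℚ ≡ L * ((L + 1ℚ) * Li) + - (L + 1ℚ) * (L * Li - 1ℚ)
    L+1-eq-identity L Li = solve (L ∷ Li ∷ []) ℚring

    μi≤1-identity : ∀ y → 1ℚ ≡ 1ℚ - y + y
    μi≤1-identity y = solve (y ∷ []) ℚring

    μi≥-identity : ∀ L Li y → 1ℚ - y ≡ 1ℚ - Li + Li * y + y * (L * Li - 1ℚ) + - Li * ((L + 1ℚ) * y - 1ℚ)
    μi≥-identity L Li y = solve (L ∷ Li ∷ y ∷ []) ℚring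

    lower-identity : ∀ x → 1ℚ ≡ 1ℚ - x + x
    lower-identity x = solve (x ∷ []) ℚring

    μ-upper-identity : ∀ κ x → # 101 ≡ # 100 * (1ℚ + # 2 * κ * x) + (1ℚ - # 200 * κ * x)
    μ-upper-identity κ x = solve (κ ∷ x ∷ []) ℚring

    μ-lower-identity : ∀ κ x → # 100 * (1ℚ - κ * x) ≡ # 99 + (# 100 * (κ * x) + (1ℚ - # 200 * κ * x))
    μ-lower-identity κ x = solve (κ ∷ x ∷ []) ℚring

    sz-upper-identity : ∀ a b → # 101 * a ≡ # 100 * (a * b) + a * (# 101 - # 100 * b)
    sz-upper-identity a b = solve (a ∷ b ∷ []) ℚring

    sz-lower-identity : ∀ a b → # 100 * (a * b) ≡ # 99 * a + a * (# 100 * b - # 99)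
    sz-lower-identity a b = solve (a ∷ b ∷ []) ℚring

    *-monoʳ-<-pos'-identity : ∀ a b p → b * p ≡ a * p + (b - a) * p
    *-monoʳ-<-pos'-identity a b p = solve (a ∷ b ∷ p ∷ []) ℚring

    μ·μi-identity : ∀ L Li y → (L + 1ℚ) * Li * (L * y) ≡ 1ℚ + (L + 1ℚ) * y * (L * Li - 1ℚ) + 1ℚ * ((L + 1ℚ) * y - 1ℚ)
    μ·μi-identity L Li y = solve (L ∷ Li ∷ y ∷ []) ℚring

    sz-*-identity : ∀ a b c d → a * b * (c * d) ≡ a * c * (b * d)
    sz-*-identity a b c d = solve (a ∷ b ∷ c ∷ d ∷ []) ℚring

    conjugate-size₁-identity : ∀ s t → ℤ.- s ℤ.+ t ≡ ℤ.- (s ℤ.- t)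
    conjugate-size₁-identity s t = solveℤ (s ∷ t ∷ [])

    μ-gap-identity : ∀ x → (1ℚ + x) * ((1ℚ + x) * (1ℚ + x)) ≡ 1ℚ + # 3 * x + (# 3 * (x * x) + x * (x * x))
    μ-gap-identity x = solve (x ∷ []) ℚring

    μ-gap-identity₂ : ∀ m p → m * (m * (m * p)) ≡ m * (m * m) + m * (m * (m * (p - 1ℚ)))
    μ-gap-identity₂ m p = solve (m ∷ p ∷ []) ℚring

    pL-mono-identity : ∀ p q → p * q ≡ p + p * (q - 1ℚ)
    pL-mono-identity p q = solve (p ∷ q ∷ []) ℚring

    pL-mono-identity₂ : ∀ a b → a ℤ.+ (b ℤ.- a) ≡ b
    pL-mono-identity₂ a b = solveℤ (a ∷ b ∷ [])

  module Sizes (n : ℕ) (n≥1 : 1 ℕ.≤ n) (B : Base n) where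
    open Base B public

    μ μi : ℚ
    μ = (L + 1ℚ) * Li
    μi = L * y

    L>0 : 0ℚ < L
    L>0 = 0<L n≥1
    Li>0 : 0ℚ < Li
    Li>0 = inverse-pos L>0 L·Li
    y>0 : 0ℚ < y
    y>0 = inverse-pos (0<L+1 n≥1) L+1·y
    μ>0 : 0ℚ < μ
    μ>0 = 0<L+1 n≥1 ⊠< Li>0
    μi>0 : 0ℚ < μi
    μi>0 = L>0 ⊠< y>0

    μ·μi : μ * μi ≡ 1ℚ
    μ·μi = lc2 ((L + 1ℚ) * y) 1ℚ L·Li L+1·y (μ·μi-identity L Li y)

    pL pμ : ℤ → ℚ
    pL = pw L Li
    pμ = pw μ μi

    pL-pos : ∀ k → 0ℚ < pL k
    pL-pos = pw-pos L>0 Li>0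
    pμ-pos : ∀ k → 0ℚ < pμ k
    pμ-pos = pw-pos μ>0 μi>0

    sz : ℤ → ℤ → ℚ
    sz g h = pL g * pμ h

    sz-pos : ∀ g h → 0ℚ < sz g h
    sz-pos g h = pL-pos g ⊠< pμ-pos h

    sz-* : ∀ g h g' h' → sz g h * sz g' h' ≡ sz (g ℤ.+ g') (h ℤ.+ h')
    sz-* g h g' h' = trans (sz-*-identity (pL g) (pμ h) (pL g') (pμ h')) (cong₂ _*_ (sym (pw-+ L·Li g g')) (sym (pw-+ μ·μi h h')))

    private
      y-eq : y ≡ Li * μi
      y-eq = lc1 (- y) L·Li (y-eq-identity L Li y)
      L+1-eq : L + 1ℚ ≡ L * μ
      L+1-eq = lc1 (- (L + 1ℚ)) L·Li (L+1-eq-identity L Li)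
      pos-abs : ∀ {x} → 0ℚ < x → ∣ x ∣ ≡ x
      pos-abs h = 0≤p⇒∣p∣≡p (<⇒≤ h)
      neg-abs : ∀ {x} → 0ℚ < x → ∣ - x ∣ ≡ x
      neg-abs {x} h = trans (∣-p∣≡∣p∣ x) (pos-abs h)

    -- L, −y and −μ stand for λ₀, λ₁ and λ₂.
    size₀ : ∀ k → ∣ pw L Li k ∣ ≡ sz k (+ 0)
    size₀ k = trans (pos-abs (pL-pos k)) (sym (*-identityʳ _))

    size₁ : ∀ k → ∣ pw (- y) (- (L + 1ℚ)) k ∣ ≡ sz (ℤ.- k) (ℤ.- k)
    size₁ k = trans (pw-abs (- y) (- (L + 1ℚ)) k) (trans (cong₂ (λ a b → pw a b k) (trans (neg-abs y>0) y-eq) (trans (neg-abs (0<L+1 n≥1)) L+1-eq))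
      (trans (pw-mul Li L μi μ k) (cong₂ _*_ (sym (pw-neg L Li k)) (sym (pw-neg μ μi k)))))

    size₂ : ∀ k → ∣ pw (- μ) (- μi) k ∣ ≡ sz (+ 0) k
    size₂ k = trans (pw-abs (- μ) (- μi) k) (trans (cong₂ (λ a b → pw a b k) (neg-abs μ>0) (neg-abs μi>0)) (sym (*-identityˡ _)))

    private
      sz-cong : ∀ {g g' h h'} → g ≡ g' → h ≡ h' → sz g h ≡ sz g' h'
      sz-cong refl refl = refl

    -- With e = (s - t, -s, t) the L-exponents of the three conjugates, their μ-exponents are -e₂,
    -- -e₀, -e₁. The unsimplified shape of the exponents in the three statements displays this
    -- cyclic pattern.
    conjugate-size₀ : ∀ s t → ∣ pw L Li s * pw (- y) (- (L + 1ℚ)) t ∣ ≡ sz (s ℤ.- t) (ℤ.- t)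
    conjugate-size₀ s t = trans (∣p*q∣≡∣p∣*∣q∣ (pw L Li s) _) (trans (cong₂ _*_ (size₀ s) (size₁ t))
      (trans (sz-* s (+ 0) (ℤ.- t) (ℤ.- t)) (sz-cong {s ℤ.- t} refl (ℤₚ.+-identityˡ (ℤ.- t)))))

    conjugate-size₁ : ∀ s t → ∣ pw (- y) (- (L + 1ℚ)) s * pw (- μ) (- μi) t ∣ ≡ sz (ℤ.- s) (ℤ.- (s ℤ.- t))
    conjugate-size₁ s t = trans (∣p*q∣≡∣p∣*∣q∣ (pw (- y) (- (L + 1ℚ)) s) _) (trans (cong₂ _*_ (size₁ s) (size₂ t))
      (trans (sz-* (ℤ.- s) (ℤ.- s) (+ 0) t) (sz-cong (ℤₚ.+-identityʳ (ℤ.- s)) (conjugate-size₁-identity s t))))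

    conjugate-size₂ : ∀ s t → ∣ pw (- μ) (- μi) s * pw L Li t ∣ ≡ sz t (ℤ.- (ℤ.- s))
    conjugate-size₂ s t = trans (∣p*q∣≡∣p∣*∣q∣ (pw (- μ) (- μi) s) _) (trans (cong₂ _*_ (size₂ s) (size₀ t))
      (trans (sz-* (+ 0) s t (+ 0)) (sz-cong (ℤₚ.+-identityˡ t) (trans (ℤₚ.+-identityʳ s) (sym (ℤₚ.neg-involutive s))))))

    private
      μ≡ : μ ≡ 1ℚ + Li
      μ≡ = q-eq n≥1
      μ≥1 : 1ℚ ≤ μ
      μ≥1 = ≤-trans (by (<⇒≤ Li>0) refl) (≤-reflexive (sym μ≡))
      μi≤1 : μi ≤ 1ℚ
      μi≤1 = ≤-trans (≤-reflexive (r-eq n≥1)) (by (<⇒≤ y>0) (μi≤1-identity y))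
      μi≥ : 1ℚ - Li ≤ μi
      μi≥ = ≤-trans (by (<⇒≤ Li>0 ⊠ <⇒≤ y>0) (lc2 (y) (- Li) (trans L·Li refl) L+1·y (μi≥-identity L Li y))) (≤-reflexive (sym (r-eq n≥1)))

      -- A reverse Bernoulli inequality for μ = 1 + 1/L: as long as 2k/L ≤ 1, doubling the linear
      -- term absorbs all higher ones.
      upper : ∀ k → # 2 * ν k * Li ≤ 1ℚ → pn μ k ≤ 1ℚ + # 2 * ν k * Li
      upper zero h = by (k0 2 ⊠ ν0 0 ⊠ <⇒≤ Li>0) (cong (λ r → 1ℚ + r) (*-assoc (# 2) (ν 0) Li))
      upper (suc k) h = ≤-trans (*-mono {μ} {pn μ k} (<⇒≤ μ>0) (≤-trans (<⇒≤ (pn-pos μ>0 k)) (upper k h'')) (≤-reflexive μ≡) (upper k h''))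
          (≤-trans (step {Li} {ν k} (<⇒≤ Li>0) h') (≤-reflexive (cong (λ r → 1ℚ + # 2 * r * Li) (sym νk))))
        where
        νk : ν (suc k) ≡ 1ℚ + ν k
        νk = trans (ν-+ 1 k) (cong (_+ ν k) (ι-# 1))
        h' : # 2 * (1ℚ + ν k) * Li ≤ 1ℚ
        h' = subst (λ r → # 2 * r * Li ≤ 1ℚ) νk h
        step : ∀ {x κ} → 0ℚ ≤ x → # 2 * (1ℚ + κ) * x ≤ 1ℚ → (1ℚ + x) * (1ℚ + # 2 * κ * x) ≤ 1ℚ + # 2 * (1ℚ + κ) * x
        step {x} {κ} x0 hh = by (x0 ⊠ dif hh ⊞ k0 2 ⊠ x0 ⊠ x0) (step-identity x κ)
        h'' : # 2 * ν k * Li ≤ 1ℚ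
        h'' = ≤-trans (weaken {Li} (<⇒≤ Li>0)) h'
          where
          weaken : ∀ {x} → 0ℚ ≤ x → # 2 * ν k * x ≤ # 2 * (1ℚ + ν k) * x
          weaken {x} x0 = by (k0 2 ⊠ x0) (weaken-identity (ν k) x)

      lower : ∀ k → 1ℚ - ν k * Li ≤ pn μi k
      lower zero = by (ν0 0 ⊠ <⇒≤ Li>0) (lower-identity (ν 0 * Li))
      lower (suc k) = ≤-trans (≤-reflexive (cong (λ r → 1ℚ - r * Li) (trans (ν-+ 1 k) (cong (_+ ν k) (ι-# 1)))))
        (step {Li} {ν k} {μi} {pn μi k} (lower k) μi≥ (<⇒≤ Li>0) (<⇒≤ (pn-pos μi>0 k)) (pn-≤1 (<⇒≤ μi>0) μi≤1 k))
        where
        step : ∀ {x κ m p} → 1ℚ - κ * x ≤ p → 1ℚ - x ≤ m → 0ℚ ≤ x → 0ℚ ≤ p → p ≤ 1ℚ → 1ℚ - (1ℚ + κ) * x ≤ m * p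
        step {x} {κ} {m} {p} h h' x0 p0 p1 = by (p0 ⊠ dif h' ⊞ dif h ⊞ x0 ⊠ dif p1) (step-identity₂ x κ m p)

      lower≤1 : ∀ k → pn μi k ≤ 1ℚ
      lower≤1 = pn-≤1 (<⇒≤ μi>0) μi≤1

    module Range (W : ℕ) (small : 200 ℕ.* W ℕ.≤ n) where
      private
        200W : # 200 * ν W ≤ L
        200W = ≤-trans (≤-trans (≤-reflexive (trans (cong (_* ν W) (sym (ι-# 200))) (sym (ν-* 200 W)))) (ν≤ small)) n≤L

        tiny : ∀ {k} → k ℕ.≤ W → # 200 * ν k * Li ≤ 1ℚ
        tiny {k} h = ≤-trans (*-monoʳ-≤-nonNeg Li {{nonNegative (<⇒≤ Li>0)}} (≤-trans (*-monoˡ-≤-nonNeg (# 200) (ν≤ h)) 200W)) (≤-reflexive L·Li)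

        from-tiny : ∀ {x} → 0ℚ ≤ x → # 200 * x ≤ 1ℚ → # 2 * x ≤ 1ℚ
        from-tiny {x} x0 h = by (k0 198 ⊠ x0 ⊞ dif h) (from-tiny-identity x)

      -- The condition 200W ≤ n gives |h|/L ≤ 1/200, so by the Bernoulli estimates μ^h is within one
      -- per cent of 1 and cannot imitate a power of L.
      μ-upper : ∀ h → ℤ.∣ h ∣ ℕ.≤ W → # 100 * pμ h ≤ # 101
      μ-upper (+ k) h = ≤-trans (*-monoˡ-≤-nonNeg (# 100) (upper k (subst (_≤ 1ℚ) (sym (*-assoc (# 2) (ν k) Li))
          (from-tiny (ν0 k ⊠ <⇒≤ Li>0) (subst (_≤ 1ℚ) (*-assoc (# 200) (ν k) Li) (tiny h))))))
          (by (dif (tiny h)) (μ-upper-identity (ν k) Li))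
      μ-upper -[1+ k ] h = ≤-trans (*-monoˡ-≤-nonNeg (# 100) (lower≤1 (suc k))) (#≤ {100} {101} (ℕₚ.n≤1+n 100))

      μ-lower : ∀ h → ℤ.∣ h ∣ ℕ.≤ W → # 99 ≤ # 100 * pμ h
      μ-lower (+ k) h = ≤-trans (#≤ {99} {100} (ℕₚ.n≤1+n 99)) (*-monoˡ-≤-nonNeg (# 100) (pn-≥1 μ≥1 k))
      μ-lower -[1+ k ] h = ≤-trans (by (k0 100 ⊠ ν0 (suc k) ⊠ <⇒≤ Li>0 ⊞ dif (tiny h)) (μ-lower-identity (ν (suc k)) Li))
          (*-monoˡ-≤-nonNeg (# 100) (lower (suc k)))

      sz-upper : ∀ g h → ℤ.∣ h ∣ ℕ.≤ W → # 100 * sz g h ≤ # 101 * pL g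
      sz-upper g h k = by (<⇒≤ (pL-pos g) ⊠ dif (μ-upper h k)) (sz-upper-identity (pL g) (pμ h))

      sz-lower : ∀ g h → ℤ.∣ h ∣ ℕ.≤ W → # 99 * pL g ≤ # 100 * sz g h
      sz-lower g h k = by (<⇒≤ (pL-pos g) ⊠ dif (μ-lower h k)) (sz-lower-identity (pL g) (pμ h))

    -- The linear term of (1 + 1/L)³; further factors μ ≥ 1 only help.
    μ-gap : ∀ k → 1ℚ + # 3 * Li ≤ pμ (+ (3 ℕ.+ k))
    μ-gap k = ≤-trans (≤-trans (by (k0 3 ⊠ Li0 ⊠ Li0 ⊞ Li0 ⊠ Li0 ⊠ Li0) (μ-gap-identity Li)) (≤-reflexive (cong (λ r → r * (r * r)) (sym μ≡))))
        (by (μ0 ⊠ μ0 ⊠ μ0 ⊠ dif (pn-≥1 μ≥1 k)) (μ-gap-identity₂ μ (pn μ k)))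
      where
      Li0 : 0ℚ ≤ Li
      Li0 = <⇒≤ Li>0
      μ0 : 0ℚ ≤ μ
      μ0 = <⇒≤ μ>0

    pL-mono : ∀ {a b} → a ℤ.≤ b → pL a ≤ pL b
    pL-mono {a} {b} h = ≤-trans (by (<⇒≤ (pL-pos a) ⊠ dif (pn-≥1 (1≤L n≥1) k)) (pL-mono-identity (pL a) (pL (+ k))))
        (≤-reflexive (trans (sym (pw-+ L·Li a (+ k))) (cong pL (trans (cong (λ r → a ℤ.+ r) (ℤₚ.0≤i⇒+∣i∣≡i (ℤₚ.i≤j⇒0≤j-i h))) (pL-mono-identity₂ a b)))))
      where
      k = ℤ.∣ b ℤ.- a ∣

    pL-step : ∀ a → pL (+ 1 ℤ.+ a) ≡ L * pL a
    pL-step a = pw-suc L·Li a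

    pL-< : ∀ {a b} → a ℤ.< b → L * pL a ≤ pL b
    pL-< {a} {b} h = ≤-trans (≤-reflexive (sym (pL-step a))) (pL-mono (ℤₚ.i<j⇒suc[i]≤j h))

    -- Exponents are integers, so a comparison of powers of L up to any factor below L compares the
    -- exponents exactly.
    exponent≤ : ∀ {a b c} → c < L → pL a ≤ c * pL b → a ℤ.≤ b
    exponent≤ {a} {b} {c} c<L h = ℤₚ.≮⇒≥ λ b<a →
      <-irrefl refl (≤-<-trans (≤-trans (pL-< b<a) h) (*-monoʳ-<-pos' (pL-pos b) c<L))
      where
      *-monoʳ-<-pos' : ∀ {p a b} → 0ℚ < p → a < b → a * p < b * p
      *-monoʳ-<-pos' {p} {a} {b} hp hab = by< (dif< hab ⊠< hp) (*-monoʳ-<-pos'-identity a b p)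

-- Siegel's identity and the comparison of exponents.

module Siegel where
  open import Data.Empty using (⊥; ⊥-elim)
  open import Data.Nat as ℕ using (ℕ)
  import Data.Nat.Properties as ℕₚ
  open import Data.Integer as ℤ using (ℤ; +_)
  import Data.Integer.Properties as ℤₚ
  open import Data.List using ([]; _∷_)
  open import Data.Product using (∃-syntax; _×_; _,_; proj₁; proj₂)
  open import Data.Sum using (_⊎_; inj₁; inj₂)
  open import Data.Rational
  open import Data.Rational.Properties
  open import Relation.Binary.Definitions using (tri<; tri≈; tri>)
  open import Relation.Nullary using (¬_; yes; no; contradiction)
  open import Relation.Binary.PropositionalEquality
  open import Tactic.RingSolver using (solve)
  open Rationals
  open Root using (Base)
  open Powers
  open import Data.Integer.Tactic.RingSolver using () renaming (solve to solveℤ)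

  -- The format of the numerical refutations below: a positive quantity plus a nonnegative
  -- combination of the hypotheses that is identically 0.
  absurd : ∀ {a b} → 0ℚ < a → 0ℚ ≤ b → a + b ≡ 0ℚ → ⊥
  absurd {a} {b} h k e = <-irrefl refl (<-≤-trans h (by k (trans (sym e) refl)))

  private
    exps-identity : ∀ a b c d → a ℤ.+ d ≡ c ℤ.+ b ℤ.+ ℤ.- + 1 ℤ.* (b ℤ.- (a ℤ.+ d ℤ.- c))
    exps-identity a b c d = solveℤ (a ∷ b ∷ c ∷ d ∷ [])

    clash-identity : ∀ x p r d → # 188 * (x * p) + (# 10 * (# 10 * d - # 29 * (x * p)) + (# 102 * r - # 100 * d + # 102 * (x * p - r))) ≡ 0ℚ
    clash-identity x p r d = solve (x ∷ p ∷ r ∷ d ∷ []) ℚring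

    zero-of-identity : ∀ a b → a ≡ + 0 ℤ.+ (+ 0 ℤ.- b) ℤ.+ + 1 ℤ.* (a ℤ.+ b ℤ.- + 0)
    zero-of-identity a b = solveℤ (a ∷ b ∷ [])

    zero-of-identity₂ : ∀ a b → b ≡ + 0 ℤ.+ (+ 0 ℤ.- a) ℤ.+ + 1 ℤ.* (a ℤ.+ b ℤ.- + 0)
    zero-of-identity₂ a b = solveℤ (a ∷ b ∷ [])

    *-monoʳ-<-nonneg-identity : ∀ k m q → m * q ≡ k * q + (m - k) * q
    *-monoʳ-<-nonneg-identity k m q = solve (k ∷ m ∷ q ∷ []) ℚring

    neg3-identity : ∀ e → ℤ.- e ≡ + 3 ℤ.+ ℤ.- (ℤ.- (e ℤ.+ e)) ℤ.+ + 3 ℤ.* (+ 0 ℤ.- (+ 1 ℤ.+ e))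
    neg3-identity e = solveℤ (e ∷ [])

    pos3-identity : ∀ e → ℤ.- (ℤ.- (e ℤ.+ e)) ≡ + 3 ℤ.+ ℤ.- e ℤ.+ + 3 ℤ.* (e ℤ.- (+ 1 ℤ.+ + 0))
    pos3-identity e = solveℤ (e ∷ [])

    rat-identity : ∀ a b c → a ℤ.+ b ≡ a ℤ.+ b ℤ.- c ℤ.+ c
    rat-identity a b c = solveℤ (a ∷ b ∷ c ∷ [])

    Hi≡-identity : ∀ a b → a ≡ a ℤ.- b ℤ.+ b
    Hi≡-identity a b = solveℤ (a ∷ b ∷ [])

    Hk≡-identity : ∀ a b c d → c ≡ a ℤ.- b ℤ.+ d ℤ.+ + 1 ℤ.* (b ℤ.- (a ℤ.+ d ℤ.- c))
    Hk≡-identity a b c d = solveℤ (a ∷ b ∷ c ∷ d ∷ [])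

    mi<Hi-arith : ∀ {p d g q} → # 98 * p ≤ # 100 * d → # 2 * d ≤ g → # 100 * g ≤ # 103 * q → # 196 * p ≤ # 103 * q
    mi<Hi-arith {p} {d} {g} {q} h1 h2 h3 = by (k0 2 ⊠ dif h1 ⊞ k0 100 ⊠ dif h2 ⊞ dif h3) (solve (p ∷ d ∷ g ∷ q ∷ []) ℚring)

    1≤r-identity : ∀ a b → b ℤ.- a ≡ + 1 ℤ.+ (b ℤ.- (+ 1 ℤ.+ a))
    1≤r-identity a b = solveℤ (a ∷ b ∷ [])

    drop-identity : ∀ Hj r mi mk ej ei ek → r ℤ.+ mi ≡ + 3 ℤ.+ Hj ℤ.+ (+ 3 ℤ.* (r ℤ.- + 1) ℤ.+ (mi ℤ.- ej ℤ.+ (mi ℤ.- ei ℤ.+ (mk ℤ.- ek))))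
      ℤ.+ ℤ.- + 1 ℤ.* (Hj ℤ.+ (r ℤ.+ mi) ℤ.+ (r ℤ.+ mk) ℤ.- + 0) ℤ.+ + 1 ℤ.* (ej ℤ.+ ei ℤ.+ ek ℤ.- + 0)
    drop-identity Hj r mi mk ej ei ek = solveℤ (Hj ∷ r ∷ mi ∷ mk ∷ ej ∷ ei ∷ ek ∷ [])

    nz'-identity : ∀ i → i ≡ + 0 ℤ.+ + 1 ℤ.* (+ 0 ℤ.+ i ℤ.+ + 0 ℤ.- + 0)
    nz'-identity i = solveℤ (i ∷ [])

    wrong-order-identity : ∀ x a b → # 3 * (x * b) + (a - (1ℚ + # 3 * x) * b + (b - a)) ≡ 0ℚ
    wrong-order-identity x a b = solve (x ∷ a ∷ b ∷ []) ℚring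

    duj≤-arith : ∀ {d a b r} → # 2 * d ≤ a + b → # 100 * a ≤ # 102 * r → # 100 * b ≤ # 102 * r → # 100 * d ≤ # 102 * r
    duj≤-arith {d} {a} {b} {r} h1 h2 h3 = cancel≤ (# 2) (k0< 1) (by (k0 100 ⊠ dif h1 ⊞ dif h2 ⊞ dif h3) (solve (d ∷ a ∷ b ∷ r ∷ []) ℚring))

    -2m≤ev-identity : ∀ j u v m → v ≡ ℤ.- (m ℤ.+ m) ℤ.+ (m ℤ.- j ℤ.+ (m ℤ.- u)) ℤ.+ + 1 ℤ.* (j ℤ.+ u ℤ.+ v ℤ.- + 0)
    -2m≤ev-identity j u v m = solveℤ (j ∷ u ∷ v ∷ m ∷ [])

    m<ev-identity : ∀ m → ℤ.- (m ℤ.+ m) ≡ + 0 ℤ.+ (+ 0 ℤ.- m ℤ.+ (+ 0 ℤ.- m))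
    m<ev-identity m = solveℤ (m ∷ [])

    dk0-identity : ∀ q → # 98 * q ≡ # 100 * 0ℚ + # 98 * q
    dk0-identity q = solve (q ∷ []) ℚring

    chain-identity : ∀ a → + 3 ℤ.+ a ≡ + 1 ℤ.+ (+ 1 ℤ.+ (+ 1 ℤ.+ a))
    chain-identity a = solveℤ (a ∷ [])

    key-identity : ∀ a b c d → a * b * (c * d) ≡ (a * c) * (b * d)
    key-identity a b c d = solve (a ∷ b ∷ c ∷ d ∷ []) ℚring

    key-identity₂ : ∀ g d → g * (# 10 * d) ≡ # 10 * (g * d)
    key-identity₂ g d = solve (g ∷ d ∷ []) ℚring

    zero-sum-identity : ∀ a → a ≡ a ℤ.+ + 0 ℤ.+ + 0
    zero-sum-identity a = solveℤ (a ∷ [])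

    rough-tiny : ∀ {x} → 0ℚ ≤ x → # 1000 * x ≤ 1ℚ → # 1000 * (x * x) ≤ 1ℚ
    rough-tiny {x} x0 xs = by (x0 ⊠ dif xs ⊞ dif xs ⊞ k0 999 ⊠ x0) (solve (x ∷ []) ℚring)

    same-ij-identity : ∀ j i k → k ≡ ℤ.- (i ℤ.+ i) ℤ.+ + 1 ℤ.* (j ℤ.+ i ℤ.+ k ℤ.- + 0) ℤ.+ + 1 ℤ.* (i ℤ.- j)
    same-ij-identity j i k = solveℤ (j ∷ i ∷ k ∷ [])

    same-kj-identity : ∀ j i k → i ≡ ℤ.- (k ℤ.+ k) ℤ.+ + 1 ℤ.* (j ℤ.+ i ℤ.+ k ℤ.- + 0) ℤ.+ + 1 ℤ.* (k ℤ.- j)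
    same-kj-identity j i k = solveℤ (j ∷ i ∷ k ∷ [])

    cross-identity : ∀ y a b → y * a * b ≡ y * b * a
    cross-identity y a b = solve (y ∷ a ∷ b ∷ []) ℚring

    finish-up : ∀ {p q d} → # 98 * p ≤ # 100 * d → # 100 * d ≤ # 109 * q → 0ℚ ≤ q → p ≤ # 2 * q
    finish-up {p} {q} {d} h k q0 = cancel≤ (# 98) (k0< 97) (by (dif h ⊞ dif k ⊞ k0 87 ⊠ q0) (solve (p ∷ q ∷ d ∷ []) ℚring))

    finish-down : ∀ {p q d} → # 92 * q ≤ # 100 * d → # 100 * d ≤ # 102 * p → 0ℚ ≤ p → q ≤ # 2 * p
    finish-down {p} {q} {d} h k p0 = cancel≤ (# 92) (k0< 91) (by (dif h ⊞ dif k ⊞ k0 82 ⊠ p0) (solve (p ∷ q ∷ d ∷ []) ℚring))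

    finish-swap : ∀ a b c → a ℤ.+ b ℤ.+ c ≡ a ℤ.+ c ℤ.+ b
    finish-swap a b c = solveℤ (a ∷ b ∷ c ∷ [])

    V-bound-identity : ∀ Hj r mi mk hi hk u → ℤ.- Hj ℤ.+ hk ≡ + 3 ℤ.+ (ℤ.- (r ℤ.+ mi) ℤ.+ hi) ℤ.+ (+ 3 ℤ.* (r ℤ.- + 1) ℤ.+ u)
      ℤ.+ ℤ.- + 1 ℤ.* (Hj ℤ.+ (r ℤ.+ mi) ℤ.+ (r ℤ.+ mk) ℤ.- + 0) ℤ.+ + 1 ℤ.* (mi ℤ.+ mi ℤ.+ mk ℤ.- hi ℤ.+ hk ℤ.- u)
    V-bound-identity Hj r mi mk hi hk u = solveℤ (Hj ∷ r ∷ mi ∷ mk ∷ hi ∷ hk ∷ u ∷ [])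

    not-both-identity : ∀ j i k → + 3 ℤ.* j ≡ + 0 ℤ.+ + 1 ℤ.* (j ℤ.+ i ℤ.+ k ℤ.- + 0) ℤ.+ ℤ.- + 1 ℤ.* (i ℤ.- j) ℤ.+ ℤ.- + 1 ℤ.* (k ℤ.- j)
    not-both-identity j i k = solveℤ (j ∷ i ∷ k ∷ [])

    strict-identity : ∀ j i k → j ℤ.+ j ℤ.+ j ℤ.- ℤ.- k ℤ.+ ℤ.- k ≡ j ℤ.- i ℤ.+ (j ℤ.- k) ℤ.+ + 1 ℤ.* (j ℤ.+ i ℤ.+ k ℤ.- + 0)
    strict-identity j i k = solveℤ (j ∷ i ∷ k ∷ [])

    strict-identity₂ : ∀ j i k → i ℤ.+ i ℤ.+ k ℤ.- ℤ.- j ℤ.+ ℤ.- i ≡ + 0 ℤ.+ + 1 ℤ.* (j ℤ.+ i ℤ.+ k ℤ.- + 0)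
    strict-identity₂ j i k = solveℤ (j ∷ i ∷ k ∷ [])

    strict-identity₃ : ∀ j i k → j ℤ.+ j ℤ.+ k ℤ.- ℤ.- k ℤ.+ ℤ.- i ≡ j ℤ.- i ℤ.+ (k ℤ.- j ℤ.+ (j ℤ.- i)) ℤ.+ + 1 ℤ.* (j ℤ.+ i ℤ.+ k ℤ.- + 0)
    strict-identity₃ j i k = solveℤ (j ∷ i ∷ k ∷ [])

    strict-identity₄ : ∀ j i k → i ℤ.+ i ℤ.+ j ℤ.- ℤ.- j ℤ.+ ℤ.- k ≡ j ℤ.- k ℤ.+ (i ℤ.- j ℤ.+ (j ℤ.- k)) ℤ.+ + 1 ℤ.* (j ℤ.+ i ℤ.+ k ℤ.- + 0)
    strict-identity₄ j i k = solveℤ (j ∷ i ∷ k ∷ [])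

    Hj≤0-identity : ∀ j i k → + 0 ≡ + 3 ℤ.* j ℤ.+ (i ℤ.- j ℤ.+ (k ℤ.- j)) ℤ.+ ℤ.- + 1 ℤ.* (j ℤ.+ i ℤ.+ k ℤ.- + 0)
    Hj≤0-identity j i k = solveℤ (j ∷ i ∷ k ∷ [])

    impossible-identity : ∀ j i k → k ≡ ℤ.- (j ℤ.+ j) ℤ.+ + 1 ℤ.* (j ℤ.+ i ℤ.+ k ℤ.- + 0) ℤ.+ + 1 ℤ.* (j ℤ.- i)
    impossible-identity j i k = solveℤ (j ∷ i ∷ k ∷ [])

    impossible-identity₂ : ∀ j i k → i ≡ ℤ.- (j ℤ.+ j) ℤ.+ + 1 ℤ.* (j ℤ.+ i ℤ.+ k ℤ.- + 0) ℤ.+ + 1 ℤ.* (j ℤ.- k)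
    impossible-identity₂ j i k = solveℤ (j ∷ i ∷ k ∷ [])

    pL-<x-identity : ∀ L m p → p ≡ m * (L * p) + - p * (L * m - 1ℚ)
    pL-<x-identity L m p = solve (L ∷ m ∷ p ∷ []) ℚring

    small-part-arith : ∀ {x p q a b} → q ≤ x * p → # 99 * p ≤ # 100 * a → # 100 * b ≤ # 101 * q → 0ℚ ≤ x → 0ℚ ≤ p → # 10 * b ≤ # 11 * (x * a)
    small-part-arith {x} {p} {q} {a} {b} h1 h2 h3 x0 p0 =
      cancel≤ (# 100) (k0< 99) (by (k0 10 ⊠ dif h3 ⊞ k0 1010 ⊠ dif h1 ⊞ k0 11 ⊠ x0 ⊠ dif h2 ⊞ k0 79 ⊠ x0 ⊠ p0) (solve (x ∷ p ∷ q ∷ a ∷ b ∷ []) ℚring))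

    dominated-up : ∀ {x a b d} → # 10 * b ≤ # 11 * (x * a) → d ≤ a + b → # 10 * d ≤ (# 10 + # 11 * x) * a
    dominated-up {x} {a} {b} {d} h k = by (dif h ⊞ k0 10 ⊠ dif k) (solve (x ∷ a ∷ b ∷ d ∷ []) ℚring)

    dominated-down : ∀ {x a b d} → # 10 * b ≤ # 11 * (x * a) → a ≤ d + b → (# 10 - # 11 * x) * a ≤ # 10 * d
    dominated-down {x} {a} {b} {d} h k = by (dif h ⊞ k0 10 ⊠ dif k) (solve (x ∷ a ∷ b ∷ d ∷ []) ℚring)

    dominated-rough-low : ∀ {x p a d} → # 99 * p ≤ # 100 * a → (# 10 - # 11 * x) * a ≤ # 10 * d → # 1000 * x ≤ 1ℚ → 0ℚ ≤ x → 0ℚ ≤ p → # 98 * p ≤ # 100 * d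
    dominated-rough-low {x} {p} {a} {d} h k xs x0 p0 = cancel≤ (# 10000) (k0< 9999) (by
      (k0 100000 ⊠ dif k ⊞ (k0 11 ⊠ dif xs ⊞ k0 9989) ⊠ dif h ⊞ k0 1089 ⊠ (dif xs ⊠ p0) ⊞ k0 8911 ⊠ p0) (solve (x ∷ p ∷ a ∷ d ∷ []) ℚring))

    dominated-rough-high : ∀ {x p a d} → # 100 * a ≤ # 101 * p → # 10 * d ≤ (# 10 + # 11 * x) * a → # 1000 * x ≤ 1ℚ → 0ℚ ≤ x → 0ℚ ≤ p → # 100 * d ≤ # 102 * p
    dominated-rough-high {x} {p} {a} {d} h k xs x0 p0 = cancel≤ (# 10000) (k0< 9999) (by
      (k0 100000 ⊠ dif k ⊞ (k0 10000 ⊞ k0 11000 ⊠ x0) ⊠ dif h ⊞ k0 1111 ⊠ (dif xs ⊠ p0) ⊞ k0 8889 ⊠ p0) (solve (x ∷ p ∷ a ∷ d ∷ []) ℚring))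

    sz-gap-identity : ∀ x s p → s * p ≡ (1ℚ + # 3 * x) * s + s * (p - (1ℚ + # 3 * x))
    sz-gap-identity x s p = solve (x ∷ s ∷ p ∷ []) ℚring

    sz-gap-identity₂ : ∀ h h' → h' ℤ.+ (+ 3 ℤ.+ (h ℤ.- (+ 3 ℤ.+ h'))) ≡ h
    sz-gap-identity₂ h h' = solveℤ (h ∷ h' ∷ [])

    case-equal-larger : ∀ {x p q r a b d} → # 99 * q ≤ # 100 * a → # 100 * b ≤ # 101 * p → p ≤ x * q → # 100 * d ≤ # 102 * r → a ≤ d + b → # 1000 * x ≤ 1ℚ → 0ℚ ≤ q → q ≤ # 2 * r
    case-equal-larger {x} {p} {q} {r} {a} {b} {d} h1 h2 h3 h4 h5 xs q0 = cancel≤ (# 51000) (k0< 50999) (by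
      (k0 1000 ⊠ dif h4 ⊞ k0 100000 ⊠ dif h5 ⊞ k0 1000 ⊠ dif h2 ⊞ k0 1000 ⊠ dif h1 ⊞ k0 101000 ⊠ dif h3 ⊞ k0 101 ⊠ (dif xs ⊠ q0) ⊞ k0 47899 ⊠ q0)
      (solve (x ∷ p ∷ q ∷ r ∷ a ∷ b ∷ d ∷ []) ℚring))

    case-equal-final : ∀ {x Q R r q av aj bv bj d} → # 99 * Q ≤ # 100 * av → av ≤ d + aj → # 2 * d ≤ bv + bj → # 100 * bv ≤ # 102 * R → # 100 * bj ≤ # 102 * r →
      # 100 * aj ≤ # 101 * q → R ≤ Q → r ≤ x * Q → q ≤ r → # 1000 * x ≤ 1ℚ → 0ℚ < Q → ⊥
    case-equal-final {x} {Q} {R} {r} {q} {av} {aj} {bv} {bj} {d} h1 h2 h3 h4 h5 h6 h7 h8 h9 xs Q0 = absurd (k0< 47847 ⊠< Q0)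
      (k0 1000 ⊠ dif h1 ⊞ k0 100000 ⊠ dif h2 ⊞ k0 50000 ⊠ dif h3 ⊞ k0 500 ⊠ dif h4 ⊞ k0 500 ⊠ dif h5 ⊞ k0 1000 ⊠ dif h6 ⊞ k0 51000 ⊠ dif h7 ⊞ k0 152000 ⊠ dif h8 ⊞ k0 101000 ⊠ dif h9
        ⊞ k0 152 ⊠ (dif xs ⊠ <⇒≤ Q0)) (solve (x ∷ Q ∷ R ∷ r ∷ q ∷ av ∷ aj ∷ bv ∷ bj ∷ d ∷ []) ℚring)

    window-low : ∀ {x p r b b' g} → # 98 * p ≤ # 100 * b → # 100 * b' ≤ # 102 * r → r ≤ x * p → b ≤ g + b' → # 1000 * x ≤ 1ℚ → 0ℚ ≤ p → # 97 * p ≤ # 100 * g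
    window-low {x} {p} {r} {b} {b'} {g} h1 h2 h3 h4 xs p0 = cancel≤ (# 1000) (k0< 999) (by
      (k0 100000 ⊠ dif h4 ⊞ k0 1000 ⊠ dif h1 ⊞ k0 1000 ⊠ dif h2 ⊞ k0 102000 ⊠ dif h3 ⊞ k0 102 ⊠ (dif xs ⊠ p0) ⊞ k0 898 ⊠ p0) (solve (x ∷ p ∷ r ∷ b ∷ b' ∷ g ∷ []) ℚring))

    window-high : ∀ {x p r b b' g} → # 100 * b ≤ # 102 * p → # 100 * b' ≤ # 102 * r → r ≤ x * p → g ≤ b + b' → # 1000 * x ≤ 1ℚ → 0ℚ ≤ p → # 100 * g ≤ # 103 * p
    window-high {x} {p} {r} {b} {b'} {g} h1 h2 h3 h4 xs p0 = cancel≤ (# 1000) (k0< 999) (by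
      (k0 100000 ⊠ dif h4 ⊞ k0 1000 ⊠ dif h1 ⊞ k0 1000 ⊠ dif h2 ⊞ k0 102000 ⊠ dif h3 ⊞ k0 102 ⊠ (dif xs ⊠ p0) ⊞ k0 898 ⊠ p0) (solve (x ∷ p ∷ r ∷ b ∷ b' ∷ g ∷ []) ℚring))

    ratio-low : ∀ {qi qk qM qr di dk gi gk} → # 97 * qi ≤ # 100 * gi → # 100 * gk ≤ # 103 * qk → # 98 * qM ≤ # 100 * dk → gi * dk ≤ gk * di → qr * qk ≤ qi * qM →
      0ℚ ≤ di → 0ℚ ≤ dk → 0ℚ ≤ qi → 0ℚ ≤ qr * qk → qk * (# 103 * (# 92 * qr)) ≤ qk * (# 103 * (# 100 * di))
    ratio-low {qi} {qk} {qM} {qr} {di} {dk} {gi} {gk} h1 h2 h3 h4 h5 di0 dk0 qi0 P0 =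
      by (k0 100 ⊠ di0 ⊠ dif h2 ⊞ k0 100 ⊠ dk0 ⊠ dif h1 ⊞ k0 97 ⊠ qi0 ⊠ dif h3 ⊞ k0 10000 ⊠ dif h4 ⊞ k0 9506 ⊠ dif h5 ⊞ k0 30 ⊠ P0)
        (solve (qi ∷ qk ∷ qM ∷ qr ∷ di ∷ dk ∷ gi ∷ gk ∷ []) ℚring)

    ratio-high : ∀ {qi qk qM qr di dk gi gk} → # 100 * gi ≤ # 103 * qi → # 97 * qk ≤ # 100 * gk → # 100 * dk ≤ # 102 * qM → gk * di ≤ gi * dk → qi * qM ≤ qr * qk →
      0ℚ ≤ di → 0ℚ ≤ dk → 0ℚ ≤ qi → 0ℚ ≤ qr * qk → qk * (# 97 * (# 100 * di)) ≤ qk * (# 97 * (# 109 * qr))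
    ratio-high {qi} {qk} {qM} {qr} {di} {dk} {gi} {gk} h1 h2 h3 h4 h5 di0 dk0 qi0 P0 =
      by (k0 100 ⊠ di0 ⊠ dif h2 ⊞ k0 100 ⊠ dk0 ⊠ dif h1 ⊞ k0 103 ⊠ qi0 ⊠ dif h3 ⊞ k0 10000 ⊠ dif h4 ⊞ k0 10506 ⊠ dif h5 ⊞ k0 67 ⊠ P0)
        (solve (qi ∷ qk ∷ qM ∷ qr ∷ di ∷ dk ∷ gi ∷ gk ∷ []) ℚring)

    same-not-ratio-near : ∀ {x p q} → # 92 * q ≤ # 202 * p → p ≤ x * q → # 1000 * x ≤ 1ℚ → 0ℚ < q → ⊥
    same-not-ratio-near {x} {p} {q} h1 h2 xs q0 = absurd (k0< 91797 ⊠< q0) (k0 1000 ⊠ dif h1 ⊞ k0 202000 ⊠ dif h2 ⊞ k0 202 ⊠ (dif xs ⊠ <⇒≤ q0)) (solve (x ∷ p ∷ q ∷ []) ℚring)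

    same-not-ratio-near₂ : ∀ {x p q d} → # 29 * (x * q) ≤ # 10 * d → # 100 * d ≤ # 109 * p → p ≤ x * q → 0ℚ < x → 0ℚ < q → ⊥
    same-not-ratio-near₂ {x} {p} {q} {d} h1 h2 h3 x0 q0 = absurd (k0< 180 ⊠< (x0 ⊠< q0)) (k0 10 ⊠ dif h1 ⊞ dif h2 ⊞ k0 109 ⊠ dif h3) (solve (x ∷ p ∷ q ∷ d ∷ []) ℚring)

    fine-part-identity : ∀ q → # 99 * q ≡ # 100 * 0ℚ + # 99 * q
    fine-part-identity q = solve (q ∷ []) ℚring

    fine-part-arith : ∀ {x p q bh b} → # 99 * p ≤ # 100 * bh → # 100 * b ≤ # 102 * q → q ≤ x * (x * (x * p)) → # 1000 * x ≤ 1ℚ → 0ℚ ≤ x → 0ℚ ≤ bh → b ≤ x * x * bh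
    fine-part-arith {x} {p} {q} {bh} {b} h1 h2 h3 xs x0 b0 = cancel≤ (# 49500) (k0< 49499) (by
      (k0 495 ⊠ dif h2 ⊞ k0 50490 ⊠ dif h3 ⊞ k0 510 ⊠ x0 ⊠ x0 ⊠ x0 ⊠ dif h1 ⊞ x0 ⊠ x0 ⊠ b0 ⊠ (k0 51 ⊠ dif xs ⊞ k0 49449)) (solve (x ∷ p ∷ q ∷ bh ∷ b ∷ []) ℚring))

    fine-low-arith : ∀ {x bh bi bj g} → (1ℚ - x * x) * bh ≤ bi → bj ≤ x * x * bh → bi ≤ g + bj → (1ℚ - # 2 * (x * x)) * bh ≤ g
    fine-low-arith {x} {bh} {bi} {bj} {g} h1 h2 h3 = by (dif h1 ⊞ dif h2 ⊞ dif h3) (solve (x ∷ bh ∷ bi ∷ bj ∷ g ∷ []) ℚring)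

    fine-high-arith : ∀ {x bh bi bj g} → bi ≤ (1ℚ + x * x) * bh → bj ≤ x * x * bh → g ≤ bi + bj → g ≤ (1ℚ + # 2 * (x * x)) * bh
    fine-high-arith {x} {bh} {bi} {bj} {g} h1 h2 h3 = by (dif h1 ⊞ dif h2 ⊞ dif h3) (solve (x ∷ bh ∷ bi ∷ bj ∷ g ∷ []) ℚring)

    μ-contradiction-c₁ : ∀ {x} → 0ℚ ≤ x → # 1000 * x ≤ 1ℚ → 0ℚ ≤ # 10 - # 11 * x
    μ-contradiction-c₁ {x} x0 xs = cancel≤ (# 1000) (k0< 999) (by (k0 11 ⊠ dif xs ⊞ k0 9989) (solve (x ∷ []) ℚring))

    μ-contradiction-c₂ : ∀ {x} → 0ℚ ≤ x → # 1000 * x ≤ 1ℚ → 0ℚ ≤ 1ℚ - # 2 * (x * x)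
    μ-contradiction-c₂ {x} x0 xs = by (dif xs ⊞ k0 998 ⊠ x0 ⊞ k0 2 ⊠ x0 ⊠ (dif xs ⊞ k0 999 ⊠ x0)) (solve (x ∷ []) ℚring)

    rotate-perm : ∀ a b c → a ℤ.+ b ℤ.+ c ≡ c ℤ.+ a ℤ.+ b
    rotate-perm a b c = solveℤ (a ∷ b ∷ c ∷ [])

  module Inequalities (n : ℕ) (n≥1 : 1 ℕ.≤ n) (B : Base n) (W : ℕ) (small : 200 ℕ.* W ℕ.≤ n) (big : 1000 ℕ.≤ n) where
    open Sizes n n≥1 B
    open Range W small

    x : ℚ
    x = Li
    x>0 : 0ℚ < x
    x>0 = Li>0
    x≥0 : 0ℚ ≤ x
    x≥0 = <⇒≤ x>0
    1000≤L : # 1000 ≤ L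
    1000≤L = ≤-trans (subst (_≤ ν n) (ι-# 1000) (ν≤ big)) n≤L
    x-small : # 1000 * x ≤ 1ℚ
    x-small = ≤-trans (*-monoʳ-≤-nonNeg Li {{nonNegative x≥0}} 1000≤L) (≤-reflexive L·Li)
    2<L : # 2 < L
    2<L = <-≤-trans (by< (k0< 997) refl) 1000≤L

    pL-<x : ∀ {a b} → a ℤ.< b → pL a ≤ x * pL b
    pL-<x {a} {b} h = ≤-trans (≤-reflexive (lc1 (- pL a) L·Li (pL-<x-identity L Li (pL a)))) (*-monoˡ-≤-nonNeg x {{nonNegative x≥0}} (pL-< h))

    -- Three accuracies are used: `Crude` for the conjugates of α; `Rough` for those of β and for
    -- dominated differences; `Fine`, with relative error x² and the power of μ retained, for the
    -- conjugates of β in the decisive step.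
    Crude : ℤ → ℚ → Set
    Crude e a = # 99 * pL e ≤ # 100 * a × # 100 * a ≤ # 101 * pL e

    Rough : ℤ → ℚ → Set
    Rough e a = # 98 * pL e ≤ # 100 * a × # 100 * a ≤ # 102 * pL e

    sz-crude : ∀ g h → ℤ.∣ h ∣ ℕ.≤ W → Crude g (sz g h)
    sz-crude g h k = sz-lower g h k , sz-upper g h k

    small-part : ∀ {e e' a b} → e' ℤ.< e → Crude e a → Crude e' b → # 10 * b ≤ # 11 * (x * a)
    small-part {e} {e'} {a} {b} h (ha , _) (_ , hb) = small-part-arith {x} {pL e} {pL e'} {a} {b} (pL-<x h) ha hb x≥0 (<⇒≤ (pL-pos e))

    -- The difference of two conjugates of α with distinct L-exponents: the smaller is at most
    -- 11x/10 times the larger, so the difference equals the larger up to that relative error.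
    record Dominated (e : ℤ) (a d : ℚ) : Set where
      field
        above : # 10 * d ≤ (# 10 + # 11 * x) * a
        below : (# 10 - # 11 * x) * a ≤ # 10 * d

    dominated : ∀ {e e' a b d} → e' ℤ.< e → Crude e a → Crude e' b → a ≤ d + b → d ≤ a + b → Dominated e a d
    dominated {e} {e'} {a} {b} {d} h ca cb h1 h2 = record
      { above = dominated-up {x} {a} {b} {d} (small-part {e} {e'} {a} {b} h ca cb) h2 ; below = dominated-down {x} {a} {b} {d} (small-part {e} {e'} {a} {b} h ca cb) h1 }

    dominated-rough : ∀ {e a d} → Crude e a → Dominated e a d → Rough e d
    dominated-rough {e} {a} {d} (h1 , h2) D = dominated-rough-low {x} {pL e} {a} {d} h1 (Dominated.below D) x-small x≥0 (<⇒≤ (pL-pos e)) , dominated-rough-high {x} {pL e} {a} {d} h2 (Dominated.above D) x-small x≥0 (<⇒≤ (pL-pos e))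

    sz-gap : ∀ {g h h'} → + 3 ℤ.+ h' ℤ.≤ h → (1ℚ + # 3 * x) * sz g h' ≤ sz g h
    sz-gap {g} {h} {h'} le = ≤-trans (by (<⇒≤ (sz-pos g h') ⊠ dif (μ-gap k)) (sz-gap-identity x (sz g h') (pμ (+ (3 ℕ.+ k)))))
        (≤-reflexive (trans (*-assoc (pL g) (pμ h') _) (cong (pL g *_) (trans (sym (pw-+ μ·μi h' (+ (3 ℕ.+ k)))) (cong pμ h≡)))))
      where
      k = ℤ.∣ h ℤ.- (+ 3 ℤ.+ h') ∣
      h≡ : h' ℤ.+ + (3 ℕ.+ k) ≡ h
      h≡ = trans (cong (λ r → h' ℤ.+ (+ 3 ℤ.+ r)) (ℤₚ.0≤i⇒+∣i∣≡i (ℤₚ.i≤j⇒0≤j-i le))) (sz-gap-identity₂ h h')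

    -- The possible absolute values of a difference when only the absolute values of its terms are
    -- known.
    Split : ℚ → ℚ → ℚ → Set
    Split a b d = d ≡ a + b ⊎ d ≡ a - b ⊎ d ≡ b - a

    -- The difference of two conjugates of α with the same L-exponent. With opposite signs it is
    -- about twice L^e; with equal signs it is at most 2 per cent of L^e, but not below 2.9 L^(e-1)
    -- because the μ-exponents differ by at least 3.
    record Same (e : ℤ) (d : ℚ) : Set where
      field
        below : # 29 * (x * pL e) ≤ # 10 * d
        dichotomy : (# 198 * pL e ≤ # 100 * d × # 100 * d ≤ # 202 * pL e) ⊎ # 100 * d ≤ # 2 * pL e

    private
      gap-low : ∀ {x q a b d} → (1ℚ + # 3 * x) * b ≤ a → # 99 * q ≤ # 100 * b → 0ℚ ≤ x → 0ℚ ≤ q → d ≡ a - b → # 29 * (x * q) ≤ # 10 * d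
      gap-low {x} {q} {a} {b} h1 h2 x0 q0 refl = cancel≤ (# 10) (k0< 9) (by (k0 100 ⊠ dif h1 ⊞ k0 3 ⊠ x0 ⊠ dif h2 ⊞ k0 7 ⊠ x0 ⊠ q0) (solve (x ∷ q ∷ a ∷ b ∷ []) ℚring))
      gap-high : ∀ {q a b d} → # 100 * a ≤ # 101 * q → # 99 * q ≤ # 100 * b → d ≡ a - b → # 100 * d ≤ # 2 * q
      gap-high {q} {a} {b} h1 h2 refl = by (dif h1 ⊞ dif h2) (solve (q ∷ a ∷ b ∷ []) ℚring)
      sum-low : ∀ {q a b d} → # 99 * q ≤ # 100 * a → # 99 * q ≤ # 100 * b → d ≡ a + b → # 198 * q ≤ # 100 * d
      sum-low {q} {a} {b} h1 h2 refl = by (dif h1 ⊞ dif h2) (solve (q ∷ a ∷ b ∷ []) ℚring)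
      sum-high : ∀ {q a b d} → # 100 * a ≤ # 101 * q → # 100 * b ≤ # 101 * q → d ≡ a + b → # 100 * d ≤ # 202 * q
      sum-high {q} {a} {b} h1 h2 refl = by (dif h1 ⊞ dif h2) (solve (q ∷ a ∷ b ∷ []) ℚring)
      sum-low' : ∀ {x q d} → # 198 * q ≤ # 100 * d → # 1000 * x ≤ 1ℚ → 0ℚ ≤ q → # 29 * (x * q) ≤ # 10 * d
      sum-low' {x} {q} {d} h xs q0 = cancel≤ (# 1000) (k0< 999) (by (k0 100 ⊠ dif h ⊞ k0 29 ⊠ (dif xs ⊠ q0) ⊞ k0 19771 ⊠ q0) (solve (x ∷ q ∷ d ∷ []) ℚring))
      wrong-order : ∀ {x a b d} → (1ℚ + # 3 * x) * b ≤ a → 0ℚ < x → 0ℚ < b → 0ℚ ≤ d → d ≡ b - a → ⊥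
      wrong-order {x} {a} {b} h x0 b0 d0 refl = absurd (k0< 2 ⊠< (x0 ⊠< b0)) (dif h ⊞ d0) (wrong-order-identity x a b)

    same-ordered : ∀ {e h h' a b d} → ℤ.∣ h ∣ ℕ.≤ W → ℤ.∣ h' ∣ ℕ.≤ W → + 3 ℤ.+ h' ℤ.≤ h → a ≡ sz e h → b ≡ sz e h' → 0ℚ ≤ d → Split a b d → Same e d
    same-ordered {e} {h} {h'} {_} {_} {d} r r' gap refl refl d0 sp = go sp
      where
      c = sz-crude e h r
      c' = sz-crude e h' r'
      q0 = <⇒≤ (pL-pos e)
      S S' : ℚ
      S = sz e h
      S' = sz e h'
      go : Split S S' d → Same e d
      go (inj₁ s) = record { below = sum-low' {x} {pL e} {d} (sum-low {pL e} {S} {S'} {d} (proj₁ c) (proj₁ c') s) x-small q0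
                           ; dichotomy = inj₁ (sum-low {pL e} {S} {S'} {d} (proj₁ c) (proj₁ c') s , sum-high {pL e} {S} {S'} {d} (proj₂ c) (proj₂ c') s) }
      go (inj₂ (inj₁ s)) = record { below = gap-low {x} {pL e} {S} {S'} {d} (sz-gap {e} {h} {h'} gap) (proj₁ c') x≥0 q0 s ; dichotomy = inj₂ (gap-high {pL e} {S} {S'} {d} (proj₂ c) (proj₁ c') s) }
      go (inj₂ (inj₂ s)) = ⊥-elim (wrong-order {x} {S} {S'} {d} (sz-gap {e} {h} {h'} gap) x>0 (sz-pos e h') d0 s)

    split-sym : ∀ {a b d} → Split a b d → Split b a d
    split-sym {a} {b} (inj₁ s) = inj₁ (trans s (+-comm a b))
    split-sym (inj₂ (inj₁ s)) = inj₂ (inj₂ s)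
    split-sym (inj₂ (inj₂ s)) = inj₂ (inj₁ s)

    Tri : ℚ → ℚ → ℚ → Set
    Tri a b d = a ≤ d + b × b ≤ d + a × d ≤ a + b

    -- The case in which two conjugates of x − αy are equally small.
    case-equal : ∀ {ej eu ev m aj au av bj bu bv duj dvj} → ej ℤ.+ eu ℤ.+ ev ≡ + 0 → ¬ (ej ≡ + 0 × eu ≡ + 0) → m ℤ.≤ + 0 →
      Crude ej aj → Crude eu au → Crude ev av → Rough m bj → Rough m bu → Rough (ℤ.- (m ℤ.+ m)) bv →
      # 2 * duj ≤ bu + bj → # 2 * dvj ≤ bv + bj → Tri au aj duj → Tri av aj dvj → (eu ≡ ej → Same eu duj) → ⊥
    case-equal {ej} {eu} {ev} {m} {aj} {au} {av} {bj} {bu} {bv} {duj} {dvj} esum nz m≤0 cj cu cv rj ru rv guj gvj (tu₁ , tu₂ , _) (tv₁ , _ , _) same =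
      case-equal-final {x} {pL ev} {pL (ℤ.- (m ℤ.+ m))} {pL m} {pL ej} {av} {aj} {bv} {bj} {dvj} (proj₁ cv) tv₁ gvj (proj₂ rv) (proj₂ rj) (proj₂ cj) (pL-mono -2m≤ev) (pL-<x m<ev) (pL-mono ej≤m) x-small (pL-pos ev)
      where
      duj≤ : # 100 * duj ≤ # 102 * pL m
      duj≤ = duj≤-arith {duj} {bu} {bj} {pL m} guj (proj₂ ru) (proj₂ rj)
      -- Since |y| ≥ 2, the difference of the two equally small conjugates of β gives |α_u - α_j| ≤
      -- 1.02 L^m. A larger exponent in α_u or α_j would therefore need cancellation, which `Same`
      -- limits.
      both : ej ℤ.≤ m × eu ℤ.≤ m
      both with ℤₚ.<-cmp eu ej
      ... | tri< eu<ej _ _ = le , ℤₚ.≤-trans (ℤₚ.<⇒≤ eu<ej) le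
        where
        le : ej ℤ.≤ m
        le = exponent≤ 2<L (case-equal-larger {x} {pL eu} {pL ej} {pL m} {aj} {au} {duj} (proj₁ cj) (proj₂ cu) (pL-<x eu<ej) duj≤ tu₂ x-small (<⇒≤ (pL-pos ej)))
      ... | tri> _ _ ej<eu = ℤₚ.≤-trans (ℤₚ.<⇒≤ ej<eu) le , le
        where
        le : eu ℤ.≤ m
        le = exponent≤ 2<L (case-equal-larger {x} {pL ej} {pL eu} {pL m} {au} {aj} {duj} (proj₁ cu) (proj₂ cj) (pL-<x ej<eu) duj≤ tu₁ x-small (<⇒≤ (pL-pos eu)))
      ... | tri≈ _ eq _ = subst (ℤ._≤ m) eq le , le
        where
        clash : ∀ {x p r d} → # 29 * (x * p) ≤ # 10 * d → # 100 * d ≤ # 102 * r → r ≤ x * p → 0ℚ < x → 0ℚ < p → ⊥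
        clash {x} {p} {r} {d} h1 h2 h3 x0 p0 = absurd (k0< 187 ⊠< (x0 ⊠< p0)) (k0 10 ⊠ dif h1 ⊞ dif h2 ⊞ k0 102 ⊠ dif h3) (clash-identity x p r d)
        le : eu ℤ.≤ m
        le = ℤₚ.≮⇒≥ λ m<eu → clash {x} {pL eu} {pL m} {duj} (Same.below (same eq)) duj≤ (pL-<x m<eu) x>0 (pL-pos eu)
      ej≤m = proj₁ both
      eu≤m = proj₂ both
      -- As the exponents sum to 0, α_v now has an L-exponent at least that of the large conjugate
      -- of β, although |y| ≥ 2 makes the difference at most about half as large.
      -2m≤ev : ℤ.- (m ℤ.+ m) ℤ.≤ ev
      -2m≤ev = Integers.by (Integers._⊞_ (Integers.dif ej≤m) (Integers.dif eu≤m)) (Integers.lc1 (+ 1) esum (-2m≤ev-identity ej eu ev m))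
      -- The borderline is m = 0, where equality would force all L-exponents of α to be 0.
      m<ev : m ℤ.< ev
      m<ev with m ℤ.≟ + 0
      ... | no m≢0 = ℤₚ.<-≤-trans (ℤₚ.<-≤-trans (ℤₚ.≤∧≢⇒< m≤0 m≢0) (Integers.by (Integers._⊞_ (Integers.dif m≤0) (Integers.dif m≤0)) (m<ev-identity m))) -2m≤ev
      ... | yes refl = ℤₚ.≤∧≢⇒< -2m≤ev λ e → nz (zero-of ej≤m eu≤m (trans (sym (ℤₚ.+-identityʳ _)) (trans (cong (λ r → ej ℤ.+ eu ℤ.+ r) e) esum)))
        where
        zero-of : ej ℤ.≤ + 0 → eu ℤ.≤ + 0 → ej ℤ.+ eu ≡ + 0 → ej ≡ + 0 × eu ≡ + 0
        zero-of h k e = ℤₚ.≤-antisym h (Integers.by (Integers.dif k) (Integers.lc1 (+ 1) e (zero-of-identity ej eu))) , ℤₚ.≤-antisym k (Integers.by (Integers.dif h) (Integers.lc1 (+ 1) e (zero-of-identity₂ ej eu)))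

    Window : ℤ → ℚ → Set
    Window e g = # 97 * pL e ≤ # 100 * g × # 100 * g ≤ # 103 * pL e

    window : ∀ {e e' b b' g} → e' ℤ.< e → Rough e b → Rough e' b' → Tri b b' g → Window e g
    window {e} {e'} {b} {b'} {g} h (r₁ , r₂) (_ , s₂) (t₁ , _ , t₃) =
      window-low {x} {pL e} {pL e'} {b} {b'} {g} r₁ s₂ (pL-<x h) t₁ x-small (<⇒≤ (pL-pos e)) , window-high {x} {pL e} {pL e'} {b} {b'} {g} r₂ s₂ (pL-<x h) t₃ x-small (<⇒≤ (pL-pos e))

    Ratio : ℤ → ℚ → Set
    Ratio r d = # 92 * pL r ≤ # 100 * d × # 100 * d ≤ # 109 * pL r

    -- Siegel's identity solved for `di`: the three other differences are powers of L within a few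
    -- per cent, so `di` must be one within 9 per cent.
    ratio : ∀ {Hi Hk M r di dk gi gk} → Hi ℤ.+ M ≡ r ℤ.+ Hk → Window Hi gi → Window Hk gk → Rough M dk → gi * dk ≡ gk * di → 0ℚ ≤ di → Ratio r di
    ratio {Hi} {Hk} {M} {r} {di} {dk} {gi} {gk} re (i₁ , i₂) (k₁ , k₂) (d₁ , d₂) cross di0 =
        cancel≤ (# 103) (k0< 102) ((cancel≤ qk (pL-pos Hk) (ratio-low {qi} {qk} {qM} {qr} {di} {dk} {gi} {gk} i₁ k₂ d₁ (≤-reflexive cross) (≤-reflexive (sym prod)) di0 dk0 (<⇒≤ (pL-pos Hi)) (<⇒≤ (pL-pos r ⊠< pL-pos Hk)))))
      , cancel≤ (# 97) (k0< 96) (cancel≤ qk (pL-pos Hk) (ratio-high {qi} {qk} {qM} {qr} {di} {dk} {gi} {gk} i₂ k₁ d₂ (≤-reflexive (sym cross)) (≤-reflexive prod) di0 dk0 (<⇒≤ (pL-pos Hi)) (<⇒≤ (pL-pos r ⊠< pL-pos Hk))))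
      where
      qi = pL Hi
      qk = pL Hk
      qM = pL M
      qr = pL r
      prod : qi * qM ≡ qr * qk
      prod = trans (sym (pw-+ L·Li Hi M)) (trans (cong pL re) (pw-+ L·Li r Hk))
      dk0 : 0ℚ ≤ dk
      dk0 = cancel≤ (# 100) (k0< 99) (≤-trans (by (k0 98 ⊠ <⇒≤ (pL-pos M)) (dk0-identity qM)) d₁)

    private
      far : ∀ {k m} → k ℕ.< m → ∀ {p q} → # m * p ≤ # k * q → q ≤ p → 0ℚ < q → ⊥
      far {k} {m} k<m {p} {q} h l q0 = <-irrefl refl (<-≤-trans (*-monoʳ-<-nonneg q0)
          (≤-trans (*-monoˡ-≤-nonNeg (# m) {{nonNegative (k0 m)}} l) h))
        where
        k<m' : # k < # m
        k<m' = <-≤-trans (subst (# k <_) (sym (trans (sym (ι-# _)) (trans (ν-+ 1 k) (cong₂ _+_ (ι-# 1) (ι-# k))))) (by< (k0< 0) (+-comm 1ℚ (# k)))) (#≤ k<m)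
        *-monoʳ-<-nonneg : 0ℚ < q → # k * q < # m * q
        *-monoʳ-<-nonneg h = by< (dif< k<m' ⊠< h) (*-monoʳ-<-nonneg-identity (# k) (# m) q)

    -- In terms of L^e such a difference is close to 2 or lies between 2.9/L and 1/50. Neither comes
    -- within 9 per cent of a power of L.
    same-not-ratio : ∀ {e r d} → Same e d → Ratio r d → ⊥
    same-not-ratio {e} {r} {d} S (r₁ , r₂) with Same.dichotomy S
    ... | inj₁ (s₁ , s₂) with ℤₚ.<-cmp e r
    ...   | tri< e<r _ _ = same-not-ratio-near {x} {pL e} {pL r} (≤-trans r₁ s₂) (pL-<x e<r) x-small (pL-pos r)
    ...   | tri≈ _ refl _ = far {109} {198} (ℕₚ.m≤m+n 110 88) {pL e} {pL e} (≤-trans s₁ r₂) ≤-refl (pL-pos e)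
    ...   | tri> _ _ r<e = far {109} {198} (ℕₚ.m≤m+n 110 88) {pL e} {pL r} (≤-trans s₁ r₂) (pL-mono (ℤₚ.<⇒≤ r<e)) (pL-pos r)
    same-not-ratio {e} {r} {d} S (r₁ , r₂) | inj₂ s with ℤₚ.<-cmp r e
    ...   | tri< r<e _ _ = same-not-ratio-near₂ {x} {pL r} {pL e} {d} (Same.below S) r₂ (pL-<x r<e) x>0 (pL-pos e)
    ...   | tri≈ _ refl _ = far {2} {92} (ℕₚ.m≤m+n 3 89) {pL e} {pL e} (≤-trans r₁ s) ≤-refl (pL-pos e)
    ...   | tri> _ _ e<r = far {2} {92} (ℕₚ.m≤m+n 3 89) {pL r} {pL e} (≤-trans r₁ s) (pL-mono (ℤₚ.<⇒≤ e<r)) (pL-pos e)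

    record Fine (H : ℤ) (b bh : ℚ) : Set where
      field
        below : (1ℚ - x * x) * bh ≤ b
        above : b ≤ (1ℚ + x * x) * bh

    -- An exponent gap of 3 makes the smaller conjugate of order x³ relative to the larger, so it
    -- disappears in the error x² of `Fine`.
    fine-part : ∀ {H H' b bh} → + 3 ℤ.+ H' ℤ.≤ H → # 99 * pL H ≤ # 100 * bh → # 100 * b ≤ # 102 * pL H' → b ≤ x * x * bh
    fine-part {H} {H'} {b} {bh} h h₁ h₂ = fine-part-arith {x} {pL H} {pL H'} {bh} {b} h₁ h₂ chain x-small x≥0 (cancel≤ (# 100) (k0< 99) (≤-trans (by (k0 99 ⊠ <⇒≤ (pL-pos H)) (fine-part-identity (pL H))) h₁))
      where
      stepℤ : ∀ a → a ℤ.< + 1 ℤ.+ a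
      stepℤ a = ℤₚ.suc[i]≤j⇒i<j ℤₚ.≤-refl
      mono-x : ∀ {p q} → p ≤ q → x * p ≤ x * q
      mono-x = *-monoˡ-≤-nonNeg x {{nonNegative x≥0}}
      chain : pL H' ≤ x * (x * (x * pL H))
      chain = ≤-trans (pL-<x (stepℤ H')) (mono-x (≤-trans (pL-<x (stepℤ (+ 1 ℤ.+ H'))) (mono-x (≤-trans (pL-<x (stepℤ (+ 1 ℤ.+ (+ 1 ℤ.+ H'))))
        (mono-x (pL-mono (subst (ℤ._≤ H) (chain-identity H') h)))))))

    fine-low : ∀ {bh bi bj g} → (1ℚ - x * x) * bh ≤ bi → bj ≤ x * x * bh → bi ≤ g + bj → (1ℚ - # 2 * (x * x)) * bh ≤ g
    fine-low {bh} {bi} {bj} {g} h1 h2 h3 = fine-low-arith {x} {bh} {bi} {bj} {g} h1 h2 h3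

    fine-high : ∀ {bh bi bj g} → bi ≤ (1ℚ + x * x) * bh → bj ≤ x * x * bh → g ≤ bi + bj → g ≤ (1ℚ + # 2 * (x * x)) * bh
    fine-high {bh} {bi} {bj} {g} h1 h2 h3 = fine-high-arith {x} {bh} {bi} {bj} {g} h1 h2 h3

    -- Each difference of α carries a relative error 11x/10 and each difference of β one of 2x², in
    -- total about 2.2x. A discrepancy of 3x in the main terms cannot be absorbed.
    μ-contradiction : ∀ {bhi bhk ahi ahk gi gk di dk} → (1ℚ - # 2 * (x * x)) * bhi ≤ gi → gk ≤ (1ℚ + # 2 * (x * x)) * bhk →
      (# 10 - # 11 * x) * ahk ≤ # 10 * dk → # 10 * di ≤ (# 10 + # 11 * x) * ahi → gi * dk ≡ gk * di →
      (1ℚ + # 3 * x) * (bhk * ahi) ≤ bhi * ahk → 0ℚ < bhi → 0ℚ < bhk → 0ℚ < ahi → 0ℚ < ahk → 0ℚ ≤ di → ⊥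
    μ-contradiction {bhi} {bhk} {ahi} {ahk} {gi} {gk} {di} {dk} h1 h2 h3 h4 cross gap bi0 bk0 ai0 ak0 di0 =
      arith {x} {bhk * ahi} {bhi * ahk} key gap x-small x>0 (bk0 ⊠< ai0)
      where
      lo hi : ℚ
      lo = # 10 - # 11 * x
      hi = # 10 + # 11 * x
      key : (1ℚ - # 2 * (x * x)) * (# 10 - # 11 * x) * (bhi * ahk) ≤ (1ℚ + # 2 * (x * x)) * (# 10 + # 11 * x) * (bhk * ahi)
      key = begin
        (1ℚ - # 2 * (x * x)) * lo * (bhi * ahk)       ≡⟨ key-identity (1ℚ - # 2 * (x * x)) lo bhi ahk ⟩
        ((1ℚ - # 2 * (x * x)) * bhi) * (lo * ahk)     ≤⟨ *-mono {(1ℚ - # 2 * (x * x)) * bhi} {lo * ahk} {gi} {# 10 * dk} (μ-contradiction-c₂ x≥0 x-small ⊠ <⇒≤ bi0)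
                                                            (≤-trans (μ-contradiction-c₁ x≥0 x-small ⊠ <⇒≤ ak0) h3) h1 h3 ⟩
        gi * (# 10 * dk)                              ≡⟨ key-identity₂ gi dk ⟩
        # 10 * (gi * dk)                              ≡⟨ cong (# 10 *_) cross ⟩
        # 10 * (gk * di)                              ≡⟨ key-identity₂ gk di ⟨
        gk * (# 10 * di)                              ≤⟨ *-monoʳ-≤-nonNeg (# 10 * di) {{nonNegative (k0 10 ⊠ di0)}} h2 ⟩
        ((1ℚ + # 2 * (x * x)) * bhk) * (# 10 * di)    ≤⟨ *-monoˡ-≤-nonNeg ((1ℚ + # 2 * (x * x)) * bhk) {{nonNegative ((k0 1 ⊞ k0 2 ⊠ x≥0 ⊠ x≥0) ⊠ <⇒≤ bk0)}} h4 ⟩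
        ((1ℚ + # 2 * (x * x)) * bhk) * (hi * ahi)     ≡⟨ key-identity (1ℚ + # 2 * (x * x)) hi bhk ahi ⟨
        (1ℚ + # 2 * (x * x)) * hi * (bhk * ahi) ∎
        where
        open ≤-Reasoning
      arith : ∀ {x P T} → (1ℚ - # 2 * (x * x)) * (# 10 - # 11 * x) * T ≤ (1ℚ + # 2 * (x * x)) * (# 10 + # 11 * x) * P → (1ℚ + # 3 * x) * P ≤ T →
        # 1000 * x ≤ 1ℚ → 0ℚ < x → 0ℚ < P → ⊥
      arith {x} {P} {T} h k xs x0 P0 = absurd (k0< 792693 ⊠< (x0 ⊠< P0))
        (k0 100000 ⊠ dif h ⊞ k0 100000 ⊠ ((μ-contradiction-c₂ x0' xs ⊠ μ-contradiction-c₁ x0' xs) ⊠ dif k) ⊞ (x0' ⊠ <⇒≤ P0) ⊠ (k0 6000 ⊠ x0' ⊠ dif xs ⊞ k0 7306 ⊠ dif xs) ⊞ k0 6600000 ⊠ (x0' ⊠ x0' ⊠ x0' ⊠ x0' ⊠ <⇒≤ P0))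
        (solve (x ∷ P ∷ T ∷ []) ℚring)
        where
        x0' = <⇒≤ x0

    -- a and b are the absolute values of the conjugates of α and of x − αy, with L-exponents e and H;
    -- d and g are those of their differences, and Y is |y|.
    record Triple (ej ei ek Hj Hi Hk : ℤ) (aj ai ak bj bi bk dij dkj dik gij gkj gik Y : ℚ) : Set where
      field
        esum : ej ℤ.+ ei ℤ.+ ek ≡ + 0
        hsum : Hj ℤ.+ Hi ℤ.+ Hk ≡ + 0
        nz : ¬ (ej ≡ + 0 × ei ≡ + 0)
        rej : ℤ.∣ ej ∣ ℕ.≤ W
        rei : ℤ.∣ ei ∣ ℕ.≤ W
        rek : ℤ.∣ ek ∣ ℕ.≤ W
        rHj : ℤ.∣ Hj ∣ ℕ.≤ W
        rHi : ℤ.∣ Hi ∣ ℕ.≤ W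
        rHk : ℤ.∣ Hk ∣ ℕ.≤ W
        aj≡ : aj ≡ sz ej (ℤ.- ek)
        ai≡ : ai ≡ sz ei (ℤ.- ej)
        ak≡ : ak ≡ sz ek (ℤ.- ei)
        fj : Fine Hj bj (sz Hj (ℤ.- Hk))
        fi : Fine Hi bi (sz Hi (ℤ.- Hj))
        fk : Fine Hk bk (sz Hk (ℤ.- Hi))
        tij : Tri ai aj dij
        tkj : Tri ak aj dkj
        tik : Tri ai ak dik
        sij : Split ai aj dij
        skj : Split ak aj dkj
        sik : Split ai ak dik
        dij0 : 0ℚ ≤ dij
        dkj0 : 0ℚ ≤ dkj
        dik0 : 0ℚ ≤ dik
        uij : Tri bi bj gij
        ukj : Tri bk bj gkj
        uik : Tri bi bk gik
        gij≡ : gij ≡ Y * dij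
        gkj≡ : gkj ≡ Y * dkj
        gik≡ : gik ≡ Y * dik
        Y≥2 : # 2 ≤ Y

    tri-sym : ∀ {a b d} → Tri a b d → Tri b a d
    tri-sym {a} {b} (p , q , r) = q , p , ≤-trans r (≤-reflexive (+-comm a b))

    -- Only cyclic relabelling preserves the pattern linking μ-exponents to L-exponents; it suffices
    -- to bring any chosen conjugate of β into position j.
    rotate : ∀ {ej ei ek Hj Hi Hk aj ai ak bj bi bk dij dkj dik gij gkj gik Y} →
      Triple ej ei ek Hj Hi Hk aj ai ak bj bi bk dij dkj dik gij gkj gik Y →
      Triple ei ek ej Hi Hk Hj ai ak aj bi bk bj dik dij dkj gik gij gkj Y
    rotate {ej} {ei} {ek} {Hj} {Hi} {Hk} {aj} {ai} {ak} {bj} {bi} {bk} {dij} {dkj} {dik} {gij} {gkj} {gik} T = record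
      { esum = trans (rotate-perm ei ek ej) esum ; hsum = trans (rotate-perm Hi Hk Hj) hsum
      ; nz = λ (i0 , k0) → nz (trans (zero-sum i0 k0) refl , i0)
      ; rej = rei ; rei = rek ; rek = rej ; rHj = rHi ; rHi = rHk ; rHk = rHj
      ; aj≡ = ai≡ ; ai≡ = ak≡ ; ak≡ = aj≡
      ; fj = fi ; fi = fk ; fk = fj
      ; tij = tri-sym {ai} {ak} {dik} tik ; tkj = tri-sym {ai} {aj} {dij} tij ; tik = tkj ; sij = split-sym {ai} {ak} {dik} sik ; skj = split-sym {ai} {aj} {dij} sij ; sik = skj
      ; dij0 = dik0 ; dkj0 = dij0 ; dik0 = dkj0
      ; uij = tri-sym {bi} {bk} {gik} uik ; ukj = tri-sym {bi} {bj} {gij} uij ; uik = ukj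
      ; gij≡ = gik≡ ; gkj≡ = gij≡ ; gik≡ = gkj≡ ; Y≥2 = Y≥2 }
      where
      open Triple T
      zero-sum : ei ≡ + 0 → ek ≡ + 0 → ej ≡ + 0
      zero-sum i0 k0 = trans (trans (zero-sum-identity ej) (cong₂ (λ r r' → ej ℤ.+ r ℤ.+ r') (sym i0) (sym k0))) esum

    -- The contradiction when position j holds a smallest conjugate of β.

    module Minimal {ej ei ek Hj Hi Hk aj ai ak bj bi bk dij dkj dik gij gkj gik Y}
                   (T : Triple ej ei ek Hj Hi Hk aj ai ak bj bi bk dij dkj dik gij gkj gik Y) where
      open Triple T

      ∣-∣ : ∀ {z} → ℤ.∣ z ∣ ℕ.≤ W → ℤ.∣ ℤ.- z ∣ ℕ.≤ W
      ∣-∣ {z} h = ℕₚ.≤-trans (ℕₚ.≤-reflexive (ℤₚ.∣-i∣≡∣i∣ z)) h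

      crude : ∀ {a e h} → ℤ.∣ h ∣ ℕ.≤ W → a ≡ sz e (ℤ.- h) → Crude e a
      crude {a} {e} {h} r refl = sz-crude e (ℤ.- h) (∣-∣ {h} r)
      cj : Crude ej aj
      cj = crude {aj} {ej} {ek} rek aj≡
      ci : Crude ei ai
      ci = crude {ai} {ei} {ej} rej ai≡
      ck : Crude ek ak
      ck = crude {ak} {ek} {ei} rei ak≡

      rough : ∀ {b H h} → ℤ.∣ h ∣ ℕ.≤ W → Fine H b (sz H (ℤ.- h)) → Rough H b
      rough {b} {H} {h} r F = low {x} {pL H} {sz H (ℤ.- h)} {b} (Fine.below F) (proj₁ c) x≥0 x-small (<⇒≤ (pL-pos H))
                            , high {x} {pL H} {sz H (ℤ.- h)} {b} (Fine.above F) (proj₂ c) x≥0 x-small (<⇒≤ (pL-pos H))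
        where
        c = sz-crude H (ℤ.- h) (∣-∣ {h} r)
        low : ∀ {x p bh b} → (1ℚ - x * x) * bh ≤ b → # 99 * p ≤ # 100 * bh → 0ℚ ≤ x → # 1000 * x ≤ 1ℚ → 0ℚ ≤ p → # 98 * p ≤ # 100 * b
        low {x} {p} {bh} {b} h1 h2 x0 xs p0 = cancel≤ (# 1000) (k0< 999) (by
          (k0 100000 ⊠ dif h1 ⊞ (dif (rough-tiny x0 xs) ⊞ k0 999) ⊠ dif h2 ⊞ k0 99 ⊠ (dif (rough-tiny x0 xs) ⊠ p0) ⊞ k0 901 ⊠ p0) (solve (x ∷ p ∷ bh ∷ b ∷ []) ℚring))
        high : ∀ {x p bh b} → b ≤ (1ℚ + x * x) * bh → # 100 * bh ≤ # 101 * p → 0ℚ ≤ x → # 1000 * x ≤ 1ℚ → 0ℚ ≤ p → # 100 * b ≤ # 102 * p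
        high {x} {p} {bh} {b} h1 h2 x0 xs p0 = cancel≤ (# 1000) (k0< 999) (by
          (k0 100000 ⊠ dif h1 ⊞ (k0 1000 ⊞ k0 1000 ⊠ x0 ⊠ x0) ⊠ dif h2 ⊞ k0 101 ⊠ (dif (rough-tiny x0 xs) ⊠ p0) ⊞ k0 899 ⊠ p0) (solve (x ∷ p ∷ bh ∷ b ∷ []) ℚring))
      rj : Rough Hj bj
      rj = rough {bj} {Hj} {Hk} rHk fj
      ri : Rough Hi bi
      ri = rough {bi} {Hi} {Hj} rHj fi
      rk : Rough Hk bk
      rk = rough {bk} {Hk} {Hi} rHi fk

      double : ∀ {d g b b'} → 0ℚ ≤ d → g ≡ Y * d → Tri b b' g → # 2 * d ≤ b + b'
      double {d} d0 refl (_ , _ , h) = ≤-trans (*-monoʳ-≤-nonNeg d {{nonNegative d0}} Y≥2) h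

      -- If two L-exponents equal e, the third is -2e. By the cyclic pattern the two μ-exponents are
      -- -e and 2e in some order, at distance 3|e| ≥ 3.
      same-pair : ∀ {e h h' a a' d} → ℤ.∣ h ∣ ℕ.≤ W → ℤ.∣ h' ∣ ℕ.≤ W → a ≡ sz e (ℤ.- h) → a' ≡ sz e (ℤ.- h') → 0ℚ ≤ d → Split a a' d →
        e ≢ + 0 → (h ≡ e × h' ≡ ℤ.- (e ℤ.+ e)) ⊎ (h' ≡ e × h ≡ ℤ.- (e ℤ.+ e)) → Same e d
      same-pair {e} {h} {h'} {a} {a'} {d} r r' p q d0 s e≢0 cases with ℤₚ.<-cmp e (+ 0) | cases
      ... | tri≈ _ e0 _ | _ = ⊥-elim (e≢0 e0)
      ... | tri< e<0 _ _ | inj₁ (refl , refl) = same-ordered {e} {ℤ.- h} {ℤ.- h'} {a} {a'} {d} (∣-∣ {h} r) (∣-∣ {h'} r') (neg3 e<0) p q d0 s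
        where
        neg3 : e ℤ.< + 0 → + 3 ℤ.+ ℤ.- (ℤ.- (e ℤ.+ e)) ℤ.≤ ℤ.- e
        neg3 h = Integers.by (Integers._⊠_ (Integers.k0 3) (Integers.dif (ℤₚ.i<j⇒suc[i]≤j h))) (neg3-identity e)
      ... | tri> _ _ 0<e | inj₁ (refl , refl) = same-ordered {e} {ℤ.- h'} {ℤ.- h} {a'} {a} {d} (∣-∣ {h'} r') (∣-∣ {h} r) (pos3 0<e) q p d0 (split-sym {a} {a'} {d} s)
        where
        pos3 : + 0 ℤ.< e → + 3 ℤ.+ ℤ.- e ℤ.≤ ℤ.- (ℤ.- (e ℤ.+ e))
        pos3 h = Integers.by (Integers._⊠_ (Integers.k0 3) (Integers.dif (ℤₚ.i<j⇒suc[i]≤j h))) (pos3-identity e)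
      ... | tri< e<0 _ _ | inj₂ (refl , refl) = same-ordered {e} {ℤ.- h'} {ℤ.- h} {a'} {a} {d} (∣-∣ {h'} r') (∣-∣ {h} r) (neg3 e<0) q p d0 (split-sym {a} {a'} {d} s)
        where
        neg3 : e ℤ.< + 0 → + 3 ℤ.+ ℤ.- (ℤ.- (e ℤ.+ e)) ℤ.≤ ℤ.- e
        neg3 h = Integers.by (Integers._⊠_ (Integers.k0 3) (Integers.dif (ℤₚ.i<j⇒suc[i]≤j h))) (neg3-identity e)
      ... | tri> _ _ 0<e | inj₂ (refl , refl) = same-ordered {e} {ℤ.- h} {ℤ.- h'} {a} {a'} {d} (∣-∣ {h} r) (∣-∣ {h'} r') (pos3 0<e) p q d0 s
        where
        pos3 : + 0 ℤ.< e → + 3 ℤ.+ ℤ.- e ℤ.≤ ℤ.- (ℤ.- (e ℤ.+ e))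
        pos3 h = Integers.by (Integers._⊠_ (Integers.k0 3) (Integers.dif (ℤₚ.i<j⇒suc[i]≤j h))) (pos3-identity e)

      same-ij : ei ≡ ej → Same ei dij
      same-ij eq = same-pair {ei} {ej} {ek} rej rek ai≡ (trans aj≡ (cong (λ r → sz r (ℤ.- ek)) (sym eq))) dij0 sij
        (λ e0 → nz (trans (sym eq) e0 , e0)) (inj₁ (sym eq , Integers.lc2 (+ 1) (+ 1) esum eq (same-ij-identity ej ei ek)))

      same-kj : ek ≡ ej → Same ek dkj
      same-kj eq = same-pair {ek} {ei} {ek} rei rek ak≡ (trans aj≡ (cong (λ r → sz r (ℤ.- ek)) (sym eq))) dkj0 skj
        (λ e0 → nz (trans (sym eq) e0 , zero-i e0)) (inj₂ (refl , Integers.lc2 (+ 1) (+ 1) esum eq (same-kj-identity ej ei ek)))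
        where
        zero-i : ek ≡ + 0 → ei ≡ + 0
        zero-i e0 = Integers.lc2 (+ 1) (+ 1) esum eq (trans (same-kj-identity ej ei ek) (cong (λ r → ℤ.- (r ℤ.+ r) ℤ.+ + 1 ℤ.* (ej ℤ.+ ei ℤ.+ ek ℤ.- + 0) ℤ.+ + 1 ℤ.* (ek ℤ.- ej)) e0))

      cross : gij * dkj ≡ gkj * dij
      cross = trans (cong (_* dkj) gij≡) (trans (cross-identity Y dij dkj) (cong (_* dij) (sym gkj≡)))

      -- Here āi and āk are the dominating terms of the two differences of α. Comparing powers of L
      -- in Siegel's identity yields Hi - mi = Hk - mk = r, and what is left to contradict is a
      -- comparison of μ-exponents, whose gap is supplied by the last hypothesis.
      finish : ∀ {mi hi mk hk āi āk} → Hj ℤ.< Hi → Hj ℤ.< Hk → āi ≡ sz mi hi → āk ≡ sz mk hk → Crude mi āi → Crude mk āk →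
        Dominated mi āi dij → Dominated mk āk dkj → ej ℤ.≤ mi → ei ℤ.≤ mi → ej ℤ.≤ mk → ek ℤ.≤ mk →
        (∀ r → Hi ≡ r ℤ.+ mi → Hk ≡ r ℤ.+ mk → + 1 ℤ.≤ r → + 3 ℤ.+ (ℤ.- Hi ℤ.+ hi) ℤ.≤ ℤ.- Hj ℤ.+ hk) → ⊥
      finish {mi} {hi} {mk} {hk} {āi} {āk} j<i j<k āi≡ āk≡ cmi cmk Di Dk ej≤mi ei≤mi ej≤mk ek≤mk V =
        μ-contradiction {bhi} {bhk} {āi} {āk} {gij} {gkj} {dij} {dkj}
          (fine-low {bhi} {bi} {bj} {gij} (Fine.below fi) (fine-part {Hi} {Hj} {bj} {bhi} 3+Hj≤Hi (proj₁ (sz-crude Hi (ℤ.- Hj) (∣-∣ {Hj} rHj))) (proj₂ rj)) (proj₁ uij))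
          (fine-high {bhk} {bk} {bj} {gkj} (Fine.above fk) (fine-part {Hk} {Hj} {bj} {bhk} 3+Hj≤Hk (proj₁ (sz-crude Hk (ℤ.- Hi) (∣-∣ {Hi} rHi))) (proj₂ rj)) (proj₂ (proj₂ ukj)))
          (Dominated.below Dk) (Dominated.above Di) cross gap
          (sz-pos Hi (ℤ.- Hj)) (sz-pos Hk (ℤ.- Hi)) (subst (0ℚ <_) (sym āi≡) (sz-pos mi hi)) (subst (0ℚ <_) (sym āk≡) (sz-pos mk hk)) dij0
        where
        bhi bhk : ℚ
        bhi = sz Hi (ℤ.- Hj)
        bhk = sz Hk (ℤ.- Hi)
        r r' : ℤ
        r' = Hi ℤ.+ mk ℤ.- Hk
        r = Hi ℤ.- mi
        roughi = dominated-rough {mi} {āi} {dij} cmi Di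
        roughk = dominated-rough {mk} {āk} {dkj} cmk Dk
        rat : Ratio r' dij
        rat = ratio {Hi} {Hk} {mk} {r'} {dij} {dkj} {gij} {gkj} (rat-identity Hi mk Hk) (window {Hi} {Hj} {bi} {bj} {gij} j<i ri rj uij) (window {Hk} {Hj} {bk} {bj} {gkj} j<k rk rj ukj) roughk cross dij0
        mi≡r' : mi ≡ r'
        mi≡r' = ℤₚ.≤-antisym (exponent≤ 2<L (finish-up {pL mi} {pL r'} {dij} (proj₁ roughi) (proj₂ rat) (<⇒≤ (pL-pos r'))))
                             (exponent≤ 2<L (finish-down {pL mi} {pL r'} {dij} (proj₁ rat) (proj₂ roughi) (<⇒≤ (pL-pos mi))))
        Hi≡ : Hi ≡ r ℤ.+ mi
        Hi≡ = Hi≡-identity Hi mi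
        Hk≡ : Hk ≡ r ℤ.+ mk
        Hk≡ = Integers.lc1 (+ 1) mi≡r' (Hk≡-identity Hi mi Hk mk)
        -- Here |y| ≥ 2 enters: the difference of β is at least twice that of α, and 2 exceeds the
        -- combined tolerances, 196 against 103.
        mi<Hi : mi ℤ.< Hi
        mi<Hi = ℤₚ.≰⇒> λ Hi≤mi → far {103} {196} (ℕₚ.m≤m+n 104 92) {pL mi} {pL Hi}
          (mi<Hi-arith {pL mi} {dij} {gij} {pL Hi} (proj₁ roughi) (≤-trans (*-monoʳ-≤-nonNeg dij {{nonNegative dij0}} Y≥2) (≤-reflexive (sym gij≡)))
            (proj₂ (window {Hi} {Hj} {bi} {bj} {gij} j<i ri rj uij))) (pL-mono Hi≤mi) (pL-pos Hi)
        1≤r : + 1 ℤ.≤ r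
        1≤r = Integers.by (Integers.dif (ℤₚ.i<j⇒suc[i]≤j mi<Hi)) (1≤r-identity mi Hi)
        -- Hi - Hj = 3r + 2mi + mk, and 2mi + mk ≥ ej + ei + ek = 0.
        drop : ∀ {Hj Hi Hk r mi mk ej ei ek : ℤ} → Hj ℤ.+ Hi ℤ.+ Hk ≡ + 0 → Hi ≡ r ℤ.+ mi → Hk ≡ r ℤ.+ mk → ej ℤ.+ ei ℤ.+ ek ≡ + 0 → + 1 ℤ.≤ r → ej ℤ.≤ mi → ei ℤ.≤ mi → ek ℤ.≤ mk →
          + 3 ℤ.+ Hj ℤ.≤ Hi
        drop {Hj} {.(r ℤ.+ mi)} {.(r ℤ.+ mk)} {r} {mi} {mk} {ej} {ei} {ek} hs refl refl es h1 h2 h3 h4 =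
          Integers.by (Integers._⊞_ (Integers._⊠_ (Integers.k0 3) (Integers.dif h1)) (Integers._⊞_ (Integers.dif h2) (Integers._⊞_ (Integers.dif h3) (Integers.dif h4))))
            (Integers.lc2 (ℤ.- + 1) (+ 1) hs es (drop-identity Hj r mi mk ej ei ek))
        3+Hj≤Hi : + 3 ℤ.+ Hj ℤ.≤ Hi
        3+Hj≤Hi = drop {Hj} {Hi} {Hk} {r} {mi} {mk} {ej} {ei} {ek} hsum Hi≡ Hk≡ esum 1≤r ej≤mi ei≤mi ek≤mk
        3+Hj≤Hk : + 3 ℤ.+ Hj ℤ.≤ Hk
        3+Hj≤Hk = drop {Hj} {Hk} {Hi} {r} {mk} {mi} {ej} {ek} {ei} (trans (finish-swap Hj Hk Hi) hsum) Hk≡ Hi≡ (trans (finish-swap ej ek ei) esum) 1≤r ej≤mk ek≤mk ei≤mi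
        gap : (1ℚ + # 3 * x) * (bhk * āi) ≤ bhi * āk
        gap = subst₂ (λ u v → (1ℚ + # 3 * x) * u ≤ v)
          (trans (cong (λ g → sz g (ℤ.- Hi ℤ.+ hi)) exps) (trans (sym (sz-* Hk (ℤ.- Hi) mi hi)) (cong (bhk *_) (sym āi≡))))
          (trans (sym (sz-* Hi (ℤ.- Hj) mk hk)) (cong (bhi *_) (sym āk≡)))
          (sz-gap {Hi ℤ.+ mk} {ℤ.- Hj ℤ.+ hk} {ℤ.- Hi ℤ.+ hi} (V r Hi≡ Hk≡ 1≤r))
          where
          exps : Hi ℤ.+ mk ≡ Hk ℤ.+ mi
          exps = Integers.lc1 (ℤ.- + 1) mi≡r' (exps-identity Hi mi Hk mk)

      bigger-i : ej ℤ.< ei → Dominated ei ai dij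
      bigger-i h = dominated {ei} {ej} {ai} {aj} {dij} h ci cj (proj₁ tij) (proj₂ (proj₂ tij))
      smaller-i : ei ℤ.< ej → Dominated ej aj dij
      smaller-i h = dominated {ej} {ei} {aj} {ai} {dij} h cj ci (proj₁ (proj₂ tij)) (≤-trans (proj₂ (proj₂ tij)) (≤-reflexive (+-comm ai aj)))
      bigger-k : ej ℤ.< ek → Dominated ek ak dkj
      bigger-k h = dominated {ek} {ej} {ak} {aj} {dkj} h ck cj (proj₁ tkj) (proj₂ (proj₂ tkj))
      smaller-k : ek ℤ.< ej → Dominated ej aj dkj
      smaller-k h = dominated {ej} {ek} {aj} {ak} {dkj} h cj ck (proj₁ (proj₂ tkj)) (≤-trans (proj₂ (proj₂ tkj)) (≤-reflexive (+-comm ak aj)))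

      -- Eliminating Hj, Hi and Hk shows that the μ-exponents differ by 3r + u. It is the cyclic
      -- pattern that makes u nonnegative in each configuration of `strict`.
      V-bound : ∀ {Hj Hi Hk r mi mk hi hk u v : ℤ} → Hj ℤ.+ Hi ℤ.+ Hk ≡ + 0 → Hi ≡ r ℤ.+ mi → Hk ≡ r ℤ.+ mk → + 1 ℤ.≤ r →
        + 0 ℤ.≤ u → mi ℤ.+ mi ℤ.+ mk ℤ.- hi ℤ.+ hk ≡ u → + 3 ℤ.+ (ℤ.- Hi ℤ.+ hi) ℤ.≤ ℤ.- Hj ℤ.+ hk
      V-bound {Hj} {.(r ℤ.+ mi)} {.(r ℤ.+ mk)} {r} {mi} {mk} {hi} {hk} {u} hs refl refl h1 u0 eq =
        Integers.by (Integers._⊞_ (Integers._⊠_ (Integers.k0 3) (Integers.dif h1)) u0) (Integers.lc2 (ℤ.- + 1) (+ 1) hs eq (V-bound-identity Hj r mi mk hi hk u))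

      comparison-k : ek ≢ ej → ∃[ M ] Rough M dkj
      comparison-k ne with ℤₚ.<-cmp ek ej
      ... | tri< h _ _ = ej , dominated-rough {ej} {aj} {dkj} cj (smaller-k h)
      ... | tri≈ _ e _ = contradiction e ne
      ... | tri> _ _ h = ek , dominated-rough {ek} {ak} {dkj} ck (bigger-k h)
      comparison-i : ei ≢ ej → ∃[ M ] Rough M dij
      comparison-i ne with ℤₚ.<-cmp ei ej
      ... | tri< h _ _ = ej , dominated-rough {ej} {aj} {dij} cj (smaller-i h)
      ... | tri≈ _ e _ = contradiction e ne
      ... | tri> _ _ h = ei , dominated-rough {ei} {ai} {dij} ci (bigger-i h)

      not-both : ei ≡ ej → ek ≡ ej → ⊥
      not-both p q = nz (ej0 , trans p ej0)
        where
        ej0 : ej ≡ + 0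
        ej0 = ℤₚ.*-cancelˡ-≡ (+ 3) ej (+ 0) (Integers.lc2 (+ 1) (ℤ.- + 1) esum p (Integers.lc1 (ℤ.- + 1) q (not-both-identity ej ei ek)))

      -- If ei or ek equals ej, the corresponding difference cannot fit Siegel's identity by
      -- `same-not-ratio`, the other one being dominated. Otherwise both differences are dominated,
      -- and the order of the exponents leaves four configurations.
      strict : Hj ℤ.< Hi → Hj ℤ.< Hk → ⊥
      strict j<i j<k with ℤₚ.<-cmp ei ej | ℤₚ.<-cmp ek ej
      ... | tri≈ _ i≡j _ | _ =
        let M , R = comparison-k (not-both i≡j)
        in same-not-ratio {ei} {Hi ℤ.+ M ℤ.- Hk} {dij} (same-ij i≡j) (ratio {Hi} {Hk} {M} {Hi ℤ.+ M ℤ.- Hk} {dij} {dkj} {gij} {gkj} (rat-identity Hi M Hk)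
          (window {Hi} {Hj} {bi} {bj} {gij} j<i ri rj uij) (window {Hk} {Hj} {bk} {bj} {gkj} j<k rk rj ukj) R cross dij0)
      ... | tri< _ i≢j _ | tri≈ _ k≡j _ =
        let M , R = comparison-i i≢j
        in same-not-ratio {ek} {Hk ℤ.+ M ℤ.- Hi} {dkj} (same-kj k≡j) (ratio {Hk} {Hi} {M} {Hk ℤ.+ M ℤ.- Hi} {dkj} {dij} {gkj} {gij} (rat-identity Hk M Hi)
          (window {Hk} {Hj} {bk} {bj} {gkj} j<k rk rj ukj) (window {Hi} {Hj} {bi} {bj} {gij} j<i ri rj uij) R (sym cross) dkj0)
      ... | tri> _ i≢j _ | tri≈ _ k≡j _ =
        let M , R = comparison-i i≢j
        in same-not-ratio {ek} {Hk ℤ.+ M ℤ.- Hi} {dkj} (same-kj k≡j) (ratio {Hk} {Hi} {M} {Hk ℤ.+ M ℤ.- Hi} {dkj} {dij} {gkj} {gij} (rat-identity Hk M Hi)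
          (window {Hk} {Hj} {bk} {bj} {gkj} j<k rk rj ukj) (window {Hi} {Hj} {bi} {bj} {gij} j<i ri rj uij) R (sym cross) dkj0)
      ... | tri< i<j _ _ | tri< k<j _ _ = finish {ej} {ℤ.- ek} {ej} {ℤ.- ek} {aj} {aj} j<i j<k aj≡ aj≡ cj cj (smaller-i i<j) (smaller-k k<j)
        ℤₚ.≤-refl (ℤₚ.<⇒≤ i<j) ℤₚ.≤-refl (ℤₚ.<⇒≤ k<j)
        (λ r p q h → V-bound {Hj} {Hi} {Hk} {r} {ej} {ej} {ℤ.- ek} {ℤ.- ek} {ej ℤ.- ei ℤ.+ (ej ℤ.- ek)} {+ 0} hsum p q h
          (Integers._⊞_ (Integers.dif (ℤₚ.<⇒≤ i<j)) (Integers.dif (ℤₚ.<⇒≤ k<j))) (Integers.lc1 (+ 1) esum (strict-identity ej ei ek)))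
      ... | tri> _ _ j<i' | tri> _ _ j<k' = finish {ei} {ℤ.- ej} {ek} {ℤ.- ei} {ai} {ak} j<i j<k ai≡ ak≡ ci ck (bigger-i j<i') (bigger-k j<k')
        (ℤₚ.<⇒≤ j<i') ℤₚ.≤-refl (ℤₚ.<⇒≤ j<k') ℤₚ.≤-refl
        (λ r p q h → V-bound {Hj} {Hi} {Hk} {r} {ei} {ek} {ℤ.- ej} {ℤ.- ei} {+ 0} {+ 0} hsum p q h ℤₚ.≤-refl (Integers.lc1 (+ 1) esum (strict-identity₂ ej ei ek)))
      ... | tri< i<j _ _ | tri> _ _ j<k' = finish {ej} {ℤ.- ek} {ek} {ℤ.- ei} {aj} {ak} j<i j<k aj≡ ak≡ cj ck (smaller-i i<j) (bigger-k j<k')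
        ℤₚ.≤-refl (ℤₚ.<⇒≤ i<j) (ℤₚ.<⇒≤ j<k') ℤₚ.≤-refl
        (λ r p q h → V-bound {Hj} {Hi} {Hk} {r} {ej} {ek} {ℤ.- ek} {ℤ.- ei} {ej ℤ.- ei ℤ.+ (ek ℤ.- ej ℤ.+ (ej ℤ.- ei))} {+ 0} hsum p q h
          (Integers._⊞_ (Integers.dif (ℤₚ.<⇒≤ i<j)) (Integers._⊞_ (Integers.dif (ℤₚ.<⇒≤ j<k')) (Integers.dif (ℤₚ.<⇒≤ i<j)))) (Integers.lc1 (+ 1) esum (strict-identity₃ ej ei ek)))
      ... | tri> _ _ j<i' | tri< k<j _ _ = finish {ei} {ℤ.- ej} {ej} {ℤ.- ek} {ai} {aj} j<i j<k ai≡ aj≡ ci cj (bigger-i j<i') (smaller-k k<j)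
        (ℤₚ.<⇒≤ j<i') ℤₚ.≤-refl ℤₚ.≤-refl (ℤₚ.<⇒≤ k<j)
        (λ r p q h → V-bound {Hj} {Hi} {Hk} {r} {ei} {ej} {ℤ.- ej} {ℤ.- ek} {ej ℤ.- ek ℤ.+ (ei ℤ.- ej ℤ.+ (ej ℤ.- ek))} {+ 0} hsum p q h
          (Integers._⊞_ (Integers.dif (ℤₚ.<⇒≤ k<j)) (Integers._⊞_ (Integers.dif (ℤₚ.<⇒≤ j<i')) (Integers.dif (ℤₚ.<⇒≤ k<j)))) (Integers.lc1 (+ 1) esum (strict-identity₄ ej ei ek)))

      Hj≤0 : Hj ℤ.≤ Hi → Hj ℤ.≤ Hk → Hj ℤ.≤ + 0
      Hj≤0 h k = ℤₚ.*-cancelˡ-≤-pos Hj (+ 0) (+ 3) (Integers.by (Integers._⊞_ (Integers.dif h) (Integers.dif k)) (Integers.lc1 (ℤ.- + 1) hsum (Hj≤0-identity Hj Hi Hk)))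

      impossible : Hj ℤ.≤ Hi → Hj ℤ.≤ Hk → ⊥
      impossible h k with Hj ℤ.≟ Hi | Hj ℤ.≟ Hk
      ... | no p | no q = strict (ℤₚ.≤∧≢⇒< h p) (ℤₚ.≤∧≢⇒< k q)
      ... | yes p | _ = case-equal {ej} {ei} {ek} {Hj} {aj} {ai} {ak} {bj} {bi} {bk} {dij} {dkj} esum nz (Hj≤0 h k) cj ci ck rj
          (subst (λ r → Rough r bi) (sym p) ri) (subst (λ r → Rough r bk) Hk≡ rk) (double {dij} {gij} {bi} {bj} dij0 gij≡ uij) (double {dkj} {gkj} {bk} {bj} dkj0 gkj≡ ukj) tij tkj same-ij
        where
        Hk≡ : Hk ≡ ℤ.- (Hj ℤ.+ Hj)
        Hk≡ = Integers.lc2 (+ 1) (+ 1) hsum p (impossible-identity Hj Hi Hk)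
      ... | no _ | yes p = case-equal {ej} {ek} {ei} {Hj} {aj} {ak} {ai} {bj} {bk} {bi} {dkj} {dij} (trans (finish-swap ej ek ei) esum) nz' (Hj≤0 h k) cj ck ci rj
          (subst (λ r → Rough r bk) (sym p) rk) (subst (λ r → Rough r bi) Hi≡ ri) (double {dkj} {gkj} {bk} {bj} dkj0 gkj≡ ukj) (double {dij} {gij} {bi} {bj} dij0 gij≡ uij) tkj tij same-kj
        where
        Hi≡ : Hi ≡ ℤ.- (Hj ℤ.+ Hj)
        Hi≡ = Integers.lc2 (+ 1) (+ 1) hsum p (impossible-identity₂ Hj Hi Hk)
        nz' : ¬ (ej ≡ + 0 × ek ≡ + 0)
        nz' (j0 , k0) = nz (j0 , Integers.lc1 (+ 1) esum (trans (nz'-identity ei) (cong₂ (λ r r' → + 0 ℤ.+ + 1 ℤ.* (r ℤ.+ ei ℤ.+ r' ℤ.- + 0)) (sym j0) (sym k0))))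

    no-triple : ∀ {ej ei ek Hj Hi Hk aj ai ak bj bi bk dij dkj dik gij gkj gik Y} →
      Triple ej ei ek Hj Hi Hk aj ai ak bj bi bk dij dkj dik gij gkj gik Y → ⊥
    no-triple {Hj = Hj} {Hi} {Hk} T with ℤₚ.≤-total Hj Hi | ℤₚ.≤-total Hj Hk | ℤₚ.≤-total Hi Hk
    ... | inj₁ p | inj₁ q | _ = Minimal.impossible T p q
    ... | inj₁ p | inj₂ q | _ = Minimal.impossible (rotate (rotate T)) q (ℤₚ.≤-trans q p)
    ... | inj₂ p | _ | inj₁ q = Minimal.impossible (rotate T) q p
    ... | inj₂ p | _ | inj₂ q = Minimal.impossible (rotate (rotate T)) (ℤₚ.≤-trans q p) q

-- Multiplying β by a unit to reach a rational integer.

module UnitStep where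
  open import Data.Empty using (⊥; ⊥-elim)
  open import Data.Nat as ℕ using (ℕ; zero; suc; z≤n; s≤s)
  import Data.Nat.Properties as ℕₚ
  open import Data.Integer as ℤ using (ℤ; +_)
  import Data.Integer.Properties as ℤₚ
  open import Data.List using ([]; _∷_)
  open import Data.Product using (∃-syntax; _×_; _,_; proj₁; proj₂)
  open import Data.Sum using (_⊎_; inj₁; inj₂)
  open import Data.Rational hiding (ceiling)
  open import Data.Rational.Properties
  open import Relation.Nullary using (¬_; Dec; yes; no)
  open import Relation.Binary.PropositionalEquality
  open import Tactic.RingSolver using (solve)
  open import Data.Integer.Tactic.RingSolver using () renaming (solve to solveℤ)
  open Rationals
  open Root using (Base)
  open Powers
  open FormBound using (crossing)
  open BetaBound using (abs≥1)
  open Siegel using (absurd)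

  private
    zero₂-identity : ∀ y m → 0ℚ * y - m * 0ℚ ≡ 0ℚ
    zero₂-identity y m = solve (y ∷ m ∷ []) ℚring

    P≡-identity : ∀ a b → a + 0ℚ * b ≡ a
    P≡-identity a b = solve (a ∷ b ∷ []) ℚring

    top-arith : ∀ {b p l} → # 20 ≤ l → 0ℚ ≤ b → b ≤ p → 0ℚ ≤ l → # 20 * b ≤ l * p
    top-arith {b} {p} {l} h1 h2 h3 h4 = by ((dif h1 ⊠ h2) ⊞ (h4 ⊠ dif h3)) (solve (b ∷ p ∷ l ∷ []) ℚring)

    bottom-identity : ∀ k → ℤ.- (+ 1 ℤ.+ (k ℤ.+ k)) ℤ.+ + 1 ℤ.+ k ℤ.+ k ≡ + 0
    bottom-identity k = solveℤ (k ∷ [])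

    bottom-arith : ∀ {b b' b'' p r} → r * p * p ≡ 1ℚ → 0ℚ ≤ b → 0ℚ ≤ b' → 0ℚ ≤ b'' → b' ≤ p → b'' ≤ p → 1ℚ ≤ # 2 * (b * b' * b'') → 0ℚ < r → 0ℚ ≤ p → r < # 20 * b
    bottom-arith {b} {b'} {b''} {p} {r} e h h' h'' k' k'' lo r0 p0 = by< ((k0< 8 ⊠< r0) ⊞< ((k0 10 ⊠ (<⇒≤ r0 ⊠ dif lo)) ⊞ (k0 20 ⊠ (<⇒≤ r0 ⊠ (h ⊠ ((dif k' ⊠ h'') ⊞ (p0 ⊠ dif k''))))))) (lc1 (# 20 * - b) e (solve (b ∷ b' ∷ b'' ∷ p ∷ r ∷ []) ℚring))

    rot₁-identity : ∀ a b c → # 2 * (a * b * c) ≡ # 2 * (b * a * c)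
    rot₁-identity a b c = solve (a ∷ b ∷ c ∷ []) ℚring

    rot₂-identity : ∀ a b c → # 2 * (a * b * c) ≡ # 2 * (c * a * b)
    rot₂-identity a b c = solve (a ∷ b ∷ c ∷ []) ℚring

    zeroth-arith : ∀ {b₀ b₁ b₂ p₁ p₂ q l r} → p₁ * p₂ * q ≡ 1ℚ → p₁ ≤ # 20 * b₁ → p₂ ≤ # 20 * b₂ → b₀ * b₁ * b₂ ≤ # 2 → # 16000 ≤ l →
            0ℚ ≤ b₀ → 0ℚ ≤ b₁ → 0ℚ ≤ b₂ → 0ℚ ≤ p₁ → 0ℚ ≤ p₂ → 0ℚ ≤ q → l * q ≡ r → # 20 * b₀ ≤ r
    zeroth-arith {b₀} {b₁} {b₂} {p₁} {p₂} {q} {l} e h₁ h₂ hi hl z₀ z₁ z₂ y₁ y₂ q0 refl =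
      by ((k0 20 ⊠ (q0 ⊠ (z₀ ⊠ ((dif h₁ ⊠ (k0 20 ⊠ z₂)) ⊞ (y₁ ⊠ dif h₂))))) ⊞ (k0 8000 ⊠ (q0 ⊠ dif hi)) ⊞ (dif hl ⊠ q0))
        (lc1 (# 20 * b₀) e (solve (b₀ ∷ b₁ ∷ b₂ ∷ p₁ ∷ p₂ ∷ q ∷ l ∷ []) ℚring))

    ¬T0-identity : ∀ F → + 0 ℤ.- F ℤ.+ + 1 ≡ ℤ.- F ℤ.+ + 1
    ¬T0-identity F = solveℤ (F ∷ [])

    Tend-identity : ∀ F → F ℤ.+ + 1 ≡ F ℤ.+ F ℤ.- F ℤ.+ + 1
    Tend-identity F = solveℤ (F ∷ [])

    bound-identity : ∀ j F → F ≡ j ℤ.- F ℤ.+ (F ℤ.+ F ℤ.- j)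
    bound-identity j F = solveℤ (j ∷ F ∷ [])

    bound-identity₂ : ∀ j F → F ≡ ℤ.- (j ℤ.- F) ℤ.+ j
    bound-identity₂ j F = solveℤ (j ∷ F ∷ [])

    close-arith : ∀ {u v l} → # 18 * u ≤ l → # 18 * v ≤ l → # 2 * (# 9 * (u + v)) ≤ # 2 * l
    close-arith {u} {v} {l} p q = by (dif p ⊞ dif q) (solve (u ∷ v ∷ l ∷ []) ℚring)

    P-bound-identity : ∀ a b c L y → a + b * L + c * (L * L) - (a + b * - y + c * (- y * - y)) ≡ (L + y) * (b + c * (L - y))
    P-bound-identity a b c L y = solve (a ∷ b ∷ c ∷ L ∷ y ∷ []) ℚring

    μ-y≥1-identity : ∀ u m y → u - y ≡ 1ℚ + (u - (1ℚ + m) + (m - y))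
    μ-y≥1-identity u m y = solve (u ∷ m ∷ y ∷ []) ℚring

    μ-y≥1-identity₂ : ∀ L m y → (L * m - 1ℚ) * y - m * (L * y - (1ℚ - y)) ≡ m - y - m * y
    μ-y≥1-identity₂ L m y = solve (L ∷ m ∷ y ∷ []) ℚring

    μ-y≥1-identity₃ : ∀ m y → m - y ≡ m * y + (m - y - m * y)
    μ-y≥1-identity₃ m y = solve (m ∷ y ∷ []) ℚring

    Q-bound-identity : ∀ a b c y u → a + b * - y + c * (- y * - y) - (a + b * - u + c * (- u * - u)) ≡ (u - y) * (b + c * (- y - u))
    Q-bound-identity a b c y u = solve (a ∷ b ∷ c ∷ y ∷ u ∷ []) ℚring

    P≤-identity : ∀ L p → L * (# 9 * p) ≡ # 9 * (L * p)
    P≤-identity L p = solve (L ∷ p ∷ []) ℚring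

    P-Q-identity : ∀ b c L y u → c * (L + u) ≡ (b + c * (L - y)) - (b + c * (- y - u))
    P-Q-identity b c L y u = solve (b ∷ c ∷ L ∷ y ∷ u ∷ []) ℚring

    g₂≡0-identity : ∀ L u m p q c → # 7 + (# 9 * (((c - 1ℚ) * (L + u)) + (p + q - c * (L + u))) + (1ℚ - # 9 * p) + (L - # 9 * (1ℚ * q)) + # 9 * (u - (1ℚ + m)) + # 9 * m + # 8 * (L - 1ℚ) + # 9) ≡ 0ℚ
    g₂≡0-identity L u m p q c = solve (L ∷ u ∷ m ∷ p ∷ q ∷ c ∷ []) ℚring

    g₁≡0-identity : ∀ p → # 8 + (# 9 * (p - 1ℚ) + (1ℚ - # 9 * p)) ≡ 0ℚ
    g₁≡0-identity p = solve (p ∷ []) ℚring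

    g≤-identity : ∀ g v → g ≡ v + (g - v)
    g≤-identity g v = solve (g ∷ v ∷ []) ℚring

    exponent-for-identity : ∀ j F → + 1 ℤ.+ j ℤ.- F ≡ j ℤ.- F ℤ.+ + 1
    exponent-for-identity j F = solveℤ (j ∷ F ∷ [])

    small-value-arith : ∀ {g b u p q l} → 0ℚ ≤ b → 0ℚ ≤ u → 0ℚ ≤ q → # 20 * b ≤ l * p → # 100 * u ≤ # 101 * q → p * q ≡ 1ℚ → g ≤ b * u + 1ℚ → # 16000 ≤ l → # 18 * g ≤ l
    small-value-arith {g} {b} {u} {p} {q} {l} b0 u0 q0 h₁ h₂ e h₃ h₄ = cancel≤ (# 2000) (k0< 1999)
      (by (((k0 18 ⊠ (dif h₂ ⊠ (k0 20 ⊠ b0))) ⊞ (k0 1818 ⊠ (q0 ⊠ dif h₁))) ⊞ (k0 36000 ⊠ dif h₃) ⊞ (k0 182 ⊠ dif h₄) ⊞ k0 2876000)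
        (lc1 (# 1818 * - l) e (solve (g ∷ b ∷ u ∷ p ∷ q ∷ l ∷ []) ℚring)))

  module _ (n : ℕ) (n≥1 : 1 ℕ.≤ n) (B : Base n) where
    open Sizes n n≥1 B

    -- The logarithm of 20b to base L is rounded to an integer. Using 20 rather than 18 leaves room
    -- for the one per cent lost in powers of μ and for an additive error 1.
    exponent-for : ∀ b F → # 20 * b ≤ pL (+ F ℤ.+ + 1) → pL (ℤ.- + F ℤ.+ + 1) < # 20 * b →
              ∃[ f ] (ℤ.∣ f ∣ ℕ.≤ F × # 20 * b ≤ pL (f ℤ.+ + 1) × pL f ≤ # 20 * b)
    exponent-for b F top bottom =
      let j , ¬Tj , Tj = crossing {T} T? ¬T0 (F ℕ.+ F) Tend in
      + suc j ℤ.- + F , bound j (j<2F j ¬Tj) , Tj , ≤-trans (≤-reflexive (cong pL (exponent-for-identity (+ j) (+ F)))) (<⇒≤ (≰⇒> ¬Tj))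
      where
      T : ℕ → Set
      T k = # 20 * b ≤ pL (+ k ℤ.- + F ℤ.+ + 1)
      T? : ∀ k → Dec (T k)
      T? k = (# 20 * b) ≤? pL (+ k ℤ.- + F ℤ.+ + 1)
      ¬T0 : ¬ T 0
      ¬T0 h = <-irrefl refl (<-≤-trans bottom (≤-trans h (≤-reflexive (cong pL (¬T0-identity (+ F))))))
      Tend : T (F ℕ.+ F)
      Tend = ≤-trans top (≤-reflexive (cong pL (Tend-identity (+ F))))
      j<2F : ∀ j → ¬ T j → j ℕ.< F ℕ.+ F
      j<2F j ¬Tj = ℕₚ.≰⇒> λ h → ¬Tj (≤-trans Tend (pL-mono (ℤₚ.+-monoˡ-≤ (+ 1) (ℤₚ.+-monoˡ-≤ (ℤ.- + F) (ℤ.+≤+ h)))))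
      bound : ∀ j → j ℕ.< F ℕ.+ F → ℤ.∣ + suc j ℤ.- + F ∣ ℕ.≤ F
      bound j h = Integers.≤⇒abs≤ {+ suc j ℤ.- + F} (Integers.by (Integers.dif (ℤ.+≤+ h)) (bound-identity (+ suc j) (+ F))) (Integers.by (Integers.k0 (suc j)) (bound-identity₂ (+ suc j) (+ F)))

    private
      1≤∣ι∣ : ∀ z → z ≢ + 0 → 1ℚ ≤ ∣ ι z ∣
      1≤∣ι∣ z h = subst₂ _≤_ (ι-# 1) (sym (ι-abs z)) (ν≤ (abs≥1 z h))

    val : ℤ → ℤ → ℤ → ℚ → ℚ
    val g₀ g₁ g₂ l = ι g₀ + ι g₁ * l + ι g₂ * (l * l)

    -- An element of ℤ[λ₀] all of whose conjugates are at most L/18 is an integer.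
    integral : ∀ g₀ g₁ g₂ → 1ℚ ≤ L → # 18 * ∣ val g₀ g₁ g₂ L ∣ ≤ L → # 18 * ∣ val g₀ g₁ g₂ (- y) ∣ ≤ L → # 18 * ∣ val g₀ g₁ g₂ (- μ) ∣ ≤ L →
               g₁ ≡ + 0 × g₂ ≡ + 0
    integral g₀ g₁ g₂ 1≤L h₀ h₁ h₂ = g₁≡0 , g₂≡0
      where
      v₀ = val g₀ g₁ g₂ L
      v₁ = val g₀ g₁ g₂ (- y)
      v₂ = val g₀ g₁ g₂ (- μ)
      -- Divided differences at the three conjugates. They satisfy |P| ≤ 1/9 and |Q| ≤ L/9, whereas
      -- P - Q = g₂(L + μ), so g₂ = 0; then P is g₁ and vanishes too.
      P Q : ℚ
      P = ι g₁ + ι g₂ * (L - y)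
      Q = ι g₁ + ι g₂ * (- y - μ)
      μ≥1 : 1ℚ + Li ≤ μ
      μ≥1 = ≤-reflexive (sym (q-eq n≥1))
      close : ∀ {a b} → # 18 * ∣ a ∣ ≤ L → # 18 * ∣ b ∣ ≤ L → # 9 * ∣ a - b ∣ ≤ L
      close {a} {b} p q = cancel≤ (# 2) (k0< 1) (≤-trans (*-monoˡ-≤-nonNeg (# 2) (*-monoˡ-≤-nonNeg (# 9) (∣p-q∣≤∣p∣+∣q∣ a b))) (close-arith {∣ a ∣} {∣ b ∣} p q))
      scaled : ∀ {k a b w} → 0ℚ ≤ k → k ≤ w → a ≡ w * b → # 9 * ∣ a ∣ ≤ L → # 9 * (k * ∣ b ∣) ≤ L
      scaled {k} {a} {b} {w} k0' k≤w eq h = ≤-trans (*-monoˡ-≤-nonNeg (# 9) (≤-trans (*-monoʳ-≤-nonNeg ∣ b ∣ {{∣-∣-nonNeg b}} k≤w)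
        (≤-reflexive (sym (trans (cong ∣_∣ eq) (trans (∣p*q∣≡∣p∣*∣q∣ w b) (cong (_* ∣ b ∣) (0≤p⇒∣p∣≡p (≤-trans k0' k≤w))))))))) h
      P-bound : # 9 * (L * ∣ P ∣) ≤ L
      P-bound = scaled {L} {v₀ - v₁} {P} {L + y} (<⇒≤ L>0) (by (<⇒≤ y>0) refl) (P-bound-identity (ι g₀) (ι g₁) (ι g₂) L y) (close {v₀} {v₁} h₀ h₁)
      μ-y≥1 : 1ℚ ≤ μ - y
      μ-y≥1 = by (dif μ≥1 ⊞ (<⇒≤ Li>0 ⊠ <⇒≤ y>0)) (trans (μ-y≥1-identity μ Li y) (cong (λ z → 1ℚ + (μ - (1ℚ + Li) + z)) Li-y))
        where
        zero₁ : ∀ {a b} → a ≡ b → a - b ≡ 0ℚ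
        zero₁ {a} refl = +-inverseʳ a
        zero₂ : ∀ {a b} → a ≡ 0ℚ → b ≡ 0ℚ → a * y - Li * b ≡ 0ℚ
        zero₂ refl refl = zero₂-identity y Li
        Li-y : Li - y ≡ Li * y
        Li-y = trans (μ-y≥1-identity₃ Li y) (trans (cong (λ z → Li * y + z) (trans (sym (μ-y≥1-identity₂ L Li y)) (zero₂ (zero₁ L·Li) (zero₁ (r-eq n≥1))))) (+-identityʳ (Li * y)))
      Q-bound : # 9 * (1ℚ * ∣ Q ∣) ≤ L
      Q-bound = scaled {1ℚ} {v₁ - v₂} {Q} {μ - y} (k0 1) μ-y≥1 (Q-bound-identity (ι g₀) (ι g₁) (ι g₂) y μ) (close {v₁} {v₂} h₁ h₂)
      P≤ : # 9 * ∣ P ∣ ≤ 1ℚ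
      P≤ = cancel≤ L L>0 (≤-trans (≤-reflexive (P≤-identity L ∣ P ∣)) (≤-trans P-bound (≤-reflexive (sym (*-identityʳ L)))))
      P-Q : ∣ ι g₂ ∣ * (L + μ) ≤ ∣ P ∣ + ∣ Q ∣
      P-Q = ≤-trans (≤-reflexive (trans (cong (∣ ι g₂ ∣ *_) (sym (0≤p⇒∣p∣≡p 0≤L+μ))) (trans (sym (∣p*q∣≡∣p∣*∣q∣ (ι g₂) (L + μ))) (cong ∣_∣ (P-Q-identity (ι g₁) (ι g₂) L y μ)))))
        (∣p-q∣≤∣p∣+∣q∣ P Q)
        where
        0≤L+μ : 0ℚ ≤ L + μ
        0≤L+μ = <⇒≤ L>0 ⊞ ≤-trans (k0 1 ⊞ <⇒≤ Li>0) μ≥1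
      g₂≡0 : g₂ ≡ + 0
      g₂≡0 with g₂ ℤ.≟ + 0
      ... | yes e = e
      ... | no  h = ⊥-elim (arith {L} {μ} {Li} {∣ P ∣} {∣ Q ∣} {∣ ι g₂ ∣} (1≤∣ι∣ g₂ h) P-Q P≤ Q-bound μ≥1 (<⇒≤ Li>0) 1≤L)
        where
        arith : ∀ {L u m p q c} → 1ℚ ≤ c → c * (L + u) ≤ p + q → # 9 * p ≤ 1ℚ → # 9 * (1ℚ * q) ≤ L → 1ℚ + m ≤ u → 0ℚ ≤ m → 1ℚ ≤ L → ⊥
        arith {L} {u} {m} {p} {q} {c} a b d e f g h = absurd (k0< 6) (((((((k0 9 ⊠ ((dif a ⊠ (≤-trans (k0 1) h ⊞ ≤-trans (k0 1 ⊞ g) f)) ⊞ dif b)) ⊞ dif d) ⊞ dif e) ⊞ (k0 9 ⊠ dif f)) ⊞ (k0 9 ⊠ g)) ⊞ (k0 8 ⊠ dif h)) ⊞ k0 9) (g₂≡0-identity L u m p q c)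
      g₁≡0 : g₁ ≡ + 0
      g₁≡0 with g₁ ℤ.≟ + 0
      ... | yes e = e
      ... | no  h = ⊥-elim (absurd (k0< 7) ((k0 9 ⊠ dif (1≤∣ι∣ g₁ h)) ⊞ dif P≤') (g₁≡0-identity ∣ ι g₁ ∣))
        where
        P≡ : P ≡ ι g₁
        P≡ = trans (cong (λ z → ι g₁ + z * (L - y)) (trans (cong ι g₂≡0) (ι-# 0))) (P≡-identity (ι g₁) (L - y))
        P≤' : # 9 * ∣ ι g₁ ∣ ≤ 1ℚ
        P≤' = ≤-trans (≤-reflexive (cong (λ z → # 9 * ∣ z ∣) (sym P≡))) P≤

    module Exponents (b₀ b₁ b₂ : ℚ) (k : ℕ) (0≤b₀ : 0ℚ ≤ b₀) (0≤b₁ : 0ℚ ≤ b₁) (0≤b₂ : 0ℚ ≤ b₂)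
      (b₀≤ : b₀ ≤ pL (+ k)) (b₁≤ : b₁ ≤ pL (+ k)) (b₂≤ : b₂ ≤ pL (+ k))
      (product-low : 1ℚ ≤ # 2 * (b₀ * b₁ * b₂)) (product-high : b₀ * b₁ * b₂ ≤ # 2) (large : # 16000 ≤ L) where

      -- All three numbers are at most L^k and their product is at least 1/2, so each is at least
      -- L^(-2k)/2. Hence 2k + 1 bounds the exponents needed.
      F : ℕ
      F = suc (k ℕ.+ k)

      private
        p : ℚ
        p = pL (+ k)
        p>0 : 0ℚ < p
        p>0 = pL-pos (+ k)
        20≤L : # 20 ≤ L
        20≤L = ≤-trans (by (k0 15980) refl) large

        top : ∀ {b} → 0ℚ ≤ b → b ≤ p → # 20 * b ≤ pL (+ F ℤ.+ + 1)
        top {b} b0 h = ≤-trans (top-arith {b} {p} {L} 20≤L b0 h (<⇒≤ L>0)) (≤-trans (≤-reflexive (sym (pL-step (+ k)))) (pL-mono {+ 1 ℤ.+ + k} {+ F ℤ.+ + 1} (ℤ.+≤+ (ℕₚ.≤-trans (s≤s (ℕₚ.m≤m+n k k)) (ℕₚ.m≤m+n F 1)))))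

        bottom : ∀ {b b' b''} → 0ℚ ≤ b → 0ℚ ≤ b' → 0ℚ ≤ b'' → b' ≤ p → b'' ≤ p → 1ℚ ≤ # 2 * (b * b' * b'') → pL (ℤ.- + F ℤ.+ + 1) < # 20 * b
        bottom {b} {b'} {b''} h h' h'' k' k'' lo = bottom-arith {b} {b'} {b''} {p} {r} rpp h h' h'' k' k'' lo r>0 (<⇒≤ p>0)
          where
          r : ℚ
          r = pL (ℤ.- + F ℤ.+ + 1)
          r>0 : 0ℚ < r
          r>0 = pL-pos (ℤ.- + F ℤ.+ + 1)
          rpp : r * p * p ≡ 1ℚ
          rpp = trans (trans (cong (_* p) (sym (pw-+ L·Li (ℤ.- + F ℤ.+ + 1) (+ k)))) (sym (pw-+ L·Li (ℤ.- + F ℤ.+ + 1 ℤ.+ + k) (+ k)))) (cong pL (bottom-identity (+ k)))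

        rot₁ : ∀ {a} → a ≤ # 2 * (b₀ * b₁ * b₂) → a ≤ # 2 * (b₁ * b₀ * b₂)
        rot₁ h = ≤-trans h (≤-reflexive (rot₁-identity b₀ b₁ b₂))
        rot₂ : ∀ {a} → a ≤ # 2 * (b₀ * b₁ * b₂) → a ≤ # 2 * (b₂ * b₀ * b₁)
        rot₂ h = ≤-trans h (≤-reflexive (rot₂-identity b₀ b₁ b₂))

      exponents : ∃[ f₁ ] ∃[ f₂ ] (ℤ.∣ f₁ ∣ ℕ.≤ F × ℤ.∣ f₂ ∣ ℕ.≤ F ×
        # 20 * b₀ ≤ pL (ℤ.- (f₁ ℤ.+ f₂) ℤ.+ + 1) × # 20 * b₁ ≤ pL (f₁ ℤ.+ + 1) × # 20 * b₂ ≤ pL (f₂ ℤ.+ + 1))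
      exponents =
        let f₁ , r₁ , up₁ , low₁ = exponent-for b₁ F (top 0≤b₁ b₁≤) (bottom 0≤b₁ 0≤b₀ 0≤b₂ b₀≤ b₂≤ (rot₁ product-low))
            f₂ , r₂ , up₂ , low₂ = exponent-for b₂ F (top 0≤b₂ b₂≤) (bottom 0≤b₂ 0≤b₀ 0≤b₁ b₀≤ b₁≤ (rot₂ product-low))
        in f₁ , f₂ , r₁ , r₂ , zeroth f₁ f₂ low₁ low₂ , up₁ , up₂
        where
        -- The exponents of a unit sum to 0, so the third one is prescribed. The upper bound 2 on
        -- the product shows that it works, and 16000 = 20 · 2 · 20² is the size of L required.
        zeroth : ∀ f₁ f₂ → pL f₁ ≤ # 20 * b₁ → pL f₂ ≤ # 20 * b₂ → # 20 * b₀ ≤ pL (ℤ.- (f₁ ℤ.+ f₂) ℤ.+ + 1)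
        zeroth f₁ f₂ h₁ h₂ = zeroth-arith {b₀} {b₁} {b₂} {pL f₁} {pL f₂} {q} {L} inv h₁ h₂ product-high large 0≤b₀ 0≤b₁ 0≤b₂ (<⇒≤ (pL-pos f₁)) (<⇒≤ (pL-pos f₂)) (<⇒≤ (pL-pos (ℤ.- (f₁ ℤ.+ f₂)))) (sym step)
          where
          q : ℚ
          q = pL (ℤ.- (f₁ ℤ.+ f₂))
          step : pL (ℤ.- (f₁ ℤ.+ f₂) ℤ.+ + 1) ≡ L * q
          step = trans (cong pL (ℤₚ.+-comm (ℤ.- (f₁ ℤ.+ f₂)) (+ 1))) (pL-step (ℤ.- (f₁ ℤ.+ f₂)))
          inv : pL f₁ * pL f₂ * q ≡ 1ℚ
          inv = trans (trans (cong (_* q) (sym (pw-+ L·Li f₁ f₂))) (sym (pw-+ L·Li (f₁ ℤ.+ f₂) (ℤ.- (f₁ ℤ.+ f₂))))) (cong pL (ℤₚ.+-inverseʳ (f₁ ℤ.+ f₂)))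

    small-value : ∀ {H b u g v} → 0ℚ ≤ b → 0ℚ ≤ u → # 20 * b ≤ pL (H ℤ.+ + 1) → # 100 * u ≤ # 101 * pL (ℤ.- H) →
                  ∣ v ∣ ≡ b * u → ∣ g - v ∣ ≤ 1ℚ → # 16000 ≤ L → # 18 * ∣ g ∣ ≤ L
    small-value {H} {b} {u} {g} {v} b0 u0 hb hu ev hd large =
      small-value-arith {∣ g ∣} {b} {u} {pL H} {pL (ℤ.- H)} {L} b0 u0 (<⇒≤ (pL-pos (ℤ.- H)))
        (≤-trans hb (≤-reflexive (trans (cong pL (ℤₚ.+-comm H (+ 1))) (pL-step H)))) hu inv g≤ large
      where
      inv : pL H * pL (ℤ.- H) ≡ 1ℚ
      inv = trans (sym (pw-+ L·Li H (ℤ.- H))) (cong pL (ℤₚ.+-inverseʳ H))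
      g≤ : ∣ g ∣ ≤ b * u + 1ℚ
      g≤ = ≤-trans (≤-reflexive (cong ∣_∣ (g≤-identity g v))) (≤-trans (∣p+q∣≤∣p∣+∣q∣ v (g - v)) (+-mono-≤ (≤-reflexive ev) hd))

  ∣ι∣-dec : ∀ g → ∣ ι g ∣ ≡ 0ℚ ⊎ ∣ ι g ∣ ≡ 1ℚ ⊎ # 2 ≤ ∣ ι g ∣
  ∣ι∣-dec g = subst (λ r → r ≡ 0ℚ ⊎ r ≡ 1ℚ ⊎ # 2 ≤ r) (sym (ι-abs g)) (nat ℤ.∣ g ∣)
    where
    nat : ∀ k → ν k ≡ 0ℚ ⊎ ν k ≡ 1ℚ ⊎ # 2 ≤ ν k
    nat zero = inj₁ (ι-# 0)
    nat (suc zero) = inj₂ (inj₁ (ι-# 1))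
    nat (suc (suc k)) = inj₂ (inj₂ (subst (_≤ ν (suc (suc k))) (ι-# 2) (ν≤ (s≤s (s≤s z≤n)))))

  abs-close : ∀ {g v d} → ∣ g - v ∣ ≤ d → ∣ v ∣ ≤ ∣ g ∣ + d × ∣ g ∣ ≤ ∣ v ∣ + d
  abs-close {g} {v} {d} h =
    ≤-trans (≤-reflexive (cong ∣_∣ (lem v g))) (≤-trans (∣p-q∣≤∣p∣+∣q∣ g (g - v)) (+-monoʳ-≤ ∣ g ∣ h)) ,
    ≤-trans (≤-reflexive (cong ∣_∣ (lem' g v))) (≤-trans (∣p+q∣≤∣p∣+∣q∣ v (g - v)) (+-monoʳ-≤ ∣ v ∣ h))
    where
    lem : ∀ v g → v ≡ g - (g - v)
    lem v g = solve (v ∷ g ∷ []) ℚring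
    lem' : ∀ g v → g ≡ v + (g - v)
    lem' g v = solve (g ∷ v ∷ []) ℚring

  private
    arith-identity : ∀ a b c → # 3 + (# 4 * (# 2 * (a * b * c) - 1ℚ) + (1ℚ - # 2 * a) + # 2 * a * (1ℚ - # 2 * b) + # 4 * (a * b) * (1ℚ - # 2 * c)) ≡ 0ℚ
    arith-identity a b c = solve (a ∷ b ∷ c ∷ []) ℚring

    down-identity : ∀ {g v d} → # 2 ≤ g → g ≤ v + d → # 2 * d ≤ 1ℚ → # 3 ≤ # 2 * v
    down-identity {g} {v} {d} a b c = by (((k0 2 ⊠ dif a) ⊞ (k0 2 ⊠ dif b)) ⊞ dif c) (solve (g ∷ v ∷ d ∷ []) ℚring)

    arith-identity₂ : ∀ a b c → # 11 + (# 8 * (# 2 - a * b * c) + (# 2 * a - # 3) * (# 4 * (b * c)) + # 6 * ((# 2 * b - # 3) * c) + # 9 * (# 2 * c - # 3)) ≡ 0ℚ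
    arith-identity₂ a b c = solve (a ∷ b ∷ c ∷ []) ℚring

  -- For g = 0 the product would be at most 1/8, and for |g| ≥ 2 at least 27/8; both lie outside the
  -- interval from 1/2 to 2.
  unit-size : ∀ g v₀ v₁ v₂ → # 2 * ∣ ι g - v₀ ∣ ≤ 1ℚ → # 2 * ∣ ι g - v₁ ∣ ≤ 1ℚ → # 2 * ∣ ι g - v₂ ∣ ≤ 1ℚ →
              1ℚ ≤ # 2 * (∣ v₀ ∣ * ∣ v₁ ∣ * ∣ v₂ ∣) → ∣ v₀ ∣ * ∣ v₁ ∣ * ∣ v₂ ∣ ≤ # 2 → ∣ ι g ∣ ≡ 1ℚ
  unit-size g v₀ v₁ v₂ h₀ h₁ h₂ lo hi with ∣ι∣-dec g
  ... | inj₂ (inj₁ e) = e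
  ... | inj₁ e = ⊥-elim (arith {∣ v₀ ∣} {∣ v₁ ∣} {∣ v₂ ∣} (0≤∣p∣ v₁) (0≤∣p∣ v₂) (0≤∣p∣ v₀) (up h₀) (up h₁) (up h₂) lo)
    where
    up : ∀ {v} → # 2 * ∣ ι g - v ∣ ≤ 1ℚ → # 2 * ∣ v ∣ ≤ 1ℚ
    up {v} h = ≤-trans (*-monoˡ-≤-nonNeg (# 2) (≤-trans (proj₁ (abs-close {ι g} {v} ≤-refl)) (≤-reflexive (trans (cong (_+ ∣ ι g - v ∣) e) (+-identityˡ ∣ ι g - v ∣))))) h
    arith : ∀ {a b c} → 0ℚ ≤ b → 0ℚ ≤ c → 0ℚ ≤ a → # 2 * a ≤ 1ℚ → # 2 * b ≤ 1ℚ → # 2 * c ≤ 1ℚ → 1ℚ ≤ # 2 * (a * b * c) → ⊥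
    arith {a} {b} {c} b0 c0 a0 ha hb hc lo = absurd (k0< 2) ((((k0 4 ⊠ dif lo) ⊞ dif ha) ⊞ ((k0 2 ⊠ a0) ⊠ dif hb)) ⊞ ((k0 4 ⊠ (a0 ⊠ b0)) ⊠ dif hc)) (arith-identity a b c)
  ... | inj₂ (inj₂ e) = ⊥-elim (arith {∣ v₀ ∣} {∣ v₁ ∣} {∣ v₂ ∣} (0≤∣p∣ v₁) (0≤∣p∣ v₂) (0≤∣p∣ v₀) (down h₀) (down h₁) (down h₂) hi)
    where
    down : ∀ {v} → # 2 * ∣ ι g - v ∣ ≤ 1ℚ → # 3 ≤ # 2 * ∣ v ∣
    down {v} h = down-identity {∣ ι g ∣} {∣ v ∣} {∣ ι g - v ∣} e (proj₂ (abs-close {ι g} {v} ≤-refl)) h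
    arith : ∀ {a b c} → 0ℚ ≤ b → 0ℚ ≤ c → 0ℚ ≤ a → # 3 ≤ # 2 * a → # 3 ≤ # 2 * b → # 3 ≤ # 2 * c → a * b * c ≤ # 2 → ⊥
    arith {a} {b} {c} b0 c0 a0 ha hb hc hi = absurd (k0< 10) ((((k0 8 ⊠ dif hi) ⊞ (dif ha ⊠ (k0 4 ⊠ (b0 ⊠ c0)))) ⊞ (k0 6 ⊠ (dif hb ⊠ c0))) ⊞ (k0 9 ⊠ dif hc)) (arith-identity₂ a b c)

-- The contradiction at a point near the root.

module Contradiction where
  open import Data.Empty using (⊥; ⊥-elim)
  open import Data.Nat as ℕ using (ℕ; suc)
  import Data.Nat.Properties as ℕₚ
  open import Data.Integer as ℤ using (ℤ; +_; -[1+_])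
  import Data.Integer.Properties as ℤₚ
  open import Data.List using ([]; _∷_)
  open import Data.Product using (_×_; _,_; proj₁; proj₂)
  open import Data.Sum using (_⊎_; inj₁; inj₂)
  open import Data.Rational hiding (neg; _≃_; ceiling)
  open import Data.Rational.Properties hiding (≃-sym)
  open import Relation.Nullary using (¬_; yes; no)
  open import Relation.Binary.PropositionalEquality
  open import Tactic.RingSolver using (solve)
  open import Data.Integer.Tactic.RingSolver using () renaming (solve to solveℤ)
  open import Defs using (K; mul; _⊖_; thueForm) renaming (ι to ιK)
  open Rationals
  open Bounds
  open Points
  open Root
  open Asymptotics
  open Conjugates
  open Powers
  open UnitStep
  open Siegel using (absurd)

  -- These are the L-exponents of the conjugates of α. As their sum is 0 they cannot all be
  -- positive, nor, when s ≠ 0, all be nonpositive.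
  not-all-positive : ∀ s t → + 1 ℤ.≤ s ℤ.- t → + 1 ℤ.≤ ℤ.- s → + 1 ℤ.≤ t → ⊥
  not-all-positive s t h₀ h₁ h₂ with subst (+ 0 ℤ.≤_) (lem s t) (Integers.dif h₀ Integers.⊞ Integers.dif h₁ Integers.⊞ Integers.dif h₂)
    where
    lem : ∀ s t → s ℤ.- t ℤ.- + 1 ℤ.+ (ℤ.- s ℤ.- + 1 ℤ.+ (t ℤ.- + 1)) ≡ -[1+ 2 ]
    lem s t = solveℤ (s ∷ t ∷ [])
  ... | ()

  some-positive : ∀ s t → s ≢ + 0 → + 1 ℤ.≤ s ℤ.- t ⊎ + 1 ℤ.≤ ℤ.- s ⊎ + 1 ℤ.≤ t
  some-positive s t s≢0 with + 1 ℤ.≤? s ℤ.- t | + 1 ℤ.≤? ℤ.- s | + 1 ℤ.≤? t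
  ... | yes h | _ | _ = inj₁ h
  ... | no _ | yes h | _ = inj₂ (inj₁ h)
  ... | no _ | no _ | yes h = inj₂ (inj₂ h)
  ... | no h₀ | no h₁ | no h₂ = ⊥-elim (s≢0 (ℤₚ.≤-antisym
      (Integers.by (Integers.dif (≤0 h₀) Integers.⊞ Integers.dif (≤0 h₂)) (lem s t)) (Integers.by (Integers.dif (≤0 h₁)) (lem' s))))
    where
    ≤0 : ∀ {e} → ¬ (+ 1 ℤ.≤ e) → e ℤ.≤ + 0
    ≤0 h = ℤₚ.i<j⇒i≤pred[j] (ℤₚ.≰⇒> h)
    lem : ∀ s t → + 0 ≡ s ℤ.+ (+ 0 ℤ.- (s ℤ.- t) ℤ.+ (+ 0 ℤ.- t))
    lem s t = solveℤ (s ∷ t ∷ [])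
    lem' : ∀ s → s ≡ + 0 ℤ.+ (+ 0 ℤ.- (ℤ.- s))
    lem' s = solveℤ (s ∷ [])

  triangle : ∀ u v → ∣ u ∣ ≤ ∣ u - v ∣ + ∣ v ∣ × ∣ v ∣ ≤ ∣ u - v ∣ + ∣ u ∣ × ∣ u - v ∣ ≤ ∣ u ∣ + ∣ v ∣
  triangle u v =
    ≤-trans (≤-reflexive (cong ∣_∣ (lem u v))) (∣p+q∣≤∣p∣+∣q∣ (u - v) v) ,
    ≤-trans (≤-reflexive (trans (sym (∣-p∣≡∣p∣ v)) (cong ∣_∣ (lem' u v)))) (∣p-q∣≤∣p∣+∣q∣ (u - v) u) ,
    ∣p-q∣≤∣p∣+∣q∣ u v
    where
    lem : ∀ u v → u ≡ u - v + v
    lem u v = solve (u ∷ v ∷ []) ℚring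
    lem' : ∀ u v → - v ≡ u - v - u
    lem' u v = solve (u ∷ v ∷ []) ℚring

  split : ∀ u v → ∣ u - v ∣ ≡ ∣ u ∣ + ∣ v ∣ ⊎ ∣ u - v ∣ ≡ ∣ u ∣ - ∣ v ∣ ⊎ ∣ u - v ∣ ≡ ∣ v ∣ - ∣ u ∣
  split u v with ≤-total 0ℚ u | ≤-total 0ℚ v | ∣p∣≡p∨∣p∣≡-p (u - v)
  ... | inj₁ 0≤u | inj₁ 0≤v | inj₁ e = inj₂ (inj₁ (trans e (sym (cong₂ _-_ (0≤p⇒∣p∣≡p 0≤u) (0≤p⇒∣p∣≡p 0≤v)))))
  ... | inj₁ 0≤u | inj₁ 0≤v | inj₂ e = inj₂ (inj₂ (trans e (trans (lem u v) (sym (cong₂ _-_ (0≤p⇒∣p∣≡p 0≤v) (0≤p⇒∣p∣≡p 0≤u))))))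
    where
    lem : ∀ u v → - (u - v) ≡ v - u
    lem u v = solve (u ∷ v ∷ []) ℚring
  ... | inj₁ 0≤u | inj₂ v≤0 | _ = inj₁ (trans (0≤p⇒∣p∣≡p (0≤u ⊞ neg-antimono-≤ v≤0)) (cong₂ _+_ (sym (0≤p⇒∣p∣≡p 0≤u)) (trans (sym (0≤p⇒∣p∣≡p (neg-antimono-≤ v≤0))) (∣-p∣≡∣p∣ v))))
  ... | inj₂ u≤0 | inj₁ 0≤v | _ = inj₁ (trans (sym (∣-p∣≡∣p∣ (u - v))) (trans (cong ∣_∣ (lem u v)) (trans (0≤p⇒∣p∣≡p (neg-antimono-≤ u≤0 ⊞ 0≤v))
      (cong₂ _+_ (trans (sym (0≤p⇒∣p∣≡p (neg-antimono-≤ u≤0))) (∣-p∣≡∣p∣ u)) (sym (0≤p⇒∣p∣≡p 0≤v))))))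
    where
    lem : ∀ u v → - (u - v) ≡ - u + v
    lem u v = solve (u ∷ v ∷ []) ℚring
  ... | inj₂ u≤0 | inj₂ v≤0 | inj₁ e = inj₂ (inj₂ (trans e (trans (lem u v) (cong₂ _-_ (trans (sym (0≤p⇒∣p∣≡p (neg-antimono-≤ v≤0))) (∣-p∣≡∣p∣ v))
      (trans (sym (0≤p⇒∣p∣≡p (neg-antimono-≤ u≤0))) (∣-p∣≡∣p∣ u))))))
    where
    lem : ∀ u v → u - v ≡ - v - - u
    lem u v = solve (u ∷ v ∷ []) ℚring
  ... | inj₂ u≤0 | inj₂ v≤0 | inj₂ e = inj₂ (inj₁ (trans e (trans (lem u v) (cong₂ _-_ (trans (sym (0≤p⇒∣p∣≡p (neg-antimono-≤ u≤0))) (∣-p∣≡∣p∣ u))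
      (trans (sym (0≤p⇒∣p∣≡p (neg-antimono-≤ v≤0))) (∣-p∣≡∣p∣ v))))))
    where
    lem : ∀ u v → - (u - v) ≡ - u - - v
    lem u v = solve (u ∷ v ∷ []) ℚring

  linear-difference : ∀ X Y u v → ∣ (X + - (u * Y)) - (X + - (v * Y)) ∣ ≡ ∣ Y ∣ * ∣ u - v ∣
  linear-difference X Y u v = trans (cong ∣_∣ (lem X Y u v)) (trans (∣-p∣≡∣p∣ (Y * (u - v))) (∣p*q∣≡∣p∣*∣q∣ Y (u - v)))
    where
    lem : ∀ X Y u v → (X + - (u * Y)) - (X + - (v * Y)) ≡ - (Y * (u - v))
    lem X Y u v = solve (X ∷ Y ∷ u ∷ v ∷ []) ℚring

  private
    arith-identity : ∀ a a' z d d' p p' l → # 1583799 + (# 100 * a - # 99 * p + (# 101 * p' - # 100 * a') + # 99 * (p - l) + # 101 * (1ℚ - p')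
      + # 100 * (z + d - a + (a' + d' - z)) + # 50 * (1ℚ - # 2 * d + (1ℚ - # 2 * d')) + # 99 * (l - # 16000)) ≡ 0ℚ
    arith-identity a a' z d d' p p' l = solve (a ∷ a' ∷ z ∷ d ∷ d' ∷ p ∷ p' ∷ l ∷ []) ℚring

    f₁₂-identity : ∀ f₁ f₂ → f₁ ℤ.- (ℤ.- f₂) ≡ ℤ.- (ℤ.- (f₁ ℤ.+ f₂))
    f₁₂-identity f₁ f₂ = solveℤ (f₁ ∷ f₂ ∷ [])

    bounded-weaken : ∀ {d} → 0ℚ ≤ d → # 2 * d ≤ 1ℚ → d ≤ 1ℚ
    bounded-weaken {d} a b = by (dif b ⊞ a) (solve (d ∷ []) ℚring)

    at≡-identity : ∀ g l → g + 0ℚ * l + 0ℚ * (l * l) ≡ g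
    at≡-identity g l = solve (g ∷ l ∷ []) ℚring

    units-identity : ∀ f₁ f₂ → ℤ.- (ℤ.- (f₁ ℤ.+ f₂)) ℤ.+ ℤ.- f₁ ℤ.+ ℤ.- f₂ ≡ + 0
    units-identity f₁ f₂ = solveℤ (f₁ ∷ f₂ ∷ [])

    units-identity₂ : ∀ f₁ f₂ → ℤ.- (ℤ.- f₂) ℤ.+ ℤ.- (ℤ.- (ℤ.- (f₁ ℤ.+ f₂))) ℤ.+ ℤ.- (ℤ.- f₁) ≡ + 0
    units-identity₂ f₁ f₂ = solveℤ (f₁ ∷ f₂ ∷ [])

    product-v-identity : ∀ a b c d e f → a * d * (b * e) * (c * f) ≡ a * b * c * (d * e * f)
    product-v-identity a b c d e f = solve (a ∷ b ∷ c ∷ d ∷ e ∷ f ∷ []) ℚring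

    triple-identity : ∀ s t → s ℤ.- t ℤ.+ ℤ.- s ℤ.+ t ≡ + 0
    triple-identity s t = solveℤ (s ∷ t ∷ [])

    triple-identity₂ : ∀ f₁ f₂ → ℤ.- (f₁ ℤ.+ f₂) ℤ.+ f₁ ℤ.+ f₂ ≡ + 0
    triple-identity₂ f₁ f₂ = solveℤ (f₁ ∷ f₂ ∷ [])

    product-low-arith : ∀ {p d} → 1ℚ ≤ p + d → # 2 * d ≤ 1ℚ → 1ℚ ≤ # 2 * p
    product-low-arith {p} {d} a b = by ((k0 2 ⊠ dif a) ⊞ dif b) (solve (p ∷ d ∷ []) ℚring)

    product-high-arith : ∀ {p d} → p ≤ 1ℚ + d → # 2 * d ≤ 1ℚ → p ≤ # 2
    product-high-arith {p} {d} a b = cancel≤ (# 2) (k0< 1) (by (((k0 2 ⊠ dif a) ⊞ dif b) ⊞ k0 1) (solve (p ∷ d ∷ []) ℚring))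

    ν-M-identity : ∀ L m → 1ℚ ≡ L * L * (m * m) + (L * m + 1ℚ) * (1ℚ - L * m) + 0ℚ * (1ℚ - L * m)
    ν-M-identity L m = solve (L ∷ m ∷ []) ℚring

    fine-low : ∀ {v b d c m x} → c ≡ v * b → 1ℚ ≤ v + d → m * d ≤ 1ℚ → 1ℚ ≤ m * (x * x) → 0ℚ < m → 0ℚ ≤ b → (1ℚ - x * x) * b ≤ c
    fine-low {v} {b} {d} {_} {m} {x} refl h₁ h₂ h₃ m0 b0 = cancel≤ m m0 (by ((b0 ⊠ (((<⇒≤ m0 ⊠ dif h₁) ⊞ dif h₂) ⊞ dif h₃))) (solve (v ∷ b ∷ d ∷ m ∷ x ∷ []) ℚring))

    fine-high : ∀ {v b d c m x} → c ≡ v * b → v ≤ 1ℚ + d → m * d ≤ 1ℚ → 1ℚ ≤ m * (x * x) → 0ℚ < m → 0ℚ ≤ b → c ≤ (1ℚ + x * x) * b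
    fine-high {v} {b} {d} {_} {m} {x} refl h₁ h₂ h₃ m0 b0 = cancel≤ m m0 (by ((b0 ⊠ (((<⇒≤ m0 ⊠ dif h₁) ⊞ dif h₂) ⊞ dif h₃))) (solve (v ∷ b ∷ d ∷ m ∷ x ∷ []) ℚring))

  module _ (n : ℕ) (n≥1 : 1 ℕ.≤ n) (s t X Y η : ℤ) (η-unit : ℤ.∣ η ∣ ≡ 1) (thue : thueForm n s t X Y ≡ ιK η) where
    open Near n n≥1
    open Solution n n≥1 s t X Y η thue
    open Evaluate n using (ev; _≈_; ≈-mul; ≈-linear; ≈-unit; unit; a₀; a₁; a₂; b-a₀; linear; b-linear)

    opaque
      -- β times the unit λ₀^h λ₁^k, as an exact element of ℤ[λ₀]; its integer coordinates are what
      -- `integral` acts on.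
      G : ℤ → ℤ → K
      G h k = mul n (ιK X ⊖ mul n (unit s t) (ιK Y)) (unit h k)

      G-≈ : ∀ h k → G h k ≈ (λ P → linear (a₀ s t) X Y P * a₀ h k P)
      G-≈ h k = ≈-mul (b-linear (b-a₀ s t) X Y) (b-a₀ h k) (≈-linear (b-a₀ s t) (≈-unit s t) X Y) (≈-unit h k)

    G-at : ℤ → ℤ → ℚ → ℚ
    G-at h k l = ι (K.c₀ (G h k)) + ι (K.c₁ (G h k)) * l + ι (K.c₂ (G h k)) * (l * l)

    u₀ u₁ u₂ : ℤ → ℤ → Fn
    u₀ h k B = a₀ h k (p₀ B)
    u₁ h k B = a₁ h k (p₀ B)
    u₂ h k B = a₂ h k (p₀ B)

    G₀ : ∀ h k → (λ B → G-at h k (l₀ B)) ≃ (λ B → β₀ B * u₀ h k B)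
    G₀ h k = ev₀ (G-≈ h k)
    G₁ : ∀ h k → (λ B → G-at h k (l₁ B)) ≃ (λ B → β₁ B * u₁ h k B)
    G₁ h k = ≃-trans (ev₁ (G-≈ h k)) (≃-≗ (λ B → cong₂ (λ r r' → (ι X + - (r * ι Y)) * r') (rotate₁ s t B) (rotate₁ h k B)))
    G₂ : ∀ h k → (λ B → G-at h k (l₂ B)) ≃ (λ B → β₂ B * u₂ h k B)
    G₂ h k = ≃-trans (ev₂ (G-≈ h k)) (≃-≗ (λ B → cong₂ (λ r r' → (ι X + - (r * ι Y)) * r') (rotate₂ s t B) (rotate₂ h k B)))

    -- Since M ≥ L², an error 1/M is at most x², the accuracy required by `Fine`.
    M : ℕ
    M = (n ℕ.+ 1) ℕ.* (n ℕ.+ 1)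

    Close : ℤ → ℤ → Base n → Set
    Close h k B = ν M * ∣ G-at h k (l₀ B) - β₀ B * u₀ h k B ∣ ≤ 1ℚ ×
                  ν M * ∣ G-at h k (l₁ B) - β₁ B * u₁ h k B ∣ ≤ 1ℚ ×
                  ν M * ∣ G-at h k (l₂ B) - β₂ B * u₂ h k B ∣ ≤ 1ℚ

    -- The multiplier is chosen only after the point B is known, so closeness is secured in advance
    -- for the finitely many candidates.
    close : ∀ F → Ev (λ B → ∀ h → ℤ.∣ h ∣ ℕ.≤ F → ∀ k → ℤ.∣ k ∣ ℕ.≤ F → Close h k B)
    close F = ev-all-ℤ (λ h → ev-all-ℤ (λ k → ev-× (≃⇒ev (G₀ h k) M) (ev-× (≃⇒ev (G₁ h k) M) (≃⇒ev (G₂ h k) M))) F) F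

    module At (B : Base n) (W : ℕ) (small : 200 ℕ.* W ℕ.≤ n) (big : 20000 ℕ.≤ n)
      (rs : ℤ.∣ s ∣ ℕ.≤ W) (rt : ℤ.∣ t ∣ ℕ.≤ W) (rst : ℤ.∣ s ℤ.- t ∣ ℕ.≤ W) (s≢0 : s ≢ + 0) where
      open Sizes n n≥1 B
      open Range W small
      private
        big' : 1000 ℕ.≤ n
        big' = ℕₚ.≤-trans (ℕₚ.≤ᵇ⇒≤ 1000 20000 _) big
      Fine : ℤ → ℚ → ℚ → Set
      Fine = Siegel.Inequalities.Fine n n≥1 B W small big'

      large : # 16000 ≤ L
      large = ≤-trans (≤-trans (#≤ (ℕₚ.≤ᵇ⇒≤ 16000 20000 _)) (subst (_≤ ν n) (ι-# 20000) (ν≤ big))) n≤L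

      size₀' : ∣ α₀ B ∣ ≡ sz (s ℤ.- t) (ℤ.- t)
      size₀' = conjugate-size₀ s t
      size₁' : ∣ α₁ B ∣ ≡ sz (ℤ.- s) (ℤ.- (s ℤ.- t))
      size₁' = conjugate-size₁ s t
      size₂' : ∣ α₂ B ∣ ≡ sz t (ℤ.- (ℤ.- s))
      size₂' = conjugate-size₂ s t

      neg-range : ∀ {z} → ℤ.∣ z ∣ ℕ.≤ W → ℤ.∣ ℤ.- z ∣ ℕ.≤ W
      neg-range {z} h = ℕₚ.≤-trans (ℕₚ.≤-reflexive (ℤₚ.∣-i∣≡∣i∣ z)) h
      r₀ : ℤ.∣ ℤ.- t ∣ ℕ.≤ W
      r₀ = neg-range {t} rt
      r₁ : ℤ.∣ ℤ.- (s ℤ.- t) ∣ ℕ.≤ W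
      r₁ = neg-range {s ℤ.- t} rst
      r₂ : ℤ.∣ ℤ.- (ℤ.- s) ∣ ℕ.≤ W
      r₂ = neg-range {ℤ.- s} (neg-range {s} rs)

      module _ (z : ℤ) (c₀ : ν 2 * ∣ ι z - α₀ B ∣ ≤ 1ℚ) (c₁ : ν 2 * ∣ ι z - α₁ B ∣ ≤ 1ℚ) (c₂ : ν 2 * ∣ ι z - α₂ B ∣ ≤ 1ℚ) where
        private
          grow : ∀ {e h e' h' a a'} → ∣ a ∣ ≡ sz e h → ℤ.∣ h ∣ ℕ.≤ W → ∣ a' ∣ ≡ sz e' h' → ℤ.∣ h' ∣ ℕ.≤ W →
                 ν 2 * ∣ ι z - a ∣ ≤ 1ℚ → ν 2 * ∣ ι z - a' ∣ ≤ 1ℚ → + 1 ℤ.≤ e → + 1 ℤ.≤ e'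
          grow {e} {h} {e'} {h'} {a} {a'} ea rh ea' rh' ca ca' e≥1 = ℤₚ.≮⇒≥ λ e'<1 →
            arith {∣ a ∣} {∣ a' ∣} {∣ ι z ∣} {∣ ι z - a ∣} {∣ ι z - a' ∣} {pL e} {pL e'} {L}
              (subst (λ r → # 99 * pL e ≤ # 100 * r) (sym ea) (sz-lower e h rh))
              (subst (λ r → # 100 * r ≤ # 101 * pL e') (sym ea') (sz-upper e' h' rh'))
              (≤-trans (≤-reflexive (sym (*-identityʳ L))) (≤-trans (≤-reflexive refl) (pL-mono {+ 1} e≥1)))
              (pL-mono {e'} {+ 0} (ℤₚ.i<j⇒i≤pred[j] e'<1))
              (proj₁ (abs-close {ι z} {a} ≤-refl)) (proj₂ (abs-close {ι z} {a'} ≤-refl))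
              (subst (λ r → r * ∣ ι z - a ∣ ≤ 1ℚ) (ι-# 2) ca) (subst (λ r → r * ∣ ι z - a' ∣ ≤ 1ℚ) (ι-# 2) ca') large
            where
            arith : ∀ {a a' z d d' p p' l} → # 99 * p ≤ # 100 * a → # 100 * a' ≤ # 101 * p' → l ≤ p → p' ≤ 1ℚ →
                    a ≤ z + d → z ≤ a' + d' → # 2 * d ≤ 1ℚ → # 2 * d' ≤ 1ℚ → # 16000 ≤ l → ⊥
            arith {a} {a'} {z} {d} {d'} {p} {p'} {l} h1 h2 h3 h4 h5 h6 h7 h8 h9 =
              absurd (k0< 1583798) (((((((dif h1 ⊞ dif h2) ⊞ (k0 99 ⊠ dif h3)) ⊞ (k0 101 ⊠ dif h4)) ⊞ (k0 100 ⊠ (dif h5 ⊞ dif h6))) ⊞ (k0 50 ⊠ (dif h7 ⊞ dif h8))) ⊞ (k0 99 ⊠ dif h9)))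
                (arith-identity a a' z d d' p p' l)

        -- An integer z would be close to all three conjugates of α at once. One conjugate with
        -- positive L-exponent exists and would force the other exponents to be positive as well.
        not-integer : ⊥
        not-integer = go (some-positive s t s≢0)
          where
          go : + 1 ℤ.≤ s ℤ.- t ⊎ + 1 ℤ.≤ ℤ.- s ⊎ + 1 ℤ.≤ t → ⊥
          go (inj₁ h) = not-all-positive s t h (grow {s ℤ.- t} {ℤ.- t} {ℤ.- s} {ℤ.- (s ℤ.- t)} {α₀ B} {α₁ B} size₀' r₀ size₁' r₁ c₀ c₁ h) (grow {s ℤ.- t} {ℤ.- t} {t} {ℤ.- (ℤ.- s)} {α₀ B} {α₂ B} size₀' r₀ size₂' r₂ c₀ c₂ h)
          go (inj₂ (inj₁ h)) = not-all-positive s t (grow {ℤ.- s} {ℤ.- (s ℤ.- t)} {s ℤ.- t} {ℤ.- t} {α₁ B} {α₀ B} size₁' r₁ size₀' r₀ c₁ c₀ h) h (grow {ℤ.- s} {ℤ.- (s ℤ.- t)} {t} {ℤ.- (ℤ.- s)} {α₁ B} {α₂ B} size₁' r₁ size₂' r₂ c₁ c₂ h)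
          go (inj₂ (inj₂ h)) = not-all-positive s t (grow {t} {ℤ.- (ℤ.- s)} {s ℤ.- t} {ℤ.- t} {α₂ B} {α₀ B} size₂' r₂ size₀' r₀ c₂ c₀ h) (grow {t} {ℤ.- (ℤ.- s)} {ℤ.- s} {ℤ.- (s ℤ.- t)} {α₂ B} {α₁ B} size₂' r₂ size₁' r₁ c₂ c₁ h) h

      ν-M : # 1 ≤ ν M * (Li * Li)
      ν-M = ≤-trans (≤-reflexive (lc2 (L * Li + 1ℚ) 0ℚ (sym L·Li) (sym L·Li) (ν-M-identity L Li)))
          (≤-trans (*-monoʳ-≤-nonNeg (Li * Li) {{nonNegative (<⇒≤ Li>0 ⊠ <⇒≤ Li>0)}} (*-mono {L} {L} {ν n + 1ℚ} {ν n + 1ℚ} (<⇒≤ L>0) (ν0 n ⊞ k0 1) L≤n+1 L≤n+1))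
            (≤-reflexive (cong (_* (Li * Li)) (sym ν-M≡))))
        where
        ν-M≡ : ν M ≡ (ν n + 1ℚ) * (ν n + 1ℚ)
        ν-M≡ = trans (ν-* (n ℕ.+ 1) (n ℕ.+ 1)) (cong (λ r → r * r) (trans (ν-+ n 1) (cong (λ r → ν n + r) (ι-# 1))))

      2≤M : # 2 ≤ ν M
      2≤M = subst (_≤ ν M) (ι-# 2) (ν≤ (ℕₚ.≤-trans (ℕₚ.+-monoˡ-≤ 1 n≥1) (ℕₚ.m≤m*n (n ℕ.+ 1) (n ℕ.+ 1) {{ℕ.>-nonZero (ℕₚ.m≤n+m 1 n)}})))

      half : ∀ {d} → 0ℚ ≤ d → ν M * d ≤ 1ℚ → # 2 * d ≤ 1ℚ
      half {d} d0 h = ≤-trans (*-monoʳ-≤-nonNeg d {{nonNegative d0}} 2≤M) h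

      sz-inverse : ∀ {a a' b b'} → a ℤ.+ a' ≡ + 0 → b ℤ.+ b' ≡ + 0 → sz a b * sz a' b' ≡ 1ℚ
      sz-inverse {a} {a'} {b} {b'} e e' = trans (sz-* a b a' b') (trans (cong₂ sz e e') refl)

      -- From βu ≈ ±1 one reads off |β| as the reciprocal of |u|, and the absolute error 1/M of the
      -- product is a relative error of |β|.
      fine : ∀ {H a b u β g} → ∣ g ∣ ≡ 1ℚ → ν M * ∣ g - β * u ∣ ≤ 1ℚ → ∣ u ∣ ≡ a → a * b ≡ 1ℚ → 0ℚ ≤ b → Fine H ∣ β ∣ b
      fine {H} {a} {b} {u} {β} {g} eg h eu ab b0 = record
        { below = fine-low {v} {b} {δ} {∣ β ∣} {ν M} {Li} v≡ (subst (λ r → r ≤ v + δ) eg (proj₂ near)) h ν-M M>0 b0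
        ; above = fine-high {v} {b} {δ} {∣ β ∣} {ν M} {Li} v≡ (subst (λ r → v ≤ r + δ) eg (proj₁ near)) h ν-M M>0 b0 }
        where
        v δ : ℚ
        v = ∣ β * u ∣
        δ = ∣ g - β * u ∣
        near = abs-close {g} {β * u} ≤-refl
        M>0 : 0ℚ < ν M
        M>0 = <-≤-trans (k0< 1) 2≤M
        v≡ : ∣ β ∣ ≡ v * b
        v≡ = sym (trans (cong (_* b) (trans (∣p*q∣≡∣p∣*∣q∣ β u) (cong (∣ β ∣ *_) eu))) (trans (*-assoc ∣ β ∣ a b) (trans (cong (∣ β ∣ *_) ab) (*-identityʳ ∣ β ∣))))

      module Impossible (k : ℕ) (b₀≤ : ∣ β₀ B ∣ ≤ pL (+ k)) (b₁≤ : ∣ β₁ B ∣ ≤ pL (+ k)) (b₂≤ : ∣ β₂ B ∣ ≤ pL (+ k))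
        (norm : ν 2 * ∣ β₀ B * β₁ B * β₂ B - ι η ∣ ≤ 1ℚ) (range : suc (k ℕ.+ k) ℕ.+ suc (k ℕ.+ k) ℕ.≤ W) (Y≥2 : 2 ℕ.≤ ℤ.∣ Y ∣)
        (G-close : ∀ h → ℤ.∣ h ∣ ℕ.≤ suc (k ℕ.+ k) → ∀ h' → ℤ.∣ h' ∣ ℕ.≤ suc (k ℕ.+ k) → Close h h' B) where
        private
          c₀ c₁ c₂ : ℚ
          c₀ = ∣ β₀ B ∣
          c₁ = ∣ β₁ B ∣
          c₂ = ∣ β₂ B ∣
          product : ∣ β₀ B * β₁ B * β₂ B ∣ ≡ c₀ * c₁ * c₂
          product = trans (∣p*q∣≡∣p∣*∣q∣ (β₀ B * β₁ B) (β₂ B)) (cong (_* c₂) (∣p*q∣≡∣p∣*∣q∣ (β₀ B) (β₁ B)))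
          η≡ : ∣ ι η ∣ ≡ 1ℚ
          η≡ = trans (ι-abs η) (trans (cong ν η-unit) (ι-# 1))
          norm' : # 2 * ∣ β₀ B * β₁ B * β₂ B - ι η ∣ ≤ 1ℚ
          norm' = subst (λ r → r * ∣ β₀ B * β₁ B * β₂ B - ι η ∣ ≤ 1ℚ) (ι-# 2) norm
          near = abs-close {β₀ B * β₁ B * β₂ B} {ι η} ≤-refl
          product-low : 1ℚ ≤ # 2 * (c₀ * c₁ * c₂)
          product-low = product-low-arith {c₀ * c₁ * c₂} {∣ β₀ B * β₁ B * β₂ B - ι η ∣} (subst₂ (λ r r' → r ≤ r' + ∣ β₀ B * β₁ B * β₂ B - ι η ∣) η≡ product (proj₁ near)) norm'
          product-high : c₀ * c₁ * c₂ ≤ # 2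
          product-high = product-high-arith {c₀ * c₁ * c₂} {∣ β₀ B * β₁ B * β₂ B - ι η ∣} (subst₂ (λ r r' → r' ≤ r + ∣ β₀ B * β₁ B * β₂ B - ι η ∣) η≡ product (proj₂ near)) norm'
          module E = Exponents n n≥1 B c₀ c₁ c₂ k (0≤∣p∣ (β₀ B)) (0≤∣p∣ (β₁ B)) (0≤∣p∣ (β₂ B)) b₀≤ b₁≤ b₂≤ product-low product-high large

        impossible : ⊥
        impossible = conclude E.exponents
          where
          module With (f₁ f₂ : ℤ) (rf₁ : ℤ.∣ f₁ ∣ ℕ.≤ E.F) (rf₂ : ℤ.∣ f₂ ∣ ℕ.≤ E.F)
            (up₀ : # 20 * c₀ ≤ pL (ℤ.- (f₁ ℤ.+ f₂) ℤ.+ + 1)) (up₁ : # 20 * c₁ ≤ pL (f₁ ℤ.+ + 1)) (up₂ : # 20 * c₂ ≤ pL (f₂ ℤ.+ + 1)) where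
            -- The unit λ₀^f₁ λ₁^(-f₂) has conjugates with L-exponents f₁ + f₂, -f₁, -f₂, the
            -- negatives of those found for β.
            h k' H₀ : ℤ
            h = f₁
            k' = ℤ.- f₂
            H₀ = ℤ.- (f₁ ℤ.+ f₂)
            F≤W : E.F ℕ.≤ W
            F≤W = ℕₚ.≤-trans (ℕₚ.m≤m+n E.F E.F) range
            rf₁₂ : ℤ.∣ f₁ ℤ.+ f₂ ∣ ℕ.≤ W
            rf₁₂ = ℕₚ.≤-trans (ℤₚ.∣i+j∣≤∣i∣+∣j∣ f₁ f₂) (ℕₚ.≤-trans (ℕₚ.+-mono-≤ rf₁ rf₂) range)
            rH₀ : ℤ.∣ H₀ ∣ ℕ.≤ W
            rH₀ = neg-range {f₁ ℤ.+ f₂} rf₁₂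
            rH₁ : ℤ.∣ f₁ ∣ ℕ.≤ W
            rH₁ = ℕₚ.≤-trans rf₁ F≤W
            rH₂ : ℤ.∣ f₂ ∣ ℕ.≤ W
            rH₂ = ℕₚ.≤-trans rf₂ F≤W
            cl : Close h k' B
            cl = G-close h rf₁ k' (ℕₚ.≤-trans (ℕₚ.≤-reflexive (ℤₚ.∣-i∣≡∣i∣ f₂)) rf₂)
            d₀ : ν M * ∣ G-at h k' L - β₀ B * u₀ h k' B ∣ ≤ 1ℚ
            d₀ = proj₁ cl
            d₁ : ν M * ∣ G-at h k' (- y) - β₁ B * u₁ h k' B ∣ ≤ 1ℚ
            d₁ = proj₁ (proj₂ cl)
            d₂ : ν M * ∣ G-at h k' (- μ) - β₂ B * u₂ h k' B ∣ ≤ 1ℚ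
            d₂ = proj₂ (proj₂ cl)
            f₁₂ : h ℤ.- k' ≡ ℤ.- H₀
            f₁₂ = f₁₂-identity f₁ f₂
            su₀ : ∣ u₀ h k' B ∣ ≡ sz (ℤ.- H₀) (ℤ.- k')
            su₀ = trans (conjugate-size₀ h k') (cong (λ r → sz r (ℤ.- k')) f₁₂)
            su₁ : ∣ u₁ h k' B ∣ ≡ sz (ℤ.- f₁) (ℤ.- (ℤ.- H₀))
            su₁ = trans (conjugate-size₁ h k') (cong (λ r → sz (ℤ.- f₁) (ℤ.- r)) f₁₂)
            su₂ : ∣ u₂ h k' B ∣ ≡ sz (ℤ.- f₂) (ℤ.- (ℤ.- f₁))
            su₂ = conjugate-size₂ h k'
            product-abs : ∀ b u → ∣ b * u ∣ ≡ ∣ b ∣ * ∣ u ∣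
            product-abs = ∣p*q∣≡∣p∣*∣q∣
            bounded : ∀ {H e v b g} → ∣ v ∣ ≡ sz (ℤ.- H) e → ℤ.∣ e ∣ ℕ.≤ W → # 20 * ∣ b ∣ ≤ pL (H ℤ.+ + 1) → ν M * ∣ g - b * v ∣ ≤ 1ℚ → # 18 * ∣ g ∣ ≤ L
            bounded {H} {e} {v} {b} {g} ev re up dd = small-value n n≥1 B {H} {∣ b ∣} {∣ v ∣} {g} {b * v} (0≤∣p∣ b) (0≤∣p∣ v) up
              (subst (λ r → # 100 * r ≤ # 101 * pL (ℤ.- H)) (sym ev) (sz-upper (ℤ.- H) e re)) (product-abs b v)
              (bounded-weaken (0≤∣p∣ (g - b * v)) (half (0≤∣p∣ (g - b * v)) dd)) large
            coefficients : K.c₁ (G h k') ≡ + 0 × K.c₂ (G h k') ≡ + 0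
            coefficients = integral n n≥1 B (K.c₀ (G h k')) (K.c₁ (G h k')) (K.c₂ (G h k')) (1≤L n≥1)
              (bounded {H₀} {ℤ.- k'} {u₀ h k' B} {β₀ B} {G-at h k' L} su₀ (neg-range {k'} (neg-range {f₂} rH₂)) up₀ d₀)
              (bounded {f₁} {ℤ.- (ℤ.- H₀)} {u₁ h k' B} {β₁ B} {G-at h k' (- y)} su₁ (neg-range {ℤ.- H₀} (neg-range {H₀} rH₀)) up₁ d₁)
              (bounded {f₂} {ℤ.- (ℤ.- f₁)} {u₂ h k' B} {β₂ B} {G-at h k' (- μ)} su₂ (neg-range {ℤ.- f₁} (neg-range {f₁} rH₁)) up₂ d₂)
            g : ℤ
            g = K.c₀ (G h k')
            at≡ : ∀ l → G-at h k' l ≡ ι g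
            at≡ l = trans (cong₂ (λ r r' → ι g + r * l + r' * (l * l)) (trans (cong ι (proj₁ coefficients)) (ι-# 0)) (trans (cong ι (proj₂ coefficients)) (ι-# 0))) (at≡-identity (ι g) l)
            to-integer : ∀ l v → ν M * ∣ G-at h k' l - v ∣ ≤ 1ℚ → ν M * ∣ ι g - v ∣ ≤ 1ℚ
            to-integer l v = subst (λ r → ν M * ∣ r - v ∣ ≤ 1ℚ) (at≡ l)
            half-integer : ∀ v → ν M * ∣ ι g - v ∣ ≤ 1ℚ → # 2 * ∣ ι g - v ∣ ≤ 1ℚ
            half-integer v = half (0≤∣p∣ (ι g - v))
            v₀ v₁ v₂ : ℚ
            v₀ = β₀ B * u₀ h k' B
            v₁ = β₁ B * u₁ h k' B
            v₂ = β₂ B * u₂ h k' B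
            i₀ = to-integer L v₀ d₀
            i₁ = to-integer (- y) v₁ d₁
            i₂ = to-integer (- μ) v₂ d₂
            units : sz (ℤ.- H₀) (ℤ.- k') * sz (ℤ.- f₁) (ℤ.- (ℤ.- H₀)) * sz (ℤ.- f₂) (ℤ.- (ℤ.- f₁)) ≡ 1ℚ
            units = trans (cong (_* sz (ℤ.- f₂) (ℤ.- (ℤ.- f₁))) (sz-* (ℤ.- H₀) (ℤ.- k') (ℤ.- f₁) (ℤ.- (ℤ.- H₀))))
              (sz-inverse {ℤ.- H₀ ℤ.+ ℤ.- f₁} {ℤ.- f₂} {ℤ.- k' ℤ.+ ℤ.- (ℤ.- H₀)} {ℤ.- (ℤ.- f₁)} (units-identity f₁ f₂) (units-identity₂ f₁ f₂))
            product-v : ∣ v₀ ∣ * ∣ v₁ ∣ * ∣ v₂ ∣ ≡ c₀ * c₁ * c₂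
            product-v = trans (cong₂ _*_ (cong₂ _*_ (trans (product-abs (β₀ B) (u₀ h k' B)) (cong (c₀ *_) su₀)) (trans (product-abs (β₁ B) (u₁ h k' B)) (cong (c₁ *_) su₁)))
                (trans (product-abs (β₂ B) (u₂ h k' B)) (cong (c₂ *_) su₂)))
              (trans (product-v-identity c₀ c₁ c₂ (sz (ℤ.- H₀) (ℤ.- k')) (sz (ℤ.- f₁) (ℤ.- (ℤ.- H₀))) (sz (ℤ.- f₂) (ℤ.- (ℤ.- f₁)))) (trans (cong (c₀ * c₁ * c₂ *_) units) (*-identityʳ _)))
            g≡1 : ∣ ι g ∣ ≡ 1ℚ
            g≡1 = unit-size g v₀ v₁ v₂ (half-integer v₀ i₀) (half-integer v₁ i₁) (half-integer v₂ i₂)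
              (subst (λ r → 1ℚ ≤ # 2 * r) (sym product-v) product-low) (subst (_≤ # 2) (sym product-v) product-high)
            fine₀ : Fine H₀ c₀ (sz H₀ (ℤ.- f₂))
            fine₀ = fine {H₀} {_} {_} {u₀ h k' B} {β₀ B} {ι g} g≡1 i₀ su₀ (sz-inverse {ℤ.- H₀} {H₀} {ℤ.- k'} {ℤ.- f₂} (ℤₚ.+-inverseˡ H₀) (ℤₚ.+-inverseˡ (ℤ.- f₂))) (<⇒≤ (sz-pos H₀ (ℤ.- f₂)))
            fine₁ : Fine f₁ c₁ (sz f₁ (ℤ.- H₀))
            fine₁ = fine {f₁} {_} {_} {u₁ h k' B} {β₁ B} {ι g} g≡1 i₁ su₁ (sz-inverse {ℤ.- f₁} {f₁} {ℤ.- (ℤ.- H₀)} {ℤ.- H₀} (ℤₚ.+-inverseˡ f₁) (ℤₚ.+-inverseˡ (ℤ.- H₀))) (<⇒≤ (sz-pos f₁ (ℤ.- H₀)))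
            fine₂ : Fine f₂ c₂ (sz f₂ (ℤ.- f₁))
            fine₂ = fine {f₂} {_} {_} {u₂ h k' B} {β₂ B} {ι g} g≡1 i₂ su₂ (sz-inverse {ℤ.- f₂} {f₂} {ℤ.- (ℤ.- f₁)} {ℤ.- f₁} (ℤₚ.+-inverseˡ f₂) (ℤₚ.+-inverseˡ (ℤ.- f₁))) (<⇒≤ (sz-pos f₂ (ℤ.- f₁)))
            triple : Siegel.Inequalities.Triple n n≥1 B W small big' (s ℤ.- t) (ℤ.- s) t H₀ f₁ f₂ (∣ α₀ B ∣) (∣ α₁ B ∣) (∣ α₂ B ∣) c₀ c₁ c₂
              (∣ α₁ B - α₀ B ∣) (∣ α₂ B - α₀ B ∣) (∣ α₁ B - α₂ B ∣) (∣ β₁ B - β₀ B ∣) (∣ β₂ B - β₀ B ∣) (∣ β₁ B - β₂ B ∣) (∣ ι Y ∣)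
            triple = record
              { esum = triple-identity s t ; hsum = triple-identity₂ f₁ f₂
              ; nz = λ (_ , e) → s≢0 (trans (sym (ℤₚ.neg-involutive s)) (cong ℤ.-_ e))
              ; rej = rst ; rei = neg-range {s} rs ; rek = rt ; rHj = rH₀ ; rHi = rH₁ ; rHk = rH₂
              ; aj≡ = size₀' ; ai≡ = size₁' ; ak≡ = size₂' ; fj = fine₀ ; fi = fine₁ ; fk = fine₂
              ; tij = triangle (α₁ B) (α₀ B) ; tkj = triangle (α₂ B) (α₀ B) ; tik = triangle (α₁ B) (α₂ B)
              ; sij = split (α₁ B) (α₀ B) ; skj = split (α₂ B) (α₀ B) ; sik = split (α₁ B) (α₂ B)
              ; dij0 = 0≤∣p∣ (α₁ B - α₀ B) ; dkj0 = 0≤∣p∣ (α₂ B - α₀ B) ; dik0 = 0≤∣p∣ (α₁ B - α₂ B)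
              ; uij = triangle (β₁ B) (β₀ B) ; ukj = triangle (β₂ B) (β₀ B) ; uik = triangle (β₁ B) (β₂ B)
              ; gij≡ = linear-difference (ι X) (ι Y) (α₁ B) (α₀ B) ; gkj≡ = linear-difference (ι X) (ι Y) (α₂ B) (α₀ B)
              ; gik≡ = linear-difference (ι X) (ι Y) (α₁ B) (α₂ B)
              ; Y≥2 = subst₂ _≤_ (ι-# 2) (sym (ι-abs Y)) (ν≤ Y≥2) }
            result : ⊥
            result = Siegel.Inequalities.no-triple n n≥1 B W small big' triple
          conclude : _ → ⊥
          conclude (f₁ , f₂ , rf₁ , rf₂ , up₀ , up₁ , up₂) = With.result f₁ f₂ rf₁ rf₂ up₀ up₁ up₂

-- The threshold for n and the conclusion.

module Final where
  open import Data.Empty using (⊥)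
  open import Data.Nat as ℕ using (ℕ; zero; suc; z≤n; s≤s)
  import Data.Nat.Properties as ℕₚ
  open import Data.Integer as ℤ using (ℤ; +_)
  import Data.Integer.Properties as ℤₚ
  open import Data.List using ([]; _∷_)
  open import Data.Product using (∃-syntax; _×_; _,_)
  open import Data.Sum using (inj₁; inj₂)
  open import Data.Rational using (1ℚ; 0ℚ; _+_; _*_; _≤_; ∣_∣; ↧ₙ_; ↥_)
  open import Data.Rational.Properties hiding (≃-sym; _≟_; _≤?_)
  open import Relation.Nullary using (¬_; Dec; yes; no)
  open import Relation.Nullary.Decidable using (_×-dec_)
  open import Relation.Binary.PropositionalEquality
  open import Tactic.RingSolver using (solve)
  open import Defs using (K; thueForm; BoundedBy) renaming (ι to ιK)
  open Naturals
  open Rationals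
  open import Data.Integer.Tactic.RingSolver using () renaming (solve to solveℤ)
  open Root
  open Asymptotics
  open Conjugates
  open Powers
  open FormBound using (N₁; C₁)
  open BetaBound
  open Contradiction

  module _ (m : ℕ) (large : 20000 ℕ.≤ suc m) (B : Base (suc m)) where
    open Sizes (suc m) (s≤s z≤n) B

    w≤L² : ν (m ℕ.+ 3) ≤ L * L
    w≤L² = ≤-trans (≤-reflexive (trans (cong ν (trans (ℕₚ.+-suc m 2) refl)) (trans (ν-+ (suc m) 2) (cong (λ r → ν (suc m) + r) (ι-# 2)))))
        (arith {ν (suc m)} {L} n≤L (≤-trans (subst (_≤ ν (suc m)) (ι-# 2) (ν≤ (ℕₚ.≤-trans (ℕₚ.≤ᵇ⇒≤ 2 20000 _) large))) n≤L))
      where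
      arith : ∀ {n l} → n ≤ l → # 2 ≤ l → n + # 2 ≤ l * l
      arith {n} {l} h k = by ((dif h ⊞ (dif k ⊠ dif k)) ⊞ (k0 3 ⊠ dif k)) (solve (n ∷ l ∷ []) ℚring)

    power≤ : ∀ {T} j → T ℕ.≤ (m ℕ.+ 3) ℕ.^ j → ν T ≤ pL (+ (j ℕ.+ j))
    power≤ j h = ≤-trans (ν≤ h) (≤-trans (go j) (≤-reflexive (trans (pn-mul L L j) (sym (pw-+ L·Li (+ j) (+ j))))))
      where
      go : ∀ j → ν ((m ℕ.+ 3) ℕ.^ j) ≤ pn (L * L) j
      go zero = ≤-reflexive (ι-# 1)
      go (suc j) = ≤-trans (≤-reflexive (ν-* (m ℕ.+ 3) ((m ℕ.+ 3) ℕ.^ j)))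
        (*-mono {ν (m ℕ.+ 3)} {ν ((m ℕ.+ 3) ℕ.^ j)} (ν0 (m ℕ.+ 3)) (≤-trans (ν0 ((m ℕ.+ 3) ℕ.^ j)) (go j)) w≤L² (go j))

  c₁-zero : ∀ k A₁ A₂ → ℤ.- (A₁ ℤ.+ k ℤ.* A₂) ≡ + 0 → A₂ ≡ + 0 → A₁ ≡ + 0
  c₁-zero k A₁ _ h refl = trans (lem k A₁) (trans (cong ℤ.-_ h) refl)
    where
    lem : ∀ k a → a ≡ ℤ.- (ℤ.- (a ℤ.+ k ℤ.* + 0))
    lem k a = solveℤ (k ∷ a ∷ [])

  constant : ∀ a b c l → b ≡ + 0 → c ≡ + 0 → ι a ≡ ι a + ι b * l + ι c * (l * l)
  constant a _ _ l refl refl = trans (lem (ι a) l) (cong (λ z → ι a + z * l + z * (l * l)) (sym (ι-# 0)))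
    where
    lem : ∀ a l → a ≡ a + 0ℚ * l + 0ℚ * (l * l)
    lem a l = solve (a ∷ l ∷ []) ℚring

  module _ (m : ℕ) (s t X Y η : ℤ) (η-unit : ℤ.∣ η ∣ ≡ 1) (thue : thueForm (suc m) s t X Y ≡ ιK η)
    (N≥ : N₁ ℕ.≤ 2 ℕ.* suc m ℕ.+ 1) (C≤ : C₁ ℕ.≤ m ℕ.+ 3) (large : 20000 ℕ.≤ suc m) (s≢0 : s ≢ + 0) (Y≥2 : 2 ℕ.≤ ℤ.∣ Y ∣) where
    open Near (suc m) (s≤s z≤n)
    open Solution (suc m) (s≤s z≤n) s t X Y η thue

    -- The conjugates of β are at most w^j with w = n + 2 ≤ L², hence at most L^(2j). Their
    -- exponents are then at most 4j + 1 in absolute value, and `W` also accommodates the sum of two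
    -- of them.
    S j W : ℕ
    S = ℤ.∣ s ∣ ℕ.+ ℤ.∣ t ∣
    j = 43 ℕ.* S
    W = suc (j ℕ.+ j ℕ.+ (j ℕ.+ j)) ℕ.+ suc (j ℕ.+ j ℕ.+ (j ℕ.+ j))

    S≥1 : 1 ℕ.≤ S
    S≥1 = ℕₚ.≤-trans (abs≥1 s s≢0) (ℕₚ.m≤m+n ℤ.∣ s ∣ ℤ.∣ t ∣)

    S≤W : S ℕ.≤ W
    S≤W = ℕₚ.≤-trans (ℕₚ.m≤m+n S (42 ℕ.* S)) (ℕₚ.≤-trans (ℕₚ.m≤m+n j (j ℕ.+ (j ℕ.+ j)))
      (ℕₚ.≤-trans (ℕₚ.≤-reflexive (sym (ℕₚ.+-assoc j j (j ℕ.+ j)))) (ℕₚ.≤-trans (ℕₚ.n≤1+n _) (ℕₚ.m≤m+n _ _))))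

    module _ (small : 200 ℕ.* W ℕ.≤ suc m) where
      private
        rs : ℤ.∣ s ∣ ℕ.≤ W
        rs = ℕₚ.≤-trans (ℕₚ.m≤m+n ℤ.∣ s ∣ ℤ.∣ t ∣) S≤W
        rt : ℤ.∣ t ∣ ℕ.≤ W
        rt = ℕₚ.≤-trans (ℕₚ.m≤n+m ℤ.∣ t ∣ ℤ.∣ s ∣) S≤W
        rst : ℤ.∣ s ℤ.- t ∣ ℕ.≤ W
        rst = ℕₚ.≤-trans (ℤₚ.∣i-j∣≤∣i∣+∣j∣ s t) S≤W

      -- If c = d = 0 the fractional linear form of α gives no information, but then the λ- and
      -- λ²-coordinates of α vanish, and α would be a rational integer.
      degenerate : d ≡ + 0 → c ≡ + 0 → ⊥
      degenerate d0 c0 = ev-⊥ (ev-map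
          (λ B (h₀ , h₁ , h₂) → At.not-integer (suc m) (s≤s z≤n) s t X Y η η-unit thue B W small large rs rt rst s≢0 A₀ h₀ h₁ h₂)
          (ev-× (near conj₀) (ev-× (near conj₁) (near conj₂))))
        where
        near : ∀ {l g} → at-l l ≃ g → Ev (λ B → ν 2 * ∣ ι A₀ Data.Rational.- g B ∣ ≤ 1ℚ)
        near {l} {g} h = ≃⇒ev {λ _ → ι A₀} {g} (≃-trans (≃-≗ (λ B → constant A₀ A₁ A₂ (l B) (c₁-zero (+ suc m ℤ.- + 1) A₁ A₂ d0 c0) c0)) h) 2

      nondegenerate : ¬ (d ≡ + 0 × c ≡ + 0) → ⊥
      nondegenerate cd≢0 = ev-⊥ (ev-map
          (λ B (h₀ , h₁ , h₂ , hn , hG) → At.Impossible.impossible (suc m) (s≤s z≤n) s t X Y η η-unit thue B W small large rs rt rst s≢0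
            (j ℕ.+ j) (≤-trans h₀ (T≤L B)) (≤-trans h₁ (T≤L B)) (≤-trans h₂ (T≤L B)) hn ℕₚ.≤-refl Y≥2 hG)
          (ev-× D.bound₀ (ev-× D.bound₁ (ev-× D.bound₂ (ev-× (≃⇒ev norm-β 2) (close (suc m) (s≤s z≤n) s t X Y η η-unit thue _))))))
        where
        module D = Nondegenerate m N≥ s t X Y η η-unit thue cd≢0
        T≤L : ∀ B → ν D.T ≤ Sizes.pL (suc m) (s≤s z≤n) B (+ (j ℕ.+ j))
        T≤L B = power≤ m large B j (D.T≤ C≤ S≥1)

      no-solution : ⊥
      no-solution = decide ((d ℤ.≟ + 0) ×-dec (c ℤ.≟ + 0))
        where
        decide : Dec (d ≡ + 0 × c ≡ + 0) → ⊥
        decide (yes (d0 , c0)) = degenerate d0 c0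
        decide (no h) = nondegenerate h

    -- Origin of 138400: 200W = 200(8 · 43S + 2) = 68800S + 400 ≤ 69200S, and S ≤ 2σ.
    W-bound : ∀ {σ} → S ℕ.≤ σ ℕ.+ σ → 138400 ℕ.* σ ℕ.≤ suc m → 200 ℕ.* W ℕ.≤ suc m
    W-bound {σ} h k = ℕₚ.≤-trans (ℕₚ.≤-reflexive (lem S)) (ℕₚ.≤-trans (ℕₚ.+-monoʳ-≤ (68800 ℕ.* S) (ℕₚ.*-monoʳ-≤ 400 S≥1))
        (ℕₚ.≤-trans (ℕₚ.≤-reflexive (lem₂ S)) (ℕₚ.≤-trans (ℕₚ.*-monoʳ-≤ 69200 h) (ℕₚ.≤-trans (ℕₚ.≤-reflexive (lem₃ σ)) k))))
      where
      lem : ∀ S → 200 ℕ.* (suc (43 ℕ.* S ℕ.+ 43 ℕ.* S ℕ.+ (43 ℕ.* S ℕ.+ 43 ℕ.* S)) ℕ.+ suc (43 ℕ.* S ℕ.+ 43 ℕ.* S ℕ.+ (43 ℕ.* S ℕ.+ 43 ℕ.* S)))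
            ≡ 68800 ℕ.* S ℕ.+ 400 ℕ.* 1
      lem S = trans (cong (200 ℕ.*_) (lem₁ (43 ℕ.* S))) (trans (ℕₚ.*-distribˡ-+ 200 (8 ℕ.* (43 ℕ.* S)) 2)
          (cong (ℕ._+ 400) (trans (cong (200 ℕ.*_) (sym (ℕₚ.*-assoc 8 43 S))) (sym (ℕₚ.*-assoc 200 344 S)))))
        where
        lem₁ : ∀ x → suc (x ℕ.+ x ℕ.+ (x ℕ.+ x)) ℕ.+ suc (x ℕ.+ x ℕ.+ (x ℕ.+ x)) ≡ 8 ℕ.* x ℕ.+ 2
        lem₁ x = solveℕ (x ∷ [])
      lem₂ : ∀ S → 68800 ℕ.* S ℕ.+ 400 ℕ.* S ≡ 69200 ℕ.* S
      lem₂ S = sym (ℕₚ.*-distribʳ-+ S 68800 400)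
      lem₃ : ∀ σ → 69200 ℕ.* (σ ℕ.+ σ) ≡ 138400 ℕ.* σ
      lem₃ σ = trans (ℕₚ.*-distribˡ-+ 69200 σ σ) (sym (ℕₚ.*-distribʳ-+ σ 69200 69200))

  -- For ε = p/q the hypothesis reads |s|^(2q) ≤ n^(q-2p), whose right side is at most n^q; the q-th
  -- root is taken by contraposition.
  square-bound : ∀ ε n s → BoundedBy ε (suc n) s → ℤ.∣ s ∣ ℕ.* ℤ.∣ s ∣ ℕ.≤ suc n
  square-bound ε n s h = ℕₚ.≮⇒≥ λ n<s² → ℕₚ.<-irrefl refl (begin-strict
      suc n ℕ.^ ↧ₙ ε                            <⟨ ℕₚ.^-monoˡ-< (↧ₙ ε) n<s² ⟩
      (ℤ.∣ s ∣ ℕ.* ℤ.∣ s ∣) ℕ.^ ↧ₙ ε            ≡⟨ cong (λ r → (ℤ.∣ s ∣ ℕ.* r) ℕ.^ ↧ₙ ε) (ℕₚ.*-identityʳ ℤ.∣ s ∣) ⟨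
      (ℤ.∣ s ∣ ℕ.^ 2) ℕ.^ ↧ₙ ε                  ≡⟨ ℕₚ.^-*-assoc ℤ.∣ s ∣ 2 (↧ₙ ε) ⟩
      ℤ.∣ s ∣ ℕ.^ (2 ℕ.* ↧ₙ ε)                  ≤⟨ h ⟩
      suc n ℕ.^ (↧ₙ ε ℕ.∸ 2 ℕ.* ℤ.∣ ↥ ε ∣)      ≤⟨ ℕₚ.^-monoʳ-≤ (suc n) (ℕₚ.m∸n≤m (↧ₙ ε) (2 ℕ.* ℤ.∣ ↥ ε ∣)) ⟩
      suc n ℕ.^ ↧ₙ ε                            ∎)
    where open ℕₚ.≤-Reasoning

  -- The larger of C and σ has its square below n. This turns a square-root bound on the exponents
  -- into the linear condition on `W`.
  linear-bound : ∀ C {σ n} → C ℕ.* C ℕ.≤ n → σ ℕ.* σ ℕ.≤ n → C ℕ.* σ ℕ.≤ n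
  linear-bound C {σ} h k with ℕₚ.≤-total C σ
  ... | inj₁ C≤σ = ℕₚ.≤-trans (ℕₚ.*-monoˡ-≤ σ C≤σ) k
  ... | inj₂ σ≤C = ℕₚ.≤-trans (ℕₚ.*-monoʳ-≤ C σ≤C) h

  max-square : ∀ a b {n} → a ℕ.* a ℕ.≤ n → b ℕ.* b ℕ.≤ n → ∃[ σ ] (a ℕ.+ b ℕ.≤ σ ℕ.+ σ × σ ℕ.* σ ℕ.≤ n)
  max-square a b h k with ℕₚ.≤-total a b
  ... | inj₁ a≤b = b , ℕₚ.+-monoˡ-≤ b a≤b , k
  ... | inj₂ b≤a = a , ℕₚ.+-monoʳ-≤ a b≤a , h

  -- `N₁` is required by the approximation argument, `C₁` lets the constant of `form-bound` be
  -- absorbed in one factor n + 2, and 138400² makes the exponents small against n.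
  bound : ℕ
  bound = N₁ ℕ.+ C₁ ℕ.+ 138400 ℕ.* 138400

  thue-insoluble : ∀ ε n → bound ℕ.< n → ∀ s t → s ≢ + 0 → BoundedBy ε n s → BoundedBy ε n t → ∀ X Y → 2 ℕ.≤ ℤ.∣ Y ∣ →
                   ∀ η → ℤ.∣ η ∣ ≡ 1 → thueForm n s t X Y ≢ ιK η
  thue-insoluble ε (suc m) n> s t s≢0 hs ht X Y Y≥2 η η-unit thue =
    let σ , S≤2σ , σ²≤n = max-square ℤ.∣ s ∣ ℤ.∣ t ∣ (square-bound ε m s hs) (square-bound ε m t ht)
    in no-solution m s t X Y η η-unit thue N≥ C≤ large s≢0 Y≥2
         (W-bound m s t X Y η η-unit thue N≥ C≤ large s≢0 Y≥2 {σ} S≤2σ (linear-bound 138400 {σ} square≤n σ²≤n))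
    where
    bound≤n : bound ℕ.≤ suc m
    bound≤n = ℕₚ.<⇒≤ n>
    N₁≤n : N₁ ℕ.≤ suc m
    N₁≤n = ℕₚ.m+n≤o⇒m≤o N₁ (ℕₚ.m+n≤o⇒m≤o (N₁ ℕ.+ C₁) bound≤n)
    C₁≤n : C₁ ℕ.≤ suc m
    C₁≤n = ℕₚ.m+n≤o⇒n≤o N₁ (ℕₚ.m+n≤o⇒m≤o (N₁ ℕ.+ C₁) bound≤n)
    square≤n : 138400 ℕ.* 138400 ℕ.≤ suc m
    square≤n = ℕₚ.m+n≤o⇒n≤o (N₁ ℕ.+ C₁) bound≤n
    N≥ : N₁ ℕ.≤ 2 ℕ.* suc m ℕ.+ 1
    N≥ = ℕₚ.≤-trans N₁≤n (ℕₚ.≤-trans (ℕₚ.m≤n*m (suc m) 2) (ℕₚ.m≤m+n (2 ℕ.* suc m) 1))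
    C≤ : C₁ ℕ.≤ m ℕ.+ 3
    C≤ = ℕₚ.≤-trans C₁≤n (ℕₚ.≤-trans (ℕₚ.≤-reflexive (ℕₚ.+-comm 1 m)) (ℕₚ.+-monoʳ-≤ m (s≤s z≤n)))
    large : 20000 ℕ.≤ suc m
    large = ℕₚ.≤-trans (ℕₚ.≤ᵇ⇒≤ 20000 (138400 ℕ.* 138400) _) square≤n

open import Defs
open import Data.Nat using (ℕ)
open import Data.Integer using (ℤ; +_; -_; ∣_∣)
open import Data.Rational using (ℚ; 0ℚ; ½)
open import Data.Product using (∃-syntax; _,_)
open import Data.Sum using (_⊎_; inj₁; inj₂)
open import Relation.Binary.PropositionalEquality using (_≡_; _≢_; refl)
open import Relation.Nullary using (¬_)
import Data.Nat as N
import Data.Rational as Q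

mainTheorem1 : (ε : ℚ) → 0ℚ Q.< ε → ε Q.< ½ →
    ∃[ n₀ ] ((n : ℕ) → n₀ N.< n → (s t : ℤ) → s ≢ + 0 → t ≢ + 0 →
    BoundedBy ε n s → BoundedBy ε n t →
    (x y : ℤ) → 2 N.≤ ∣ y ∣ →
    ¬ (thueForm n s t x y ≡ ι (+ 1) ⊎ thueForm n s t x y ≡ ι (- + 1)))
mainTheorem1 ε _ _ = Final.bound , λ n n> s t s≢0 _ hs ht x y y≥2 →
  λ { (inj₁ e) → Final.thue-insoluble ε n n> s t s≢0 hs ht x y y≥2 (+ 1) refl e
    ; (inj₂ e) → Final.thue-insoluble ε n n> s t s≢0 hs ht x y y≥2 (- + 1) refl e }
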